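{- Let $k=ab$ where $a,b$ are primes with $a\equiv b\equiv1\pmod4$, and let $m$ be a nonzero integer. For the existence of integers $x,y,z$ with $x^2+y^2+z^k=m$ it is necessary, and under Schinzel's hypothesis (H) also sufficient, that both of the following hold: (1) there is no integer $n\equiv6\pmod8$ such that $m=n^a$ and such that for each prime $p\equiv3\pmod4$ dividing $n$: $b\nmid v_p(n)$ or $2\mid v_p(n)$ or there is no $z'\in\{0,\dots,p-1\}$ with $p\mid \sum_{i=0}^{a-1}r_p(n)^{a-1-i}z'^{ib}$; (2) there is no integer $n\equiv6\pmod8$ such that $m=n^b$ and such that for each prime $p\equiv3\pmod4$ dividing $n$: $a\nmid v_p(n)$ or $2\mid v_p(n)$ or there is no $z'\in\{0,\dots,p-1\}$ with $p\mid \sum_{i=0}^{b-1}r_p(n)^{b-1-i}z'^{ia}$.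
   Context: For a prime $p$ and $x\in\mathbb{Q}_p^\times$, $r_p(x)=x/p^{v_p(x)}$. Schinzel's hypothesis (H): if $f_1,\dots,f_s\in\mathbb{Z}[X]$ are irreducible in $\mathbb{Q}[X]$, $\gcd\{f_1(x)\cdots f_s(x)\mid x\in\mathbb{Z}\}=1$ and $f_i(x)\to\infty$ as $x\to\infty$ for each $i$, then there is $x\in\mathbb{Z}$ with all $f_i(x)$ prime. -}

module Defs where

open import Data.Nat as ℕ using (ℕ; zero; suc; _∸_; _<_; _≤_; _%_)
open import Data.Nat.Primality using (Prime)
open import Data.Integer as ℤ using (ℤ; +_; _-_; _^_; ∣_∣)
open import Data.Integer.Divisibility using () renaming (_∣_ to _∣ℤ_)
open import Data.Rational as ℚ using (ℚ; 0ℚ; _/_)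
open import Data.List using (List; []; _∷_)
open import Data.List.Relation.Unary.All using (All)
open import Data.Product using (Σ; ∃; _×_; ∃-syntax)
open import Data.Sum using (_⊎_)
open import Relation.Nullary using (¬_)
open import Relation.Binary.PropositionalEquality using (_≡_; _≢_)

sumℤ : ℕ → (ℕ → ℤ) → ℤ
sumℤ zero    f = + 0
sumℤ (suc n) f = sumℤ n f ℤ.+ f n

sumℚ : ℕ → (ℕ → ℚ) → ℚ
sumℚ zero    f = 0ℚ
sumℚ (suc n) f = sumℚ n f ℚ.+ f n

-- Polynomials as coefficient lists (constant term first).

coeff : {A : Set} → A → List A → ℕ → A
coeff z []       i       = z
coeff z (c ∷ cs) zero    = c
coeff z (c ∷ cs) (suc i) = coeff z cs i

PolyZ : Set
PolyZ = List ℤ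

PolyQ : Set
PolyQ = List ℚ

evalZ : PolyZ → ℤ → ℤ
evalZ []       x = + 0
evalZ (c ∷ cs) x = c ℤ.+ x ℤ.* evalZ cs x

coeffQofZ : PolyZ → ℕ → ℚ
coeffQofZ f i = coeff (+ 0) f i / 1

mulCoeffQ : PolyQ → PolyQ → ℕ → ℚ
mulCoeffQ g h n = sumℚ (suc n) (λ i → coeff 0ℚ g i ℚ.* coeff 0ℚ h (n ∸ i))

ConstantQ : PolyQ → Set
ConstantQ g = ∀ i → 1 ≤ i → coeff 0ℚ g i ≡ 0ℚ

-- f ∈ ℤ[X] is irreducible in ℚ[X]: f is nonconstant, and in every
-- factorisation f = g·h in ℚ[X] one factor is constant (a unit, since f ≠ 0).
IrreducibleQ : PolyZ → Set
IrreducibleQ f =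
  (∃[ i ] (1 ≤ i × coeff (+ 0) f i ≢ + 0)) ×
  (∀ (g h : PolyQ) → (∀ n → mulCoeffQ g h n ≡ coeffQofZ f n) → ConstantQ g ⊎ ConstantQ h)

prodEval : List PolyZ → ℤ → ℤ
prodEval []       x = + 1
prodEval (f ∷ fs) x = evalZ f x ℤ.* prodEval fs x

HypothesisH : Set
HypothesisH =
  ∀ (fs : List PolyZ) →
    All IrreducibleQ fs →
    (∀ (d : ℕ) → (∀ (x : ℤ) → (+ d) ∣ℤ prodEval fs x) → d ≡ 1) →
    All (λ f → ∀ (B : ℤ) → ∃[ N ] (∀ (x : ℤ) → N ℤ.≤ x → B ℤ.≤ evalZ f x)) fs →
    ∃[ x ] All (λ f → ∃[ p ] (Prime p × evalZ f x ≡ + p)) fs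

Solvable : ℕ → ℤ → Set
Solvable k m = ∃[ x ] ∃[ y ] ∃[ z ] (x ^ 2 ℤ.+ y ^ 2 ℤ.+ z ^ k ≡ m)

-- Condition (1) (with (a,b) = (a,b)) resp. (2) (with (a,b) swapped):
-- there is no integer n ≡ 6 (mod 8) with m = n^a such that for each prime
-- p ≡ 3 (mod 4) dividing n (writing n = p^v · r with p ∤ r, i.e.
-- v = v_p(n), r = r_p(n)):  b ∤ v  or  2 ∣ v  or there is no
-- z' ∈ {0,…,p-1} with p ∣ Σ_{i=0}^{a-1} r^{a-1-i} z'^{ib}.
Cond : ℕ → ℕ → ℤ → Set
Cond a b m =
  ¬ (∃[ n ] ((+ 8) ∣ℤ (n - + 6) × m ≡ n ^ a ×
       (∀ (p v : ℕ) (r : ℤ) → Prime p → p % 4 ≡ 3 → (+ p) ∣ℤ n →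
          n ≡ (+ p) ^ v ℤ.* r → ¬ ((+ p) ∣ℤ r) →
          (¬ (+ b ∣ℤ + v)) ⊎ (+ 2 ∣ℤ + v) ⊎
          ¬ (∃[ z′ ] (z′ < p ×
               (+ p) ∣ℤ sumℤ a (λ i → r ^ (a ∸ 1 ∸ i) ℤ.* (+ z′) ^ (i ℕ.* b)))))))

module Submission where

-- Necessity.  Put w = z^b.  Then x² + y² = nᵃ − wᵃ = (n − w) Σ nᵃ⁻¹⁻ⁱwⁱ, and a congruence modulo 4 produces a prime
-- p ≡ 3 (mod 4) with odd exponent in one factor, hence in both.  Such a p divides n and w, and comparing the
-- exponents of p in n and in w contradicts what is assumed at p.
--
-- Sufficiency.  With z = −y the polynomial m + y^(ab) has to represent a sum of two squares.  It is irreducible unless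
-- m = nᵃ or m = nᵇ, where (say) it is the product of n + y^b and Σ (−n)ᵃ⁻¹⁻ⁱy^(bi).  On a suitable progression
-- y = c + dt each irreducible factor is a constant times a polynomial with values ≡ 1 (mod 4) and without fixed prime
-- divisor (y ∈ {0, 1} excludes the primes not dividing d), and the product of the constants is a sum of two squares.
-- If n ≡ 6 (mod 8) this needs a prime p violating the condition: c then makes both factors exactly divisible by odd
-- powers of p.  Hypothesis (H) makes the values prime, and primes ≡ 1 (mod 4) are sums of two squares.
--
-- Irreducibility (a weighted form of Ljunggren's trick).  Let gh = X^K + C over ℚ, let S be the real number |C|^(2/K)
-- and e = deg h.  Replacing h by its reversal ĥ = Σ hᵢSⁱX^(e−i) multiplies the weighted norm Σ fⱼ²Sʲ of the product by
-- S^e, and comparing it with the two extreme coefficients of gĥ (AM–GM) leaves no room for others.  Hence gĥ is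
-- proportional to gh, so ĥ to h, and Sⁱ is rational whenever hᵢ ≠ 0.  If X^K + C is reducible this makes C a perfect
-- power.  For the second factor above it shows that all its divisors are polynomials in X^b, which reduces its
-- irreducibility to that of the cyclotomic polynomial Φₐ (Eisenstein).


-- The circle |z|² = S passes through all complex roots of X^K + C. Equivalently S^K = C², so both
-- coefficients of X^K + C contribute C² to the weighted norm. For u = gĥ the norm is then 2C²S^e,
-- while u₀u_K = CS^e, so that 2Cu₀u_K already exhausts the norm. As S is irrational in the cases
-- that matter, the argument runs over a ring containing such roots, of which only the positivity of
-- squares is used.
--
-- The obstacle on the arithmetic side is n ≡ 6 (mod 8). For odd c the second factor is ≡ 3 (mod 4);
-- for even c the first one is twice a number ≡ 3 (mod 4). So for positive values one factor is
-- never a sum of two squares, and some prime p ≡ 3 (mod 4) must have an odd exponent in both. Such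
-- a p has to be built into both fixed divisors: neither is then a sum of two squares, but their
-- product is. The conditions say exactly when no p can play this role: b ∣ v_p(n), v_p(n) odd and a
-- root of the sum modulo p are what is needed to make the exponents of p in both factors odd.

module PolynomialRings where
  open import Defs using (coeff)
  open import Level using (0ℓ)
  open import Algebra.Bundles using (CommutativeRing)
  open import Data.Nat using (ℕ; zero; suc)
  open import Data.List using (List; []; _∷_; map)
  open import Data.Product using (_,_)
  import Algebra.Properties.Ring
  import Relation.Binary.Reasoning.Setoid

  -- Polynomials over a commutative ring as coefficient lists, their products and compositions.

  module Polynomials (R : CommutativeRing 0ℓ 0ℓ) where
    open CommutativeRing R
    open Algebra.Properties.Ring ring using ( -‿distribˡ-*)
    module ≈-R = Relation.Binary.Reasoning.Setoid setoid

    Poly : Set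
    Poly = List Carrier

    co : Poly → ℕ → Carrier
    co = coeff 0#

    infix 4 _≋_
    -- Equality of coefficients, so that trailing zeros do not count. As a record it lets
    -- unification recover `p` and `q` from a proof.
    record _≋_ (p q : Poly) : Set where
      constructor mk
      field at : ∀ i → co p i ≈ co q i
    open _≋_ public

    infixl 6 _⊕_
    infixl 7 _⊛_
    infixr 7 _·_

    _⊕_ : Poly → Poly → Poly
    []      ⊕ q       = q
    (c ∷ p) ⊕ []      = c ∷ p
    (c ∷ p) ⊕ (d ∷ q) = (c + d) ∷ (p ⊕ q)

    _·_ : Carrier → Poly → Poly
    c · p = map (c *_) p

    _⊛_ : Poly → Poly → Poly
    []      ⊛ q = []
    (c ∷ p) ⊛ q = c · q ⊕ (0# ∷ p ⊛ q)

    co-⊕ : ∀ p q i → co (p ⊕ q) i ≈ co p i + co q i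
    co-⊕ []      q       i       = sym (+-identityˡ _)
    co-⊕ (c ∷ p) []      i       = sym (+-identityʳ _)
    co-⊕ (c ∷ p) (d ∷ q) zero    = refl
    co-⊕ (c ∷ p) (d ∷ q) (suc i) = co-⊕ p q i

    co-· : ∀ c p i → co (c · p) i ≈ c * co p i
    co-· c []      i       = sym (zeroʳ c)
    co-· c (d ∷ p) zero    = refl
    co-· c (d ∷ p) (suc i) = co-· c p i

    ≋-refl : ∀ {p} → p ≋ p
    ≋-refl = mk λ i → refl

    ≋-sym : ∀ {p q} → p ≋ q → q ≋ p
    ≋-sym e = mk λ i → sym (at e i)

    ≋-trans : ∀ {p q r} → p ≋ q → q ≋ r → p ≋ r
    ≋-trans e f = mk λ i → trans (at e i) (at f i)

    ∷-cong : ∀ {c d p q} → c ≈ d → p ≋ q → (c ∷ p) ≋ (d ∷ q)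
    ∷-cong e f = mk λ { zero → e ; (suc i) → at f i }

    []≋0∷ : ∀ {c p} → c ≈ 0# → p ≋ [] → [] ≋ (c ∷ p)
    []≋0∷ e f = mk λ { zero → sym e ; (suc i) → sym (at f i) }

    ⊕-cong : ∀ {p q p′ q′} → p ≋ p′ → q ≋ q′ → p ⊕ q ≋ p′ ⊕ q′
    ⊕-cong {p} {q} {p′} {q′} e f = mk λ i →
      trans (co-⊕ p q i) (trans (+-cong (at e i) (at f i)) (sym (co-⊕ p′ q′ i)))

    ·-cong : ∀ {c d p q} → c ≈ d → p ≋ q → c · p ≋ d · q
    ·-cong {c} {d} {p} {q} e f = mk λ i →
      trans (co-· c p i) (trans (*-cong e (at f i)) (sym (co-· d q i)))

    ⊕-comm : ∀ p q → p ⊕ q ≋ q ⊕ p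
    ⊕-comm p q = mk λ i → trans (co-⊕ p q i) (trans (+-comm _ _) (sym (co-⊕ q p i)))

    ⊕-assoc : ∀ p q r → (p ⊕ q) ⊕ r ≋ p ⊕ (q ⊕ r)
    ⊕-assoc p q r = mk λ i → begin
      co ((p ⊕ q) ⊕ r) i          ≈⟨ co-⊕ (p ⊕ q) r i ⟩
      co (p ⊕ q) i + co r i       ≈⟨ +-congʳ (co-⊕ p q i) ⟩
      co p i + co q i + co r i    ≈⟨ +-assoc _ _ _ ⟩
      co p i + (co q i + co r i)  ≈⟨ +-congˡ (co-⊕ q r i) ⟨
      co p i + co (q ⊕ r) i       ≈⟨ co-⊕ p (q ⊕ r) i ⟨
      co (p ⊕ (q ⊕ r)) i          ∎
      where open ≈-R

    ⊕-identityʳ : ∀ p → p ⊕ [] ≋ p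
    ⊕-identityʳ p = mk λ i → trans (co-⊕ p [] i) (+-identityʳ _)

    ⊖_ : Poly → Poly
    ⊖ p = (- 1#) · p

    -1*x≈-x : ∀ x → - 1# * x ≈ - x
    -1*x≈-x x = trans (sym (-‿distribˡ-* 1# x)) (-‿cong (*-identityˡ x))

    ⊖-inverseʳ : ∀ p → p ⊕ (⊖ p) ≋ []
    ⊖-inverseʳ p = mk λ i → trans (co-⊕ p (⊖ p) i)
      (trans (+-congˡ (trans (co-· (- 1#) p i) (-1*x≈-x _))) (-‿inverseʳ _))

    0·p≋[] : ∀ p → 0# · p ≋ []
    0·p≋[] p = mk λ i → trans (co-· 0# p i) (zeroˡ _)

    1·p≋p : ∀ p → 1# · p ≋ p
    1·p≋p p = mk λ i → trans (co-· 1# p i) (*-identityˡ _)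

    ·-distribˡ : ∀ c p q → c · (p ⊕ q) ≋ c · p ⊕ c · q
    ·-distribˡ c p q = mk λ i → begin
      co (c · (p ⊕ q)) i           ≈⟨ co-· c (p ⊕ q) i ⟩
      c * co (p ⊕ q) i             ≈⟨ *-congˡ (co-⊕ p q i) ⟩
      c * (co p i + co q i)        ≈⟨ distribˡ _ _ _ ⟩
      c * co p i + c * co q i      ≈⟨ +-cong (co-· c p i) (co-· c q i) ⟨
      co (c · p) i + co (c · q) i  ≈⟨ co-⊕ (c · p) (c · q) i ⟨
      co (c · p ⊕ c · q) i         ∎
      where open ≈-R

    ·-distribʳ : ∀ c d p → (c + d) · p ≋ c · p ⊕ d · p
    ·-distribʳ c d p = mk λ i → begin
      co ((c + d) · p) i           ≈⟨ co-· (c + d) p i ⟩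
      (c + d) * co p i             ≈⟨ distribʳ _ _ _ ⟩
      c * co p i + d * co p i      ≈⟨ +-cong (co-· c p i) (co-· d p i) ⟨
      co (c · p) i + co (d · p) i  ≈⟨ co-⊕ (c · p) (d · p) i ⟨
      co (c · p ⊕ d · p) i         ∎
      where open ≈-R

    ·-assoc : ∀ c d p → (c * d) · p ≋ c · (d · p)
    ·-assoc c d p = mk λ i → begin
      co ((c * d) · p) i   ≈⟨ co-· (c * d) p i ⟩
      c * d * co p i       ≈⟨ *-assoc _ _ _ ⟩
      c * (d * co p i)     ≈⟨ *-congˡ (co-· d p i) ⟨
      c * co (d · p) i     ≈⟨ co-· c (d · p) i ⟨
      co (c · (d · p)) i   ∎
      where open ≈-R

    open import Algebra.Bundles using (CommutativeMonoid)

    ⊕-commutativeMonoid : CommutativeMonoid 0ℓ 0ℓ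
    ⊕-commutativeMonoid = record
      { Carrier = Poly ; _≈_ = _≋_ ; _∙_ = _⊕_ ; ε = []
      ; isCommutativeMonoid = record
        { isMonoid = record
          { isSemigroup = record
            { isMagma = record
              { isEquivalence = record { refl = ≋-refl ; sym = ≋-sym ; trans = ≋-trans }
              ; ∙-cong = ⊕-cong }
            ; assoc = ⊕-assoc }
          ; identity = (λ p → ≋-refl) , ⊕-identityʳ }
        ; comm = ⊕-comm } }

    open import Algebra.Properties.CommutativeSemigroup
      (CommutativeMonoid.commutativeSemigroup ⊕-commutativeMonoid) using (interchange; x∙yz≈y∙xz)
    module ≋-R = Relation.Binary.Reasoning.Setoid (CommutativeMonoid.setoid ⊕-commutativeMonoid)

    0∷-⊕ : ∀ p q → (0# ∷ (p ⊕ q)) ≋ (0# ∷ p) ⊕ (0# ∷ q)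
    0∷-⊕ p q = ∷-cong (sym (+-identityʳ 0#)) ≋-refl

    0∷-· : ∀ c p → (0# ∷ c · p) ≋ c · (0# ∷ p)
    0∷-· c p = ∷-cong (sym (zeroʳ c)) ≋-refl

    ⊛-congʳ : ∀ p {q q′} → q ≋ q′ → p ⊛ q ≋ p ⊛ q′
    ⊛-congʳ []      e = ≋-refl
    ⊛-congʳ (c ∷ p) e = ⊕-cong (·-cong refl e) (∷-cong refl (⊛-congʳ p e))

    ⊛-zeroʳ : ∀ p → p ⊛ [] ≋ []
    ⊛-zeroʳ []      = ≋-refl
    ⊛-zeroʳ (c ∷ p) = ≋-sym ([]≋0∷ refl (⊛-zeroʳ p))

    ⊛-distribˡ : ∀ p q r → p ⊛ (q ⊕ r) ≋ p ⊛ q ⊕ p ⊛ r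
    ⊛-distribˡ []      q r = ≋-refl
    ⊛-distribˡ (c ∷ p) q r = begin
      c · (q ⊕ r) ⊕ (0# ∷ p ⊛ (q ⊕ r))
        ≈⟨ ⊕-cong (·-distribˡ c q r) (≋-trans (∷-cong refl (⊛-distribˡ p q r)) (0∷-⊕ (p ⊛ q) (p ⊛ r))) ⟩
      (c · q ⊕ c · r) ⊕ ((0# ∷ p ⊛ q) ⊕ (0# ∷ p ⊛ r))
        ≈⟨ interchange (c · q) (c · r) (0# ∷ p ⊛ q) (0# ∷ p ⊛ r) ⟩
      (c · q ⊕ (0# ∷ p ⊛ q)) ⊕ (c · r ⊕ (0# ∷ p ⊛ r)) ∎
      where open ≋-R

    ⊛-distribʳ : ∀ r p q → (p ⊕ q) ⊛ r ≋ p ⊛ r ⊕ q ⊛ r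
    ⊛-distribʳ r []      q       = ≋-refl
    ⊛-distribʳ r (c ∷ p) []      = ≋-sym (⊕-identityʳ _)
    ⊛-distribʳ r (c ∷ p) (d ∷ q) = begin
      (c + d) · r ⊕ (0# ∷ (p ⊕ q) ⊛ r)
        ≈⟨ ⊕-cong (·-distribʳ c d r) (≋-trans (∷-cong refl (⊛-distribʳ r p q)) (0∷-⊕ (p ⊛ r) (q ⊛ r))) ⟩
      (c · r ⊕ d · r) ⊕ ((0# ∷ p ⊛ r) ⊕ (0# ∷ q ⊛ r))
        ≈⟨ interchange (c · r) (d · r) (0# ∷ p ⊛ r) (0# ∷ q ⊛ r) ⟩
      (c · r ⊕ (0# ∷ p ⊛ r)) ⊕ (d · r ⊕ (0# ∷ q ⊛ r)) ∎
      where open ≋-R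

    ·-⊛ : ∀ c p q → (c · p) ⊛ q ≋ c · (p ⊛ q)
    ·-⊛ c []      q = ≋-refl
    ·-⊛ c (d ∷ p) q = begin
      (c * d) · q ⊕ (0# ∷ (c · p) ⊛ q)
        ≈⟨ ⊕-cong (·-assoc c d q) (≋-trans (∷-cong refl (·-⊛ c p q)) (0∷-· c (p ⊛ q))) ⟩
      c · (d · q) ⊕ c · (0# ∷ p ⊛ q)
        ≈⟨ ·-distribˡ c (d · q) (0# ∷ p ⊛ q) ⟨
      c · (d · q ⊕ (0# ∷ p ⊛ q)) ∎
      where open ≋-R

    0∷-⊛ : ∀ p q → (0# ∷ p) ⊛ q ≋ (0# ∷ p ⊛ q)
    0∷-⊛ p q = ⊕-cong (0·p≋[] q) ≋-refl

    -- The product recurses on its left factor; this is the same recursion on the right one, and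
    -- commutativity follows from it by induction.
    ⊛-∷ : ∀ p c q → p ⊛ (c ∷ q) ≋ c · p ⊕ (0# ∷ p ⊛ q)
    ⊛-∷ []      c q = []≋0∷ refl ≋-refl
    ⊛-∷ (d ∷ p) c q = ∷-cong (+-congʳ (*-comm d c)) (begin
      d · q ⊕ p ⊛ (c ∷ q)               ≈⟨ ⊕-cong ≋-refl (⊛-∷ p c q) ⟩
      d · q ⊕ (c · p ⊕ (0# ∷ p ⊛ q))    ≈⟨ x∙yz≈y∙xz (d · q) (c · p) (0# ∷ p ⊛ q) ⟩
      c · p ⊕ (d · q ⊕ (0# ∷ p ⊛ q))    ∎)
      where open ≋-R

    ⊛-comm : ∀ p q → p ⊛ q ≋ q ⊛ p
    ⊛-comm []      q = ≋-sym (⊛-zeroʳ q)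
    ⊛-comm (c ∷ p) q = ≋-trans (⊕-cong ≋-refl (∷-cong refl (⊛-comm p q))) (≋-sym (⊛-∷ q c p))

    ⊛-cong : ∀ {p p′ q q′} → p ≋ p′ → q ≋ q′ → p ⊛ q ≋ p′ ⊛ q′
    ⊛-cong {p} {p′} {q} {q′} e f = ≋-trans (⊛-congʳ p f)
      (≋-trans (⊛-comm p q′) (≋-trans (⊛-congʳ q′ e) (⊛-comm q′ p′)))

    ⊛-assoc : ∀ p q r → (p ⊛ q) ⊛ r ≋ p ⊛ (q ⊛ r)
    ⊛-assoc []      q r = ≋-refl
    ⊛-assoc (c ∷ p) q r = begin
      (c · q ⊕ (0# ∷ p ⊛ q)) ⊛ r           ≈⟨ ⊛-distribʳ r (c · q) (0# ∷ p ⊛ q) ⟩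
      (c · q) ⊛ r ⊕ (0# ∷ p ⊛ q) ⊛ r       ≈⟨ ⊕-cong (·-⊛ c q r) (0∷-⊛ (p ⊛ q) r) ⟩
      c · (q ⊛ r) ⊕ (0# ∷ (p ⊛ q) ⊛ r)     ≈⟨ ⊕-cong ≋-refl (∷-cong refl (⊛-assoc p q r)) ⟩
      c · (q ⊛ r) ⊕ (0# ∷ p ⊛ (q ⊛ r))     ∎
      where open ≋-R

    ⊛-· : ∀ c p q → p ⊛ (c · q) ≋ c · (p ⊛ q)
    ⊛-· c p q = ≋-trans (⊛-comm p (c · q)) (≋-trans (·-⊛ c q p) (·-cong refl (⊛-comm q p)))

    [c]⊛ : ∀ c p → (c ∷ []) ⊛ p ≋ c · p
    [c]⊛ c p = ≋-trans (⊕-cong ≋-refl (≋-sym ([]≋0∷ refl ≋-refl))) (⊕-identityʳ _)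

    ⊛-identityˡ : ∀ p → (1# ∷ []) ⊛ p ≋ p
    ⊛-identityˡ p = ≋-trans ([c]⊛ 1# p) (1·p≋p p)

    -- The polynomial p(L) by Horner's scheme. A constant `L` gives evaluation, a linear one a
    -- change of variable, and `mono b` the substitution X ↦ X^b; all three occur below.
    comp : Poly → Poly → Poly
    comp L []      = []
    comp L (c ∷ p) = (c ∷ []) ⊕ L ⊛ comp L p

    comp-zero : ∀ L {p} → p ≋ [] → comp L p ≋ []
    comp-zero L {[]}    e = ≋-refl
    comp-zero L {c ∷ p} e = ⊕-cong (≋-sym ([]≋0∷ (at e 0) ≋-refl))
      (≋-trans (⊛-congʳ L (comp-zero L {p} (mk λ i → at e (suc i)))) (⊛-zeroʳ L))

    comp-cong : ∀ L {p q} → p ≋ q → comp L p ≋ comp L q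
    comp-cong L {[]}    {q}     e = ≋-sym (comp-zero L (≋-sym e))
    comp-cong L {c ∷ p} {[]}    e = comp-zero L e
    comp-cong L {c ∷ p} {d ∷ q} e = ⊕-cong (∷-cong (at e 0) ≋-refl)
      (⊛-congʳ L (comp-cong L {p} {q} (mk λ i → at e (suc i))))

    comp-⊕ : ∀ L p q → comp L (p ⊕ q) ≋ comp L p ⊕ comp L q
    comp-⊕ L []      q       = ≋-refl
    comp-⊕ L (c ∷ p) []      = ≋-sym (⊕-identityʳ _)
    comp-⊕ L (c ∷ p) (d ∷ q) = begin
      ((c ∷ []) ⊕ (d ∷ [])) ⊕ L ⊛ comp L (p ⊕ q)
        ≈⟨ ⊕-cong (≋-refl {(c ∷ []) ⊕ (d ∷ [])}) (≋-trans (⊛-congʳ L (comp-⊕ L p q)) (⊛-distribˡ L (comp L p) (comp L q))) ⟩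
      ((c ∷ []) ⊕ (d ∷ [])) ⊕ (L ⊛ comp L p ⊕ L ⊛ comp L q)
        ≈⟨ interchange (c ∷ []) (d ∷ []) (L ⊛ comp L p) (L ⊛ comp L q) ⟩
      ((c ∷ []) ⊕ L ⊛ comp L p) ⊕ ((d ∷ []) ⊕ L ⊛ comp L q) ∎
      where open ≋-R

    comp-· : ∀ L c p → comp L (c · p) ≋ c · comp L p
    comp-· L c []      = ≋-refl
    comp-· L c (d ∷ p) = ≋-trans
      (⊕-cong ≋-refl (≋-trans (⊛-congʳ L (comp-· L c p)) (⊛-· c L (comp L p))))
      (≋-sym (·-distribˡ c (d ∷ []) (L ⊛ comp L p)))

    comp-0∷ : ∀ L p → comp L (0# ∷ p) ≋ L ⊛ comp L p
    comp-0∷ L p = ⊕-cong (≋-sym ([]≋0∷ refl ≋-refl)) ≋-refl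

    comp-⊛ : ∀ L p q → comp L (p ⊛ q) ≋ comp L p ⊛ comp L q
    comp-⊛ L []      q = ≋-refl
    comp-⊛ L (c ∷ p) q = begin
      comp L (c · q ⊕ (0# ∷ p ⊛ q))               ≈⟨ comp-⊕ L (c · q) (0# ∷ p ⊛ q) ⟩
      comp L (c · q) ⊕ comp L (0# ∷ p ⊛ q)        ≈⟨ ⊕-cong (comp-· L c q) (≋-trans (comp-0∷ L (p ⊛ q)) (⊛-congʳ L (comp-⊛ L p q))) ⟩
      c · comp L q ⊕ L ⊛ (comp L p ⊛ comp L q)    ≈⟨ ⊕-cong ([c]⊛ c (comp L q)) (⊛-assoc L (comp L p) (comp L q)) ⟨
      (c ∷ []) ⊛ comp L q ⊕ (L ⊛ comp L p) ⊛ comp L q ≈⟨ ⊛-distribʳ (comp L q) (c ∷ []) (L ⊛ comp L p) ⟨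
      ((c ∷ []) ⊕ L ⊛ comp L p) ⊛ comp L q        ∎
      where open ≋-R

    X : Poly
    X = 0# ∷ 1# ∷ []

    X⊛ : ∀ p → X ⊛ p ≋ (0# ∷ p)
    X⊛ p = ≋-trans (0∷-⊛ (1# ∷ []) p) (∷-cong refl (⊛-identityˡ p))

    comp-congL : ∀ {L M} p → L ≋ M → comp L p ≋ comp M p
    comp-congL []      e = ≋-refl
    comp-congL (c ∷ p) e = ⊕-cong ≋-refl (⊛-cong e (comp-congL p e))

    comp-comp : ∀ L M p → comp L (comp M p) ≋ comp (comp L M) p
    comp-comp L M []      = ≋-refl
    comp-comp L M (c ∷ p) = ≋-trans (comp-⊕ L (c ∷ []) (M ⊛ comp M p))
      (⊕-cong (≋-trans (⊕-cong ≋-refl (⊛-zeroʳ L)) (⊕-identityʳ _))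
              (≋-trans (comp-⊛ L M (comp M p)) (⊛-congʳ (comp L M) (comp-comp L M p))))

    comp-X : ∀ p → comp X p ≋ p
    comp-X []      = ≋-refl
    comp-X (c ∷ p) = ≋-trans (⊕-cong (≋-refl {c ∷ []}) (≋-trans (X⊛ (comp X p)) (∷-cong refl (comp-X p))))
      (∷-cong (+-identityʳ c) (≋-refl {p}))

  module Maps (R S : CommutativeRing 0ℓ 0ℓ) where
    private
      module R = CommutativeRing R
      module S = CommutativeRing S
      module PR = Polynomials R
      module PS = Polynomials S
    record Hom : Set where
      field
        ⟦_⟧    : R.Carrier → S.Carrier
        cong   : ∀ {x y} → x R.≈ y → ⟦ x ⟧ S.≈ ⟦ y ⟧
        +-homo : ∀ x y → ⟦ x R.+ y ⟧ S.≈ ⟦ x ⟧ S.+ ⟦ y ⟧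
        *-homo : ∀ x y → ⟦ x R.* y ⟧ S.≈ ⟦ x ⟧ S.* ⟦ y ⟧
        0-homo : ⟦ R.0# ⟧ S.≈ S.0#
        1-homo : ⟦ R.1# ⟧ S.≈ S.1#

      mapP : PR.Poly → PS.Poly
      mapP = map ⟦_⟧

      co-map : ∀ p i → PS.co (mapP p) i S.≈ ⟦ PR.co p i ⟧
      co-map []      i       = S.sym 0-homo
      co-map (c ∷ p) zero    = S.refl
      co-map (c ∷ p) (suc i) = co-map p i

      map-cong : ∀ {p q} → p PR.≋ q → mapP p PS.≋ mapP q
      map-cong {p} {q} e = PS.mk λ i →
        S.trans (co-map p i) (S.trans (cong (PR.at e i)) (S.sym (co-map q i)))

      map-⊕ : ∀ p q → mapP (p PR.⊕ q) PS.≋ mapP p PS.⊕ mapP q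
      map-⊕ []      q       = PS.≋-refl
      map-⊕ (c ∷ p) []      = PS.≋-refl
      map-⊕ (c ∷ p) (d ∷ q) = PS.∷-cong (+-homo c d) (map-⊕ p q)

      map-· : ∀ c p → mapP (c PR.· p) PS.≋ ⟦ c ⟧ PS.· mapP p
      map-· c []      = PS.≋-refl
      map-· c (d ∷ p) = PS.∷-cong (*-homo c d) (map-· c p)

      map-⊛ : ∀ p q → mapP (p PR.⊛ q) PS.≋ mapP p PS.⊛ mapP q
      map-⊛ []      q = PS.≋-refl
      map-⊛ (c ∷ p) q = PS.≋-trans (map-⊕ (c PR.· q) (R.0# ∷ p PR.⊛ q))
        (PS.⊕-cong (map-· c q) (PS.∷-cong 0-homo (map-⊛ p q)))

      map-comp : ∀ L p → mapP (PR.comp L p) PS.≋ PS.comp (mapP L) (mapP p)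
      map-comp L []      = PS.≋-refl
      map-comp L (c ∷ p) = PS.≋-trans (map-⊕ (c ∷ []) (L PR.⊛ PR.comp L p))
        (PS.⊕-cong PS.≋-refl (PS.≋-trans (map-⊛ L (PR.comp L p)) (PS.⊛-congʳ (mapP L) (map-comp L p))))

-- The weighted norm and the weighted reversal of a polynomial.

module WeightedReciprocals where
  open import Level using (0ℓ)
  open import Algebra.Bundles using (CommutativeRing)
  open import Data.Nat as ℕ using (ℕ; zero; suc; z≤n; s≤s)
  import Data.Nat.Properties as ℕₚ
  open import Data.List using ([]; _∷_; length)
  open import Data.Product using (_,_)
  open import Data.Empty using (⊥-elim)
  open import Relation.Nullary using (yes; no)
  open import Relation.Binary.PropositionalEquality as ≡ using (_≡_; _≢_)
  import Relation.Binary.Reasoning.Setoid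
  import Algebra.Solver.Ring.NaturalCoefficients.Default
  import Algebra.Properties.Ring
  open PolynomialRings

  module Degrees (R : CommutativeRing 0ℓ 0ℓ) where
    open CommutativeRing R
    open Polynomials R

    pow : Carrier → ℕ → Carrier
    pow x zero    = 1#
    pow x (suc n) = x * pow x n

    Deg≤ : ℕ → Poly → Set
    Deg≤ n p = ∀ i → n ℕ.< i → co p i ≈ 0#

    mono : ℕ → Poly
    mono zero    = 1# ∷ []
    mono (suc n) = 0# ∷ mono n

    co-mono-≡ : ∀ n → co (mono n) n ≈ 1#
    co-mono-≡ zero    = refl
    co-mono-≡ (suc n) = co-mono-≡ n

    co-mono-≢ : ∀ n i → i ≢ n → co (mono n) i ≈ 0#
    co-mono-≢ zero    zero    ne = ⊥-elim (ne ≡.refl)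
    co-mono-≢ zero    (suc i) ne = refl
    co-mono-≢ (suc n) zero    ne = refl
    co-mono-≢ (suc n) (suc i) ne = co-mono-≢ n i (λ e → ne (≡.cong suc e))

    co-beyond : ∀ p i → length p ℕ.≤ i → co p i ≈ 0#
    co-beyond []      i       le       = refl
    co-beyond (c ∷ p) (suc i) (s≤s le) = co-beyond p i le

    co-⊛-suc : ∀ c p q i → co ((c ∷ p) ⊛ q) (suc i) ≈ c * co q (suc i) + co (p ⊛ q) i
    co-⊛-suc c p q i = trans (co-⊕ (c · q) (0# ∷ p ⊛ q) (suc i)) (+-congʳ (co-· c q (suc i)))

    co-⊛-zero : ∀ p q → co (p ⊛ q) 0 ≈ co p 0 * co q 0
    co-⊛-zero []      q = sym (zeroˡ _)
    co-⊛-zero (c ∷ p) q = trans (co-⊕ (c · q) (0# ∷ p ⊛ q) 0) (trans (+-identityʳ _) (co-· c q 0))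

    co-⊛-top : ∀ d e p q → Deg≤ d p → Deg≤ e q → co (p ⊛ q) (d ℕ.+ e) ≈ co p d * co q e
    co-⊛-top d       e       []      q dp dq = sym (zeroˡ _)
    co-⊛-top zero    zero    (c ∷ p) q dp dq = co-⊛-zero (c ∷ p) q
    co-⊛-top zero    (suc e) (c ∷ p) q dp dq =
      trans (co-⊛-suc c p q e) (trans (+-congˡ (at (⊛-cong {p} {[]} {q} {q} (mk λ i → dp (suc i) (s≤s z≤n)) ≋-refl) e)) (+-identityʳ _))
    co-⊛-top (suc d) e       (c ∷ p) q dp dq =
      trans (co-⊛-suc c p q (d ℕ.+ e))
        (trans (+-cong (trans (*-congˡ (dq (suc (d ℕ.+ e)) (s≤s (ℕₚ.m≤n+m e d)))) (zeroʳ c))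
                       (co-⊛-top d e p q (λ i lt → dp (suc i) (s≤s lt)) dq))
               (+-identityˡ _))

  -- The fragment of an ordering that the norm argument consumes: a cone in which a vanishing sum
  -- has vanishing terms. A ring with zero divisors can qualify, and `NN` may speak of
  -- representatives rather than of classes modulo `_≈_`.
  record FormallyReal (A : CommutativeRing 0ℓ 0ℓ) : Set₁ where
    open CommutativeRing A
    field
      NN     : Carrier → Set
      NN-0   : NN 0#
      NN-+   : ∀ {x y} → NN x → NN y → NN (x + y)
      NN-*   : ∀ {x y} → NN x → NN y → NN (x * y)
      NN-sq  : ∀ x → NN (x * x)
      +-zero : ∀ {x y} → NN x → NN y → x + y ≈ 0# → x ≈ 0#
      sq-zero : ∀ {x} → x * x ≈ 0# → x ≈ 0#

  module WeightedReciprocal (A : CommutativeRing 0ℓ 0ℓ) (real : FormallyReal A)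
      (S : CommutativeRing.Carrier A) (S≥0 : FormallyReal.NN real S)
      (S-cancel : ∀ x → CommutativeRing._≈_ A (CommutativeRing._*_ A S x) (CommutativeRing.0# A) → CommutativeRing._≈_ A x (CommutativeRing.0# A))
      where
    open CommutativeRing A
    open FormallyReal real
    open Polynomials A
    open Degrees A
    open Algebra.Solver.Ring.NaturalCoefficients.Default commutativeSemiring using (solve; _:+_; _:*_; _:=_; con)
    module AR = Algebra.Properties.Ring ring

    -- The inner product Σ pᵢqᵢSⁱ; for real coefficients it is the mean of p(z) times the conjugate
    -- of q(z) over the circle |z|² = S.
    ⟨_,_⟩ : Poly → Poly → Carrier
    ⟨ []    , q     ⟩ = 0#
    ⟨ c ∷ p , []    ⟩ = 0#
    ⟨ c ∷ p , d ∷ q ⟩ = c * d + S * ⟨ p , q ⟩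

    ⟨⟩-comm : ∀ p q → ⟨ p , q ⟩ ≈ ⟨ q , p ⟩
    ⟨⟩-comm []      []      = refl
    ⟨⟩-comm []      (d ∷ q) = refl
    ⟨⟩-comm (c ∷ p) []      = refl
    ⟨⟩-comm (c ∷ p) (d ∷ q) = +-cong (*-comm c d) (*-congˡ (⟨⟩-comm p q))

    ⟨⟩-zero : ∀ p q → p ≋ [] → ⟨ p , q ⟩ ≈ 0#
    ⟨⟩-zero []      q       e = refl
    ⟨⟩-zero (c ∷ p) []      e = refl
    ⟨⟩-zero (c ∷ p) (d ∷ q) e =
      trans (+-cong (trans (*-congʳ (at e 0)) (zeroˡ d))
                    (trans (*-congˡ (⟨⟩-zero p q (mk λ i → at e (suc i)))) (zeroʳ S)))
            (+-identityʳ 0#)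

    ⟨⟩-congˡ : ∀ p p′ q → p ≋ p′ → ⟨ p , q ⟩ ≈ ⟨ p′ , q ⟩
    ⟨⟩-congˡ []      p′        q       e = sym (⟨⟩-zero p′ q (≋-sym e))
    ⟨⟩-congˡ (c ∷ p) []        q       e = ⟨⟩-zero (c ∷ p) q e
    ⟨⟩-congˡ (c ∷ p) (c′ ∷ p′) []      e = refl
    ⟨⟩-congˡ (c ∷ p) (c′ ∷ p′) (d ∷ q) e =
      +-cong (*-congʳ (at e 0)) (*-congˡ (⟨⟩-congˡ p p′ q (mk λ i → at e (suc i))))

    ⟨⟩-cong : ∀ {p p′ q q′} → p ≋ p′ → q ≋ q′ → ⟨ p , q ⟩ ≈ ⟨ p′ , q′ ⟩
    ⟨⟩-cong {p} {p′} {q} {q′} e f = trans (⟨⟩-congˡ p p′ q e)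
      (trans (⟨⟩-comm p′ q) (trans (⟨⟩-congˡ q q′ p′ f) (⟨⟩-comm q′ p′)))

    ⟨⟩-⊕ : ∀ p q r → ⟨ p ⊕ q , r ⟩ ≈ ⟨ p , r ⟩ + ⟨ q , r ⟩
    ⟨⟩-⊕ []      q       r       = sym (+-identityˡ _)
    ⟨⟩-⊕ (c ∷ p) []      r       = sym (+-identityʳ _)
    ⟨⟩-⊕ (c ∷ p) (d ∷ q) []      = sym (+-identityʳ _)
    ⟨⟩-⊕ (c ∷ p) (d ∷ q) (b ∷ r) = trans (+-congˡ (*-congˡ (⟨⟩-⊕ p q r)))
      (solve 6 (λ c d b s x y → (c :+ d) :* b :+ s :* (x :+ y) := (c :* b :+ s :* x) :+ (d :* b :+ s :* y)) refl c d b S ⟨ p , r ⟩ ⟨ q , r ⟩)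

    ⟨⟩-· : ∀ a p r → ⟨ a · p , r ⟩ ≈ a * ⟨ p , r ⟩
    ⟨⟩-· a []      r       = sym (zeroʳ a)
    ⟨⟩-· a (c ∷ p) []      = sym (zeroʳ a)
    ⟨⟩-· a (c ∷ p) (b ∷ r) = trans (+-congˡ (*-congˡ (⟨⟩-· a p r)))
      (solve 5 (λ a c b s x → a :* c :* b :+ s :* (a :* x) := a :* (c :* b :+ s :* x)) refl a c b S ⟨ p , r ⟩)

    ⟨⟩-0∷ : ∀ p q → ⟨ 0# ∷ p , 0# ∷ q ⟩ ≈ S * ⟨ p , q ⟩
    ⟨⟩-0∷ p q = trans (+-congʳ (zeroˡ 0#)) (+-identityˡ _)

    ⟨⟩-mono : ∀ n → ⟨ mono n , mono n ⟩ ≈ pow S n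
    ⟨⟩-mono zero    = trans (+-cong (*-identityˡ 1#) (zeroʳ S)) (+-identityʳ 1#)
    ⟨⟩-mono (suc n) = trans (⟨⟩-0∷ (mono n) (mono n)) (*-congˡ (⟨⟩-mono n))

    NN-⟨⟩ : ∀ p → NN ⟨ p , p ⟩
    NN-⟨⟩ []      = NN-0
    NN-⟨⟩ (c ∷ p) = NN-+ (NN-sq c) (NN-* S≥0 (NN-⟨⟩ p))

    ⟨⟩-definite : ∀ p → ⟨ p , p ⟩ ≈ 0# → p ≋ []
    ⟨⟩-definite []      e = ≋-refl
    ⟨⟩-definite (c ∷ p) e = ≋-sym ([]≋0∷ (sq-zero (+-zero (NN-sq c) (NN-* S≥0 (NN-⟨⟩ p)) e))
      (⟨⟩-definite p (S-cancel _ (+-zero (NN-* S≥0 (NN-⟨⟩ p)) (NN-sq c) (trans (+-comm _ _) e)))))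

    delete : ℕ → Poly → Poly
    delete j       []      = []
    delete zero    (c ∷ p) = 0# ∷ p
    delete (suc j) (c ∷ p) = c ∷ delete j p

    co-delete : ∀ j p i → i ≢ j → co (delete j p) i ≈ co p i
    co-delete j       []      i       ne = refl
    co-delete zero    (c ∷ p) zero    ne = ⊥-elim (ne ≡.refl)
    co-delete zero    (c ∷ p) (suc i) ne = refl
    co-delete (suc j) (c ∷ p) zero    ne = refl
    co-delete (suc j) (c ∷ p) (suc i) ne = co-delete j p i (λ e → ne (≡.cong suc e))

    ⟨⟩-delete : ∀ j p → ⟨ p , p ⟩ ≈ pow S j * (co p j * co p j) + ⟨ delete j p , delete j p ⟩
    ⟨⟩-delete j       []      = sym (trans (+-identityʳ _) (trans (*-congˡ (zeroˡ 0#)) (zeroʳ _)))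
    ⟨⟩-delete zero    (c ∷ p) = trans (+-congʳ (sym (*-identityˡ _))) (+-congˡ (sym (⟨⟩-0∷ p p)))
    ⟨⟩-delete (suc j) (c ∷ p) = trans (+-congˡ (*-congˡ (⟨⟩-delete j p)))
      (solve 5 (λ c s t x y → c :* c :+ s :* (t :* (x :* x) :+ y) := s :* t :* (x :* x) :+ (c :* c :+ s :* y))
         refl c S (pow S j) (co p j) ⟨ delete j p , delete j p ⟩)

    -- The recursion reads `c ∷ h` as c + X h: the formal degree is `length h`, and the factor X
    -- leaves the reversal of h in place but costs a factor S.
    hat : Poly → Poly
    hat []      = []
    hat (c ∷ h) = c · mono (length h) ⊕ S · hat h

    hat-Deg≤ : ∀ h i → length h ℕ.≤ i → co (hat h) i ≈ 0#
    hat-Deg≤ []      i le = refl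
    hat-Deg≤ (c ∷ h) i le = trans (co-⊕ (c · mono (length h)) (S · hat h) i)
      (trans (+-cong (trans (co-· c (mono (length h)) i) (trans (*-congˡ (co-mono-≢ (length h) i (λ e → ℕₚ.<-irrefl (≡.sym e) le))) (zeroʳ c)))
                     (trans (co-· S (hat h) i) (trans (*-congˡ (hat-Deg≤ h i (ℕₚ.<⇒≤ le))) (zeroʳ S))))
             (+-identityʳ 0#))

    co-hat : ∀ c h i j → i ℕ.+ j ≡ length h → co (hat (c ∷ h)) j ≈ pow S i * co (c ∷ h) i
    co-hat c h zero j ≡.refl = trans (co-⊕ (c · mono (length h)) (S · hat h) j)
      (trans (+-cong (trans (co-· c (mono j) j) (trans (*-congˡ (co-mono-≡ j)) (*-identityʳ c)))
                     (trans (co-· S (hat h) j) (trans (*-congˡ (hat-Deg≤ h j ℕₚ.≤-refl)) (zeroʳ S))))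
             (trans (+-identityʳ c) (sym (*-identityˡ c))))
    co-hat c (d ∷ h) (suc i) j e = trans (co-⊕ (c · mono (length (d ∷ h))) (S · hat (d ∷ h)) j)
      (trans (+-cong (trans (co-· c (mono (length (d ∷ h))) j) (trans (*-congˡ (co-mono-≢ (length (d ∷ h)) j λ e′ → ℕₚ.m≢1+n+m j (≡.trans e′ (≡.sym e)))) (zeroʳ c)))
                     (trans (co-· S (hat (d ∷ h)) j) (*-congˡ (co-hat d h i j (ℕₚ.suc-injective e)))))
             (trans (+-identityˡ _) (sym (*-assoc S _ _))))

    shift : ℕ → Poly → Poly
    shift zero    p = p
    shift (suc n) p = 0# ∷ shift n p

    shift-∷ : ∀ i c k → shift i (c ∷ k) ≋ c · mono i ⊕ shift (suc i) k
    shift-∷ zero    c k = ∷-cong (sym (trans (+-identityʳ _) (*-identityʳ c))) ≋-refl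
    shift-∷ (suc i) c k = ∷-cong (sym (trans (+-identityʳ _) (zeroʳ c))) (shift-∷ i c k)

    module _ (g : Poly) where
      -- Multiplying both arguments by X scales this form by S (`B-0∷`). Together with symmetry and
      -- bilinearity that is all that `B-hat` needs to know about `g`.
      B : Poly → Poly → Carrier
      B p q = ⟨ g ⊛ p , g ⊛ q ⟩

      B-comm : ∀ p q → B p q ≈ B q p
      B-comm p q = ⟨⟩-comm (g ⊛ p) (g ⊛ q)

      B-cong : ∀ {p p′ q q′} → p ≋ p′ → q ≋ q′ → B p q ≈ B p′ q′
      B-cong e f = ⟨⟩-cong (⊛-congʳ g e) (⊛-congʳ g f)

      B-linear : ∀ a p b q r → B (a · p ⊕ b · q) r ≈ a * B p r + b * B q r
      B-linear a p b q r = begin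
        ⟨ g ⊛ (a · p ⊕ b · q) , g ⊛ r ⟩
          ≈⟨ ⟨⟩-cong (≋-trans (⊛-distribˡ g (a · p) (b · q)) (⊕-cong (⊛-· a g p) (⊛-· b g q))) ≋-refl ⟩
        ⟨ a · (g ⊛ p) ⊕ b · (g ⊛ q) , g ⊛ r ⟩
          ≈⟨ ⟨⟩-⊕ (a · (g ⊛ p)) (b · (g ⊛ q)) (g ⊛ r) ⟩
        ⟨ a · (g ⊛ p) , g ⊛ r ⟩ + ⟨ b · (g ⊛ q) , g ⊛ r ⟩
          ≈⟨ +-cong (⟨⟩-· a (g ⊛ p) (g ⊛ r)) (⟨⟩-· b (g ⊛ q) (g ⊛ r)) ⟩
        a * B p r + b * B q r ∎
        where open ≈-R

      B-linearʳ : ∀ a p b q r → B r (a · p ⊕ b · q) ≈ a * B r p + b * B r q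
      B-linearʳ a p b q r = trans (B-comm r _) (trans (B-linear a p b q r)
        (+-cong (*-congˡ (B-comm p r)) (*-congˡ (B-comm q r))))

      B-quadratic : ∀ a p b q → B (a · p ⊕ b · q) (a · p ⊕ b · q) ≈
        a * a * B p p + (a * b * B p q + a * b * B p q) + b * b * B q q
      B-quadratic a p b q = begin
        B (a · p ⊕ b · q) (a · p ⊕ b · q) ≈⟨ B-linear a p b q _ ⟩
        a * B p (a · p ⊕ b · q) + b * B q (a · p ⊕ b · q)
          ≈⟨ +-cong (*-congˡ (B-linearʳ a p b q p)) (*-congˡ (trans (B-linearʳ a p b q q) (+-congʳ (*-congˡ (B-comm q p))))) ⟩
        a * (a * B p p + b * B p q) + b * (a * B p q + b * B q q)
          ≈⟨ solve 5 (λ a b x y z → a :* (a :* x :+ b :* y) :+ b :* (a :* y :+ b :* z) := a :* a :* x :+ (a :* b :* y :+ a :* b :* y) :+ b :* b :* z) refl a b (B p p) (B p q) (B q q) ⟩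
        a * a * B p p + (a * b * B p q + a * b * B p q) + b * b * B q q ∎
        where open ≈-R

      ⊛-0∷ : ∀ p → g ⊛ (0# ∷ p) ≋ (0# ∷ g ⊛ p)
      ⊛-0∷ p = ≋-trans (⊛-∷ g 0# p) (⊕-cong (0·p≋[] g) ≋-refl)

      B-0∷ : ∀ p q → B (0# ∷ p) (0# ∷ q) ≈ S * B p q
      B-0∷ p q = trans (⟨⟩-cong (⊛-0∷ p) (⊛-0∷ q)) (⟨⟩-0∷ (g ⊛ p) (g ⊛ q))

      B-mono : ∀ m i → B (mono (m ℕ.+ i)) (mono m) ≈ pow S m * B (mono i) (mono 0)
      B-mono zero    i = sym (*-identityˡ _)
      B-mono (suc m) i = trans (B-0∷ (mono (m ℕ.+ i)) (mono m))
        (trans (*-congˡ (B-mono m i)) (sym (*-assoc S _ _)))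

      -- With n = `length k`, pairing X^(n+i) with SʲX^(n-j) gives Sⁿ times the pairing of 1 with
      -- X^(i+j). Summed over j, the reversal is undone.
      B-mono-hat : ∀ c k i → B (mono (length k ℕ.+ i)) (hat (c ∷ k)) ≈ pow S (length k) * B (mono 0) (shift i (c ∷ k))
      B-mono-hat c [] i = begin
        B (mono i) (c · mono 0 ⊕ S · [])   ≈⟨ B-linearʳ c (mono 0) S [] (mono i) ⟩
        c * B (mono i) (mono 0) + S * B (mono i) []
          ≈⟨ +-cong (*-congˡ (B-comm (mono i) (mono 0))) (*-congˡ (trans (B-comm (mono i) []) (⟨⟩-zero (g ⊛ []) _ (⊛-zeroʳ g)))) ⟩
        c * B (mono 0) (mono i) + S * 0#
          ≈⟨ +-congˡ (trans (zeroʳ S) (sym (trans (*-congˡ (trans (B-comm (mono 0) []) (⟨⟩-zero (g ⊛ []) _ (⊛-zeroʳ g)))) (zeroʳ 1#)))) ⟩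
        c * B (mono 0) (mono i) + 1# * B (mono 0) []
          ≈⟨ B-linearʳ c (mono i) 1# [] (mono 0) ⟨
        B (mono 0) (c · mono i ⊕ [])
          ≈⟨ B-cong (≋-refl {mono 0}) (≋-trans (shift-∷ i c []) (⊕-cong (≋-refl {c · mono i}) (shift-[] (suc i)))) ⟨
        B (mono 0) (shift i (c ∷ []))
          ≈⟨ *-identityˡ _ ⟨
        1# * B (mono 0) (shift i (c ∷ [])) ∎
        where
          open ≈-R
          shift-[] : ∀ n → shift n [] ≋ []
          shift-[] zero    = ≋-refl
          shift-[] (suc n) = ≋-sym ([]≋0∷ refl (shift-[] n))
      B-mono-hat c (d ∷ k) i = begin
        B (mono (suc n ℕ.+ i)) (c · mono (suc n) ⊕ S · hat (d ∷ k))
          ≈⟨ B-linearʳ c (mono (suc n)) S (hat (d ∷ k)) (mono (suc n ℕ.+ i)) ⟩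
        c * B (mono (suc n ℕ.+ i)) (mono (suc n)) + S * B (mono (suc n ℕ.+ i)) (hat (d ∷ k))
          ≈⟨ +-cong (*-congˡ (trans (B-mono (suc n) i) (*-congˡ (B-comm (mono i) (mono 0)))))
               (*-congˡ (trans (reflexive (≡.cong (λ t → B (mono t) (hat (d ∷ k))) (≡.sym (ℕₚ.+-suc n i)))) (B-mono-hat d k (suc i)))) ⟩
        c * (S * pow S n * B (mono 0) (mono i)) + S * (pow S n * B (mono 0) (shift (suc i) (d ∷ k)))
          ≈⟨ solve 5 (λ c s t x y → c :* (s :* t :* x) :+ s :* (t :* y) := s :* t :* (c :* x :+ con 1 :* y)) refl c S (pow S n) (B (mono 0) (mono i)) (B (mono 0) (shift (suc i) (d ∷ k))) ⟩
        S * pow S n * (c * B (mono 0) (mono i) + 1# * B (mono 0) (shift (suc i) (d ∷ k)))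
          ≈⟨ *-congˡ (B-linearʳ c (mono i) 1# (shift (suc i) (d ∷ k)) (mono 0)) ⟨
        S * pow S n * B (mono 0) (c · mono i ⊕ 1# · shift (suc i) (d ∷ k))
          ≈⟨ *-congˡ (B-cong (≋-refl {mono 0}) (≋-trans (shift-∷ i c (d ∷ k)) (⊕-cong (≋-refl {c · mono i}) (≋-sym (1·p≋p (shift (suc i) (d ∷ k))))))) ⟨
        S * pow S n * B (mono 0) (shift i (c ∷ d ∷ k)) ∎
        where
          open ≈-R
          n = length k

      -- On the circle |z|² = S the reversal h ↦ ĥ preserves |h| up to the factor S^e, so it preserves the norm.
      B-hat : ∀ c h → B (hat (c ∷ h)) (hat (c ∷ h)) ≈ pow S (length h) * B (c ∷ h) (c ∷ h)
      B-hat c [] = trans (B-cong e e) (sym (*-identityˡ _))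
        where
          e : hat (c ∷ []) ≋ (c ∷ [])
          e = ∷-cong (*-identityʳ c) ≋-refl
      B-hat c (d ∷ h) = begin
        B (c · mono (suc n) ⊕ S · k) (c · mono (suc n) ⊕ S · k)
          ≈⟨ B-quadratic c (mono (suc n)) S k ⟩
        c * c * B (mono (suc n)) (mono (suc n)) + (c * S * B (mono (suc n)) k + c * S * B (mono (suc n)) k) + S * S * B k k
          ≈⟨ +-cong (+-cong (*-congˡ e₁) (+-cong (*-congˡ e₂) (*-congˡ e₂))) (*-congˡ (B-hat d h)) ⟩
        c * c * (S * t * x) + (c * S * (t * y) + c * S * (t * y)) + S * S * (t * z)
          ≈⟨ solve 6 (λ c s t x y z → c :* c :* (s :* t :* x) :+ (c :* s :* (t :* y) :+ c :* s :* (t :* y)) :+ s :* s :* (t :* z)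
               := s :* t :* (c :* c :* x :+ (c :* con 1 :* y :+ c :* con 1 :* y) :+ con 1 :* con 1 :* (s :* z))) refl c S t x y z ⟩
        S * t * (c * c * x + (c * 1# * y + c * 1# * y) + 1# * 1# * (S * z))
          ≈⟨ *-congˡ (+-congˡ (*-congˡ (B-0∷ (d ∷ h) (d ∷ h)))) ⟨
        S * t * (c * c * x + (c * 1# * y + c * 1# * y) + 1# * 1# * B (0# ∷ d ∷ h) (0# ∷ d ∷ h))
          ≈⟨ *-congˡ (B-quadratic c (mono 0) 1# (0# ∷ d ∷ h)) ⟨
        S * t * B (c · mono 0 ⊕ 1# · (0# ∷ d ∷ h)) (c · mono 0 ⊕ 1# · (0# ∷ d ∷ h))
          ≈⟨ *-congˡ (B-cong e₃ e₃) ⟨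
        S * t * B (c ∷ d ∷ h) (c ∷ d ∷ h) ∎
        where
          open ≈-R
          n = length h
          k = hat (d ∷ h)
          t = pow S n
          x = B (mono 0) (mono 0)
          y = B (mono 0) (0# ∷ d ∷ h)
          z = B (d ∷ h) (d ∷ h)
          e₁ : B (mono (suc n)) (mono (suc n)) ≈ S * t * x
          e₁ = trans (reflexive (≡.cong (λ j → B (mono j) (mono (suc n))) (≡.sym (ℕₚ.+-identityʳ (suc n))))) (B-mono (suc n) 0)
          e₂ : B (mono (suc n)) k ≈ t * y
          e₂ = trans (reflexive (≡.cong (λ j → B (mono j) k) (ℕₚ.+-comm 1 n))) (B-mono-hat d h 1)
          e₃ : (c ∷ d ∷ h) ≋ c · mono 0 ⊕ 1# · (0# ∷ d ∷ h)
          e₃ = ≋-trans (shift-∷ 0 c (d ∷ h)) (⊕-cong (≋-refl {c · mono 0}) (≋-sym (1·p≋p (0# ∷ d ∷ h))))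

    -- The coefficients of `p` vanish one after the other from the bottom. A unit as constant
    -- coefficient takes the place of an integral domain, which the ring of sequences below is not.
    ⊛-cancel-zero : ∀ g b⁻¹ → b⁻¹ * co g 0 ≈ 1# → ∀ p → g ⊛ p ≋ [] → p ≋ []
    ⊛-cancel-zero g b⁻¹ inv []      e = ≋-refl
    ⊛-cancel-zero g b⁻¹ inv (c ∷ p) e = ≋-sym ([]≋0∷ c≈0 (⊛-cancel-zero g b⁻¹ inv p
        (mk λ i → at (≋-trans (≋-sym (⊛-0∷ g p)) (≋-trans (⊛-congʳ g (∷-cong (sym c≈0) ≋-refl)) e)) (suc i))))
      where
        c≈0 : c ≈ 0#
        c≈0 = trans (sym (*-identityˡ c)) (trans (*-congʳ (sym inv)) (trans (*-assoc b⁻¹ _ c)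
          (trans (*-congˡ (trans (sym (co-⊛-zero g (c ∷ p))) (at e 0))) (zeroʳ b⁻¹))))

    ⊛-cancel : ∀ g b⁻¹ → b⁻¹ * co g 0 ≈ 1# → ∀ p q → g ⊛ p ≋ g ⊛ q → p ≋ q
    ⊛-cancel g b⁻¹ inv p q e = mk λ i → x-y≈0⇒x≈y _ _ (trans (sym (trans (co-⊕ p (⊖ q) i) (+-congˡ (trans (co-· (- 1#) q i) (-1*x≈-x _))))) (at z i))
      where
        x-y≈0⇒x≈y : ∀ x y → x + - y ≈ 0# → x ≈ y
        x-y≈0⇒x≈y x y e = trans (sym (+-identityʳ x)) (trans (+-congˡ (sym (-‿inverseˡ y)))
          (trans (sym (+-assoc x (- y) y)) (trans (+-congʳ e) (+-identityˡ y))))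
        z : p ⊕ (⊖ q) ≋ []
        z = ⊛-cancel-zero g b⁻¹ inv (p ⊕ (⊖ q)) (≋-trans (⊛-distribˡ g p (⊖ q))
          (≋-trans (⊕-cong e (⊛-· (- 1#) g q)) (⊖-inverseʳ (g ⊛ q))))

    -- Here K is `suc k` and the product is X^K + C. By `len` the formal degrees of the factors add
    -- up to K, so their top coefficients multiply to 1.
    module _ (C : Carrier) (k : ℕ) (S^K≈C² : S * pow S k ≈ C * C)
             (b : Carrier) (g : Poly) (c : Carrier) (h : Poly)
             (len : length g ℕ.+ length h ≡ suc k)
             (f-eq : (b ∷ g) ⊛ (c ∷ h) ≋ (C ∷ mono k))
             (b⁻¹ : Carrier) (inv : b⁻¹ * b ≈ 1#) where
      private
        f u : Poly
        f = C ∷ mono k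
        u = (b ∷ g) ⊛ hat (c ∷ h)
        d e : ℕ
        d = length g
        e = length h
        t uK gd he : Carrier
        t = pow S e
        gd = co (b ∷ g) d
        he = co (c ∷ h) e
        uK = gd * c

        g-Deg : Deg≤ d (b ∷ g)
        g-Deg i lt = co-beyond (b ∷ g) i lt

        u-K : co u (suc k) ≈ uK
        u-K = trans (reflexive (≡.cong (co u) (≡.sym len)))
          (trans (co-⊛-top d e (b ∷ g) (hat (c ∷ h)) g-Deg (hat-Deg≤ (c ∷ h)))
            (*-congˡ (trans (co-hat c h 0 e ≡.refl) (*-identityˡ c))))

        u-0 : co u 0 ≈ b * (t * he)
        u-0 = trans (co-⊛-zero (b ∷ g) (hat (c ∷ h))) (*-congˡ (co-hat c h e 0 (ℕₚ.+-identityʳ e)))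

        gdhe : gd * he ≈ 1#
        gdhe = trans (sym (co-⊛-top d e (b ∷ g) (c ∷ h) g-Deg (co-beyond (c ∷ h))))
          (trans (reflexive (≡.cong (co ((b ∷ g) ⊛ (c ∷ h))) len)) (trans (at f-eq (suc k)) (co-mono-≡ k)))

        bc : b * c ≈ C
        bc = trans (sym (co-⊛-zero (b ∷ g) (c ∷ h))) (at f-eq 0)

        -- The extreme coefficients of u are b S^e h_e and g_d c. Regrouped, their product is (b
        -- c)(g_d h_e) S^e, and b c = C, g_d h_e = 1.
        u0uK : co u 0 * uK ≈ C * t
        u0uK = trans (*-congʳ u-0) (trans
          (solve 5 (λ b t he gd c → b :* (t :* he) :* (gd :* c) := b :* c :* t :* (gd :* he)) refl b t he gd c)
          (trans (*-cong (*-congʳ bc) gdhe) (*-identityʳ _)))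

        tl : Poly → Poly
        tl []      = []
        tl (x ∷ p) = p

        ∷-tl : ∀ p → p ≋ (co p 0 ∷ tl p)
        ∷-tl []      = []≋0∷ refl ≋-refl
        ∷-tl (x ∷ p) = ≋-refl

        -- `w` is u without its two extreme coefficients and divided by X; this division is the
        -- factor S in front of its norm in `split-u`.
        u′ w : Poly
        u′ = tl u
        w = delete k u′

        norm-u : ⟨ u , u ⟩ ≈ t * (C * C + C * C)
        norm-u = trans (B-hat (b ∷ g) c h) (*-congˡ (trans (⟨⟩-cong f-eq f-eq)
          (+-congˡ (trans (*-congˡ (⟨⟩-mono k)) S^K≈C²))))

        split-u : ⟨ u , u ⟩ ≈ co u 0 * co u 0 + (C * C * (uK * uK) + S * ⟨ w , w ⟩)
        split-u = trans (⟨⟩-cong (∷-tl u) (∷-tl u)) (+-congˡ (trans (*-congˡ (⟨⟩-delete k u′))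
          (trans (solve 4 (λ s t x y → s :* (t :* x :+ y) := s :* t :* x :+ s :* y) refl S (pow S k) (co u′ k * co u′ k) ⟨ w , w ⟩)
            (+-congʳ (*-cong S^K≈C² (*-cong u′k u′k))))))
          where
            u′k : co u′ k ≈ uK
            u′k = trans (sym (at (∷-tl u) (suc k))) u-K

        v : Carrier
        v = co u 0 + - (C * uK)

        -- AM–GM in square form: u₀² + (C u_K)² − 2 C u₀ u_K, where 2 C u₀ u_K is the whole norm of u.
        sum-zero : v * v + S * ⟨ w , w ⟩ ≈ 0#
        sum-zero = AR.+-cancelʳ (t * (C * C + C * C)) _ _ (begin
          (x + - y) * (x + - y) + r + t * (C * C + C * C)
            ≈⟨ +-congˡ (solve 2 (λ C t → t :* (C :* C :+ C :* C) := C :* (C :* t) :+ C :* (C :* t)) refl C t) ⟩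
          (x + - y) * (x + - y) + r + (C * (C * t) + C * (C * t))
            ≈⟨ +-congˡ (+-cong (*-congˡ u0uK) (*-congˡ u0uK)) ⟨
          (x + - y) * (x + - y) + r + (C * (x * uK) + C * (x * uK))
            ≈⟨ solve 5 (λ x z r C k → (x :+ z) :* (x :+ z) :+ r :+ (C :* (x :* k) :+ C :* (x :* k))
                 := x :* x :+ z :* z :+ r :+ ((C :* k :+ z) :* x :+ (C :* k :+ z) :* x)) refl x (- y) r C uK ⟩
          x * x + - y * - y + r + ((y + - y) * x + (y + - y) * x)
            ≈⟨ +-cong (+-congʳ (+-congˡ (trans (sym (AR.-‿distribˡ-* y (- y))) (trans (-‿cong (sym (AR.-‿distribʳ-* y y))) (AR.-‿involutive _)))))
                 (trans (+-cong (trans (*-congʳ (-‿inverseʳ y)) (zeroˡ x)) (trans (*-congʳ (-‿inverseʳ y)) (zeroˡ x))) (+-identityʳ 0#)) ⟩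
          x * x + y * y + r + 0#
            ≈⟨ solve 4 (λ x C k r → x :* x :+ C :* k :* (C :* k) :+ r :+ con 0 := x :* x :+ (C :* C :* (k :* k) :+ r)) refl x C uK r ⟩
          x * x + (C * C * (uK * uK) + r)
            ≈⟨ split-u ⟨
          ⟨ u , u ⟩
            ≈⟨ norm-u ⟩
          t * (C * C + C * C)
            ≈⟨ +-identityˡ _ ⟨
          0# + t * (C * C + C * C) ∎)
          where
            open ≈-R
            x = co u 0
            y = C * uK
            r = S * ⟨ w , w ⟩

        NN-w : NN (S * ⟨ w , w ⟩)
        NN-w = NN-* S≥0 (NN-⟨⟩ w)

        u0≈ : co u 0 ≈ C * uK
        u0≈ = AR.x∙y⁻¹≈ε⇒x≈y _ _ (sq-zero (+-zero (NN-sq v) NN-w sum-zero))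

        w≋[] : w ≋ []
        w≋[] = ⟨⟩-definite w (S-cancel _ (+-zero NN-w (NN-sq v) (trans (+-comm _ _) sum-zero)))

        u≋ : ∀ i → co u i ≈ co (uK · f) i
        u≋ zero    = trans u0≈ (*-comm C uK)
        u≋ (suc i) with i ℕ.≟ k
        ... | yes ≡.refl = trans u-K (sym (trans (co-· uK f (suc k)) (trans (*-congˡ (co-mono-≡ k)) (*-identityʳ uK))))
        ... | no i≢k     = trans (at (∷-tl u) (suc i)) (trans (sym (co-delete k u′ i i≢k)) (trans (at w≋[] i)
                             (sym (trans (co-· uK f (suc i)) (trans (*-congˡ (co-mono-≢ k i i≢k)) (zeroʳ uK))))))

      -- By `u≋`, g ĥ equals u_K (X^K + C) = u_K g h. Cancelling g leaves ĥ = u_K h, of which this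
      -- is the coefficient at X^j.
      self-reciprocal : ∀ i j → i ℕ.+ j ≡ length h → pow S i * co (c ∷ h) i ≈ co (b ∷ g) (length g) * c * co (c ∷ h) j
      self-reciprocal i j e = trans (sym (co-hat c h i j e))
        (trans (at (⊛-cancel (b ∷ g) b⁻¹ inv (hat (c ∷ h)) (uK · (c ∷ h))
          (≋-trans (mk u≋) (≋-trans (·-cong refl (≋-sym f-eq)) (≋-sym (⊛-· uK (b ∷ g) (c ∷ h)))))) j)
          (co-· uK (c ∷ h) j))

-- A formally real ring of bounded rational sequences containing K-th roots.

module BoundedSequences where
  open import Level using (0ℓ)
  open import Algebra.Bundles using (CommutativeRing)
  open import Data.Nat as ℕ using (ℕ; zero; suc)
  import Data.Nat.Properties as ℕₚ
  import Data.Integer as ℤ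
  import Data.Integer.Properties as ℤₚ
  open import Data.Rational as ℚ using (ℚ; 0ℚ; 1ℚ; ½; _+_; _*_; -_; _≤_; ∣_∣; mkℚ; *≤*)
  open import Data.Rational.Properties
  open import Data.Rational.Literals using (fromℤ)
  open import Data.Rational.Solver using (module +-*-Solver)
  open import Data.Product using (_,_; proj₁; proj₂; ∃-syntax)
  open import Data.Empty using (⊥-elim)
  open import Data.Sum using (inj₁; inj₂)
  open import Relation.Nullary using (¬_; yes; no)
  open import Relation.Binary.PropositionalEquality as ≡ using (_≡_; _≢_; refl; sym; trans; cong; cong₂; subst; subst₂)
  open PolynomialRings
  open WeightedReciprocals

  open +-*-Solver using (solve; _:+_; _:*_; _:=_; con; :-_; _:-_)

  0≤1 : 0ℚ ≤ 1ℚ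
  0≤1 = *≤* (ℤ.+≤+ ℕ.z≤n)

  0≤½ : 0ℚ ≤ ½
  0≤½ = *≤* (ℤ.+≤+ ℕ.z≤n)

  *-monoˡ : ∀ {r p q} → 0ℚ ≤ r → p ≤ q → r * p ≤ r * q
  *-monoˡ {r} 0≤r = *-monoˡ-≤-nonNeg r {{ℚ.nonNegative 0≤r}}

  *-monoʳ : ∀ {r p q} → 0ℚ ≤ r → p ≤ q → p * r ≤ q * r
  *-monoʳ {r} 0≤r = *-monoʳ-≤-nonNeg r {{ℚ.nonNegative 0≤r}}

  0≤* : ∀ {p q} → 0ℚ ≤ p → 0ℚ ≤ q → 0ℚ ≤ p * q
  0≤* {p} {q} 0≤p 0≤q = subst (_≤ p * q) (*-zeroʳ p) (*-monoˡ 0≤p 0≤q)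

  0≤+ : ∀ {p q} → 0ℚ ≤ p → 0ℚ ≤ q → 0ℚ ≤ p + q
  0≤+ {p} {q} 0≤p 0≤q = subst (_≤ p + q) (+-identityʳ 0ℚ) (+-mono-≤ 0≤p 0≤q)

  0≤sq : ∀ p → 0ℚ ≤ p * p
  0≤sq p with ≤-total 0ℚ p
  ... | inj₁ 0≤p = 0≤* 0≤p 0≤p
  ... | inj₂ p≤0 = subst (0ℚ ≤_) (solve 1 (λ p → (:- p) :* (:- p) := p :* p) refl p) (0≤* 0≤-p 0≤-p)
    where
      0≤-p : 0ℚ ≤ - p
      0≤-p = neg-antimono-≤ p≤0

  p≤p+q : ∀ {p q} → 0ℚ ≤ q → p ≤ p + q
  p≤p+q {p} {q} 0≤q = subst (_≤ p + q) (+-identityʳ p) (+-monoʳ-≤ p 0≤q)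

  q≤p+q : ∀ {p q} → 0ℚ ≤ p → q ≤ p + q
  q≤p+q {p} {q} 0≤p = subst (q ≤_) (+-comm q p) (p≤p+q 0≤p)

  ∣∣-sq : ∀ p → ∣ p ∣ * ∣ p ∣ ≡ ∣ p * p ∣
  ∣∣-sq p = sym (∣p*q∣≡∣p∣*∣q∣ p p)

  sq≤1⇒≤1 : ∀ p → 0ℚ ≤ p → p * p ≤ 1ℚ → p ≤ 1ℚ
  sq≤1⇒≤1 p 0≤p le with ≤-total p 1ℚ
  ... | inj₁ p≤1 = p≤1
  ... | inj₂ 1≤p = ≤-trans (subst (_≤ p * p) (*-identityʳ p) (*-monoˡ 0≤p 1≤p)) le

  p≤q⇒0≤q-p : ∀ {p q} → p ≤ q → 0ℚ ≤ q + - p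
  p≤q⇒0≤q-p {p} {q} le = subst (_≤ q + - p) (+-inverseʳ p) (+-monoˡ-≤ (- p) le)

  ∣∣-mono : ∀ {p q} → 0ℚ ≤ p → p ≤ q → ∣ p ∣ ≤ ∣ q ∣
  ∣∣-mono 0≤p p≤q = subst₂ _≤_ (sym (0≤p⇒∣p∣≡p 0≤p)) (sym (0≤p⇒∣p∣≡p (≤-trans 0≤p p≤q))) p≤q

  -- Convergence to 0 stated without quotients: `c` stands for 1/ε.
  Null : (ℕ → ℚ) → Set
  Null x = ∀ c → 0ℚ ≤ c → ∃[ N ] (∀ i → N ℕ.≤ i → c * ∣ x i ∣ ≤ 1ℚ)

  null-≤ : ∀ {x y : ℕ → ℚ} → (∀ i → ∣ x i ∣ ≤ ∣ y i ∣) → Null y → Null x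
  null-≤ le ny c 0≤c with ny c 0≤c
  ... | N , h = N , λ i N≤i → ≤-trans (*-monoˡ 0≤c (le i)) (h i N≤i)

  null-≡ : ∀ {x y : ℕ → ℚ} → (∀ i → x i ≡ y i) → Null y → Null x
  null-≡ e = null-≤ (λ i → ≤-reflexive (cong ∣_∣ (e i)))

  null-0 : Null (λ _ → 0ℚ)
  null-0 c 0≤c = 0 , λ i _ → subst (_≤ 1ℚ) (sym (*-zeroʳ c)) 0≤1

  null-+ : ∀ {x y : ℕ → ℚ} → Null x → Null y → Null (λ i → x i + y i)
  null-+ {x} {y} nx ny c 0≤c with nx (c + c) (0≤+ 0≤c 0≤c) | ny (c + c) (0≤+ 0≤c 0≤c)
  ... | N , h | M , k = N ℕ.⊔ M , λ i le → begin
    c * ∣ x i + y i ∣                       ≤⟨ *-monoˡ 0≤c (∣p+q∣≤∣p∣+∣q∣ (x i) (y i)) ⟩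
    c * (∣ x i ∣ + ∣ y i ∣)                 ≡⟨ solve 3 (λ c a b → c :* (a :+ b) := con ½ :* ((c :+ c) :* a :+ (c :+ c) :* b)) refl c (∣ x i ∣) (∣ y i ∣) ⟩
    ½ * ((c + c) * ∣ x i ∣ + (c + c) * ∣ y i ∣)
      ≤⟨ *-monoˡ 0≤½ (+-mono-≤ (h i (ℕₚ.≤-trans (ℕₚ.m≤m⊔n N M) le)) (k i (ℕₚ.≤-trans (ℕₚ.m≤n⊔m N M) le))) ⟩
    ½ * (1ℚ + 1ℚ)                           ≡⟨ refl ⟩
    1ℚ                                      ∎
    where open ≤-Reasoning

  null-neg : ∀ {x} → Null x → Null (λ i → - x i)
  null-neg {x} = null-≤ (λ i → ≤-reflexive (∣-p∣≡∣p∣ (x i)))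

  null-*-bounded : ∀ (x : ℕ → ℚ) {y : ℕ → ℚ} {B} → (∀ i → ∣ x i ∣ ≤ B) → Null y → Null (λ i → x i * y i)
  null-*-bounded x {y} {B} bd ny c 0≤c with ny (c * B) (0≤* 0≤c (≤-trans (0≤∣p∣ (x 0)) (bd 0)))
  ... | N , h = N , λ i le → begin
    c * ∣ x i * y i ∣        ≡⟨ cong (c *_) (∣p*q∣≡∣p∣*∣q∣ (x i) (y i)) ⟩
    c * (∣ x i ∣ * ∣ y i ∣)  ≤⟨ *-monoˡ 0≤c (*-monoʳ (0≤∣p∣ (y i)) (bd i)) ⟩
    c * (B * ∣ y i ∣)        ≡⟨ *-assoc c B _ ⟨
    c * B * ∣ y i ∣          ≤⟨ h i le ⟩
    1ℚ                       ∎
    where open ≤-Reasoning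

  null-sq : ∀ {x} → Null (λ i → x i * x i) → Null x
  null-sq {x} nx c 0≤c with nx (c * c) (0≤* 0≤c 0≤c)
  ... | N , h = N , λ i le → sq≤1⇒≤1 _ (0≤* 0≤c (0≤∣p∣ (x i))) (subst (_≤ 1ℚ)
    (trans (cong (c * c *_) (sym (∣∣-sq (x i)))) (solve 2 (λ c a → c :* c :* (a :* a) := c :* a :* (c :* a)) refl c ∣ x i ∣)) (h i le))

  null-const : ∀ q → Null (λ _ → q) → q ≡ 0ℚ
  null-const q nq with ∣ q ∣ ≟ 0ℚ
  ... | yes e = ∣p∣≡0⇒p≡0 q e
  -- For c = 2/|q| the definition of a null sequence would give 2 ≤ 1.
  ... | no ne = ⊥-elim (2≰1 (subst (_≤ 1ℚ) 2r∣q∣≡2 (proj₂ (nq (2ℚ * r) 0≤2r) _ ℕₚ.≤-refl)))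
    where
      instance
        pos : ℚ.Positive ∣ q ∣
        pos = nonNeg∧nonZero⇒pos ∣ q ∣ {{ℚ.nonNegative (0≤∣p∣ q)}} {{ℚ.≢-nonZero ne}}
      2ℚ r : ℚ
      2ℚ = 1ℚ + 1ℚ
      r = (ℚ.1/ ∣ q ∣) {{pos⇒nonZero ∣ q ∣}}
      0≤2r : 0ℚ ≤ 2ℚ * r
      0≤2r = 0≤* {2ℚ} {r} (0≤+ {1ℚ} {1ℚ} 0≤1 0≤1) (<⇒≤ (positive⁻¹ r {{1/pos⇒pos ∣ q ∣}}))
      2r∣q∣≡2 : 2ℚ * r * ∣ q ∣ ≡ 2ℚ
      2r∣q∣≡2 = trans (*-assoc 2ℚ r ∣ q ∣) (trans (cong (2ℚ *_) (*-inverseˡ ∣ q ∣ {{pos⇒nonZero ∣ q ∣}})) (*-identityʳ 2ℚ))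
      2≰1 : ¬ (2ℚ ≤ 1ℚ)
      2≰1 (*≤* (ℤ.+≤+ (ℕ.s≤s ())))

  -- The real numbers are represented by bounded rational sequences modulo null sequences; this ring is large
  -- enough to contain the real roots used below and positivity of squares survives in it.
  record BSeq : Set where
    field
      seq     : ℕ → ℚ
      bound   : ℚ
      bounded : ∀ i → ∣ seq i ∣ ≤ bound
  open BSeq

  infix 4 _≈ₛ_
  infixl 6 _+ₛ_
  infixl 7 _*ₛ_
  record _≈ₛ_ (x y : BSeq) : Set where
    constructor null
    field un : Null (λ i → seq x i + - seq y i)
  open _≈ₛ_

  _+ₛ_ _*ₛ_ : BSeq → BSeq → BSeq
  x +ₛ y = record
    { seq = λ i → seq x i + seq y i
    ; bound = bound x + bound y
    ; bounded = λ i → ≤-trans (∣p+q∣≤∣p∣+∣q∣ (seq x i) (seq y i)) (+-mono-≤ (bounded x i) (bounded y i)) }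
  x *ₛ y = record
    { seq = λ i → seq x i * seq y i
    ; bound = bound x * bound y
    ; bounded = λ i → ≤-trans (≤-reflexive (∣p*q∣≡∣p∣*∣q∣ (seq x i) (seq y i)))
        (≤-trans (*-monoˡ (0≤∣p∣ (seq x i)) (bounded y i))
                 (*-monoʳ (≤-trans (0≤∣p∣ (seq y i)) (bounded y i)) (bounded x i))) }

  -ₛ_ : BSeq → BSeq
  -ₛ x = record { seq = λ i → - seq x i ; bound = bound x
                ; bounded = λ i → ≤-trans (≤-reflexive (∣-p∣≡∣p∣ (seq x i))) (bounded x i) }

  const : ℚ → BSeq
  const q = record { seq = λ _ → q ; bound = ∣ q ∣ ; bounded = λ _ → ≤-refl }

  pointwise : ∀ {x y} → (∀ i → seq x i ≡ seq y i) → x ≈ₛ y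
  pointwise {x} {y} e = null (null-≡ (λ i → trans (cong (_+ - seq y i) (e i)) (+-inverseʳ (seq y i))) null-0)

  seqRing : CommutativeRing 0ℓ 0ℓ
  seqRing = record
    { Carrier = BSeq ; _≈_ = _≈ₛ_ ; _+_ = _+ₛ_ ; _*_ = _*ₛ_ ; -_ = -ₛ_ ; 0# = const 0ℚ ; 1# = const 1ℚ
    ; isCommutativeRing = record
      { isRing = record
        { +-isAbelianGroup = record
          { isGroup = record
            { isMonoid = record
              { isSemigroup = record
                { isMagma = record
                  { isEquivalence = record
                    { refl = pointwise λ i → refl
                    ; sym = λ {x} {y} e → null (null-≡ (λ i → solve 2 (λ x y → y :- x := :- (x :- y)) refl (seq x i) (seq y i)) (null-neg (un e)))
                    ; trans = λ {x} {y} {z} e f → null (null-≡ (λ i → solve 3 (λ x y z → x :- z := (x :- y) :+ (y :- z)) refl (seq x i) (seq y i) (seq z i)) (null-+ (un e) (un f))) }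
                  ; ∙-cong = λ {x} {y} {u} {v} e f → null (null-≡ (λ i → solve 4 (λ x y u v → (x :+ u) :- (y :+ v) := (x :- y) :+ (u :- v)) refl (seq x i) (seq y i) (seq u i) (seq v i)) (null-+ (un e) (un f))) }
                ; assoc = λ x y z → pointwise λ i → +-assoc (seq x i) (seq y i) (seq z i) }
              ; identity = (λ x → pointwise λ i → +-identityˡ (seq x i)) , (λ x → pointwise λ i → +-identityʳ (seq x i)) }
            ; inverse = (λ x → pointwise λ i → +-inverseˡ (seq x i)) , (λ x → pointwise λ i → +-inverseʳ (seq x i))
            ; ⁻¹-cong = λ {x} {y} e → null (null-≡ (λ i → solve 2 (λ x y → (:- x) :- (:- y) := :- (x :- y)) refl (seq x i) (seq y i)) (null-neg (un e))) }
          ; comm = λ x y → pointwise λ i → +-comm (seq x i) (seq y i) }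
        -- In xu - yv = u(x - y) + y(u - v) the null sequences are multiplied by u and y, which is
        -- why boundedness is part of `BSeq`.
        ; *-cong = λ {x} {y} {u} {v} e f → null (null-≡
            (λ i → solve 4 (λ x y u v → x :* u :- y :* v := u :* (x :- y) :+ y :* (u :- v)) refl (seq x i) (seq y i) (seq u i) (seq v i))
            (null-+ {λ i → seq u i * (seq x i + - seq y i)} {λ i → seq y i * (seq u i + - seq v i)}
              (null-*-bounded (seq u) (bounded u) (un e)) (null-*-bounded (seq y) (bounded y) (un f))))
        ; *-assoc = λ x y z → pointwise λ i → *-assoc (seq x i) (seq y i) (seq z i)
        ; *-identity = (λ x → pointwise λ i → *-identityˡ (seq x i)) , (λ x → pointwise λ i → *-identityʳ (seq x i))
        ; distrib = (λ x y z → pointwise λ i → *-distribˡ-+ (seq x i) (seq y i) (seq z i))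
                  , (λ x y z → pointwise λ i → *-distribʳ-+ (seq x i) (seq y i) (seq z i)) }
      ; *-comm = λ x y → pointwise λ i → *-comm (seq x i) (seq y i) } }

  module Rₛ = CommutativeRing seqRing

  null⇒≈0 : ∀ {x} → Null (seq x) → x ≈ₛ const 0ℚ
  null⇒≈0 {x} n = null (null-≡ (λ i → +-identityʳ (seq x i)) n)

  ≈0⇒null : ∀ {x} → x ≈ₛ const 0ℚ → Null (seq x)
  ≈0⇒null {x} e = null-≡ (λ i → sym (+-identityʳ (seq x i))) (un e)

  -- Nonnegativity is imposed termwise on the representative; a nonnegative term is dominated by the
  -- sum, so a null sum has null terms.
  seqReal : FormallyReal seqRing
  seqReal = record
    { NN = λ x → ∀ i → 0ℚ ≤ seq x i
    ; NN-0 = λ i → ≤-refl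
    ; NN-+ = λ hx hy i → 0≤+ (hx i) (hy i)
    ; NN-* = λ hx hy i → 0≤* (hx i) (hy i)
    ; NN-sq = λ x i → 0≤sq (seq x i)
    ; +-zero = λ {x} {y} hx hy e → null⇒≈0 (null-≤ {seq x} {λ i → seq x i + seq y i} (λ i → ∣∣-mono (hx i) (p≤p+q (hy i))) (≈0⇒null e))
    ; sq-zero = λ {x} e → null⇒≈0 (null-sq {seq x} (≈0⇒null e)) }

  ℚRing : CommutativeRing 0ℓ 0ℓ
  ℚRing = +-*-commutativeRing

  ι : Maps.Hom ℚRing seqRing
  ι = record
    { ⟦_⟧ = const ; cong = λ { refl → Rₛ.refl } ; +-homo = λ x y → pointwise λ i → refl
    ; *-homo = λ x y → pointwise λ i → refl ; 0-homo = Rₛ.refl ; 1-homo = Rₛ.refl }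

  -- The way back: identities between rational constants found in the large ring hold in ℚ.
  const-injective : ∀ p q → const p ≈ₛ const q → p ≡ q
  const-injective p q e = begin
    p               ≡⟨ solve 2 (λ p q → p := (p :- q) :+ q) refl p q ⟩
    (p + - q) + q   ≡⟨ cong (_+ q) (null-const _ (un e)) ⟩
    0ℚ + q          ≡⟨ +-identityˡ q ⟩
    q               ∎
    where open ≡.≡-Reasoning

  module DQ = Degrees ℚRing
  module DS = Degrees seqRing

  pow-const : ∀ q n → DS.pow (const q) n ≈ₛ const (DQ.pow q n)
  pow-const q n = pointwise (go n)
    where
      go : ∀ n i → seq (DS.pow (const q) n) i ≡ DQ.pow q n
      go zero    i = refl
      go (suc n) i = cong (q *_) (go n i)

  seq-pow : ∀ x n i → seq (DS.pow x n) i ≡ DQ.pow (seq x i) n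
  seq-pow x zero    i = refl
  seq-pow x (suc n) i = cong (seq x i *_) (seq-pow x n i)

  pow-cong : ∀ {x y} n → x ≈ₛ y → DS.pow x n ≈ₛ DS.pow y n
  pow-cong zero    e = Rₛ.refl
  pow-cong {x} {y} (suc n) e = Rₛ.*-cong {x} {y} {DS.pow x n} {DS.pow y n} e (pow-cong n e)

  fromℕ : ℕ → ℚ
  fromℕ zero    = 0ℚ
  fromℕ (suc n) = 1ℚ + fromℕ n

  0≤fromℕ : ∀ n → 0ℚ ≤ fromℕ n
  0≤fromℕ zero    = ≤-refl
  0≤fromℕ (suc n) = 0≤+ 0≤1 (0≤fromℕ n)

  fromℕ-mono : ∀ {m n} → m ℕ.≤ n → fromℕ m ≤ fromℕ n
  fromℕ-mono {n = n} ℕ.z≤n = 0≤fromℕ n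
  fromℕ-mono (ℕ.s≤s le)    = +-monoʳ-≤ 1ℚ (fromℕ-mono le)

  -- The absolute value of the numerator is large enough, since the denominator is at least 1.
  archimedean : ∀ p → ∃[ n ] p ≤ fromℕ n
  archimedean p = ℤ.∣ ℚ.↥ p ∣ , ≤-trans (lemma p) (≤-reflexive (e ℤ.∣ ℚ.↥ p ∣))
    where
      lemma : ∀ p → p ≤ fromℤ (ℤ.+ ℤ.∣ ℚ.↥ p ∣)
      lemma (mkℚ (ℤ.+ n) d _) = *≤* (subst (ℤ._≤ ℤ.+ n ℤ.* ℤ.+ suc d) (sym (ℤₚ.*-identityʳ (ℤ.+ n)))
        (subst (ℤ._≤ ℤ.+ n ℤ.* ℤ.+ suc d) (ℤₚ.*-identityʳ (ℤ.+ n)) (ℤₚ.*-monoˡ-≤-nonNeg (ℤ.+ n) (ℤ.+≤+ (ℕ.s≤s ℕ.z≤n)))))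
      lemma (mkℚ ℤ.-[1+ n ] d _) = *≤* ℤ.-≤+
      step : ∀ n → fromℤ (ℤ.+ suc n) ≡ 1ℚ + fromℤ (ℤ.+ n)
      step n = sym (trans (cong (ℚ._/ 1) (cong₂ ℤ._+_ (refl {x = ℤ.+ 1}) (ℤₚ.*-identityʳ (ℤ.+ n)))) (↥p/↧p≡p (fromℤ (ℤ.+ suc n))))
      e : ∀ n → fromℤ (ℤ.+ n) ≡ fromℕ n
      e zero    = refl
      e (suc n) = trans (step n) (cong (1ℚ +_) (e n))

  pow-nonneg : ∀ {q} → 0ℚ ≤ q → ∀ n → 0ℚ ≤ DQ.pow q n
  pow-nonneg 0≤q zero    = 0≤1
  pow-nonneg 0≤q (suc n) = 0≤* 0≤q (pow-nonneg 0≤q n)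

  pow½≤1 : ∀ n → DQ.pow ½ n ≤ 1ℚ
  pow½≤1 zero    = ≤-refl
  pow½≤1 (suc n) = ≤-trans (*-monoˡ 0≤½ (pow½≤1 n)) (*≤* (ℤ.+≤+ (ℕ.s≤s ℕ.z≤n)))

  n½ⁿ≤1 : ∀ n → fromℕ n * DQ.pow ½ n ≤ 1ℚ
  n½ⁿ≤1 zero    = 0≤1
  n½ⁿ≤1 (suc n) = begin
    (1ℚ + fromℕ n) * (½ * DQ.pow ½ n)           ≡⟨ solve 2 (λ a b → (con 1ℚ :+ a) :* (con ½ :* b) := con ½ :* (b :+ a :* b)) refl (fromℕ n) (DQ.pow ½ n) ⟩
    ½ * (DQ.pow ½ n + fromℕ n * DQ.pow ½ n)     ≤⟨ *-monoˡ 0≤½ (+-mono-≤ (pow½≤1 n) (n½ⁿ≤1 n)) ⟩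
    ½ * (1ℚ + 1ℚ)                               ≡⟨ refl ⟩
    1ℚ                                          ∎
    where open ≤-Reasoning

  -- As soon as i ≥ c U, one has c U 2⁻ⁱ ≤ i 2⁻ⁱ ≤ 1.
  null-geometric : ∀ U → 0ℚ ≤ U → Null (λ i → DQ.pow ½ i * U)
  null-geometric U 0≤U c 0≤c with archimedean (c * U)
  ... | n , h = n , λ i n≤i → begin
    c * ∣ DQ.pow ½ i * U ∣  ≡⟨ cong (c *_) (0≤p⇒∣p∣≡p (0≤* (pow-nonneg 0≤½ i) 0≤U)) ⟩
    c * (DQ.pow ½ i * U)    ≡⟨ solve 3 (λ c a u → c :* (a :* u) := c :* u :* a) refl c (DQ.pow ½ i) U ⟩
    c * U * DQ.pow ½ i      ≤⟨ *-monoʳ (pow-nonneg 0≤½ i) (≤-trans h (fromℕ-mono n≤i)) ⟩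
    fromℕ i * DQ.pow ½ i    ≤⟨ n½ⁿ≤1 i ⟩
    1ℚ                      ∎
    where open ≤-Reasoning

  -- Bisection for the (k+1)-st root of `M`. The sequence of left endpoints represents the root.
  module Root (k : ℕ) (M : ℚ) (0≤M : 0ℚ ≤ M) where
    U : ℚ
    U = 1ℚ + M

    0≤U : 0ℚ ≤ U
    0≤U = 0≤+ 0≤1 0≤M

    record Bracket : Set where
      field
        l u : ℚ
        0≤l : 0ℚ ≤ l
        l≤u : l ≤ u
        u≤U : u ≤ U
        lo  : DQ.pow l (suc k) ≤ M
        hi  : M ≤ DQ.pow u (suc k)
    open Bracket

    -- The bound 1 + M is at least 1, so its powers do not fall below 1 + M ≥ M, whatever the
    -- exponent.
    start : Bracket
    start = record
      { l = 0ℚ ; u = U ; 0≤l = ≤-refl ; l≤u = 0≤U ; u≤U = ≤-refl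
      ; lo = subst (_≤ M) (sym (*-zeroˡ (DQ.pow 0ℚ k))) 0≤M
      ; hi = ≤-trans (q≤p+q 0≤1) (subst (_≤ DQ.pow U (suc k)) (*-identityʳ U) (*-monoˡ 0≤U (1≤pow k))) }
      where
        1≤pow : ∀ n → 1ℚ ≤ DQ.pow U n
        1≤pow zero    = ≤-refl
        1≤pow (suc n) = ≤-trans (p≤p+q {1ℚ} 0≤M) (subst (_≤ U * DQ.pow U n) (*-identityʳ U) (*-monoˡ 0≤U (1≤pow n)))

    mid-≥ : ∀ {l u} → l ≤ u → l ≤ ½ * (l + u)
    mid-≥ {l} {u} le = subst (_≤ ½ * (l + u)) (solve 1 (λ l → con ½ :* (l :+ l) := l) refl l) (*-monoˡ 0≤½ (+-monoʳ-≤ l le))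

    mid-≤ : ∀ {l u} → l ≤ u → ½ * (l + u) ≤ u
    mid-≤ {l} {u} le = subst (½ * (l + u) ≤_) (solve 1 (λ l → con ½ :* (l :+ l) := l) refl u) (*-monoˡ 0≤½ (+-monoˡ-≤ u le))

    step : (b : Bracket) → ∃[ b′ ] u b′ + - l b′ ≡ ½ * (u b + - l b)
    step b with ≤-total (DQ.pow (½ * (l b + u b)) (suc k)) M
    ... | inj₁ le = record { l = ½ * (l b + u b) ; u = u b ; 0≤l = ≤-trans (0≤l b) (mid-≥ (l≤u b))
                           ; l≤u = mid-≤ (l≤u b) ; u≤U = u≤U b ; lo = le ; hi = hi b }
                  , solve 2 (λ l u → u :- con ½ :* (l :+ u) := con ½ :* (u :- l)) refl (l b) (u b)
    ... | inj₂ ge = record { l = l b ; u = ½ * (l b + u b) ; 0≤l = 0≤l b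
                           ; l≤u = mid-≥ (l≤u b) ; u≤U = ≤-trans (mid-≤ (l≤u b)) (u≤U b) ; lo = lo b ; hi = ge }
                  , solve 2 (λ l u → con ½ :* (l :+ u) :- l := con ½ :* (u :- l)) refl (l b) (u b)

    brackets : ℕ → Bracket
    brackets zero    = start
    brackets (suc i) = proj₁ (step (brackets i))

    width : ∀ i → u (brackets i) + - l (brackets i) ≡ DQ.pow ½ i * U
    width zero    = trans (+-identityʳ U) (sym (*-identityˡ U))
    width (suc i) = trans (proj₂ (step (brackets i))) (trans (cong (½ *_) (width i)) (sym (*-assoc ½ (DQ.pow ½ i) U)))

    root upper : BSeq
    root = record { seq = λ i → l (brackets i) ; bound = U
      ; bounded = λ i → subst (_≤ U) (sym (0≤p⇒∣p∣≡p (0≤l (brackets i)))) (≤-trans (l≤u (brackets i)) (u≤U (brackets i))) }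
    upper = record { seq = λ i → u (brackets i) ; bound = U
      ; bounded = λ i → subst (_≤ U) (sym (0≤p⇒∣p∣≡p (≤-trans (0≤l (brackets i)) (l≤u (brackets i))))) (u≤U (brackets i)) }

    upper≈root : upper ≈ₛ root
    upper≈root = null (null-≡ width (null-geometric U 0≤U))

    root≥0 : ∀ i → 0ℚ ≤ seq root i
    root≥0 i = 0≤l (brackets i)

    -- `M` lies between the powers of the two endpoints, and these powers differ by a null sequence
    -- because the endpoints do.
    M≈root^ : const M ≈ₛ DS.pow root (suc k)
    M≈root^ = null (null-≤ le (un (pow-cong (suc k) upper≈root)))
      where
        le : ∀ i → ∣ M + - seq (DS.pow root (suc k)) i ∣ ≤ ∣ seq (DS.pow upper (suc k)) i + - seq (DS.pow root (suc k)) i ∣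
        le i rewrite seq-pow root (suc k) i | seq-pow upper (suc k) i =
          ∣∣-mono (p≤q⇒0≤q-p (lo b)) (+-monoˡ-≤ (- DQ.pow (l b) (suc k)) (hi b))
          where
            b = brackets i

    -- The root is a unit: rootᵏ/M is its inverse.
    root-cancel : M ≢ 0ℚ → ∀ x → root *ₛ x ≈ₛ const 0ℚ → x ≈ₛ const 0ℚ
    root-cancel M≢0 x e = begin
      x                                      ≈⟨ Rₛ.*-identityˡ x ⟨
      const 1ℚ *ₛ x                          ≈⟨ pointwise (λ i → cong (_* seq x i) (sym (*-inverseˡ M))) ⟩
      (const (ℚ.1/ M) *ₛ const M) *ₛ x       ≈⟨ Rₛ.*-congʳ {x} (Rₛ.*-congˡ {const (ℚ.1/ M)} M≈root^) ⟩
      (c *ₛ (root *ₛ p)) *ₛ x                ≈⟨ pointwise (λ i → solve 4 (λ c r p x → c :* (r :* p) :* x := c :* p :* (r :* x)) refl (seq c i) (seq root i) (seq p i) (seq x i)) ⟩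
      (c *ₛ p) *ₛ (root *ₛ x)                ≈⟨ Rₛ.*-congˡ {c *ₛ p} e ⟩
      (c *ₛ p) *ₛ const 0ℚ                   ≈⟨ Rₛ.zeroʳ (c *ₛ p) ⟩
      const 0ℚ ∎
      where
        instance _ = ℚ.≢-nonZero M≢0
        c = const (ℚ.1/ M)
        p = DS.pow root k
        open import Relation.Binary.Reasoning.Setoid Rₛ.setoid

-- Perfect powers of natural numbers.

module NaturalPowers where
  open import Data.Nat
  open import Data.Nat.Properties
  open import Data.Nat.Divisibility
  open import Data.Nat.DivMod using (_/_; m/n*n≡m)
  open import Data.Nat.GCD using (gcd; gcd[m,n]∣m; gcd[m,n]∣n; gcd[m,n]≢0; module Bézout)
  open import Data.Nat.Coprimality using (Coprime; coprime-/gcd; coprime-divisor; coprime-Bézout)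
  import Data.Nat.Coprimality as Coprimality
  open import Data.Nat.Primality using (Prime; prime⇒irreducible; prime⇒nonTrivial; prime⇒nonZero; euclidsLemma)
  open import Data.Nat.Solver using (module +-*-Solver)
  open import Data.Product using (_,_; ∃-syntax)
  open import Data.Sum using (inj₁; inj₂)
  open import Data.Empty using (⊥-elim)
  open import Relation.Nullary using (¬_)
  open import Relation.Binary.Definitions using (tri<; tri≈; tri>)
  open import Relation.Binary.PropositionalEquality

  ^-distribʳ-* : ∀ m n o → (m * n) ^ o ≡ m ^ o * n ^ o
  ^-distribʳ-* m n zero    = refl
  ^-distribʳ-* m n (suc o) = trans (cong (m * n *_) (^-distribʳ-* m n o))
    (+-*-Solver.solve 4 (λ m n x y → m :* n :* (x :* y) := m :* x :* (n :* y)) refl m n (m ^ o) (n ^ o))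
    where open +-*-Solver

  ^-injectiveˡ : ∀ k .{{_ : NonZero k}} m n → m ^ k ≡ n ^ k → m ≡ n
  ^-injectiveˡ k m n e with <-cmp m n
  ... | tri< m<n _ _ = ⊥-elim (<-irrefl e (^-monoˡ-< k m<n))
  ... | tri≈ _ m≡n _ = m≡n
  ... | tri> _ _ n<m = ⊥-elim (<-irrefl (sym e) (^-monoˡ-< k n<m))

  coprime-^ : ∀ {d y} n → Coprime d y → d ∣ y ^ n → d ∣ 1
  coprime-^ zero    c h = h
  coprime-^ (suc n) c h = coprime-^ n c (coprime-divisor c h)

  prime-coprime : ∀ {p n} → Prime p → ¬ p ∣ n → Coprime p n
  prime-coprime pp p∤n {i} (i∣p , i∣n) with prime⇒irreducible pp i∣p
  ... | inj₁ i≡1 = i≡1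
  ... | inj₂ refl = ⊥-elim (p∤n i∣n)

  ∣^⇒∣ : ∀ {p} n k → Prime p → p ∣ n ^ k → p ∣ n
  ∣^⇒∣ n zero    pp h = ⊥-elim (nonTrivial⇒≢1 {{prime⇒nonTrivial pp}} (∣1⇒≡1 h))
  ∣^⇒∣ n (suc k) pp h with euclidsLemma n (n ^ k) pp h
  ... | inj₁ h′ = h′
  ... | inj₂ h′ = ∣^⇒∣ n k pp h′

  -- In lowest terms Y/D = y/d the denominator d divides y^b although it is prime to y, hence d = 1
  -- and N = y^b.
  power-quotient : ∀ b .{{_ : NonZero b}} N D Y .{{_ : NonZero D}} → N * D ^ b ≡ Y ^ b → ∃[ n ] n ^ b ≡ N
  power-quotient (suc b) N D Y e = y , sym (begin
      N               ≡⟨ *-identityʳ N ⟨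
      N * 1           ≡⟨ cong (N *_) (^-zeroˡ (suc b)) ⟨
      N * 1 ^ suc b   ≡⟨ cong (λ t → N * t ^ suc b) (∣1⇒≡1 (coprime-^ (suc b) (Coprimality.sym (coprime-/gcd Y D)) d∣y^)) ⟨
      N * d ^ suc b   ≡⟨ Ndb≡yb ⟩
      y ^ suc b       ∎)
    where
      open ≡-Reasoning
      g = gcd Y D
      instance
        g≢0 : NonZero g
        g≢0 = ≢-nonZero (gcd[m,n]≢0 Y D (inj₂ (≢-nonZero⁻¹ D)))
        gb≢0 : NonZero (g ^ suc b)
        gb≢0 = m^n≢0 g (suc b)
      y d : ℕ
      y = Y / g
      d = D / g
      Ndb≡yb : N * d ^ suc b ≡ y ^ suc b
      Ndb≡yb = *-cancelʳ-≡ _ _ (g ^ suc b) (begin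
        N * d ^ suc b * g ^ suc b   ≡⟨ *-assoc N _ _ ⟩
        N * (d ^ suc b * g ^ suc b) ≡⟨ cong (N *_) (^-distribʳ-* d g (suc b)) ⟨
        N * (d * g) ^ suc b         ≡⟨ cong (λ t → N * t ^ suc b) (m/n*n≡m (gcd[m,n]∣n Y D)) ⟩
        N * D ^ suc b               ≡⟨ e ⟩
        Y ^ suc b                   ≡⟨ cong (_^ suc b) (m/n*n≡m (gcd[m,n]∣m Y D)) ⟨
        (y * g) ^ suc b             ≡⟨ ^-distribʳ-* y g (suc b) ⟩
        y ^ suc b * g ^ suc b       ∎)
      d∣y^ : d ∣ y ^ suc b
      d∣y^ = subst (d ∣_) Ndb≡yb (∣n⇒∣m*n N (m∣m*n (d ^ b)))

  -- By Bézout N itself becomes a quotient of b-th powers.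
  power-extract : ∀ {b} j N s t .{{_ : NonZero N}} .{{_ : NonZero t}} → Prime b → ¬ b ∣ j →
    s ^ b ≡ N ^ j * t ^ b → ∃[ n ] n ^ b ≡ N
  power-extract {b} j N s t pb b∤j e with coprime-Bézout (prime-coprime pb b∤j)
  ... | Bézout.+- x y eq = power-quotient b {{prime⇒nonZero pb}} N (s ^ y) (N ^ x * t ^ y) {{m^n≢0 s y {{s≢0}}}} (begin
      N * (s ^ y) ^ b                  ≡⟨ cong (N *_) (swap s y b) ⟩
      N * (s ^ b) ^ y                  ≡⟨ cong (λ z → N * z ^ y) e ⟩
      N * (N ^ j * t ^ b) ^ y          ≡⟨ cong (N *_) (^-distribʳ-* (N ^ j) (t ^ b) y) ⟩
      N * ((N ^ j) ^ y * (t ^ b) ^ y)  ≡⟨ *-assoc N _ _ ⟨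
      N * (N ^ j) ^ y * (t ^ b) ^ y    ≡⟨ cong₂ _*_ (trans (cong (N *_) (trans (^-*-assoc N j y) (cong (N ^_) (*-comm j y)))) (trans (cong (N ^_) eq) (sym (^-*-assoc N x b)))) (swap t b y) ⟩
      (N ^ x) ^ b * (t ^ y) ^ b        ≡⟨ ^-distribʳ-* (N ^ x) (t ^ y) b ⟨
      (N ^ x * t ^ y) ^ b              ∎)
    where
      open ≡-Reasoning
      swap : ∀ m p q → (m ^ p) ^ q ≡ (m ^ q) ^ p
      swap m p q = trans (^-*-assoc m p q) (trans (cong (m ^_) (*-comm p q)) (sym (^-*-assoc m q p)))
      s≢0 : NonZero s
      s≢0 = ≢-nonZero λ { refl → ≢-nonZero⁻¹ (N ^ j * t ^ b) {{m*n≢0 _ _ {{m^n≢0 N j}} {{m^n≢0 t b}}}}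
        (trans (sym e) (0^ b {{prime⇒nonZero pb}})) }
        where
          0^ : ∀ b .{{_ : NonZero b}} → 0 ^ b ≡ 0
          0^ (suc b) = refl
  ... | Bézout.-+ x y eq = power-quotient b {{prime⇒nonZero pb}} N (N ^ x * t ^ y) (s ^ y) {{m*n≢0 _ _ {{m^n≢0 N x}} {{m^n≢0 t y}}}} (begin
      N * (N ^ x * t ^ y) ^ b          ≡⟨ cong (N *_) (^-distribʳ-* (N ^ x) (t ^ y) b) ⟩
      N * ((N ^ x) ^ b * (t ^ y) ^ b)  ≡⟨ *-assoc N _ _ ⟨
      N * (N ^ x) ^ b * (t ^ y) ^ b    ≡⟨ cong₂ _*_ (trans (cong (N *_) (^-*-assoc N x b)) (trans (cong (N ^_) (trans eq (*-comm y j))) (sym (^-*-assoc N j y)))) (swap t y b) ⟩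
      (N ^ j) ^ y * (t ^ b) ^ y        ≡⟨ ^-distribʳ-* (N ^ j) (t ^ b) y ⟨
      (N ^ j * t ^ b) ^ y              ≡⟨ cong (_^ y) e ⟨
      (s ^ b) ^ y                      ≡⟨ swap s b y ⟩
      (s ^ y) ^ b                      ∎)
    where
      open ≡-Reasoning
      swap : ∀ m p q → (m ^ p) ^ q ≡ (m ^ q) ^ p
      swap m p q = trans (^-*-assoc m p q) (trans (cong (m ^_) (*-comm p q)) (sym (^-*-assoc m q p)))

-- The embedding of the integers into the rationals, and numerators of powers.

module IntegersInRationals where
  open import Level using (0ℓ)
  open import Algebra.Bundles using (CommutativeRing)
  open import Data.Nat as ℕ using (zero; suc)
  open import Data.Integer as ℤ using (ℤ; +_; ∣_∣)
  import Data.Integer.Properties as ℤₚ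
  open import Data.Rational as ℚ using (ℚ; mkℚ; ↥_; ↧_; ↧ₙ_)
  import Data.Rational.Properties as ℚₚ
  import Data.Rational.Unnormalised as ℚᵘ
  import Data.Rational.Unnormalised.Properties as ℚᵘₚ
  open import Data.Rational.Literals using (fromℤ)
  open import Relation.Binary.PropositionalEquality
  open PolynomialRings
  open WeightedReciprocals
  open BoundedSequences
  open NaturalPowers

  ℤRing : CommutativeRing 0ℓ 0ℓ
  ℤRing = ℤₚ.+-*-commutativeRing

  _/1 : ℤ → ℚ
  z /1 = z ℚ./ 1

  /1≡fromℤ : ∀ z → z /1 ≡ fromℤ z
  /1≡fromℤ z = ℚₚ.↥p/↧p≡p (fromℤ z)

  /1-+ : ∀ x y → (x ℤ.+ y) /1 ≡ x /1 ℚ.+ y /1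
  /1-+ x y = sym (trans (cong₂ ℚ._+_ (/1≡fromℤ x) (/1≡fromℤ y))
    (cong (ℚ._/ 1) (cong₂ ℤ._+_ (ℤₚ.*-identityʳ x) (ℤₚ.*-identityʳ y))))

  /1-* : ∀ x y → (x ℤ.* y) /1 ≡ x /1 ℚ.* y /1
  /1-* x y = sym (cong₂ ℚ._*_ (/1≡fromℤ x) (/1≡fromℤ y))

  /1-injective : ∀ {x y} → x /1 ≡ y /1 → x ≡ y
  /1-injective {x} {y} e = cong ↥_ (trans (sym (/1≡fromℤ x)) (trans e (/1≡fromℤ y)))

  ζ : Maps.Hom ℤRing ℚRing
  ζ = record { ⟦_⟧ = _/1 ; cong = cong _/1 ; +-homo = /1-+ ; *-homo = /1-* ; 0-homo = refl ; 1-homo = refl }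

  *↧≡↥ : ∀ r → r ℚ.* (↧ r) /1 ≡ (↥ r) /1
  *↧≡↥ r@(mkℚ n d _) = trans (cong (r ℚ.*_) (/1≡fromℤ (↧ r))) (trans (ℚₚ.toℚᵘ-injective
    (ℚᵘₚ.≃-trans (ℚₚ.toℚᵘ-homo-* r (fromℤ (↧ r))) (ℚᵘ.*≡* (begin
      n ℤ.* + suc d ℤ.* + 1       ≡⟨ ℤₚ.*-assoc n (+ suc d) (+ 1) ⟩
      n ℤ.* (+ suc d ℤ.* + 1)     ≡⟨ cong (n ℤ.*_) (ℤₚ.pos-* (suc d) 1) ⟨
      n ℤ.* + (suc d ℕ.* 1)       ∎))))
    (sym (/1≡fromℤ n)))
    where open ≡-Reasoning

  module DZ = Degrees ℤRing

  /1-pow : ∀ z n → DQ.pow (z /1) n ≡ (z ℤ.^ n) /1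
  /1-pow z zero    = refl
  /1-pow z (suc n) = trans (cong (z /1 ℚ.*_) (/1-pow z n)) (sym (/1-* z (z ℤ.^ n)))

  pow-* : ∀ p q n → DQ.pow (p ℚ.* q) n ≡ DQ.pow p n ℚ.* DQ.pow q n
  pow-* p q zero    = refl
  pow-* p q (suc n) = trans (cong (p ℚ.* q ℚ.*_) (pow-* p q n))
    (+-*-Solver.solve 4 (λ a b c d → (a :* b) :* (c :* d) := (a :* c) :* (b :* d)) refl p q (DQ.pow p n) (DQ.pow q n))
    where open import Data.Rational.Solver
          open +-*-Solver

  ∣^∣ : ∀ z n → ∣ z ℤ.^ n ∣ ≡ ∣ z ∣ ℕ.^ n
  ∣^∣ z zero    = refl
  ∣^∣ z (suc n) = trans (ℤₚ.abs-* z (z ℤ.^ n)) (cong (∣ z ∣ ℕ.*_) (∣^∣ z n))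

  -- Turns the rationality of a power of S into the kind of equation on which `power-extract` works.
  clear-denominator : ∀ r k N i → DQ.pow r k ≡ DQ.pow (N /1) i →
    ∣ ↥ r ∣ ℕ.^ k ≡ ∣ N ∣ ℕ.^ i ℕ.* ↧ₙ r ℕ.^ k
  clear-denominator r@record{} k N i e = begin
    ∣ ↥ r ∣ ℕ.^ k                       ≡⟨ ∣^∣ (↥ r) k ⟨
    ∣ ↥ r ℤ.^ k ∣                       ≡⟨ cong ∣_∣ (/1-injective {↥ r ℤ.^ k} {N ℤ.^ i ℤ.* ↧ r ℤ.^ k} e′) ⟩
    ∣ N ℤ.^ i ℤ.* ↧ r ℤ.^ k ∣           ≡⟨ ℤₚ.abs-* (N ℤ.^ i) _ ⟩
    ∣ N ℤ.^ i ∣ ℕ.* ∣ ↧ r ℤ.^ k ∣       ≡⟨ cong₂ ℕ._*_ (∣^∣ N i) (∣^∣ (↧ r) k) ⟩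
    ∣ N ∣ ℕ.^ i ℕ.* ↧ₙ r ℕ.^ k          ∎
    where
      open ≡-Reasoning
      e′ : (↥ r ℤ.^ k) /1 ≡ (N ℤ.^ i ℤ.* ↧ r ℤ.^ k) /1
      e′ = begin
        (↥ r ℤ.^ k) /1                                ≡⟨ /1-pow (↥ r) k ⟨
        DQ.pow ((↥ r) /1) k                           ≡⟨ cong (λ q → DQ.pow q k) (*↧≡↥ r) ⟨
        DQ.pow (r ℚ.* (↧ r) /1) k                     ≡⟨ pow-* r ((↧ r) /1) k ⟩
        DQ.pow r k ℚ.* DQ.pow ((↧ r) /1) k            ≡⟨ cong₂ ℚ._*_ (trans e (/1-pow N i)) (/1-pow (↧ r) k) ⟩
        (N ℤ.^ i) /1 ℚ.* (↧ r ℤ.^ k) /1               ≡⟨ /1-* (N ℤ.^ i) (↧ r ℤ.^ k) ⟨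
        (N ℤ.^ i ℤ.* ↧ r ℤ.^ k) /1                    ∎

-- Irreducibility of X^K + C.

module PureBinomials where
  open import Defs using (ConstantQ)
  open import Data.Nat as ℕ using (ℕ; zero; suc; z≤n; s≤s)
  import Data.Nat.Properties as ℕₚ
  open import Data.Nat.Divisibility as ∣ℕ using (_∣_; divides)
  open import Data.Nat.Primality using (Prime; euclidsLemma; prime⇒nonZero; prime⇒nonTrivial; prime[2]; prime⇒irreducible)
  open import Data.Integer using (+_; ∣_∣)
  open import Data.Rational as ℚ using (ℚ; 0ℚ; 1ℚ; ↥_; ↧ₙ_)
  import Data.Rational.Properties as ℚₚ
  open import Data.List using ([]; _∷_; length)
  open import Data.List.Properties using (length-map)
  open import Data.Product using (_,_; _×_; ∃-syntax)
  open import Data.Sum using (_⊎_; inj₁; inj₂)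
  open import Data.Empty using (⊥-elim)
  open import Relation.Nullary using (¬_; yes; no)
  open import Function using (it)
  open import Relation.Binary.Definitions using (tri<; tri≈; tri>)
  open import Relation.Binary.PropositionalEquality
  open PolynomialRings
  open WeightedReciprocals
  open BoundedSequences
  open NaturalPowers
  open IntegersInRationals

  module PQ = Polynomials ℚRing
  module PA = Polynomials seqRing
  open PQ using (Poly; co; _≋_; at; _⊛_; ≋-refl; ≋-sym; ≋-trans)
  open DQ using (Deg≤; mono)

  *≡0 : ∀ p q → p ≢ 0ℚ → p ℚ.* q ≡ 0ℚ → q ≡ 0ℚ
  *≡0 p q p≢0 e = begin
    q                        ≡⟨ ℚₚ.*-identityˡ q ⟨
    1ℚ ℚ.* q                 ≡⟨ cong (ℚ._* q) (ℚₚ.*-inverseˡ p) ⟨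
    ℚ.1/ p ℚ.* p ℚ.* q       ≡⟨ ℚₚ.*-assoc (ℚ.1/ p) p q ⟩
    ℚ.1/ p ℚ.* (p ℚ.* q)     ≡⟨ cong (ℚ.1/ p ℚ.*_) e ⟩
    ℚ.1/ p ℚ.* 0ℚ            ≡⟨ ℚₚ.*-zeroʳ (ℚ.1/ p) ⟩
    0ℚ                       ∎
    where
      open ≡-Reasoning
      instance _ = ℚ.≢-nonZero p≢0

  -- The reversal depends on the formal degree, so factors are first replaced by representatives
  -- whose length is exact.
  trim : ∀ p → p ≋ [] ⊎ ∃[ c ] ∃[ p′ ] ((c ∷ p′) ≋ p × co (c ∷ p′) (length p′) ≢ 0ℚ)
  trim []      = inj₁ ≋-refl
  trim (c ∷ p) with trim p
  ... | inj₂ (d , p′ , e , ne) = inj₂ (c , d ∷ p′ , PQ.∷-cong refl e , ne)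
  ... | inj₁ e with c ℚₚ.≟ 0ℚ
  ...   | yes c≡0 = inj₁ (≋-sym (PQ.[]≋0∷ c≡0 e))
  ...   | no c≢0  = inj₂ (c , [] , PQ.∷-cong refl (≋-sym e) , c≢0)

  Deg≤-⊛ : ∀ d e p q → Deg≤ d p → Deg≤ e q → Deg≤ (d ℕ.+ e) (p ⊛ q)
  Deg≤-⊛ d e p q dp dq i d+e<i = begin
    co (p ⊛ q) i              ≡⟨ cong (co (p ⊛ q)) (ℕₚ.m∸n+n≡m e≤i) ⟨
    co (p ⊛ q) (d′ ℕ.+ e)     ≡⟨ DQ.co-⊛-top d′ e p q (λ j lt → dp j (ℕₚ.<-trans d<d′ lt)) dq ⟩
    co p d′ ℚ.* co q e        ≡⟨ cong (ℚ._* co q e) (dp d′ d<d′) ⟩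
    0ℚ ℚ.* co q e             ≡⟨ ℚₚ.*-zeroˡ (co q e) ⟩
    0ℚ                        ∎
    where
      open ≡-Reasoning
      e≤i = ℕₚ.≤-trans (ℕₚ.m≤n+m e d) (ℕₚ.<⇒≤ d+e<i)
      d′ = i ℕ.∸ e
      d<d′ : d ℕ.< d′
      d<d′ = ℕₚ.m+n≤o⇒m≤o∸n (suc d) d+e<i

  Deg≤-cong : ∀ {d p q} → p ≋ q → Deg≤ d p → Deg≤ d q
  Deg≤-cong e dp i lt = trans (sym (at e i)) (dp i lt)

  -- S stands for the positive real number |C|^(2/K), K = k + 1.
  record SquareRoot (k : ℕ) (C : ℚ) : Set where
    field
      S      : BSeq
      S≥0    : ∀ i → 0ℚ ℚ.≤ BSeq.seq S i
      cancel : ∀ x → S *ₛ x ≈ₛ const 0ℚ → x ≈ₛ const 0ℚ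
      S^K    : DS.pow S (suc k) ≈ₛ const (C ℚ.* C)

  map-mono : ∀ n → Maps.Hom.mapP ι (mono n) ≡ DS.mono n
  map-mono zero    = refl
  map-mono (suc n) = cong (const 0ℚ ∷_) (map-mono n)

  module _ (k : ℕ) (C : ℚ) (C≢0 : C ≢ 0ℚ) (R : SquareRoot k C) where
    open SquareRoot R
    open Maps.Hom ι using (mapP; co-map; map-⊛; map-cong)

    private
      -- Self-reciprocity reads Sⁱhᵢ = q h_(e-i) with a rational constant q; dividing by hᵢ ≠ 0
      -- exhibits Sⁱ as a rational number.
      powers-rational : ∀ b g c h → length g ℕ.+ length h ≡ suc k → (b ∷ g) ⊛ (c ∷ h) ≋ (C ∷ mono k) →
        ∀ i → co (c ∷ h) i ≢ 0ℚ → ∃[ r ] DS.pow S i ≈ₛ const r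
      powers-rational b g c h len f-eq i hi≢0 with i ℕ.≤? length h
      ... | no i≰h = ⊥-elim (hi≢0 (DQ.co-beyond (c ∷ h) i (ℕₚ.≰⇒> i≰h)))
      ... | yes i≤h = r , (begin
          DS.pow S i                                          ≈⟨ Rₛ.*-identityʳ _ ⟨
          DS.pow S i *ₛ const 1ℚ                              ≈⟨ Rₛ.*-congˡ {DS.pow S i} (pointwise λ _ → sym (ℚₚ.*-inverseʳ hi)) ⟩
          DS.pow S i *ₛ (const hi *ₛ const (ℚ.1/ hi))         ≈⟨ Rₛ.*-assoc (DS.pow S i) (const hi) (const (ℚ.1/ hi)) ⟨
          (DS.pow S i *ₛ const hi) *ₛ const (ℚ.1/ hi)         ≈⟨ Rₛ.*-congʳ {const (ℚ.1/ hi)} reciprocal ⟩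
          const (co (b ∷ g) (length g) ℚ.* c ℚ.* hj) *ₛ const (ℚ.1/ hi)
                                                              ≈⟨ pointwise (λ _ → refl) ⟩
          const r                                             ∎)
        where
          open import Relation.Binary.Reasoning.Setoid Rₛ.setoid
          hi hj r : ℚ
          hi = co (c ∷ h) i
          j = length h ℕ.∸ i
          hj = co (c ∷ h) j
          instance _ = ℚ.≢-nonZero hi≢0
          r = co (b ∷ g) (length g) ℚ.* c ℚ.* hj ℚ.* ℚ.1/ hi
          b≢0 : b ≢ 0ℚ
          b≢0 b≡0 = C≢0 (trans (sym (at f-eq 0)) (trans (DQ.co-⊛-zero (b ∷ g) (c ∷ h)) (trans (cong (ℚ._* c) b≡0) (ℚₚ.*-zeroˡ c))))
          mapped : mapP (b ∷ g) PA.⊛ mapP (c ∷ h) PA.≋ (const C ∷ DS.mono k)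
          mapped = PA.≋-trans (PA.≋-sym (map-⊛ (b ∷ g) (c ∷ h))) (subst (λ t → mapP ((b ∷ g) ⊛ (c ∷ h)) PA.≋ (const C ∷ t)) (map-mono k) (map-cong f-eq))
          reciprocal : DS.pow S i *ₛ const hi ≈ₛ const (co (b ∷ g) (length g) ℚ.* c ℚ.* hj)
          reciprocal = begin
            DS.pow S i *ₛ const hi
              ≈⟨ Rₛ.*-congˡ {DS.pow S i} (co-map (c ∷ h) i) ⟨
            DS.pow S i *ₛ PA.co (mapP (c ∷ h)) i
              ≈⟨ WeightedReciprocal.self-reciprocal seqRing seqReal S S≥0 cancel (const C) k (Rₛ.trans S^K (pointwise λ _ → refl))
                   (const b) (mapP g) (const c) (mapP h)
                   (trans (cong₂ ℕ._+_ (length-map const g) (length-map const h)) len) mapped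
                   (const ((ℚ.1/ b) {{ℚ.≢-nonZero b≢0}})) (pointwise λ _ → ℚₚ.*-inverseˡ b {{ℚ.≢-nonZero b≢0}})
                   i j (trans (ℕₚ.m+[n∸m]≡n i≤h) (sym (length-map const h))) ⟩
            PA.co (mapP (b ∷ g)) (length (mapP g)) *ₛ const c *ₛ PA.co (mapP (c ∷ h)) j
              ≈⟨ Rₛ.*-cong {PA.co (mapP (b ∷ g)) (length (mapP g)) *ₛ const c}
                   (Rₛ.*-congʳ {const c} (Rₛ.trans (Rₛ.reflexive (cong (PA.co (mapP (b ∷ g))) (length-map const g))) (co-map (b ∷ g) (length g))))
                   (co-map (c ∷ h) j) ⟩
            const (co (b ∷ g) (length g)) *ₛ const c *ₛ const hj
              ≈⟨ pointwise (λ _ → refl) ⟩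
            const (co (b ∷ g) (length g) ℚ.* c ℚ.* hj) ∎

    -- After trimming, the product of the leading coefficients is nonzero and sits at d + e, which
    -- therefore is K. Everything about a factor that is used later is collected here.
    pure-factor : ∀ p q → p ⊛ q ≋ (C ∷ mono k) → ∃[ d ] ∃[ e ]
      (d ℕ.+ e ≡ suc k × Deg≤ d p × Deg≤ e q × co q e ≢ 0ℚ ×
       (∀ i → co q i ≢ 0ℚ → ∃[ r ] DS.pow S i ≈ₛ const r))
    pure-factor p q f-eq with trim p | trim q
    ... | inj₁ p≋[] | _ = ⊥-elim (C≢0 (trans (sym (at f-eq 0)) (at (PQ.⊛-cong {p} {[]} {q} {q} p≋[] ≋-refl) 0)))
    ... | inj₂ _ | inj₁ q≋[] = ⊥-elim (C≢0 (trans (sym (at f-eq 0)) (at (≋-trans (PQ.⊛-congʳ p q≋[]) (PQ.⊛-zeroʳ p)) 0)))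
    ... | inj₂ (b , g , ep , gd≢0) | inj₂ (c , h , eq , he≢0) =
      d , e , len , Deg≤-cong ep (DQ.co-beyond (b ∷ g)) , Deg≤-cong eq (DQ.co-beyond (c ∷ h)) ,
      (λ z → he≢0 (trans (at eq e) z)) ,
      (λ i ne → powers-rational b g c h len f-eq′ i (λ z → ne (trans (sym (at eq i)) z)))
      where
        d = length g
        e = length h
        f-eq′ : (b ∷ g) ⊛ (c ∷ h) ≋ (C ∷ mono k)
        f-eq′ = ≋-trans (PQ.⊛-cong ep eq) f-eq
        top : co (C ∷ mono k) (d ℕ.+ e) ≢ 0ℚ
        top z = he≢0 (*≡0 _ _ gd≢0 (trans (sym (DQ.co-⊛-top d e (b ∷ g) (c ∷ h) (DQ.co-beyond (b ∷ g)) (DQ.co-beyond (c ∷ h)))) (trans (at f-eq′ (d ℕ.+ e)) z)))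
        len : d ℕ.+ e ≡ suc k
        len with ℕₚ.<-cmp (d ℕ.+ e) (suc k)
        ... | tri≈ _ r _ = r
        ... | tri< lt _ _ = ⊥-elim (1≢0 (trans (sym (DQ.co-mono-≡ k)) (trans (sym (at f-eq′ (suc k)))
                (Deg≤-⊛ d e (b ∷ g) (c ∷ h) (DQ.co-beyond (b ∷ g)) (DQ.co-beyond (c ∷ h)) (suc k) lt))))
          where
            1≢0 : 1ℚ ≢ 0ℚ
            1≢0 ()
        ... | tri> _ _ gt = ⊥-elim (top (beyond (d ℕ.+ e) gt))
          where
            beyond : ∀ i → suc k ℕ.< i → co (C ∷ mono k) i ≡ 0ℚ
            beyond (suc i) (s≤s lt) = DQ.co-mono-≢ k i λ i≡k → ℕₚ.<-irrefl (sym i≡k) lt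

  pow-one : ∀ n → DQ.pow 1ℚ n ≡ 1ℚ
  pow-one zero    = refl
  pow-one (suc n) = trans (ℚₚ.*-identityˡ _) (pow-one n)

  pow-swap : ∀ x m n → DQ.pow (DQ.pow x m) n ≡ DQ.pow (DQ.pow x n) m
  pow-swap x zero    n = pow-one n
  pow-swap x (suc m) n = trans (pow-* x (DQ.pow x m) n) (cong (DQ.pow x n ℚ.*_) (pow-swap x m n))

  powₛ-swap : ∀ x m n → DS.pow (DS.pow x m) n ≈ₛ DS.pow (DS.pow x n) m
  powₛ-swap x m n = pointwise λ i → begin
    BSeq.seq (DS.pow (DS.pow x m) n) i        ≡⟨ seq-pow (DS.pow x m) n i ⟩
    DQ.pow (BSeq.seq (DS.pow x m) i) n        ≡⟨ cong (λ t → DQ.pow t n) (seq-pow x m i) ⟩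
    DQ.pow (DQ.pow (BSeq.seq x i) m) n        ≡⟨ pow-swap (BSeq.seq x i) m n ⟩
    DQ.pow (DQ.pow (BSeq.seq x i) n) m        ≡⟨ cong (λ t → DQ.pow t m) (seq-pow x n i) ⟨
    DQ.pow (BSeq.seq (DS.pow x n) i) m        ≡⟨ seq-pow (DS.pow x n) m i ⟨
    BSeq.seq (DS.pow (DS.pow x n) m) i        ∎
    where open ≡-Reasoning

  -- Both sides are S^(Ki), once as (Sⁱ)^K and once as (S^K)ⁱ.
  rational-power : ∀ S K M i r → DS.pow S K ≈ₛ const M → DS.pow S i ≈ₛ const r → DQ.pow r K ≡ DQ.pow M i
  rational-power S K M i r S^K S^i = const-injective _ _ (begin
    const (DQ.pow r K)       ≈⟨ pow-const r K ⟨
    DS.pow (const r) K       ≈⟨ pow-cong K S^i ⟨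
    DS.pow (DS.pow S i) K    ≈⟨ powₛ-swap S i K ⟩
    DS.pow (DS.pow S K) i    ≈⟨ pow-cong i S^K ⟩
    DS.pow (const M) i       ≈⟨ pow-const M i ⟩
    const (DQ.pow M i)       ∎)
    where open import Relation.Binary.Reasoning.Setoid Rₛ.setoid

  squareRoot : ∀ k (C : ℚ) → C ≢ 0ℚ → SquareRoot k C
  squareRoot k C C≢0 = record
    { S = root ; S≥0 = root≥0 ; cancel = root-cancel (λ z → C≢0 (*≡0 C C C≢0 z)) ; S^K = Rₛ.sym M≈root^ }
    where open Root k (C ℚ.* C) (0≤sq C)

  -- Irrationality of N^(2e/K) for 0 < e < K, with s/t as the excluded value. The 2 comes from S^K =
  -- C².
  RootFree : ℕ → ℕ → Set
  RootFree K N = ∀ e s t .{{_ : ℕ.NonZero t}} → 0 ℕ.< e → e ℕ.< K → s ℕ.^ K ≢ N ℕ.^ (2 ℕ.* e) ℕ.* t ℕ.^ K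

  /1≢0 : ∀ {N} → N ≢ + 0 → N /1 ≢ 0ℚ
  /1≢0 N≢0 z = N≢0 (/1-injective z)

  square-power : ∀ N i → DQ.pow (N /1 ℚ.* N /1) i ≡ DQ.pow (N /1) (2 ℕ.* i)
  square-power N zero    = refl
  square-power N (suc i) = begin
    N /1 ℚ.* N /1 ℚ.* DQ.pow (N /1 ℚ.* N /1) i        ≡⟨ cong (N /1 ℚ.* N /1 ℚ.*_) (square-power N i) ⟩
    N /1 ℚ.* N /1 ℚ.* DQ.pow (N /1) (2 ℕ.* i)         ≡⟨ ℚₚ.*-assoc (N /1) (N /1) _ ⟩
    DQ.pow (N /1) (2 ℕ.+ 2 ℕ.* i)                     ≡⟨ cong (DQ.pow (N /1)) (ℕₚ.*-suc 2 i) ⟨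
    DQ.pow (N /1) (2 ℕ.* suc i)                       ∎
    where open ≡-Reasoning

  -- A factor of degree e has a nonzero coefficient at X^e, so S^e is rational; for 0 < e < K this
  -- is what `RootFree` forbids.
  pure-irreducible : ∀ k N → N ≢ + 0 → RootFree (suc k) ∣ N ∣ → ∀ p q → p ⊛ q ≋ (N /1 ∷ mono k) → ConstantQ p ⊎ ConstantQ q
  pure-irreducible k N N≢0 free p q f-eq with pure-factor k (N /1) (/1≢0 N≢0) R p q f-eq
    where R = squareRoot k (N /1) (/1≢0 N≢0)
  ... | d , zero , len , dp , dq , _ , _ = inj₂ dq
  ... | zero , suc e , len , dp , dq , _ , _ = inj₁ dp
  ... | suc d , suc e , len , dp , dq , qe≢0 , rat with rat (suc e) qe≢0
  ...   | r , S^e = ⊥-elim (free (suc e) ∣ ↥ r ∣ (↧ₙ r) (s≤s z≤n) (subst (suc e ℕ.<_) len (s≤s (ℕₚ.m≤n+m (suc e) d)))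
            (clear-denominator r (suc k) N (2 ℕ.* suc e)
              (trans (rational-power S (suc k) _ (suc e) r S^K S^e) (square-power N (suc e)))))
    where open SquareRoot (squareRoot k (N /1) (/1≢0 N≢0))

  NotPower : ℕ → ℕ → Set
  NotPower a N = ∀ n → n ℕ.^ a ≢ N

  ∤2* : ∀ {b e} → Prime b → b ≢ 2 → ¬ b ∣ e → ¬ b ∣ 2 ℕ.* e
  ∤2* {b} {e} pb b≢2 b∤e h with euclidsLemma 2 e pb h
  ... | inj₂ b∣e = b∤e b∣e
  ... | inj₁ b∣2 with prime⇒irreducible prime[2] b∣2
  ...   | inj₁ refl = ℕₚ.<-irrefl refl (ℕ.nonTrivial⇒n>1 1 {{prime⇒nonTrivial pb}})
  ...   | inj₂ b≡2 = b≢2 b≡2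

  prime-rootFree : ∀ {b N} .{{_ : ℕ.NonZero N}} → Prime b → b ≢ 2 → NotPower b N → RootFree b N
  prime-rootFree {b} {N} pb b≢2 np e@(suc _) s t _ e<b eq with power-extract (2 ℕ.* e) N s t pb
    (∤2* pb b≢2 λ b∣e → ℕₚ.<-irrefl refl (ℕₚ.<-≤-trans e<b (∣ℕ.∣⇒≤ b∣e))) eq
  ... | n , h = np n h

  -- If a does not divide e, the equation read between a-th powers makes N an a-th power. If e =
  -- e′a, its a-th root is the analogous equation for b with e′ < b, and N becomes a b-th power.
  product-rootFree : ∀ {a b N} .{{_ : ℕ.NonZero N}} → Prime a → Prime b → a ≢ 2 → b ≢ 2 →
    NotPower a N → NotPower b N → RootFree (a ℕ.* b) N
  product-rootFree {a} {b} {N} pa pb a≢2 b≢2 npa npb e@(suc _) s t _ e<ab eq with a ∣ℕ.∣? e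
  ... | no a∤e = contra (power-extract (2 ℕ.* e) N (s ℕ.^ b) (t ℕ.^ b) {{it}} {{ℕₚ.m^n≢0 t b}} pa (∤2* pa a≢2 a∤e)
      (trans (pow-ba s) (trans eq (cong (N ℕ.^ (2 ℕ.* e) ℕ.*_) (sym (pow-ba t))))))
    where
      contra : ¬ (∃[ n ] n ℕ.^ a ≡ N)
      contra (n , h) = npa n h
      pow-ba : ∀ x → (x ℕ.^ b) ℕ.^ a ≡ x ℕ.^ (a ℕ.* b)
      pow-ba x = trans (ℕₚ.^-*-assoc x b a) (cong (x ℕ.^_) (ℕₚ.*-comm b a))
  ... | yes (divides e′ e≡e′a) = contra (power-extract (2 ℕ.* e′) N s t pb (∤2* pb b≢2 b∤e′)
      (^-injectiveˡ a {{prime⇒nonZero pa}} _ _ (begin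
        (s ℕ.^ b) ℕ.^ a                                        ≡⟨ pow-ba s ⟩
        s ℕ.^ (a ℕ.* b)                                        ≡⟨ eq ⟩
        N ℕ.^ (2 ℕ.* e) ℕ.* t ℕ.^ (a ℕ.* b)                    ≡⟨ cong₂ ℕ._*_ (trans (cong (N ℕ.^_) (trans (cong (2 ℕ.*_) e≡e′a) (sym (ℕₚ.*-assoc 2 e′ a)))) (sym (ℕₚ.^-*-assoc N (2 ℕ.* e′) a))) (sym (pow-ba t)) ⟩
        (N ℕ.^ (2 ℕ.* e′)) ℕ.^ a ℕ.* (t ℕ.^ b) ℕ.^ a           ≡⟨ ^-distribʳ-* (N ℕ.^ (2 ℕ.* e′)) (t ℕ.^ b) a ⟨
        (N ℕ.^ (2 ℕ.* e′) ℕ.* t ℕ.^ b) ℕ.^ a                   ∎)))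
    where
      open ≡-Reasoning
      contra : ¬ (∃[ n ] n ℕ.^ b ≡ N)
      contra (n , h) = npb n h
      pow-ba : ∀ x → (x ℕ.^ b) ℕ.^ a ≡ x ℕ.^ (a ℕ.* b)
      pow-ba x = trans (ℕₚ.^-*-assoc x b a) (cong (x ℕ.^_) (ℕₚ.*-comm b a))
      b∤e′ : ¬ b ∣ e′
      b∤e′ b∣e′ = ℕₚ.<-irrefl refl (ℕₚ.<-≤-trans e<ab (ℕₚ.≤-trans (ℕₚ.≤-reflexive (ℕₚ.*-comm a b))
        (∣ℕ.∣⇒≤ (subst (b ℕ.* a ∣_) (sym e≡e′a) (∣ℕ.*-monoˡ-∣ a b∣e′)))))

-- The cofactor of X - α in X^j - α^j.

module GeometricPolynomials where
  open import Level using (0ℓ)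
  open import Algebra.Bundles using (CommutativeRing)
  open import Data.Nat using (ℕ; zero; suc)
  open import Data.List using ([]; _∷_)
  open PolynomialRings
  open WeightedReciprocals

  module Geometric (R : CommutativeRing 0ℓ 0ℓ) where
    open CommutativeRing R
    open Polynomials R
    open Degrees R
    open import Algebra.Properties.Ring ring using (-‿distribˡ-*)

    -- The polynomial Σ α^(j-1-i) Xⁱ over i < j, which for α = 1 and prime j is the cyclotomic
    -- polynomial.
    phi : Carrier → ℕ → Poly
    phi α zero    = []
    phi α (suc i) = pow α i ∷ phi α i

    private
      mono-step : ∀ α j → (- α) · phi α j ⊕ phi α (suc j) ≋ mono j
      mono-step α zero    = ≋-refl
      mono-step α (suc j) = ∷-cong
        (trans (+-congʳ (sym (-‿distribˡ-* α (pow α j)))) (-‿inverseˡ (α * pow α j)))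
        (mono-step α j)

    phi-⊛ : ∀ α j → phi α (suc j) ⊛ (- α ∷ 1# ∷ []) ≋ (- pow α (suc j) ∷ mono j)
    phi-⊛ α j = ≋-trans (⊛-∷ (phi α (suc j)) (- α) (1# ∷ []))
      (≋-trans (⊕-cong (≋-refl {(- α) · phi α (suc j)}) (∷-cong (refl {0#}) (≋-trans (⊛-comm (phi α (suc j)) (1# ∷ [])) (⊛-identityˡ (phi α (suc j))))))
        (∷-cong (trans (+-identityʳ _) (sym (-‿distribˡ-* α (pow α j)))) (mono-step α j)))

    1+Y : Poly
    1+Y = 1# ∷ 1# ∷ []

    -- This is ((1 + Y)^j - 1)/Y, the form to which Eisenstein's criterion applies when j is prime.
    shifted : ℕ → Poly
    shifted j = comp 1+Y (phi 1# j)

    pow-1 : ∀ n → pow 1# n ≈ 1#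
    pow-1 zero    = refl
    pow-1 (suc n) = trans (*-identityˡ _) (pow-1 n)

    -- Homogeneity: with X = α(1 + Y) every summand carries the same power of α, so that only α = 1
    -- has to be treated.
    comp-phi : ∀ α j → comp (α · 1+Y) (phi α (suc j)) ≋ pow α j · shifted (suc j)
    comp-phi α zero = begin
      (1# ∷ []) ⊕ (α · 1+Y) ⊛ []           ≈⟨ ⊕-cong (≋-refl {1# ∷ []}) (≋-trans (⊛-zeroʳ (α · 1+Y)) (≋-sym (⊛-zeroʳ 1+Y))) ⟩
      shifted 1                             ≈⟨ 1·p≋p (shifted 1) ⟨
      1# · shifted 1                        ∎
      where open ≋-R
    comp-phi α (suc j) = begin
      (β ∷ []) ⊕ (α · 1+Y) ⊛ comp (α · 1+Y) (phi α (suc j))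
        ≈⟨ ⊕-cong (∷-cong (sym (trans (*-congˡ (pow-1 (suc j))) (*-identityʳ β))) ≋-refl) (⊛-congʳ (α · 1+Y) (comp-phi α j)) ⟩
      β · (pow 1# (suc j) ∷ []) ⊕ (α · 1+Y) ⊛ (pow α j · shifted (suc j))
        ≈⟨ ⊕-cong ≋-refl (≋-trans (⊛-· (pow α j) (α · 1+Y) (shifted (suc j)))
             (≋-trans (·-cong refl (·-⊛ α 1+Y (shifted (suc j))))
             (≋-trans (≋-sym (·-assoc (pow α j) α _)) (·-cong (*-comm (pow α j) α) ≋-refl)))) ⟩
      β · (pow 1# (suc j) ∷ []) ⊕ β · (1+Y ⊛ shifted (suc j))
        ≈⟨ ·-distribˡ β (pow 1# (suc j) ∷ []) (1+Y ⊛ shifted (suc j)) ⟨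
      β · shifted (suc (suc j)) ∎
      where
        open ≋-R
        β = pow α (suc j)

-- Binomial coefficients, Eisenstein's criterion and common denominators.

module CyclotomicShift where
  open import Data.Nat as ℕ using (ℕ; zero; suc; z≤n; s≤s)
  import Data.Nat.Properties as ℕₚ
  import Data.Nat.Divisibility as ∣ℕ
  open import Data.Nat.Induction using (<-wellFounded)
  open import Induction.WellFounded using (Acc; acc)
  open import Data.Nat.Primality using (Prime; euclidsLemma; prime⇒nonTrivial)
  open import Data.Nat.Combinatorics using (_C_; nC1≡n; nCk+nC[k+1]≡[n+1]C[k+1]; k>n⇒nCk≡0)
  open import Data.Integer as ℤ using (+_; -_; ∣_∣)
  import Data.Integer.Properties as ℤₚ
  open import Data.Integer.Divisibility.Signed using (_∣_; divides; ∣ᵤ⇒∣; ∣⇒∣ᵤ; ∣m∣n⇒∣m+n; ∣m+n∣m⇒∣n; ∣n⇒∣m*n; ∣m⇒∣m*n; _∣?_; ∣-refl)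
  open import Data.Integer.Tactic.RingSolver using (solve-∀)
  open import Data.Rational as ℚ using (0ℚ; ↥_; ↧_)
  open import Data.List using ([]; _∷_; map; length)
  open import Data.Product using (_,_; _×_; proj₁; proj₂; ∃-syntax)
  open import Data.Sum as Sum using (_⊎_; inj₁; inj₂)
  open import Data.Empty using (⊥-elim)
  open import Relation.Nullary using (¬_; yes; no)
  open import Relation.Binary.Definitions using (tri<; tri≈; tri>)
  open import Relation.Binary.PropositionalEquality
  open PolynomialRings
  open WeightedReciprocals
  open GeometricPolynomials
  open BoundedSequences using (ℚRing; module DQ)
  open IntegersInRationals
  open PureBinomials using (module PQ; trim; *≡0; Deg≤-cong)

  module PZ = Polynomials ℤRing

  -- The absorption identity, by Pascal's rule. It shows that a prime p divides the inner binomial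
  -- coefficients of row p.
  [1+k]nCk : ∀ n k → suc k ℕ.* (suc n C suc k) ≡ suc n ℕ.* (n C k)
  [1+k]nCk n zero = trans (ℕₚ.*-identityˡ _) (trans (nC1≡n (suc n)) (sym (ℕₚ.*-identityʳ (suc n))))
  [1+k]nCk zero (suc k) = trans (cong (suc (suc k) ℕ.*_) (k>n⇒nCk≡0 {1} {suc (suc k)} (s≤s (s≤s z≤n)))) (trans (ℕₚ.*-zeroʳ (suc (suc k))) (sym (trans (ℕₚ.*-identityˡ _) (k>n⇒nCk≡0 {0} {suc k} (s≤s z≤n)))))
  [1+k]nCk (suc n) (suc k) = begin
    suc (suc k) ℕ.* (suc (suc n) C suc (suc k))  ≡⟨ cong (suc (suc k) ℕ.*_) (sym (nCk+nC[k+1]≡[n+1]C[k+1] (suc n) (suc k))) ⟩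
    suc (suc k) ℕ.* (c ℕ.+ suc n C suc (suc k))  ≡⟨ ℕₚ.*-distribˡ-+ (suc (suc k)) c _ ⟩
    c ℕ.+ suc k ℕ.* c ℕ.+ suc (suc k) ℕ.* (suc n C suc (suc k)) ≡⟨ cong₂ ℕ._+_ (cong (c ℕ.+_) ([1+k]nCk n k)) ([1+k]nCk n (suc k)) ⟩
    c ℕ.+ suc n ℕ.* (n C k) ℕ.+ suc n ℕ.* (n C suc k) ≡⟨ ℕₚ.+-assoc c _ _ ⟩
    c ℕ.+ (suc n ℕ.* (n C k) ℕ.+ suc n ℕ.* (n C suc k)) ≡⟨ cong (c ℕ.+_) (sym (ℕₚ.*-distribˡ-+ (suc n) (n C k) (n C suc k))) ⟩
    c ℕ.+ suc n ℕ.* (n C k ℕ.+ n C suc k)        ≡⟨ cong (λ t → c ℕ.+ suc n ℕ.* t) (nCk+nC[k+1]≡[n+1]C[k+1] n k) ⟩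
    c ℕ.+ suc n ℕ.* c                            ∎
    where
      open ≡-Reasoning
      c = suc n C suc k

  prime∣C : ∀ {p} → Prime p → ∀ k → suc k ℕ.< p → p ∣ℕ.∣ (p C suc k)
  prime∣C {suc p} pp k k<p with euclidsLemma (suc k) (suc p C suc k) pp
      (subst (suc p ∣ℕ.∣_) (sym ([1+k]nCk p k)) (∣ℕ.m∣m*n (p C k)))
  ... | inj₂ h = h
  ... | inj₁ h = ⊥-elim (ℕₚ.<-irrefl refl (ℕₚ.<-≤-trans k<p (∣ℕ.∣⇒≤ h)))

  module GZ = Geometric ℤRing
  module GQ = Geometric ℚRing

  co-binomial : ∀ n i → PZ.co (PZ.comp GZ.1+Y (DZ.mono n)) i ≡ + (n C i)
  co-binomial zero zero    = refl
  co-binomial zero (suc zero) = refl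
  co-binomial zero (suc (suc i)) = cong +_ (sym (k>n⇒nCk≡0 {0} {suc (suc i)} (s≤s z≤n)))
  co-binomial (suc n) zero = trans (PZ.at (PZ.comp-0∷ GZ.1+Y (DZ.mono n)) 0)
    (trans (DZ.co-⊛-zero GZ.1+Y P) (trans (ℤₚ.*-identityˡ _) (co-binomial n 0)))
    where P = PZ.comp GZ.1+Y (DZ.mono n)
  co-binomial (suc n) (suc i) = begin
    PZ.co (PZ.comp GZ.1+Y (DZ.mono (suc n))) (suc i)   ≡⟨ PZ.at (PZ.comp-0∷ GZ.1+Y (DZ.mono n)) (suc i) ⟩
    PZ.co (GZ.1+Y PZ.⊛ P) (suc i)                      ≡⟨ DZ.co-⊛-suc (+ 1) (+ 1 ∷ []) P i ⟩
    + 1 ℤ.* PZ.co P (suc i) ℤ.+ PZ.co ((+ 1 ∷ []) PZ.⊛ P) i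
      ≡⟨ cong₂ ℤ._+_ (trans (ℤₚ.*-identityˡ _) (co-binomial n (suc i))) (trans (PZ.at (PZ.⊛-identityˡ P) i) (co-binomial n i)) ⟩
    + (n C suc i) ℤ.+ + (n C i)                        ≡⟨ cong +_ (trans (ℕₚ.+-comm (n C suc i) (n C i)) (nCk+nC[k+1]≡[n+1]C[k+1] n i)) ⟩
    + (suc n C suc i)                                  ∎
    where
      open ≡-Reasoning
      P = PZ.comp GZ.1+Y (DZ.mono n)

  -- Multiplication by Y = (1 + Y) - 1 gives (1 + Y)^(j+1) - 1, so the coefficients are binomial
  -- coefficients moved down by one place.
  co-shifted : ∀ j i → PZ.co (GZ.shifted (suc j)) i ≡ + (suc j C suc i)
  co-shifted j i = begin
    PZ.co E i                                       ≡⟨ PZ.at (PZ.X⊛ E) (suc i) ⟨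
    PZ.co (PZ.X PZ.⊛ E) (suc i)                     ≡⟨ PZ.at (PZ.⊛-comm PZ.X E) (suc i) ⟩
    PZ.co (E PZ.⊛ PZ.X) (suc i)                     ≡⟨ PZ.at (PZ.⊛-congʳ E {PZ.X} {M} (PZ.mk λ { zero → refl ; (suc zero) → refl ; (suc (suc zero)) → refl ; (suc (suc (suc i))) → refl })) (suc i) ⟩
    PZ.co (E PZ.⊛ M) (suc i)                        ≡⟨ PZ.at (PZ.comp-⊛ L (GZ.phi (+ 1) (suc j)) (- + 1 ∷ + 1 ∷ [])) (suc i) ⟨
    PZ.co (PZ.comp L (GZ.phi (+ 1) (suc j) PZ.⊛ (- + 1 ∷ + 1 ∷ []))) (suc i)
      ≡⟨ PZ.at (PZ.comp-cong L (GZ.phi-⊛ (+ 1) j)) (suc i) ⟩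
    PZ.co ((- DZ.pow (+ 1) (suc j) ∷ []) PZ.⊕ L PZ.⊛ PZ.comp L (DZ.mono j)) (suc i)
      ≡⟨ PZ.co-⊕ (- DZ.pow (+ 1) (suc j) ∷ []) (L PZ.⊛ PZ.comp L (DZ.mono j)) (suc i) ⟩
    + 0 ℤ.+ PZ.co (L PZ.⊛ PZ.comp L (DZ.mono j)) (suc i) ≡⟨ ℤₚ.+-identityˡ _ ⟩
    PZ.co (L PZ.⊛ PZ.comp L (DZ.mono j)) (suc i)    ≡⟨ PZ.at (PZ.comp-0∷ L (DZ.mono j)) (suc i) ⟨
    PZ.co (PZ.comp L (DZ.mono (suc j))) (suc i)     ≡⟨ co-binomial (suc j) (suc i) ⟩
    + (suc j C suc i)                               ∎
    where
      open ≡-Reasoning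
      L = GZ.1+Y
      E = GZ.shifted (suc j)
      M = PZ.comp L (- + 1 ∷ + 1 ∷ [])

  euclidℤ : ∀ {p} → Prime p → ∀ x y → + p ∣ x ℤ.* y → (+ p ∣ x) ⊎ (+ p ∣ y)
  euclidℤ {p} pp x y h = Sum.map ∣ᵤ⇒∣ ∣ᵤ⇒∣ (euclidsLemma ∣ x ∣ ∣ y ∣ pp (subst (p ∣ℕ.∣_) (ℤₚ.abs-* x y) (∣⇒∣ᵤ h)))

  p∤1 : ∀ {p} → Prime p → ¬ (+ p ∣ + 1)
  p∤1 pp h = ℕₚ.<-irrefl (sym (∣ℕ.∣1⇒≡1 (∣⇒∣ᵤ h))) (ℕ.nonTrivial⇒n>1 _ {{prime⇒nonTrivial pp}})

  module Eisenstein (a′ : ℕ) (pa : Prime (suc a′)) where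
    private
      a : ℕ
      a = suc a′

    open PZ

    AllDiv : Poly → Set
    AllDiv G = ∀ k → + a ∣ co G k

    -- `i` is the order of vanishing at 0 of the reduction of `G` modulo a.
    First : Poly → ℕ → Set
    First G i = (∀ k → k ℕ.< i → + a ∣ co G k) × ¬ (+ a ∣ co G i)

    first? : ∀ G → AllDiv G ⊎ ∃[ i ] First G i
    first? [] = inj₁ λ k → divides (+ 0) refl
    first? (c ∷ G) with + a ∣? c | first? G
    ... | no a∤c  | _ = inj₂ (0 , (λ _ ()) , a∤c)
    ... | yes a∣c | inj₁ all = inj₁ λ { zero → a∣c ; (suc k) → all k }
    ... | yes a∣c | inj₂ (i , lo , hi) = inj₂ (suc i , (λ { zero _ → a∣c ; (suc k) (s≤s lt) → lo k lt }) , hi)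

    low-divisible : ∀ G H n → (∀ k → k ℕ.≤ n → + a ∣ co H k) → + a ∣ co (G ⊛ H) n
    low-divisible []      H n       h = divides (+ 0) refl
    low-divisible (c ∷ G) H zero    h = subst (+ a ∣_) (sym (DZ.co-⊛-zero (c ∷ G) H)) (∣n⇒∣m*n c (h 0 z≤n))
    low-divisible (c ∷ G) H (suc n) h = subst (+ a ∣_) (sym (DZ.co-⊛-suc c G H n))
      (∣m∣n⇒∣m+n (∣n⇒∣m*n c (h (suc n) ℕₚ.≤-refl)) (low-divisible G H n (λ k le → h k (ℕₚ.m≤n⇒m≤1+n le))))

    -- Orders of vanishing modulo a prime add up: in the coefficient at i + j only the product of
    -- the two first units survives. It serves as Gauss's lemma and inside Eisenstein's argument.
    first-⊛ : ∀ G H i j → First G i → First H j → ¬ (+ a ∣ co (G ⊛ H) (i ℕ.+ j))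
    first-⊛ []      H i j (_ , hi) F h = hi (divides (+ 0) refl)
    first-⊛ (c ∷ G) H zero j (_ , a∤c) (loH , a∤h) h with euclidℤ pa c (co H j) (step j loH h)
      where
        step : ∀ j → (∀ k → k ℕ.< j → + a ∣ co H k) → + a ∣ co ((c ∷ G) ⊛ H) j → + a ∣ c ℤ.* co H j
        step zero    lo h = subst (+ a ∣_) (DZ.co-⊛-zero (c ∷ G) H) h
        step (suc j) lo h = ∣m+n∣m⇒∣n (subst (+ a ∣_) (trans (DZ.co-⊛-suc c G H j) (ℤₚ.+-comm (c ℤ.* co H (suc j)) (co (G ⊛ H) j))) h)
          (low-divisible G H j (λ k le → lo k (s≤s le)))
    ... | inj₁ a∣c = a∤c a∣c
    ... | inj₂ a∣h = a∤h a∣h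
    first-⊛ (c ∷ G) H (suc i) j (lo , hi) F h = first-⊛ G H i j ((λ k lt → lo (suc k) (s≤s lt)) , hi) F
      (∣m+n∣m⇒∣n (subst (+ a ∣_) (DZ.co-⊛-suc c G H (i ℕ.+ j)) h) (∣m⇒∣m*n (co H (suc (i ℕ.+ j))) (lo 0 (s≤s z≤n))))

    divide : ∀ G → AllDiv G → ∃[ G′ ] G ≋ (+ a) · G′
    divide []      all = [] , ≋-refl
    divide (c ∷ G) all with all 0 | divide G (λ k → all (suc k))
    ... | divides q e | G′ , e′ = q ∷ G′ , ∷-cong (trans e (ℤₚ.*-comm q (+ a))) e′

    ·-cancel : ∀ p q → (+ a) · p ≋ (+ a) · q → p ≋ q
    ·-cancel p q e = mk λ i → ℤₚ.*-cancelˡ-≡ (+ a) (co p i) (co q i) (trans (sym (co-· (+ a) p i)) (trans (at e i) (co-· (+ a) q i)))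

    module _ (E : Poly) (E-lo : ∀ k → k ℕ.< a′ → + a ∣ co E k) (E-top : co E a′ ≡ + 1) (E-0 : co E 0 ≡ + a)
             (E-deg : ∀ k → a′ ℕ.< k → co E k ≡ + 0) where

      private
        p∤q⇒≢0 : ∀ {x} → ¬ (+ a ∣ x) → x ≢ + 0
        p∤q⇒≢0 h refl = h (divides (+ 0) refl)

        E-off : ∀ D k → k ≢ a′ → + a ∣ co (D · E) k
        E-off D k k≢a′ = subst (+ a ∣_) (sym (co-· D E k)) (∣n⇒∣m*n D (lem (ℕₚ.<-cmp k a′)))
          where
            lem : _ → + a ∣ co E k
            lem (tri< lt _ _) = E-lo k lt
            lem (tri≈ _ e _)  = ⊥-elim (k≢a′ e)
            lem (tri> _ _ gt) = subst (+ a ∣_) (sym (E-deg k gt)) (divides (+ 0) refl)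

        DE-top : ∀ D → co (D · E) a′ ≡ D
        DE-top D = trans (co-· D E a′) (trans (cong (D ℤ.*_) E-top) (ℤₚ.*-identityʳ D))

        -- i + j = a − 1, and i, j cannot both be positive since a² does not divide the constant term D a.
        primitive-case : ∀ D G H → ¬ (+ a ∣ D) → G ⊛ H ≋ D · E → co G a′ ≢ + 0 ⊎ co H a′ ≢ + 0
        primitive-case D G H a∤D e with first? G | first? H
        ... | inj₁ all | _ = ⊥-elim (a∤D (subst (+ a ∣_) (DE-top D) (subst (+ a ∣_) (trans (at (⊛-comm H G) a′) (at e a′)) (low-divisible H G a′ (λ k _ → all k)))))
        ... | inj₂ _ | inj₁ all = ⊥-elim (a∤D (subst (+ a ∣_) (DE-top D) (subst (+ a ∣_) (at e a′) (low-divisible G H a′ (λ k _ → all k)))))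
        ... | inj₂ (i , Fi) | inj₂ (j , Fj) with i ℕ.+ j ℕ.≟ a′
        ...   | no ne = ⊥-elim (first-⊛ G H i j Fi Fj (subst (+ a ∣_) (sym (at e (i ℕ.+ j))) (E-off D (i ℕ.+ j) ne)))
        ...   | yes s with i | j
        ...     | zero  | _     = inj₂ (p∤q⇒≢0 (subst (λ t → ¬ (+ a ∣ co H t)) s (proj₂ Fj)))
        ...     | suc _ | zero  = inj₁ (p∤q⇒≢0 (subst (λ t → ¬ (+ a ∣ co G t)) (trans (sym (ℕₚ.+-identityʳ _)) s) (proj₂ Fi)))
        ...     | suc _ | suc _ with proj₁ Fi 0 (s≤s z≤n) | proj₁ Fj 0 (s≤s z≤n)
        ...       | divides g eg | divides h eh = ⊥-elim (a∤D (divides (g ℤ.* h) (ℤₚ.*-cancelʳ-≡ D _ (+ a) (begin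
                      D ℤ.* + a                       ≡⟨ cong (D ℤ.*_) E-0 ⟨
                      D ℤ.* co E 0                    ≡⟨ co-· D E 0 ⟨
                      co (D · E) 0                    ≡⟨ at e 0 ⟨
                      co (G ⊛ H) 0                    ≡⟨ DZ.co-⊛-zero G H ⟩
                      co G 0 ℤ.* co H 0               ≡⟨ cong₂ ℤ._*_ eg eh ⟩
                      g ℤ.* + a ℤ.* (h ℤ.* + a)       ≡⟨ lem g h (+ a) ⟩
                      g ℤ.* h ℤ.* + a ℤ.* + a         ∎))))
          where
            open ≡-Reasoning
            lem : ∀ g h a → g ℤ.* a ℤ.* (h ℤ.* a) ≡ g ℤ.* h ℤ.* a ℤ.* a
            lem = solve-∀

        scaled-≢0 : ∀ {G G′} → G ≋ (+ a) · G′ → co G′ a′ ≢ + 0 → co G a′ ≢ + 0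
        scaled-≢0 {G} {G′} e ne z with ℤₚ.i*j≡0⇒i≡0∨j≡0 (+ a) (trans (sym (co-· (+ a) G′ a′)) (trans (sym (at e a′)) z))
        ... | inj₂ z′ = ne z′

        -- Descent on |D|: as long as a divides D, it divides all coefficients of one factor (Gauss)
        -- and can be cancelled there, until `primitive-case` applies.
        go : ∀ D → Acc ℕ._<_ ∣ D ∣ → D ≢ + 0 → ∀ G H → G ⊛ H ≋ D · E → co G a′ ≢ + 0 ⊎ co H a′ ≢ + 0
        go D (acc rs) D≢0 G H e with + a ∣? D
        ... | no a∤D = primitive-case D G H a∤D e
        ... | yes (divides q D≡qa) = split (first? G) (first? H)
          where
            q≢0 : q ≢ + 0
            q≢0 refl = D≢0 D≡qa
            q<D : ∣ q ∣ ℕ.< ∣ D ∣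
            q<D = subst (∣ q ∣ ℕ.<_) (sym (trans (cong ∣_∣ D≡qa) (ℤₚ.abs-* q (+ a))))
              (ℕₚ.m<m*n ∣ q ∣ a {{ℕ.≢-nonZero (λ z → q≢0 (ℤₚ.∣i∣≡0⇒i≡0 z))}} (ℕ.nonTrivial⇒n>1 a {{prime⇒nonTrivial pa}}))
            DE : D · E ≋ (+ a) · (q · E)
            DE = ≋-trans (·-cong (trans D≡qa (ℤₚ.*-comm q (+ a))) ≋-refl) (·-assoc (+ a) q E)
            split : AllDiv G ⊎ ∃[ i ] First G i → AllDiv H ⊎ ∃[ i ] First H i → co G a′ ≢ + 0 ⊎ co H a′ ≢ + 0
            split (inj₁ all) _ with divide G all
            ... | G′ , eG = Sum.map₁ (scaled-≢0 {G} {G′} eG) (go q (rs q<D) q≢0 G′ H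
                  (·-cancel (G′ ⊛ H) (q · E) (≋-trans (≋-sym (·-⊛ (+ a) G′ H)) (≋-trans (⊛-cong (≋-sym eG) ≋-refl) (≋-trans e DE)))))
            split (inj₂ _) (inj₁ all) with divide H all
            ... | H′ , eH = Sum.map₂ (scaled-≢0 {H} {H′} eH) (go q (rs q<D) q≢0 G H′
                  (·-cancel (G ⊛ H′) (q · E) (≋-trans (≋-sym (⊛-· (+ a) G H′)) (≋-trans (⊛-congʳ G (≋-sym eH)) (≋-trans e DE)))))
            split (inj₂ (i , Fi)) (inj₂ (j , Fj)) = ⊥-elim (first-⊛ G H i j Fi Fj
              (subst (+ a ∣_) (sym (trans (at e (i ℕ.+ j)) (trans (at DE (i ℕ.+ j)) (co-· (+ a) (q · E) (i ℕ.+ j))))) (∣m⇒∣m*n (co (q · E) (i ℕ.+ j)) ∣-refl)))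

      -- `D` is the common denominator of a factorisation over ℚ. A nonzero coefficient at the full
      -- degree a - 1 in one factor forces the other to be constant.
      eisenstein : ∀ D → D ≢ + 0 → ∀ G H → G ⊛ H ≋ D · E → co G a′ ≢ + 0 ⊎ co H a′ ≢ + 0
      eisenstein D = go D (<-wellFounded ∣ D ∣)

  clear-denominators : ∀ p → ∃[ D ] (D ≢ + 0 × ∃[ G ] (D /1) PQ.· p PQ.≋ Maps.Hom.mapP ζ G)
  clear-denominators [] = + 1 , (λ ()) , [] , PQ.≋-refl
  clear-denominators (c ∷ p) with clear-denominators p
  ... | D , D≢0 , G , e = ↧ c ℤ.* D , ne , (↥ c ℤ.* D ∷ (↧ c) PZ.· G) , PQ.∷-cong head tail
    where
      open Maps.Hom ζ using (mapP; map-·)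
      ne : ↧ c ℤ.* D ≢ + 0
      ne z with ℤₚ.i*j≡0⇒i≡0∨j≡0 (↧ c) z
      ... | inj₂ z′ = D≢0 z′
      head : (↧ c ℤ.* D) /1 ℚ.* c ≡ (↥ c ℤ.* D) /1
      head = begin
        (↧ c ℤ.* D) /1 ℚ.* c           ≡⟨ cong (ℚ._* c) (/1-* (↧ c) D) ⟩
        (↧ c) /1 ℚ.* D /1 ℚ.* c        ≡⟨ +-*-Solver.solve 3 (λ x y z → x :* y :* z := z :* x :* y) refl ((↧ c) /1) (D /1) c ⟩
        c ℚ.* (↧ c) /1 ℚ.* D /1        ≡⟨ cong (ℚ._* D /1) (*↧≡↥ c) ⟩
        (↥ c) /1 ℚ.* D /1              ≡⟨ /1-* (↥ c) D ⟨
        (↥ c ℤ.* D) /1                 ∎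
        where
          open ≡-Reasoning
          open import Data.Rational.Solver using (module +-*-Solver)
          open +-*-Solver
      tail : ((↧ c ℤ.* D) /1) PQ.· p PQ.≋ mapP ((↧ c) PZ.· G)
      tail = PQ.≋-trans (PQ.·-cong (/1-* (↧ c) D) PQ.≋-refl) (PQ.≋-trans (PQ.·-assoc ((↧ c) /1) (D /1) p)
        (PQ.≋-trans (PQ.·-cong {(↧ c) /1} refl e) (PQ.≋-sym (map-· (↧ c) G))))

  -- Degrees add over a field, so a factor reaching degree n leaves nothing for the other one.
  Deg≤-complement : ∀ n p q → DQ.Deg≤ n (p PQ.⊛ q) → PQ.co q n ≢ 0ℚ → DQ.Deg≤ 0 p
  Deg≤-complement n p q dpq qn≢0 with trim p | trim q
  ... | inj₁ p≋[] | _ = λ i _ → PQ.at p≋[] i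
  ... | inj₂ _ | inj₁ q≋[] = ⊥-elim (qn≢0 (PQ.at q≋[] n))
  ... | inj₂ (b , [] , ep , gd≢0) | inj₂ (c , h , eq , he≢0) = Deg≤-cong ep (DQ.co-beyond (b ∷ []))
  ... | inj₂ (b , g@(_ ∷ g′) , ep , gd≢0) | inj₂ (c , h , eq , he≢0) = ⊥-elim (he≢0 (*≡0 _ _ gd≢0
        (trans (sym (DQ.co-⊛-top d e (b ∷ g) (c ∷ h) (DQ.co-beyond (b ∷ g)) (DQ.co-beyond (c ∷ h))))
          (trans (PQ.at (PQ.⊛-cong ep eq) (d ℕ.+ e)) (dpq (d ℕ.+ e) (s≤s (ℕₚ.≤-trans n≤e (ℕₚ.m≤n+m e (length g′)))))))))
    where
      d = length g
      e = length h
      n≤e : n ℕ.≤ e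
      n≤e with n ℕ.≤? e
      ... | yes le = le
      ... | no n≰e = ⊥-elim (qn≢0 (trans (sym (PQ.at eq n)) (DQ.co-beyond (c ∷ h) n (ℕₚ.≰⇒> n≰e))))

-- Irreducibility of the cofactor of X^b - α in X^(ab) - α^a.

module SparsePolynomials where
  open import Defs using (ConstantQ)
  open import Data.Nat as ℕ using (ℕ; zero; suc; z≤n; s≤s)
  import Data.Nat.Properties as ℕₚ
  import Data.Nat.Divisibility as ∣ℕ
  open import Data.Nat.Primality using (Prime)
  open import Data.Nat.Combinatorics using (nCn≡1; nC1≡n; k>n⇒nCk≡0)
  open import Data.Integer as ℤ using (ℤ; +_; ∣_∣)
  import Data.Integer.Properties as ℤₚ
  open import Data.Integer.Divisibility.Signed using (∣ᵤ⇒∣)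
  open import Data.Rational as ℚ using (ℚ; 0ℚ; 1ℚ; ↥_; ↧ₙ_)
  import Data.Rational.Properties as ℚₚ
  open import Data.List using ([]; _∷_; map; length)
  open import Data.Product using (_,_; proj₁; proj₂; ∃-syntax)
  open import Data.Sum as Sum using (_⊎_; inj₁; inj₂)
  open import Data.Empty using (⊥-elim)
  open import Relation.Nullary using (¬_; yes; no)
  open import Relation.Nullary.Decidable using (decidable-stable)
  open import Relation.Binary.PropositionalEquality
  open PolynomialRings
  open WeightedReciprocals
  open GeometricPolynomials
  open BoundedSequences
  open NaturalPowers
  open IntegersInRationals
  open PureBinomials
  open CyclotomicShift

  open PQ
  open DQ using (pow; Deg≤; mono)

  Deg≤0-comp : ∀ M p → Deg≤ 0 p → Deg≤ 0 (comp M p)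
  Deg≤0-comp M p dp = Deg≤-cong {0} {co p 0 ∷ []} {comp M p} (≋-sym (≋-trans (comp-cong M {p} {co p 0 ∷ []} e)
      (≋-trans (⊕-cong (≋-refl {co p 0 ∷ []}) (⊛-zeroʳ M)) (⊕-identityʳ _)))) (λ { (suc i) _ → refl })
    where
      e : p ≋ (co p 0 ∷ [])
      e = mk λ { zero → refl ; (suc i) → dp (suc i) (s≤s z≤n) }

  pow≢0 : ∀ {α} → α ≢ 0ℚ → ∀ n → pow α n ≢ 0ℚ
  pow≢0 α≢0 zero    ()
  pow≢0 {α} α≢0 (suc n) z = pow≢0 α≢0 n (*≡0 α _ α≢0 z)

  map-phi : ∀ j → Maps.Hom.mapP ζ (GZ.phi (+ 1) j) ≋ GQ.phi 1ℚ j
  map-phi zero    = ≋-refl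
  map-phi (suc j) = ∷-cong (trans (cong _/1 (GZ.pow-1 j)) (sym (GQ.pow-1 j))) (map-phi j)

  module Cyclotomic (a′ : ℕ) (pa : Prime (suc a′)) (α : ℚ) (α≢0 : α ≢ 0ℚ) where
    open Maps.Hom ζ using (mapP; co-map; map-⊛; map-comp; map-·)
    private
      a = suc a′
      E = GQ.shifted a
      EZ = GZ.shifted a
      L = α · GQ.1+Y
      instance _ = ℚ.≢-nonZero α≢0

      E≋ : mapP EZ ≋ E
      E≋ = ≋-trans (map-comp GZ.1+Y (GZ.phi (+ 1) a)) (comp-cong GQ.1+Y (map-phi a))

      E-deg : ∀ k → a′ ℕ.< k → PZ.co EZ k ≡ + 0
      E-deg k lt = trans (co-shifted a′ k) (cong +_ (k>n⇒nCk≡0 (s≤s lt)))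

      -- The substitution Y = X/α - 1, inverse to X = α(1 + Y).
      M : Poly
      M = ℚ.- 1ℚ ∷ ℚ.1/ α ∷ []

      inverse : comp M L ≋ X
      inverse = ≋-trans (comp-· M α GQ.1+Y) (≋-trans (·-cong {α} refl e) (∷-cong (ℚₚ.*-zeroʳ α) (∷-cong (ℚₚ.*-inverseʳ α) ≋-refl)))
        where
          e : comp M GQ.1+Y ≋ (0ℚ ∷ ℚ.1/ α ∷ [])
          e = ≋-trans (⊕-cong (≋-refl {1ℚ ∷ []}) (≋-trans (⊛-congʳ M {_} {1ℚ ∷ []} (≋-trans (⊕-cong (≋-refl {1ℚ ∷ []}) (⊛-zeroʳ M)) (⊕-identityʳ _)))
                (≋-trans (⊛-comm M (1ℚ ∷ [])) (⊛-identityˡ M)))) (∷-cong refl ≋-refl)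

      un-comp : ∀ p → Deg≤ 0 (comp L p) → Deg≤ 0 p
      un-comp p dp = Deg≤-cong (≋-trans (comp-comp M L p) (≋-trans (comp-congL p inverse) (comp-X p))) (Deg≤0-comp M (comp L p) dp)

      co-scaled≢0 : ∀ {D p G i} → (D /1) · p ≋ mapP G → PZ.co G i ≢ + 0 → co p i ≢ 0ℚ
      co-scaled≢0 {D} {p} {G} {i} e ne z = ne (/1-injective (trans (sym (co-map G i)) (trans (sym (at e i))
        (trans (co-· (D /1) p i) (trans (cong (D /1 ℚ.*_) z) (ℚₚ.*-zeroʳ (D /1)))))))

      core : ∀ p q → p ⊛ q ≋ E → Deg≤ 0 p ⊎ Deg≤ 0 q
      core p q pq≋E with clear-denominators p | clear-denominators q
      ... | D , D≢0 , G , eG | F , F≢0 , H , eH = Sum.swap (Sum.map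
            (λ ne → Deg≤-complement a′ q p (Deg≤-cong (≋-trans (≋-sym pq≋E) (⊛-comm p q)) dE) (co-scaled≢0 {D} {p} eG ne))
            (λ ne → Deg≤-complement a′ p q (Deg≤-cong (≋-sym pq≋E) dE) (co-scaled≢0 {F} {q} eH ne))
            (Eisenstein.eisenstein a′ pa EZ
              (λ k lt → subst (_ Data.Integer.Divisibility.Signed.∣_) (sym (co-shifted a′ k)) (∣ᵤ⇒∣ (prime∣C pa k (s≤s lt))))
              (trans (co-shifted a′ a′) (cong +_ (nCn≡1 a))) (trans (co-shifted a′ 0) (cong +_ (nC1≡n a))) E-deg
              (D ℤ.* F) DF≢0 G H (PZ.mk λ i → /1-injective (trans (sym (co-map (G PZ.⊛ H) i)) (trans (at GH i) (co-map ((D ℤ.* F) PZ.· EZ) i))))))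
        where
          import Data.Integer.Divisibility.Signed
          dE : Deg≤ a′ E
          dE k lt = trans (sym (at E≋ k)) (trans (co-map EZ k) (cong _/1 (E-deg k lt)))
          DF≢0 : D ℤ.* F ≢ + 0
          DF≢0 z with ℤₚ.i*j≡0⇒i≡0∨j≡0 D z
          ... | inj₁ z′ = D≢0 z′
          ... | inj₂ z′ = F≢0 z′
          GH : mapP (G PZ.⊛ H) ≋ mapP ((D ℤ.* F) PZ.· EZ)
          GH = begin
            mapP (G PZ.⊛ H)                     ≈⟨ map-⊛ G H ⟩
            mapP G ⊛ mapP H                     ≈⟨ ⊛-cong eG eH ⟨
            ((D /1) · p) ⊛ ((F /1) · q)         ≈⟨ ·-⊛ (D /1) p ((F /1) · q) ⟩
            (D /1) · (p ⊛ ((F /1) · q))         ≈⟨ ·-cong {D /1} refl (⊛-· (F /1) p q) ⟩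
            (D /1) · ((F /1) · (p ⊛ q))         ≈⟨ ·-assoc (D /1) (F /1) (p ⊛ q) ⟨
            (D /1 ℚ.* F /1) · (p ⊛ q)           ≈⟨ ·-cong (sym (/1-* D F)) (≋-trans pq≋E (≋-sym E≋)) ⟩
            ((D ℤ.* F) /1) · mapP EZ            ≈⟨ map-· (D ℤ.* F) EZ ⟨
            mapP ((D ℤ.* F) PZ.· EZ)            ∎
            where open ≋-R

    phi-irreducible : ∀ p q → p ⊛ q ≋ GQ.phi α a → Deg≤ 0 p ⊎ Deg≤ 0 q
    phi-irreducible p q e = Sum.map (λ d → un-comp p (unscale d)) (un-comp q) (core (β · comp L p) (comp L q) e′)
      where
        A = pow α a′
        instance _ = ℚ.≢-nonZero (pow≢0 α≢0 a′)
        -- Put into the first factor, `β` absorbs the power α^(a-1) that `comp-phi` takes out.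
        β = ℚ.1/ A
        unscale : Deg≤ 0 (β · comp L p) → Deg≤ 0 (comp L p)
        unscale d i lt = *≡0 β _ (λ z → pow≢0 α≢0 a′ (trans (sym (ℚₚ.*-identityʳ A))
          (⊥-elim (1≢0 (trans (sym (ℚₚ.*-inverseʳ A)) (trans (cong (A ℚ.*_) z) (ℚₚ.*-zeroʳ A))))))) (trans (sym (co-· β (comp L p) i)) (d i lt))
          where
            1≢0 : 1ℚ ≢ 0ℚ
            1≢0 ()
        e′ : (β · comp L p) ⊛ comp L q ≋ E
        e′ = begin
          (β · comp L p) ⊛ comp L q    ≈⟨ ·-⊛ β (comp L p) (comp L q) ⟩
          β · (comp L p ⊛ comp L q)    ≈⟨ ·-cong {β} refl (≋-trans (≋-sym (comp-⊛ L p q)) (≋-trans (comp-cong L e) (GQ.comp-phi α a′))) ⟩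
          β · (A · E)                  ≈⟨ ·-assoc β A E ⟨
          (β ℚ.* A) · E                ≈⟨ ·-cong (ℚₚ.*-inverseˡ A) ≋-refl ⟩
          1ℚ · E                       ≈⟨ 1·p≋p E ⟩
          E                            ∎
          where open ≋-R

  co-mono-⊛ : ∀ b p i → co (mono b ⊛ p) (b ℕ.+ i) ≡ co p i
  co-mono-⊛ zero    p i = at (⊛-identityˡ p) i
  co-mono-⊛ (suc b) p i = trans (at (0∷-⊛ (mono b) p) (suc b ℕ.+ i)) (co-mono-⊛ b p i)

  co-mono-⊛-low : ∀ b p i → i ℕ.< b → co (mono b ⊛ p) i ≡ 0ℚ
  co-mono-⊛-low (suc b) p zero    _        = at (0∷-⊛ (mono b) p) 0
  co-mono-⊛-low (suc b) p (suc i) (s≤s lt) = trans (at (0∷-⊛ (mono b) p) (suc i)) (co-mono-⊛-low b p i lt)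

  module Inflate (b′ : ℕ) where
    private
      b = suc b′

    inflate : Poly → Poly
    inflate = comp (mono b)

    co-inflate : ∀ G i → co (inflate G) (b ℕ.* i) ≡ co G i
    co-inflate []      i = refl
    co-inflate (c ∷ G) zero rewrite ℕₚ.*-zeroʳ b′ = trans (co-⊕ (c ∷ []) (mono b ⊛ inflate G) 0)
      (trans (cong (c ℚ.+_) (co-mono-⊛-low b (inflate G) 0 (s≤s z≤n))) (ℚₚ.+-identityʳ c))
    co-inflate (c ∷ G) (suc i) = begin
      co (inflate (c ∷ G)) (b ℕ.* suc i)              ≡⟨ cong (co (inflate (c ∷ G))) (ℕₚ.*-suc b i) ⟩
      co (inflate (c ∷ G)) (b ℕ.+ b ℕ.* i)            ≡⟨ co-⊕ (c ∷ []) (mono b ⊛ inflate G) (b ℕ.+ b ℕ.* i) ⟩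
      0ℚ ℚ.+ co (mono b ⊛ inflate G) (b ℕ.+ b ℕ.* i)  ≡⟨ ℚₚ.+-identityˡ _ ⟩
      co (mono b ⊛ inflate G) (b ℕ.+ b ℕ.* i)         ≡⟨ co-mono-⊛ b (inflate G) (b ℕ.* i) ⟩
      co (inflate G) (b ℕ.* i)                        ≡⟨ co-inflate G i ⟩
      co G i                                          ∎
      where open ≡-Reasoning

    co-inflate-∤ : ∀ G j → ¬ b ∣ℕ.∣ j → co (inflate G) j ≡ 0ℚ
    co-inflate-∤ []      j b∤j = refl
    co-inflate-∤ (c ∷ G) zero b∤j = ⊥-elim (b∤j (b ∣ℕ.∣0))
    co-inflate-∤ (c ∷ G) j@(suc j′) b∤j = trans (co-⊕ (c ∷ []) (mono b ⊛ inflate G) j) (trans (ℚₚ.+-identityˡ _) rest)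
      where
        rest : co (mono b ⊛ inflate G) j ≡ 0ℚ
        rest with j ℕ.<? b
        ... | yes j<b = co-mono-⊛-low b (inflate G) j j<b
        ... | no j≮b  = trans (cong (co (mono b ⊛ inflate G)) (sym b+[j-b]≡j)) (trans (co-mono-⊛ b (inflate G) (j ℕ.∸ b))
              (co-inflate-∤ G (j ℕ.∸ b) λ h → b∤j (subst (b ∣ℕ.∣_) b+[j-b]≡j (∣ℕ.∣m∣n⇒∣m+n ∣ℕ.∣-refl h))))
          where
            b+[j-b]≡j : b ℕ.+ (j ℕ.∸ b) ≡ j
            b+[j-b]≡j = ℕₚ.m+[n∸m]≡n (ℕₚ.≮⇒≥ j≮b)

    table : (ℕ → ℚ) → ℕ → Poly
    table φ zero    = []
    table φ (suc n) = φ 0 ∷ table (λ i → φ (suc i)) n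

    co-table : ∀ φ n i → (n ℕ.≤ i → φ i ≡ 0ℚ) → co (table φ n) i ≡ φ i
    co-table φ zero    i       h = sym (h z≤n)
    co-table φ (suc n) zero    h = refl
    co-table φ (suc n) (suc i) h = co-table (λ i → φ (suc i)) n i (λ le → h (s≤s le))

    -- Every b-th coefficient. Since i ≤ b i, the places beyond `length p` are zero and the table
    -- may stop there.
    deflate : Poly → Poly
    deflate p = table (λ i → co p (b ℕ.* i)) (length p)

    co-deflate : ∀ p i → co (deflate p) i ≡ co p (b ℕ.* i)
    co-deflate p i = co-table _ (length p) i λ le → DQ.co-beyond p (b ℕ.* i) (ℕₚ.≤-trans le (ℕₚ.m≤n*m i b))

    inflate-deflate : ∀ p → (∀ i → ¬ b ∣ℕ.∣ i → co p i ≡ 0ℚ) → inflate (deflate p) ≋ p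
    inflate-deflate p sparse = mk λ i → lem i (b ∣ℕ.∣? i)
      where
        open import Relation.Nullary using (Dec)
        lem : ∀ i → Dec (b ∣ℕ.∣ i) → co (inflate (deflate p)) i ≡ co p i
        lem i (no b∤i) = trans (co-inflate-∤ (deflate p) i b∤i) (sym (sparse i b∤i))
        lem i (yes (∣ℕ.divides j e)) = subst (λ t → co (inflate (deflate p)) t ≡ co p t) (trans (ℕₚ.*-comm b j) (sym e))
          (trans (co-inflate (deflate p) j) (co-deflate p j))

    inflate-injective : ∀ p q → inflate p ≋ inflate q → p ≋ q
    inflate-injective p q e = mk λ i → trans (sym (co-inflate p i)) (trans (at e (b ℕ.* i)) (co-inflate q i))

    inflate-constant : ∀ p → Deg≤ 0 p → Deg≤ 0 (inflate p)
    inflate-constant p = Deg≤0-comp (mono b) p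

    inflate-mono : ∀ j → inflate (mono j) ≋ mono (j ℕ.* b)
    inflate-mono zero    = ≋-trans (⊕-cong (≋-refl {1ℚ ∷ []}) (⊛-zeroʳ (mono b))) (⊕-identityʳ _)
    inflate-mono (suc j) = ≋-trans (comp-0∷ (mono b) (mono j)) (≋-trans (⊛-congʳ (mono b) (inflate-mono j)) (mono-⊛ b (j ℕ.* b)))
      where
        mono-⊛ : ∀ m n → mono m ⊛ mono n ≋ mono (m ℕ.+ n)
        mono-⊛ zero    n = ⊛-identityˡ (mono n)
        mono-⊛ (suc m) n = ≋-trans (0∷-⊛ (mono m) (mono n)) (∷-cong refl (mono-⊛ m n))

  pow-+ : ∀ x m n → pow x (m ℕ.+ n) ≡ pow x m ℚ.* pow x n
  pow-+ x zero    n = sym (ℚₚ.*-identityˡ _)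
  pow-+ x (suc m) n = trans (cong (x ℚ.*_) (pow-+ x m n)) (sym (ℚₚ.*-assoc x (pow x m) (pow x n)))

  pow-pow : ∀ x m n → pow x (m ℕ.* n) ≡ pow (pow x n) m
  pow-pow x zero    n = refl
  pow-pow x (suc m) n = trans (pow-+ x n (m ℕ.* n)) (cong (pow x n ℚ.*_) (pow-pow x m n))

  module _ (a′ b′ : ℕ) (pa : Prime (suc a′)) (pb : Prime (suc b′)) (b≢2 : suc b′ ≢ 2)
           (N : ℤ) (N≢0 : N ≢ + 0) (np : NotPower (suc b′) ∣ N ∣)
           (R₀ : SquareRoot b′ (N /1)) where
    private
      a b k : ℕ
      a = suc a′
      b = suc b′
      -- In this form `suc k` computes to `a ℕ.* b`.
      k = b′ ℕ.+ a′ ℕ.* b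
      α : ℚ
      α = N /1
      α≢0 : α ≢ 0ℚ
      α≢0 = /1≢0 N≢0
      C : ℚ
      C = ℚ.- pow α a
    open Inflate b′
    private
      open SquareRoot R₀
      open import Data.Rational.Solver using (module +-*-Solver)

      C≢0 : C ≢ 0ℚ
      C≢0 z = pow≢0 α≢0 a (trans (+-*-Solver.solve 1 (λ x → x +-*-Solver.:= +-*-Solver.:- (+-*-Solver.:- x)) refl (pow α a)) (cong ℚ.-_ z))

      -- The real number belonging to X^b + α serves for X^(ab) - α^a as well: S^b = α² gives S^(ab)
      -- = C². Hence the rationality of its powers can be judged with the exponent b alone.
      R : SquareRoot k C
      R = record { S = S ; S≥0 = S≥0 ; cancel = cancel ; S^K = begin
          DS.pow S (suc k)          ≈⟨ pointwise (λ i → trans (seq-pow S (suc k) i) (trans (pow-pow (BSeq.seq S i) a b)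
                                         (trans (cong (λ t → pow t a) (sym (seq-pow S b i))) (sym (seq-pow (DS.pow S b) a i))))) ⟩
          DS.pow (DS.pow S b) a     ≈⟨ pow-cong a S^K ⟩
          DS.pow (const (α ℚ.* α)) a ≈⟨ pow-const (α ℚ.* α) a ⟩
          const (pow (α ℚ.* α) a)   ≈⟨ pointwise (λ i → trans (pow-* α α a) (+-*-Solver.solve 1 (λ x → x +-*-Solver.:* x +-*-Solver.:= (+-*-Solver.:- x) +-*-Solver.:* (+-*-Solver.:- x)) refl (pow α a))) ⟩
          const (C ℚ.* C)           ∎ }
        where open import Relation.Binary.Reasoning.Setoid Rₛ.setoid

      L₁ P : Poly
      L₁ = inflate (ℚ.- α ∷ 1ℚ ∷ [])
      P = inflate (GQ.phi α a)

      P⊛L₁ : P ⊛ L₁ ≋ (C ∷ mono k)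
      P⊛L₁ = ≋-trans (≋-sym (comp-⊛ (mono b) (GQ.phi α a) (ℚ.- α ∷ 1ℚ ∷ []))) (≋-trans (comp-cong (mono b) (GQ.phi-⊛ α a′))
        (≋-trans (⊕-cong (≋-refl {C ∷ []}) (≋-trans (≋-sym (comp-0∷ (mono b) (mono a′))) (inflate-mono a)))
          (∷-cong (ℚₚ.+-identityʳ C) (≋-refl {mono k}))))

      -- A divisor of `P` is also a divisor of the binomial `P ⊛ L₁`, to which the reversal argument
      -- applies.
      power-rational : ∀ p q → p ⊛ q ≋ P → ∀ i → co q i ≢ 0ℚ → ∃[ r ] DS.pow S i ≈ₛ const r
      power-rational p q e = proj₂ (proj₂ (proj₂ (proj₂ (proj₂ (proj₂ (pure-factor k C C≢0 R (L₁ ⊛ p) q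
        (≋-trans (⊛-assoc L₁ p q) (≋-trans (⊛-congʳ L₁ e) (≋-trans (⊛-comm L₁ P) P⊛L₁)))))))))

      -- From S^b = α² a rational Sⁱ would make |N|^(2i) the b-th power of a rational number, and as
      -- b does not divide 2i, |N| itself would be a b-th power.
      irrational : ∀ i → ¬ b ∣ℕ.∣ i → ¬ (∃[ r ] DS.pow S i ≈ₛ const r)
      irrational i b∤i (r , S^i) = np (proj₁ root) (proj₂ root)
        where
          root : ∃[ n ] n ℕ.^ b ≡ ∣ N ∣
          root = power-extract (2 ℕ.* i) ∣ N ∣ ∣ ↥ r ∣ (↧ₙ r) {{ℕ.≢-nonZero (λ z → N≢0 (ℤₚ.∣i∣≡0⇒i≡0 z))}} pb (∤2* pb b≢2 b∤i)
            (clear-denominator r b N (2 ℕ.* i) (trans (rational-power S b (α ℚ.* α) i r S^K S^i) (square-power N i)))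

      sparse : ∀ p q → p ⊛ q ≋ P → ∀ i → ¬ b ∣ℕ.∣ i → co q i ≡ 0ℚ
      sparse p q e i b∤i = decidable-stable (co q i ℚₚ.≟ 0ℚ) λ ne → irrational i b∤i (power-rational p q e i ne)

    sparse-irreducible : ∀ p q → p ⊛ q ≋ P → ConstantQ p ⊎ ConstantQ q
    sparse-irreducible p q e = Sum.map (constant p p-sparse) (constant q q-sparse)
        (Cyclotomic.phi-irreducible a′ pa α α≢0 (deflate p) (deflate q)
          (inflate-injective (deflate p ⊛ deflate q) (GQ.phi α a)
            (≋-trans (comp-⊛ (mono b) (deflate p) (deflate q))
              (≋-trans (⊛-cong (inflate-deflate p p-sparse) (inflate-deflate q q-sparse)) e))))
      where
        q-sparse = sparse p q e
        p-sparse = sparse q p (≋-trans (⊛-comm q p) e)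
        constant : ∀ p → (∀ i → ¬ b ∣ℕ.∣ i → co p i ≡ 0ℚ) → Deg≤ 0 (deflate p) → ConstantQ p
        constant p s d = Deg≤-cong {0} (inflate-deflate p s) (inflate-constant (deflate p) d)

-- Simultaneous prime values along an arithmetic progression.

module PrimeValues where
  open import Defs using (ConstantQ; IrreducibleQ; HypothesisH; evalZ; prodEval; mulCoeffQ; coeffQofZ; sumℚ)
  open import Data.Nat as ℕ using (ℕ; zero; suc; z≤n; s≤s; _%_)
  import Data.Nat.Properties as ℕₚ
  import Data.Nat.Divisibility as ∣ℕ
  import Data.Nat.DivMod as ℕ%
  open import Data.Nat.Coprimality using (coprime-Bézout)
  open import Data.Nat.GCD using (module Bézout)
  open import Data.Nat.Primality using (Prime; prime[2])
  open import Data.Nat.Primality.Factorisation using (factorise)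
  open import Data.Nat.ListAction using (product)
  open import Data.Integer as ℤ using (ℤ; +_; -[1+_]; -_; ∣_∣)
  import Data.Integer.Properties as ℤₚ
  open import Data.Integer.Divisibility.Signed using (_∣_; divides; ∣ᵤ⇒∣; ∣⇒∣ᵤ; ∣m∣n⇒∣m+n; ∣n⇒∣m*n; ∣m⇒∣m*n; _∣?_; ∣-trans; ∣m⇒∣-m)
  open import Data.Integer.Tactic.RingSolver using (solve-∀)
  open import Data.Rational as ℚ using (ℚ; 0ℚ; 1ℚ)
  open import Data.Rational.Solver using (module +-*-Solver)
  import Data.Rational.Properties as ℚₚ
  open import Data.List using (List; []; _∷_; map)
  open import Data.List.Relation.Unary.All using (All; []; _∷_)
  open import Data.Product using (_,_; _×_; proj₁; proj₂; ∃-syntax)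
  open import Data.Sum as Sum using (_⊎_; inj₁; inj₂)
  open import Data.Empty using (⊥; ⊥-elim)
  open import Relation.Nullary using (¬_; yes; no)
  open import Relation.Binary.PropositionalEquality
  open PolynomialRings
  open WeightedReciprocals
  open BoundedSequences using (module DQ)
  open NaturalPowers using (prime-coprime)
  open IntegersInRationals
  open PureBinomials using (module PQ; *≡0; Deg≤-cong; /1≢0)
  open CyclotomicShift using (module PZ; euclidℤ; p∤1)
  open SparsePolynomials using (Deg≤0-comp)

  open Maps.Hom ζ using (mapP; co-map; map-cong; map-comp; map-·)
  module ℚSolver = +-*-Solver
  open ℚSolver using (_:+_; _:*_; _:-_; :-_; _:=_; con)

  sumℚ-front : ∀ n f → sumℚ (suc n) f ≡ f 0 ℚ.+ sumℚ n (λ i → f (suc i))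
  sumℚ-front zero    f = trans (ℚₚ.+-identityˡ (f 0)) (sym (ℚₚ.+-identityʳ (f 0)))
  sumℚ-front (suc n) f = trans (cong (ℚ._+ f (suc n)) (sumℚ-front n f)) (ℚₚ.+-assoc (f 0) _ (f (suc n)))

  sumℚ-zero : ∀ n f → (∀ i → f i ≡ 0ℚ) → sumℚ n f ≡ 0ℚ
  sumℚ-zero zero    f h = refl
  sumℚ-zero (suc n) f h = cong₂ ℚ._+_ (sumℚ-zero n f h) (h n)

  mulCoeff≡co : ∀ g h n → mulCoeffQ g h n ≡ PQ.co (g PQ.⊛ h) n
  mulCoeff≡co []      h n = sumℚ-zero (suc n) _ λ i → ℚₚ.*-zeroˡ (PQ.co h (n ℕ.∸ i))
  mulCoeff≡co (c ∷ g) h zero = trans (sumℚ-front 0 (λ i → PQ.co (c ∷ g) i ℚ.* PQ.co h (0 ℕ.∸ i)))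
    (trans (ℚₚ.+-identityʳ _) (sym (DQ.co-⊛-zero (c ∷ g) h)))
  mulCoeff≡co (c ∷ g) h (suc n) = trans (sumℚ-front (suc n) (λ i → PQ.co (c ∷ g) i ℚ.* PQ.co h (suc n ℕ.∸ i)))
    (trans (cong (c ℚ.* PQ.co h (suc n) ℚ.+_) (mulCoeff≡co g h n)) (sym (DQ.co-⊛-suc c g h n)))

  open PZ using (Poly; co; comp; _≋_; mk; at; _⊕_; _⊛_; _·_; ≋-refl; ≋-sym; ≋-trans)

  -- Evaluation is composition with a constant polynomial, so its laws are inherited from those of
  -- `comp`.
  comp-const : ∀ t p → comp (t ∷ []) p ≋ (evalZ p t ∷ [])
  comp-const t []      = PZ.[]≋0∷ refl ≋-refl
  comp-const t (c ∷ p) = ≋-trans (PZ.⊕-cong (≋-refl {c ∷ []}) (≋-trans (PZ.[c]⊛ t (comp (t ∷ []) p)) (PZ.·-cong {t} refl (comp-const t p)))) ≋-refl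

  evalZ-co : ∀ t p → evalZ p t ≡ co (comp (t ∷ []) p) 0
  evalZ-co t p = sym (at (comp-const t p) 0)

  evalZ-cong : ∀ {p q} t → p ≋ q → evalZ p t ≡ evalZ q t
  evalZ-cong {p} {q} t e = trans (evalZ-co t p) (trans (at (PZ.comp-cong (t ∷ []) e) 0) (sym (evalZ-co t q)))

  evalZ-⊕ : ∀ t p q → evalZ (p ⊕ q) t ≡ evalZ p t ℤ.+ evalZ q t
  evalZ-⊕ t p q = trans (evalZ-co t (p ⊕ q)) (trans (at (PZ.comp-⊕ (t ∷ []) p q) 0)
    (at (PZ.⊕-cong (comp-const t p) (comp-const t q)) 0))

  evalZ-· : ∀ t c p → evalZ (c · p) t ≡ c ℤ.* evalZ p t
  evalZ-· t c p = trans (evalZ-co t (c · p)) (trans (at (PZ.comp-· (t ∷ []) c p) 0) (at (PZ.·-cong {c} refl (comp-const t p)) 0))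

  evalZ-comp : ∀ t L p → evalZ (comp L p) t ≡ evalZ p (evalZ L t)
  evalZ-comp t L p = trans (evalZ-co t (comp L p)) (trans (at (PZ.comp-comp (t ∷ []) L p) 0)
    (trans (at (PZ.comp-congL p (comp-const t L)) 0) (sym (evalZ-co (evalZ L t) p))))

  evalZ-≡-mod : ∀ n p x y → n ∣ x ℤ.- y → n ∣ evalZ p x ℤ.- evalZ p y
  evalZ-≡-mod n []      x y h = divides (+ 0) refl
  evalZ-≡-mod n (c ∷ p) x y h = subst (n ∣_) (lem c x y (evalZ p x) (evalZ p y))
      (∣m∣n⇒∣m+n (∣m⇒∣m*n (evalZ p x) h) (∣n⇒∣m*n y (evalZ-≡-mod n p x y h)))
    where
      lem : ∀ c x y a b → (x ℤ.- y) ℤ.* a ℤ.+ y ℤ.* (a ℤ.- b) ≡ c ℤ.+ x ℤ.* a ℤ.- (c ℤ.+ y ℤ.* b)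
      lem = solve-∀

  ∣-cong-mod : ∀ {n} x y → n ∣ x ℤ.- y → n ∣ x → n ∣ y
  ∣-cong-mod {n} x y h h′ = subst (n ∣_) (lem x y) (∣m∣n⇒∣m+n h′ (∣m⇒∣-m h))
    where
      lem : ∀ x y → x ℤ.+ - (x ℤ.- y) ≡ y
      lem = solve-∀

  -- The increment quotient (p(c + dX) − p(c)) / (dX).
  quotient : ℤ → ℤ → Poly → Poly
  quotient c d []      = []
  quotient c d (k ∷ p) = (evalZ p c ∷ []) ⊕ (c · quotient c d p ⊕ d · (+ 0 ∷ quotient c d p))

  comp-linear : ∀ c d p → comp (c ∷ d ∷ []) p ≋ (evalZ p c ∷ d · quotient c d p)
  comp-linear c d []      = ≋-trans (PZ.[]≋0∷ refl ≋-refl) ≋-refl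
  comp-linear c d (k ∷ p) = begin
    (k ∷ []) ⊕ (c ∷ d ∷ []) ⊛ comp (c ∷ d ∷ []) p
      ≈⟨ PZ.⊕-cong (≋-refl {k ∷ []}) (PZ.⊛-congʳ (c ∷ d ∷ []) (comp-linear c d p)) ⟩
    (k ∷ []) ⊕ (c · r ⊕ (+ 0 ∷ (d ∷ []) ⊛ r))
      ≈⟨ PZ.⊕-cong (≋-refl {k ∷ []}) (PZ.⊕-cong (≋-refl {c · r}) (PZ.∷-cong refl (PZ.[c]⊛ d r))) ⟩
    (k ∷ []) ⊕ (c · r ⊕ (+ 0 ∷ d · r))
      ≈⟨ PZ.∷-cong (cong (λ z → k ℤ.+ z) (ℤₚ.+-identityʳ _)) tail ⟩
    (evalZ (k ∷ p) c ∷ d · quotient c d (k ∷ p)) ∎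
    where
      open PZ.≋-R
      v = evalZ p c
      q = quotient c d p
      r = v ∷ d · q
      tail : c · (d · q) ⊕ d · r ≋ d · ((v ∷ []) ⊕ (c · q ⊕ d · (+ 0 ∷ q)))
      tail = mk λ i → trans (PZ.co-⊕ (c · (d · q)) (d · r) i) (trans (cong₂ ℤ._+_ (trans (PZ.co-· c (d · q) i) (cong (c ℤ.*_) (PZ.co-· d q i))) (PZ.co-· d r i))
        (sym (trans (PZ.co-· d ((v ∷ []) ⊕ (c · q ⊕ d · (+ 0 ∷ q))) i) (trans (cong (d ℤ.*_) (trans (PZ.co-⊕ (v ∷ []) (c · q ⊕ d · (+ 0 ∷ q)) i)
          (cong (λ z → co (v ∷ []) i ℤ.+ z) (trans (PZ.co-⊕ (c · q) (d · (+ 0 ∷ q)) i) (cong₂ ℤ._+_ (PZ.co-· c q i) (PZ.co-· d (+ 0 ∷ q) i)))))) (final i)))))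
        where
          final : ∀ i → d ℤ.* (co (v ∷ []) i ℤ.+ (c ℤ.* co q i ℤ.+ d ℤ.* co (+ 0 ∷ q) i)) ≡ c ℤ.* (d ℤ.* co q i) ℤ.+ d ℤ.* co r i
          final zero = lem c d v (co q 0)
            where
              lem : ∀ c d v x → d ℤ.* (v ℤ.+ (c ℤ.* x ℤ.+ d ℤ.* + 0)) ≡ c ℤ.* (d ℤ.* x) ℤ.+ d ℤ.* v
              lem = solve-∀
          final (suc i) = trans (lem c d (co q (suc i)) (co q i)) (cong (λ z → c ℤ.* (d ℤ.* co q (suc i)) ℤ.+ d ℤ.* z) (sym (PZ.co-· d q i)))
            where
              lem : ∀ c d x y → d ℤ.* (+ 0 ℤ.+ (c ℤ.* x ℤ.+ d ℤ.* y)) ≡ c ℤ.* (d ℤ.* x) ℤ.+ d ℤ.* (d ℤ.* y)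
              lem = solve-∀

  -- With 2 as a prime divisor of 0, the fixed divisor 0 is excluded together with all others.
  prime-divisor : ∀ n → n ≢ 1 → ∃[ ℓ ] Prime ℓ × ℓ ∣ℕ.∣ n
  prime-divisor zero      ne = 2 , prime[2] , (2 ∣ℕ.∣0)
  prime-divisor n@(suc _) ne with factorise n
  ... | record { factors = [] ; isFactorisation = e } = ⊥-elim (ne e)
  ... | record { factors = ℓ ∷ ℓs ; isFactorisation = e ; factorsPrime = pℓ ∷ _ } = ℓ , pℓ , subst (ℓ ∣ℕ.∣_) (sym e) (∣ℕ.m∣m*n (product ℓs))

  inverse-mod : ∀ {ℓ} d → Prime ℓ → ¬ (+ ℓ ∣ + d) → ∃[ u ] + ℓ ∣ + d ℤ.* u ℤ.- + 1
  inverse-mod {ℓ} d pℓ ℓ∤d with coprime-Bézout (prime-coprime pℓ (λ h → ℓ∤d (∣ᵤ⇒∣ h)))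
  ... | Bézout.+- x y eq = - + y , divides (- + x) (begin
      + d ℤ.* - + y ℤ.- + 1             ≡⟨ lem (+ d) (+ y) ⟩
      - (+ 1 ℤ.+ + y ℤ.* + d)           ≡⟨ cong (λ z → - (+ 1 ℤ.+ z)) (ℤₚ.pos-* y d) ⟨
      - (+ (1 ℕ.+ y ℕ.* d))             ≡⟨ cong (λ z → - (+ z)) eq ⟩
      - (+ (x ℕ.* ℓ))                   ≡⟨ cong -_ (ℤₚ.pos-* x ℓ) ⟩
      - (+ x ℤ.* + ℓ)                   ≡⟨ ℤₚ.neg-distribˡ-* (+ x) (+ ℓ) ⟩
      - + x ℤ.* + ℓ                     ∎)
    where
      open ≡-Reasoning
      lem : ∀ d y → d ℤ.* - y ℤ.- + 1 ≡ - (+ 1 ℤ.+ y ℤ.* d)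
      lem = solve-∀
  ... | Bézout.-+ x y eq = + y , divides (+ x) (begin
      + d ℤ.* + y ℤ.- + 1               ≡⟨ cong (ℤ._- + 1) (trans (ℤₚ.*-comm (+ d) (+ y)) (sym (ℤₚ.pos-* y d))) ⟩
      + (y ℕ.* d) ℤ.- + 1               ≡⟨ cong (λ z → + z ℤ.- + 1) eq ⟨
      + 1 ℤ.+ + (x ℕ.* ℓ) ℤ.- + 1       ≡⟨ lem (+ (x ℕ.* ℓ)) ⟩
      + (x ℕ.* ℓ)                       ≡⟨ ℤₚ.pos-* x ℓ ⟩
      + x ℤ.* + ℓ                       ∎)
    where
      open ≡-Reasoning
      lem : ∀ z → + 1 ℤ.+ z ℤ.- + 1 ≡ z
      lem = solve-∀

  Grows : Poly → Set
  Grows f = ∀ (B : ℤ) → ∃[ N ] (∀ (x : ℤ) → N ℤ.≤ x → B ℤ.≤ evalZ f x)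

  nonzero-coefficient? : ∀ p → p ≋ [] ⊎ ∃[ i ] co p i ≢ + 0
  nonzero-coefficient? [] = inj₁ ≋-refl
  nonzero-coefficient? (c ∷ p) with c ℤ.≟ + 0 | nonzero-coefficient? p
  ... | no c≢0  | _ = inj₂ (0 , c≢0)
  ... | yes _   | inj₂ (i , ne) = inj₂ (suc i , ne)
  ... | yes c≡0 | inj₁ e = inj₁ (≋-sym (PZ.[]≋0∷ c≡0 e))

  ≡1-mod-4 : ∀ p → + 4 ∣ + p ℤ.- + 1 → p % 4 ≡ 1
  ≡1-mod-4 zero    h with ∣⇒∣ᵤ h
  ... | ∣ℕ.divides zero ()
  ... | ∣ℕ.divides (suc _) ()
  ≡1-mod-4 (suc p) h with ∣⇒∣ᵤ h
  ... | ∣ℕ.divides q e = trans (cong (_% 4) (cong suc e)) (ℕ%.[m+kn]%n≡m%n 1 q 4)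

  i≤∣i∣ : ∀ i → i ℤ.≤ + ∣ i ∣
  i≤∣i∣ (+ n)    = ℤₚ.≤-refl
  i≤∣i∣ -[1+ n ] = ℤ.-≤+

  0≤i+∣i∣ : ∀ i → + 0 ℤ.≤ i ℤ.+ + ∣ i ∣
  0≤i+∣i∣ (+ n)    = ℤ.+≤+ z≤n
  0≤i+∣i∣ -[1+ n ] = ℤₚ.≤-reflexive (sym (ℤₚ.n⊖n≡0 (suc n)))

  module Progression (c : ℤ) (d′ : ℕ) where
    d : ℤ
    d = + suc d′

    -- On the progression y = c + d t the polynomial f has the fixed divisor G, and f(c + d t) / G = w + D t (…).
    record Piece : Set where
      field
        f     : Poly
        G′    : ℕ
        w D   : ℤ
        f-c   : + suc G′ ℤ.* w ≡ evalZ f c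
        GD    : + suc G′ ℤ.* D ≡ d
        4∣D   : + 4 ∣ D
        4∣w-1 : + 4 ∣ w ℤ.- + 1
        unit  : ∀ {ℓ} → Prime ℓ → + ℓ ∣ d → ¬ (+ ℓ ∣ w)
        irr   : ∀ p q → p PQ.⊛ q PQ.≋ mapP f → ConstantQ p ⊎ ConstantQ q
        grows : Grows f

      G : ℤ
      G = + suc G′

      f̃ : Poly
      f̃ = w ∷ D · quotient c d f

      G·f̃ : G · f̃ ≋ comp (c ∷ d ∷ []) f
      G·f̃ = ≋-trans (PZ.∷-cong f-c (≋-trans (≋-sym (PZ.·-assoc G D (quotient c d f))) (PZ.·-cong GD ≋-refl))) (≋-sym (comp-linear c d f))

      eval-f̃ : ∀ t → G ℤ.* evalZ f̃ t ≡ evalZ f (c ℤ.+ d ℤ.* t)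
      eval-f̃ t = begin
        G ℤ.* evalZ f̃ t                        ≡⟨ evalZ-· t G f̃ ⟨
        evalZ (G · f̃) t                        ≡⟨ evalZ-cong t G·f̃ ⟩
        evalZ (comp (c ∷ d ∷ []) f) t          ≡⟨ evalZ-comp t (c ∷ d ∷ []) f ⟩
        evalZ f (c ℤ.+ t ℤ.* (d ℤ.+ t ℤ.* + 0)) ≡⟨ cong (evalZ f) (lem c d t) ⟩
        evalZ f (c ℤ.+ d ℤ.* t)                ∎
        where
          open ≡-Reasoning
          lem : ∀ c d t → c ℤ.+ t ℤ.* (d ℤ.+ t ℤ.* + 0) ≡ c ℤ.+ d ℤ.* t
          lem = solve-∀

      f̃-mod-4 : ∀ t → + 4 ∣ evalZ f̃ t ℤ.- + 1
      f̃-mod-4 t = subst (+ 4 ∣_) (trans (lem w D t (evalZ (quotient c d f) t)) (cong (λ z → w ℤ.+ t ℤ.* z ℤ.- + 1) (sym (evalZ-· t D (quotient c d f)))))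
          (∣m∣n⇒∣m+n 4∣w-1 (∣m⇒∣m*n (t ℤ.* evalZ (quotient c d f) t) 4∣D))
        where
          lem : ∀ w D t q → w ℤ.- + 1 ℤ.+ D ℤ.* (t ℤ.* q) ≡ w ℤ.+ t ℤ.* (D ℤ.* q) ℤ.- + 1
          lem = solve-∀

      grows-f̃ : Grows f̃
      grows-f̃ B with grows (G ℤ.* B)
      ... | N , h = + (∣ c ∣ ℕ.+ ∣ N ∣) , λ x le → ℤₚ.*-cancelˡ-≤-pos B (evalZ f̃ x) G (subst (G ℤ.* B ℤ.≤_) (sym (eval-f̃ x)) (h (c ℤ.+ d ℤ.* x) (large x le)))
        where
          large : ∀ x → + (∣ c ∣ ℕ.+ ∣ N ∣) ℤ.≤ x → N ℤ.≤ c ℤ.+ d ℤ.* x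
          large (+ x) (ℤ.+≤+ le) = begin
            N                                   ≤⟨ i≤∣i∣ N ⟩
            + ∣ N ∣                             ≡⟨ ℤₚ.+-identityˡ _ ⟨
            + 0 ℤ.+ + ∣ N ∣                     ≤⟨ ℤₚ.+-monoˡ-≤ (+ ∣ N ∣) (0≤i+∣i∣ c) ⟩
            c ℤ.+ + ∣ c ∣ ℤ.+ + ∣ N ∣           ≡⟨ ℤₚ.+-assoc c (+ ∣ c ∣) (+ ∣ N ∣) ⟩
            c ℤ.+ + (∣ c ∣ ℕ.+ ∣ N ∣)           ≤⟨ ℤₚ.+-monoʳ-≤ c (ℤ.+≤+ (ℕₚ.≤-trans le (ℕₚ.m≤n*m x (suc d′)))) ⟩
            c ℤ.+ + (suc d′ ℕ.* x)              ≡⟨ cong (λ z → c ℤ.+ z) (ℤₚ.pos-* (suc d′) x) ⟩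
            c ℤ.+ d ℤ.* + x                     ∎
            where open ℤₚ.≤-Reasoning

      -- A constant `f̃` would take the value `w` everywhere, while growth forces a value of at
      -- least w + 1.
      nonconstant : ∃[ i ] (1 ℕ.≤ i × co f̃ i ≢ + 0)
      nonconstant with nonzero-coefficient? (D · quotient c d f)
      ... | inj₂ (i , ne) = suc i , s≤s z≤n , ne
      ... | inj₁ e with grows-f̃ (ℤ.suc w)
      ...   | N , h = ⊥-elim (ℤₚ.<-irrefl (sym value) (ℤₚ.suc[i]≤j⇒i<j (h N ℤₚ.≤-refl)))
        where
          value : evalZ f̃ N ≡ w
          value = trans (cong (λ z → w ℤ.+ N ℤ.* z) (evalZ-cong N e)) (trans (cong (λ z → w ℤ.+ z) (ℤₚ.*-zeroʳ N)) (ℤₚ.+-identityʳ w))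

      private
        δ γ : ℚ
        δ = d /1
        γ = c /1
        δ≢0 : δ ≢ 0ℚ
        δ≢0 = /1≢0 {d} λ ()
        G/1≢0 : G /1 ≢ 0ℚ
        G/1≢0 = /1≢0 {G} λ ()
        instance _ = ℚ.≢-nonZero δ≢0
        L M : PQ.Poly
        L = γ ∷ δ ∷ []
        M = ℚ.- γ ℚ.* ℚ.1/ δ ∷ ℚ.1/ δ ∷ []

        comp-linear-[] : ∀ K x y → PQ.comp K (x ∷ y ∷ []) PQ.≋ (x ∷ []) PQ.⊕ y PQ.· K
        comp-linear-[] K x y = PQ.⊕-cong (PQ.≋-refl {x ∷ []}) (PQ.≋-trans (PQ.⊛-congʳ K {_} {y ∷ []} (PQ.≋-trans (PQ.⊕-cong (PQ.≋-refl {y ∷ []}) (PQ.⊛-zeroʳ K)) (PQ.⊕-identityʳ _)))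
          (PQ.≋-trans (PQ.⊛-comm K (y ∷ [])) (PQ.[c]⊛ y K)))

        ML : PQ.comp M L PQ.≋ PQ.X
        ML = PQ.≋-trans (comp-linear-[] M γ δ) (PQ.∷-cong head (PQ.∷-cong (ℚₚ.*-inverseʳ δ) PQ.≋-refl))
          where
            open ≡-Reasoning
            head : γ ℚ.+ δ ℚ.* (ℚ.- γ ℚ.* ℚ.1/ δ) ≡ 0ℚ
            head = begin
              γ ℚ.+ δ ℚ.* (ℚ.- γ ℚ.* ℚ.1/ δ)     ≡⟨ ℚSolver.solve 3 (λ g d e → g :+ d :* (:- g :* e) := g :- g :* (d :* e)) refl γ δ (ℚ.1/ δ) ⟩
              γ ℚ.- γ ℚ.* (δ ℚ.* ℚ.1/ δ)         ≡⟨ cong (λ z → γ ℚ.- γ ℚ.* z) (ℚₚ.*-inverseʳ δ) ⟩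
              γ ℚ.- γ ℚ.* 1ℚ                     ≡⟨ ℚSolver.solve 1 (λ g → g :- g :* con 1ℚ := con 0ℚ) refl γ ⟩
              0ℚ                                 ∎

        LM : PQ.comp L M PQ.≋ PQ.X
        LM = PQ.≋-trans (comp-linear-[] L (ℚ.- γ ℚ.* ℚ.1/ δ) (ℚ.1/ δ)) (PQ.∷-cong head (PQ.∷-cong (ℚₚ.*-inverseˡ δ) PQ.≋-refl))
          where
            head : ℚ.- γ ℚ.* ℚ.1/ δ ℚ.+ ℚ.1/ δ ℚ.* γ ≡ 0ℚ
            head = ℚSolver.solve 2 (λ g e → :- g :* e :+ e :* g := con 0ℚ) refl γ (ℚ.1/ δ)

        un-comp : ∀ p → ConstantQ (PQ.comp M p) → ConstantQ p
        un-comp p dp = Deg≤-cong {0} (PQ.≋-trans (PQ.comp-comp L M p) (PQ.≋-trans (PQ.comp-congL p LM) (PQ.comp-X p))) (Deg≤0-comp L (PQ.comp M p) dp)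

      -- Undoing y = c + d t over ℚ turns a factorisation of `f̃` into one of `f`, the constant `G`
      -- going into the first factor. Invertible linear substitutions preserve constancy both ways.
      irreducible-f̃ : IrreducibleQ f̃
      irreducible-f̃ = nonconstant , λ g h e →
        Sum.map (λ k → un-comp g (unscale g k)) (un-comp h) (irr (G /1 PQ.· PQ.comp M g) (PQ.comp M h) (product-eq g h e))
        where
          unscale : ∀ g → ConstantQ (G /1 PQ.· PQ.comp M g) → ConstantQ (PQ.comp M g)
          unscale g k i lt = *≡0 (G /1) _ G/1≢0 (trans (sym (PQ.co-· (G /1) (PQ.comp M g) i)) (k i lt))
          product-eq : ∀ g h → (∀ n → mulCoeffQ g h n ≡ coeffQofZ f̃ n) → (G /1 PQ.· PQ.comp M g) PQ.⊛ PQ.comp M h PQ.≋ mapP f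
          product-eq g h e = begin
            (G /1 PQ.· PQ.comp M g) PQ.⊛ PQ.comp M h     ≈⟨ PQ.·-⊛ (G /1) (PQ.comp M g) (PQ.comp M h) ⟩
            G /1 PQ.· (PQ.comp M g PQ.⊛ PQ.comp M h)     ≈⟨ PQ.·-cong {G /1} refl (PQ.≋-trans (PQ.≋-sym (PQ.comp-⊛ M g h)) (PQ.comp-cong M gh)) ⟩
            G /1 PQ.· PQ.comp M (mapP f̃)                 ≈⟨ PQ.comp-· M (G /1) (mapP f̃) ⟨
            PQ.comp M (G /1 PQ.· mapP f̃)                 ≈⟨ PQ.comp-cong M (PQ.≋-trans (PQ.≋-sym (map-· G f̃)) (PQ.≋-trans (map-cong G·f̃) (map-comp (c ∷ d ∷ []) f))) ⟩
            PQ.comp M (PQ.comp L (mapP f))               ≈⟨ PQ.comp-comp M L (mapP f) ⟩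
            PQ.comp (PQ.comp M L) (mapP f)               ≈⟨ PQ.≋-trans (PQ.comp-congL (mapP f) ML) (PQ.comp-X (mapP f)) ⟩
            mapP f                                       ∎
            where
              open PQ.≋-R
              gh : g PQ.⊛ h PQ.≋ mapP f̃
              gh = PQ.mk λ n → trans (sym (mulCoeff≡co g h n)) (trans (e n) (sym (co-map f̃ n)))

    open Piece using (f; f̃; G; w)

    tildes : List Piece → List Poly
    tildes = map f̃

    values : List Piece → ℤ → ℤ
    values ps y = prodEval (map f ps) y

    fixed : List Piece → ℤ
    fixed []       = + 1
    fixed (p ∷ ps) = G p ℤ.* fixed ps

    fixed-tildes : ∀ ps t → fixed ps ℤ.* prodEval (tildes ps) t ≡ values ps (c ℤ.+ d ℤ.* t)
    fixed-tildes []       t = refl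
    fixed-tildes (p ∷ ps) t = trans (lem (G p) (fixed ps) (evalZ (f̃ p) t) (prodEval (tildes ps) t)) (cong₂ ℤ._*_ (Piece.eval-f̃ p t) (fixed-tildes ps t))
      where
        lem : ∀ a b c d → a ℤ.* b ℤ.* (c ℤ.* d) ≡ a ℤ.* c ℤ.* (b ℤ.* d)
        lem = solve-∀

    values-mod : ∀ n ps x y → n ∣ x ℤ.- y → n ∣ values ps x ℤ.- values ps y
    values-mod n []       x y h = divides (+ 0) refl
    values-mod n (p ∷ ps) x y h = subst (n ∣_) (lem (evalZ (f p) x) (evalZ (f p) y) (values ps x) (values ps y))
        (∣m∣n⇒∣m+n (∣m⇒∣m*n (values ps x) (evalZ-≡-mod n (f p) x y h)) (∣n⇒∣m*n (evalZ (f p) y) (values-mod n ps x y h)))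
      where
        lem : ∀ a b u v → (a ℤ.- b) ℤ.* u ℤ.+ b ℤ.* (u ℤ.- v) ≡ a ℤ.* u ℤ.- b ℤ.* v
        lem = solve-∀

    module _ (ps : List Piece)
             (coprime : ∀ {ℓ} → Prime ℓ → + ℓ ∣ values ps (+ 0) → + ℓ ∣ values ps (+ 1) → ⊥) where

      unit-product : ∀ {ℓ} qs → Prime ℓ → + ℓ ∣ d → ¬ (+ ℓ ∣ prodEval (tildes qs) (+ 0))
      unit-product []       pℓ ℓ∣d h = p∤1 pℓ h
      unit-product {ℓ} (q ∷ qs) pℓ ℓ∣d h with euclidℤ pℓ (evalZ (f̃ q) (+ 0)) (prodEval (tildes qs) (+ 0)) h
      ... | inj₁ h′ = Piece.unit q pℓ ℓ∣d (subst (+ ℓ ∣_) (trans (cong (λ z → w q ℤ.+ z) (ℤₚ.*-zeroˡ (evalZ (Piece.D q · quotient c d (f q)) (+ 0)))) (ℤₚ.+-identityʳ (w q))) h′)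
      ... | inj₂ h′ = unit-product qs pℓ ℓ∣d h′

      -- A prime dividing d does not divide the value at t = 0, the product of the `w`. For any
      -- other ℓ the progression meets the classes of y = 0 and y = 1 modulo ℓ, and ℓ would divide
      -- both values there.
      no-prime-divisor : ∀ {ℓ} → Prime ℓ → ¬ (∀ t → + ℓ ∣ prodEval (tildes ps) t)
      no-prime-divisor {ℓ} pℓ all with + ℓ ∣? d
      ... | yes ℓ∣d = unit-product ps pℓ ℓ∣d (all (+ 0))
      ... | no ℓ∤d  = coprime pℓ (at-y (+ 0)) (at-y (+ 1))
        where
          at-y : ∀ y → + ℓ ∣ values ps y
          at-y y = ∣-cong-mod (values ps (c ℤ.+ d ℤ.* t)) (values ps y)
              (values-mod (+ ℓ) ps (c ℤ.+ d ℤ.* t) y (subst (+ ℓ ∣_) (lem c d (proj₁ inv) y) (∣m⇒∣m*n (y ℤ.- c) (proj₂ inv))))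
              (subst (+ ℓ ∣_) (fixed-tildes ps t) (∣n⇒∣m*n (fixed ps) (all t)))
            where
              inv = inverse-mod (suc d′) pℓ ℓ∤d
              t = proj₁ inv ℤ.* (y ℤ.- c)
              lem : ∀ c d u y → (d ℤ.* u ℤ.- + 1) ℤ.* (y ℤ.- c) ≡ c ℤ.+ d ℤ.* (u ℤ.* (y ℤ.- c)) ℤ.- y
              lem = solve-∀

      no-fixed-divisor : ∀ (n : ℕ) → (∀ t → ∣ + n ∣ ∣ℕ.∣ ∣ prodEval (tildes ps) t ∣) → n ≡ 1
      no-fixed-divisor n h with n ℕ.≟ 1
      ... | yes n≡1 = n≡1
      ... | no n≢1 with prime-divisor n n≢1
      ...   | ℓ , pℓ , ℓ∣n = ⊥-elim (no-prime-divisor pℓ λ t → ∣ᵤ⇒∣ (∣ℕ.∣-trans ℓ∣n (h t)))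

      PrimeValue : ℤ → Piece → Set
      PrimeValue y q = ∃[ p ] (Prime p × p % 4 ≡ 1 × evalZ (f q) y ≡ G q ℤ.* + p)

      prime-values : HypothesisH → ∃[ y ] All (PrimeValue y) ps
      prime-values H = collect (H (tildes ps) (each Piece.irreducible-f̃ ps) no-fixed-divisor (each Piece.grows-f̃ ps))
        where
          each : ∀ {P : Poly → Set} → (∀ q → P (f̃ q)) → ∀ qs → All P (tildes qs)
          each h []       = []
          each h (q ∷ qs) = h q ∷ each h qs
          pull : ∀ t qs → All (λ g → ∃[ p ] (Prime p × evalZ g t ≡ + p)) (tildes qs) → All (PrimeValue (c ℤ.+ d ℤ.* t)) qs
          pull t []       []                  = []
          pull t (q ∷ qs) ((p , pp , e) ∷ hs) = (p , pp , ≡1-mod-4 p (subst (λ z → + 4 ∣ z ℤ.- + 1) e (Piece.f̃-mod-4 q t)) ,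
            trans (sym (Piece.eval-f̃ q t)) (cong (G q ℤ.*_) e)) ∷ pull t qs hs
          collect : ∃[ t ] All (λ g → ∃[ p ] (Prime p × evalZ g t ≡ + p)) (tildes ps) → ∃[ y ] All (PrimeValue y) ps
          collect (t , hs) = c ℤ.+ d ℤ.* t , pull t ps hs

-- Primes ≡ 1 (mod 4) as sums of two squares, by counting fixed points of involutions.

module Fermat where
  open import Data.Nat
  open import Data.Nat.Properties
  open import Data.Nat.Divisibility using (_∣_; divides; m∣m*n)
  open import Data.Nat.DivMod using (m≡m%n+[m/n]*n; m*n%n≡0; [m+kn]%n≡m%n)
  open import Data.Nat.Primality using (Prime; prime⇒irreducible; prime⇒nonTrivial)
  open import Data.Nat.Solver using (module +-*-Solver)
  open import Data.List using (List; []; _∷_; _++_; length; filter; upTo; cartesianProduct)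
  open import Data.List.Membership.Propositional using (_∈_)
  open import Data.List.Membership.Propositional.Properties using (∈-∃++; ∈-filter⁺; ∈-filter⁻; ∈-cartesianProduct⁺; ∈-upTo⁺)
  open import Data.List.Relation.Unary.Any using (here; there)
  open import Data.List.Relation.Unary.All as All using ([]; _∷_)
  open import Data.List.Relation.Unary.AllPairs using ([]; _∷_)
  open import Data.List.Relation.Unary.Unique.Propositional using (Unique)
  import Data.List.Relation.Unary.Unique.Propositional.Properties as Unique
  open import Data.List.Relation.Binary.Permutation.Propositional using (_↭_; ↭⇒↭ₛ; ↭-sym)
  open import Data.List.Relation.Binary.Permutation.Propositional.Properties using (shift; ↭-length; ∈-resp-↭)
  open import Data.Product using (_,_; _×_; ∃-syntax; proj₁; proj₂)
  open import Data.Sum using (inj₁; inj₂)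
  open import Data.Empty using (⊥-elim)
  open import Relation.Nullary using (¬_; Dec; yes; no)
  open import Relation.Binary.Definitions using (tri<; tri≈; tri>)
  open import Relation.Binary.PropositionalEquality
  open import Relation.Binary.PropositionalEquality.Properties using (setoid)
  import Data.List.Relation.Binary.Permutation.Setoid.Properties as Permₛ
  open +-*-Solver using (solve; _:+_; _:*_; _:=_; con)

  Even : ℕ → Set
  Even n = ∃[ k ] n ≡ k + k

  ¬both-even : ∀ n → Even n → ¬ Even (suc n)
  ¬both-even n (k , refl) (suc l , e) = go k l (suc-injective (trans e (cong suc (+-suc l l))))
    where
      go : ∀ k l → k + k ≢ suc (l + l)
      go zero    l ()
      go (suc k) zero e with trans (sym (+-suc k k)) (suc-injective e)
      ... | ()
      go (suc k) (suc l) e = go k l (suc-injective (suc-injective (trans (cong suc (sym (+-suc k k))) (trans e (cong (λ t → suc (suc t)) (+-suc l l))))))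

  module _ {A : Set} where
    split-∈ : ∀ {x : A} {xs} → x ∈ xs → ∃[ ys ] xs ↭ x ∷ ys
    split-∈ {x} x∈ with ∈-∃++ x∈
    ... | ys , zs , refl = ys ++ zs , shift x ys zs

    unique-↭ : {xs ys : List A} → xs ↭ ys → Unique xs → Unique ys
    unique-↭ p = Permₛ.Unique-resp-↭ (setoid A) (↭⇒↭ₛ p)

    ∈-tail : ∀ {x y : A} {xs} → y ∈ x ∷ xs → y ≢ x → y ∈ xs
    ∈-tail (here e)  ne = ⊥-elim (ne e)
    ∈-tail (there m) ne = m

    head∉tail : ∀ {x : A} {xs} → Unique (x ∷ xs) → ∀ {y} → y ∈ xs → y ≢ x
    head∉tail (h ∷ _) y∈ refl = All.lookup h y∈ refl

    unique-tail : ∀ {x : A} {xs} → Unique (x ∷ xs) → Unique xs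
    unique-tail (_ ∷ u) = u

    -- Elements leave in pairs x, f x. The bound `n` carries the recursion, because what remains is
    -- not a sublist but a permutation of a part of `xs`.
    involution-even : (f : A → A) (n : ℕ) (xs : List A) → length xs ≤ n → Unique xs →
      (∀ {x} → x ∈ xs → f x ∈ xs × f (f x) ≡ x × f x ≢ x) → Even (length xs)
    involution-even f n       []       le u h = 0 , refl
    involution-even f (suc n) (x ∷ xs) (s≤s le) u h = grow (split-∈ fx∈xs)
      where
        fx∈xs : f x ∈ xs
        fx∈xs = ∈-tail (proj₁ (h (here refl))) (proj₂ (proj₂ (h (here refl))))
        grow : ∃[ ys ] xs ↭ f x ∷ ys → Even (suc (length xs))
        grow (ys , p) = double (involution-even f n ys (≤-trans (n≤1+n _) (≤-trans (≤-reflexive (sym (↭-length p))) le))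
            (unique-tail u′) λ y∈ → closed y∈ , proj₁ (proj₂ (h (there (in-xs y∈)))) , proj₂ (proj₂ (h (there (in-xs y∈)))))
          where
            u′ : Unique (f x ∷ ys)
            u′ = unique-↭ p (unique-tail u)
            in-xs : ∀ {y} → y ∈ ys → y ∈ xs
            in-xs y∈ = ∈-resp-↭ (↭-sym p) (there y∈)
            closed : ∀ {y} → y ∈ ys → f y ∈ ys
            closed {y} y∈ = ∈-tail (∈-resp-↭ p (∈-tail (proj₁ (h (there (in-xs y∈)))) fy≢x)) fy≢fx
              where
                fy≢x : f y ≢ x
                fy≢x e = head∉tail u′ y∈ (trans (sym (proj₁ (proj₂ (h (there (in-xs y∈)))))) (cong f e))
                fy≢fx : f y ≢ f x
                fy≢fx e = head∉tail u (in-xs y∈) (trans (sym (proj₁ (proj₂ (h (there (in-xs y∈)))))) (trans (cong f e) (proj₁ (proj₂ (h (here refl))))))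
            double : Even (length ys) → Even (suc (length xs))
            double (k , e) = suc k , cong suc (trans (↭-length p) (trans (cong suc e) (sym (+-suc k k))))

    -- Without the single fixed point `a` the rest falls into pairs.
    involution-odd : (f : A → A) (xs : List A) (a : A) → Unique xs → a ∈ xs →
      (∀ {x} → x ∈ xs → f x ∈ xs × f (f x) ≡ x) → (∀ {x} → x ∈ xs → f x ≡ x → x ≡ a) → f a ≡ a → ¬ Even (length xs)
    involution-odd f xs a u a∈ h only fa = contra (split-∈ a∈)
      where
        contra : ∃[ ys ] xs ↭ a ∷ ys → ¬ Even (length xs)
        contra (ys , p) ev = ¬both-even (length ys)
            (involution-even f (length ys) ys ≤-refl (unique-tail u′) λ y∈ →
              ∈-tail (∈-resp-↭ p (proj₁ (h (in-xs y∈)))) (λ e → head∉tail u′ y∈ (trans (sym (proj₂ (h (in-xs y∈)))) (trans (cong f e) fa))) ,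
              proj₂ (h (in-xs y∈)) ,
              λ e → head∉tail u′ y∈ (only (in-xs y∈) e))
            (subst Even (↭-length p) ev)
          where
            u′ : Unique (a ∷ ys)
            u′ = unique-↭ p u
            in-xs : ∀ {y} → y ∈ ys → y ∈ xs
            in-xs y∈ = ∈-resp-↭ (↭-sym p) (there y∈)

  Triple : Set
  Triple = ℕ × ℕ × ℕ

  -- Zagier's involution on the solutions of x² + 4yz = p.
  zagier : Triple → Triple
  zagier (x , y , z) = branch (x + z <? y) (2 * y <? x)
    where
      branch : Dec (x + z < y) → Dec (2 * y < x) → Triple
      branch (yes _) _       = x + 2 * z , z , y ∸ (x + z)
      branch (no _)  (yes _) = x ∸ 2 * y , x + z ∸ y , y
      branch (no _)  (no _)  = 2 * y ∸ x , y , x + z ∸ y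

  -- This and the next two evaluate the branches at triples whose differences have names, so that
  -- truncated subtraction disappears from the later identities.
  zagier₁ : ∀ x z t → 0 < t → zagier (x , x + z + t , z) ≡ (x + 2 * z , z , t)
  zagier₁ x z t 0<t with x + z <? x + z + t
  ... | no ≮ = ⊥-elim (≮ (m<m+n (x + z) 0<t))
  ... | yes _ = cong (λ w → x + 2 * z , z , w) (m+n∸m≡n (x + z) t)

  zagier₂ : ∀ x y z s r → x + s ≡ 2 * y → y + r ≡ x + z → zagier (x , y , z) ≡ (s , y , r)
  zagier₂ x y z s r e₁ e₂ with x + z <? y | 2 * y <? x
  ... | yes lt | _ = ⊥-elim (<-irrefl refl (<-≤-trans lt (subst (y ≤_) e₂ (m≤m+n y r))))
  ... | no _ | yes lt = ⊥-elim (<-irrefl refl (<-≤-trans lt (subst (x ≤_) e₁ (m≤m+n x s))))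
  ... | no _ | no _ = cong₂ (λ a b → a , y , b) (trans (cong (_∸ x) (sym e₁)) (m+n∸m≡n x s)) (trans (cong (_∸ y) (sym e₂)) (m+n∸m≡n y r))

  zagier₃ : ∀ y z t → 0 < t → zagier (2 * y + t , y , z) ≡ (t , t + y + z , y)
  zagier₃ y z t 0<t with 2 * y + t + z <? y | 2 * y <? 2 * y + t
  ... | yes lt | _ = ⊥-elim (<-irrefl refl (<-≤-trans lt (≤-trans (m≤m+n y (y + 0)) (≤-trans (m≤m+n (2 * y) t) (m≤m+n (2 * y + t) z)))))
  ... | no _ | no ≮ = ⊥-elim (≮ (m<m+n (2 * y) 0<t))
  ... | no _ | yes _ = cong₂ (λ a b → a , b , y) (m+n∸m≡n (2 * y) t)
        (trans (cong (_∸ y) (solve 3 (λ y t z → con 2 :* y :+ t :+ z := y :+ (t :+ y :+ z)) refl y t z)) (m+n∸m≡n y (t + y + z)))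

  -- The three regions of Zagier's map with the slack variables made explicit. The walls y = x + z
  -- and x = 2y carry no solutions: there p would be a square or divisible by 4.
  data View : Triple → Set where
    view₁ : ∀ x z t → 0 < t → View (x , x + z + t , z)
    view₂ : ∀ x y z s r → 0 < s → x + s ≡ 2 * y → y + r ≡ x + z → View (x , y , z)
    view₃ : ∀ y z t → 0 < t → View (2 * y + t , y , z)

  module TwoSquares (p k : ℕ) (pp : Prime p) (p≡ : p ≡ 1 + 4 * suc k) where
    Sol : Triple → Set
    Sol (x , y , z) = x * x + 4 * (y * z) ≡ p

    4∤p : ∀ q → 4 * q ≢ p
    4∤p q e with trans (sym ([m+kn]%n≡m%n 1 (suc k) 4)) (trans (cong (λ w → suc w % 4) (*-comm (suc k) 4)) (trans (cong (_% 4) (trans (sym p≡) (trans (sym e) (*-comm 4 q)))) (m*n%n≡0 q 4)))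
    ... | ()

    not-square : ∀ x → x * x ≢ p
    not-square x e with prime⇒irreducible pp (subst (x ∣_) e (m∣m*n x))
    ... | inj₁ refl = <-irrefl e (nonTrivial⇒n>1 p {{prime⇒nonTrivial pp}})
    ... | inj₂ refl = <-irrefl (sym e) (m<m*n x x {{≢-nonZero (λ { refl → <-irrefl e (≤-trans (s≤s z≤n) (nonTrivial⇒n>1 0 {{prime⇒nonTrivial pp}})) })}} (nonTrivial⇒n>1 x {{prime⇒nonTrivial pp}}))

    positive : ∀ {x y z} → Sol (x , y , z) → 0 < x × 0 < y × 0 < z
    positive {x} {y} {z} e = n≢0⇒n>0 x≢0 , n≢0⇒n>0 y≢0 , n≢0⇒n>0 z≢0
      where
        x≢0 : x ≢ 0
        x≢0 refl = 4∤p (y * z) e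
        y≢0 : y ≢ 0
        y≢0 refl = not-square x (trans (sym (+-identityʳ (x * x))) e)
        z≢0 : z ≢ 0
        z≢0 refl = not-square x (trans (sym (+-identityʳ (x * x))) (trans (cong (λ w → x * x + 4 * w) (sym (*-zeroʳ y))) e))

    view : ∀ u → Sol u → View u
    view (x , y , z) e with <-cmp (x + z) y
    ... | tri< lt _ _ = subst (λ w → View (x , w , z)) (m+[n∸m]≡n (<⇒≤ lt)) (view₁ x z (y ∸ (x + z)) (m<n⇒0<n∸m lt))
    ... | tri≈ _ refl _ = ⊥-elim (not-square (x + 2 * z) (trans (solve 2 (λ x z → (x :+ con 2 :* z) :* (x :+ con 2 :* z) := x :* x :+ con 4 :* ((x :+ z) :* z)) refl x z) e))
    ... | tri> _ _ gt with <-cmp x (2 * y)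
    ...   | tri< lt _ _ = view₂ x y z (2 * y ∸ x) (x + z ∸ y) (m<n⇒0<n∸m lt) (m+[n∸m]≡n (<⇒≤ lt)) (m+[n∸m]≡n (<⇒≤ gt))
    ...   | tri≈ _ refl _ = ⊥-elim (4∤p (y * y + y * z) (trans (solve 2 (λ y z → con 4 :* (y :* y :+ y :* z) := con 2 :* y :* (con 2 :* y) :+ con 4 :* (y :* z)) refl y z) e))
    ...   | tri> _ _ gt′ = subst (λ w → View (w , y , z)) (m+[n∸m]≡n (<⇒≤ gt′)) (view₃ y z (x ∸ 2 * y) (m<n⇒0<n∸m gt′))

    zagier-Sol : ∀ u → Sol u → View u → Sol (zagier u)
    zagier-Sol _ e (view₁ x z t 0<t) rewrite zagier₁ x z t 0<t =
      trans (solve 3 (λ x z t → (x :+ con 2 :* z) :* (x :+ con 2 :* z) :+ con 4 :* (z :* t) := x :* x :+ con 4 :* ((x :+ z :+ t) :* z)) refl x z t) e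
    zagier-Sol _ e (view₂ x y z s r _ e₁ e₂) rewrite zagier₂ x y z s r e₁ e₂ = trans (+-cancelʳ-≡ (2 * y * (2 * y)) _ _ (begin
        s * s + 4 * (y * r) + 2 * y * (2 * y)        ≡⟨ solve 3 (λ s y r → s :* s :+ con 4 :* (y :* r) :+ con 2 :* y :* (con 2 :* y) := s :* s :+ con 2 :* (con 2 :* y :* (y :+ r))) refl s y r ⟩
        s * s + 2 * (2 * y * (y + r))                ≡⟨ cong₂ (λ a b → s * s + 2 * (a * b)) (sym e₁) e₂ ⟩
        s * s + 2 * ((x + s) * (x + z))              ≡⟨ solve 3 (λ s x z → s :* s :+ con 2 :* ((x :+ s) :* (x :+ z)) := x :* x :+ con 2 :* ((x :+ s) :* z) :+ (x :+ s) :* (x :+ s)) refl s x z ⟩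
        x * x + 2 * ((x + s) * z) + (x + s) * (x + s) ≡⟨ cong (λ w → x * x + 2 * (w * z) + w * w) e₁ ⟩
        x * x + 2 * (2 * y * z) + 2 * y * (2 * y)    ≡⟨ solve 3 (λ x y z → x :* x :+ con 2 :* (con 2 :* y :* z) :+ con 2 :* y :* (con 2 :* y) := x :* x :+ con 4 :* (y :* z) :+ con 2 :* y :* (con 2 :* y)) refl x y z ⟩
        x * x + 4 * (y * z) + 2 * y * (2 * y)        ∎)) e
      where open ≡-Reasoning
    zagier-Sol _ e (view₃ y z t 0<t) rewrite zagier₃ y z t 0<t =
      trans (solve 3 (λ y z t → t :* t :+ con 4 :* ((t :+ y :+ z) :* y) := (con 2 :* y :+ t) :* (con 2 :* y :+ t) :+ con 4 :* (y :* z)) refl y z t) e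

    zagier-involutive : ∀ u → Sol u → View u → zagier (zagier u) ≡ u
    zagier-involutive _ e (view₁ x z t 0<t) rewrite zagier₁ x z t 0<t =
      trans (cong (λ w → zagier (w , z , t)) (+-comm x (2 * z))) (zagier₃ z t x (proj₁ (positive {x} {x + z + t} {z} e)))
    zagier-involutive _ e (view₂ x y z s r _ e₁ e₂) rewrite zagier₂ x y z s r e₁ e₂ = zagier₂ s y r x z (trans (+-comm s x) e₁)
        (+-cancelˡ-≡ x _ _ (trans (solve 3 (λ x y z → x :+ (y :+ z) := y :+ (x :+ z)) refl x y z)
          (trans (cong (y +_) (sym e₂)) (trans (solve 2 (λ y r → y :+ (y :+ r) := con 2 :* y :+ r) refl y r) (trans (cong (_+ r) (sym e₁)) (+-assoc x s r))))))
    zagier-involutive _ e (view₃ y z t 0<t) rewrite zagier₃ y z t 0<t =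
      trans (cong (λ w → zagier (t , w , y)) refl) (trans (zagier₁ t y z (proj₂ (proj₂ (positive {2 * y + t} {y} {z} e)))) (cong (λ w → w , y , z) (+-comm t (2 * y))))

    -- The outer regions change the first coordinate strictly. In the middle one a fixed point has x
    -- = y, so x divides p, and x = p is too large.
    fixed-point : ∀ u → Sol u → View u → zagier u ≡ u → u ≡ (1 , 1 , suc k)
    fixed-point _ e (view₁ x z t 0<t) fix = ⊥-elim (x+2z≢x (proj₂ (proj₂ (positive {x} {x + z + t} {z} e))) (cong proj₁ (trans (sym (zagier₁ x z t 0<t)) fix)))
      where
        x+2z≢x : 0 < z → x + 2 * z ≢ x
        x+2z≢x 0<z q = <-irrefl (sym q) (m<m+n x (≤-trans 0<z (m≤m+n z (z + 0))))
    fixed-point _ e (view₃ y z t 0<t) fix = ⊥-elim (<-irrefl (cong proj₁ (trans (sym (zagier₃ y z t 0<t)) fix)) (m<n+m t (≤-trans (proj₁ (proj₂ (positive {2 * y + t} {y} {z} e))) (m≤m+n y (y + 0)))))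
    fixed-point _ e (view₂ x y z s r _ e₁ e₂) fix with cong proj₁ (trans (sym (zagier₂ x y z s r e₁ e₂)) fix)
    ... | refl with *-cancelˡ-≡ x y 2 (trans (solve 1 (λ x → con 2 :* x := x :+ x) refl x) e₁)
    ...   | refl with prime⇒irreducible pp (divides (x + 4 * z) (trans (sym e) (solve 2 (λ x z → x :* x :+ con 4 :* (x :* z) := (x :+ con 4 :* z) :* x) refl x z)))
    ...     | inj₁ refl = cong (λ w → 1 , 1 , w) (*-cancelˡ-≡ z (suc k) 4 (trans (cong (4 *_) (sym (*-identityˡ z))) (suc-injective (trans e p≡))))
    ...     | inj₂ refl = ⊥-elim (<-irrefl (sym (trans (solve 2 (λ x z → x :+ con 4 :* z :+ con 0 := x :+ con 4 :* z) refl x z) x+4z≡1)) (≤-trans (nonTrivial⇒n>1 x {{prime⇒nonTrivial pp}}) (≤-trans (m≤m+n x (4 * z)) (m≤m+n _ 0))))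
      where
        x+4z≡1 : x + 4 * z ≡ 1
        x+4z≡1 = *-cancelʳ-≡ _ _ x {{>-nonZero (≤-trans (s≤s z≤n) (nonTrivial⇒n>1 x {{prime⇒nonTrivial pp}}))}}
          (trans (solve 2 (λ x z → (x :+ con 4 :* z) :* x := x :* x :+ con 4 :* (x :* z)) refl x z) (trans e (sym (*-identityˡ x))))

    Sol? : ∀ u → Dec (Sol u)
    Sol? (x , y , z) = x * x + 4 * (y * z) ≟ p

    candidates sols : List Triple
    candidates = cartesianProduct (upTo (suc p)) (cartesianProduct (upTo (suc p)) (upTo (suc p)))
    sols = filter Sol? candidates

    sols-unique : Unique sols
    sols-unique = Unique.filter⁺ Sol? (Unique.cartesianProduct⁺ (Unique.upTo⁺ (suc p)) (Unique.cartesianProduct⁺ (Unique.upTo⁺ (suc p)) (Unique.upTo⁺ (suc p))))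

    ∈-sols : ∀ u → Sol u → u ∈ sols
    ∈-sols (x , y , z) e = ∈-filter⁺ Sol? (∈-cartesianProduct⁺ (∈-upTo⁺ (s≤s x≤p)) (∈-cartesianProduct⁺ (∈-upTo⁺ (s≤s y≤p)) (∈-upTo⁺ (s≤s z≤p)))) e
      where
        pos = positive e
        instance
          x≢0 = >-nonZero (proj₁ pos)
          y≢0 = >-nonZero (proj₁ (proj₂ pos))
          z≢0 = >-nonZero (proj₂ (proj₂ pos))
        yz≤p : y * z ≤ p
        yz≤p = subst (y * z ≤_) e (≤-trans (m≤n*m (y * z) 4) (m≤n+m _ (x * x)))
        x≤p : x ≤ p
        x≤p = subst (x ≤_) e (≤-trans (m≤m*n x x) (m≤m+n (x * x) _))
        y≤p : y ≤ p
        y≤p = ≤-trans (m≤m*n y z) yz≤p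
        z≤p : z ≤ p
        z≤p = ≤-trans (m≤n*m z y) yz≤p

    sol : ∀ {u} → u ∈ sols → Sol u
    sol u∈ = proj₂ (∈-filter⁻ Sol? {xs = candidates} u∈)

    odd-sols : ¬ Even (length sols)
    odd-sols = involution-odd zagier sols (1 , 1 , suc k) sols-unique
        (∈-sols _ sol₁)
        (λ {u} u∈ → ∈-sols _ (zagier-Sol u (sol u∈) (view u (sol u∈))) , zagier-involutive u (sol u∈) (view u (sol u∈)))
        (λ {u} u∈ → fixed-point u (sol u∈) (view u (sol u∈)))
        (zagier₂ 1 1 (suc k) 1 (suc k) refl refl)
      where
        sol₁ : Sol (1 , 1 , suc k)
        sol₁ = trans (cong (λ w → 1 + 4 * w) (*-identityˡ (suc k))) (sym p≡)

    swap : Triple → Triple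
    swap (x , y , z) = x , z , y

    -- If no solution had y = z, exchanging y and z would pair off all solutions, against their odd
    -- number. A solution with y = z reads x² + (2y)² = p.
    two-squares : ∃[ x ] ∃[ y ] x * x + y * y ≡ p
    two-squares = search sols (λ {u} u∈ e → sol {u} u∈) (λ none → odd-sols (involution-even swap (length sols) sols ≤-refl sols-unique λ {u} u∈ →
        ∈-sols (swap u) (trans (cong (λ w → proj₁ u * proj₁ u + 4 * w) (*-comm (proj₂ (proj₂ u)) (proj₁ (proj₂ u)))) (sol u∈)) , refl , λ e → none u∈ (sym (cong (λ w → proj₁ (proj₂ w)) e))))
      where
        search : ∀ us → (∀ {u} → u ∈ us → proj₁ (proj₂ u) ≡ proj₂ (proj₂ u) → Sol u) →
          ¬ (∀ {u} → u ∈ us → proj₁ (proj₂ u) ≢ proj₂ (proj₂ u)) → ∃[ x ] ∃[ y ] x * x + y * y ≡ p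
        search [] h ne = ⊥-elim (ne λ ())
        search ((x , y , z) ∷ us) h ne with y ≟ z
        ... | yes refl = x , 2 * y , trans (solve 2 (λ x y → x :* x :+ con 2 :* y :* (con 2 :* y) := x :* x :+ con 4 :* (y :* y)) refl x y) (h (here refl) refl)
        ... | no y≢z = search us (λ u∈ → h (there u∈)) λ all → ne λ { (here refl) → y≢z ; (there u∈) → all u∈ }

  prime-two-squares : ∀ {p} → Prime p → p % 4 ≡ 1 → ∃[ x ] ∃[ y ] x * x + y * y ≡ p
  prime-two-squares {p} pp e = go (p / 4) refl
    where
      p≡ : p ≡ 1 + 4 * (p / 4)
      p≡ = trans (m≡m%n+[m/n]*n p 4) (cong₂ _+_ e (*-comm (p / 4) 4))
      go : ∀ q → p / 4 ≡ q → ∃[ x ] ∃[ y ] x * x + y * y ≡ p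
      go zero    eq = ⊥-elim (<-irrefl (sym (trans p≡ (cong (λ w → 1 + 4 * w) eq))) (nonTrivial⇒n>1 p {{prime⇒nonTrivial pp}}))
      go (suc k) eq = TwoSquares.two-squares p k pp (trans p≡ (cong (λ w → 1 + 4 * w) eq))

-- Arithmetic modulo a prime, valuations, and the sums Σ αⁿ⁻¹⁻ⁱwⁱ.

module ArithmeticModP where
  open import Defs using (evalZ; sumℤ)
  open import Data.Nat as ℕ using (ℕ; zero; suc; z≤n; s≤s; _%_; _∸_)
  import Data.Nat.Properties as ℕₚ
  import Data.Nat.Divisibility as ∣ℕ
  import Data.Nat.DivMod as ℕ%
  open import Data.Nat.Induction using (<-wellFounded)
  open import Induction.WellFounded using (Acc; acc)
  open import Data.Nat.Combinatorics using (_C_; nCn≡1; k>n⇒nCk≡0)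
  open import Data.Nat.Primality using (Prime; prime⇒nonTrivial; prime⇒nonZero)
  open import Data.Integer as ℤ using (ℤ; +_; -[1+_]; _+_; _-_; _*_; -_; _^_; ∣_∣)
  import Data.Integer.Properties as ℤₚ
  open import Data.Integer.Divisibility.Signed using (_∣_; divides; ∣ᵤ⇒∣; ∣⇒∣ᵤ; ∣m∣n⇒∣m+n; ∣m+n∣m⇒∣n; ∣n⇒∣m*n; ∣m⇒∣m*n; _∣?_; ∣-refl; ∣m⇒∣-m)
  open import Data.Integer.Tactic.RingSolver using (solve-∀)
  open import Data.List using ([]; _∷_)
  open import Data.Product using (_,_; _×_; ∃-syntax)
  open import Data.Sum using (inj₁; inj₂)
  open import Data.Empty using (⊥; ⊥-elim)
  open import Relation.Nullary using (¬_; yes; no)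
  open import Relation.Binary.Definitions using (tri<; tri≈; tri>)
  open import Relation.Binary.PropositionalEquality
  open PolynomialRings
  open WeightedReciprocals
  open GeometricPolynomials
  open IntegersInRationals using (module DZ)
  open CyclotomicShift using (module PZ; module GZ; euclidℤ; p∤1; prime∣C; co-binomial)
  open PrimeValues using (evalZ-⊕; evalZ-·; evalZ-comp; evalZ-≡-mod; ∣-cong-mod)

  ∣0 : ∀ {n} → n ∣ + 0
  ∣0 = divides (+ 0) refl

  ∣+ : ∀ {n x y} → n ∣ x → n ∣ y → n ∣ x + y
  ∣+ = ∣m∣n⇒∣m+n

  ∣- : ∀ {n x y} → n ∣ x → n ∣ y → n ∣ x - y
  ∣- h k = ∣m∣n⇒∣m+n h (∣m⇒∣-m k)

  ∤-* : ∀ {p} → Prime p → ∀ {x y} → ¬ (+ p ∣ x) → ¬ (+ p ∣ y) → ¬ (+ p ∣ x * y)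
  ∤-* pp {x} {y} h k d with euclidℤ pp x y d
  ... | inj₁ h′ = h h′
  ... | inj₂ k′ = k k′

  ∤-^ : ∀ {p} → Prime p → ∀ {x} n → ¬ (+ p ∣ x) → ¬ (+ p ∣ x ^ n)
  ∤-^ pp zero    h = p∤1 pp
  ∤-^ pp (suc n) h = ∤-* pp h (∤-^ pp n h)

  evalZ-mono : ∀ n x → evalZ (DZ.mono n) x ≡ x ^ n
  evalZ-mono zero    x = trans (cong (λ t → + 1 + t) (ℤₚ.*-zeroʳ x)) refl
  evalZ-mono (suc n) x = trans (ℤₚ.+-identityˡ _) (cong (x *_) (evalZ-mono n x))

  ^-mod : ∀ n k x y → n ∣ x - y → n ∣ x ^ k - y ^ k
  ^-mod n k x y h = subst (n ∣_) (cong₂ _-_ (evalZ-mono k x) (evalZ-mono k y)) (evalZ-≡-mod n (DZ.mono k) x y h)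

  evalZ-AllDiv : ∀ n p x → (∀ i → n ∣ PZ.co p i) → n ∣ evalZ p x
  evalZ-AllDiv n []      x h = ∣0
  evalZ-AllDiv n (c ∷ p) x h = ∣+ (h 0) (∣n⇒∣m*n x (evalZ-AllDiv n p x (λ i → h (suc i))))

  -- Proved for the polynomial (1 + X)^p - 1 - X^p, whose nonzero coefficients are inner binomial
  -- coefficients, and then evaluated.
  freshman : ∀ {p} → Prime p → ∀ x → + p ∣ (+ 1 + x) ^ p - (+ 1 + x ^ p)
  freshman {suc p} pp x = subst (+ suc p ∣_) value (evalZ-AllDiv (+ suc p) R x divisible)
    where
      P Q R : PZ.Poly
      P = PZ.comp GZ.1+Y (DZ.mono (suc p))
      Q = (+ 1 ∷ []) PZ.⊕ DZ.mono (suc p)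
      R = P PZ.⊕ PZ.⊖ Q
      value : evalZ R x ≡ (+ 1 + x) ^ suc p - (+ 1 + x ^ suc p)
      value = trans (evalZ-⊕ x P (PZ.⊖ Q)) (cong₂ _+_
        (trans (evalZ-comp x GZ.1+Y (DZ.mono (suc p))) (trans (evalZ-mono (suc p) (+ 1 + x * (+ 1 + x * + 0))) (cong (_^ suc p) (lem₁ x))))
        (trans (evalZ-· x (- + 1) Q) (trans (cong (- + 1 *_) (trans (evalZ-⊕ x (+ 1 ∷ []) (DZ.mono (suc p))) (cong₂ _+_ (lem₂ x) (evalZ-mono (suc p) x)))) (lem₃ (+ 1 + x ^ suc p)))))
        where
          lem₁ : ∀ x → + 1 + x * (+ 1 + x * + 0) ≡ + 1 + x
          lem₁ = solve-∀
          lem₂ : ∀ x → + 1 + x * + 0 ≡ + 1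
          lem₂ = solve-∀
          lem₃ : ∀ y → - + 1 * y ≡ - y
          lem₃ = solve-∀
      co-R : ∀ i → PZ.co R i ≡ + (suc p C i) - PZ.co Q i
      co-R i = trans (PZ.co-⊕ P (PZ.⊖ Q) i) (cong₂ _+_ (co-binomial (suc p) i) (trans (PZ.co-· (- + 1) Q i) (ℤₚ.-1*i≡-i (PZ.co Q i))))
      divisible : ∀ i → + suc p ∣ PZ.co R i
      divisible zero = subst (+ suc p ∣_) (sym (co-R 0)) ∣0
      divisible (suc i) with ℕₚ.<-cmp i p
      ... | tri< lt _ _ = subst (+ suc p ∣_) (sym (trans (co-R (suc i)) (trans (cong (λ t → + (suc p C suc i) - t) (DZ.co-mono-≢ p i (ℕₚ.<⇒≢ lt))) (ℤₚ.+-identityʳ (+ (suc p C suc i))))))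
                            (∣ᵤ⇒∣ (prime∣C pp i (s≤s lt)))
      ... | tri≈ _ refl _ = subst (+ suc p ∣_) (sym (trans (co-R (suc p)) (cong₂ (λ s t → + s - t) (nCn≡1 (suc p)) (DZ.co-mono-≡ p)))) ∣0
      ... | tri> _ _ gt = subst (+ suc p ∣_) (sym (trans (co-R (suc i)) (cong₂ (λ s t → + s - t) (k>n⇒nCk≡0 (s≤s gt)) (DZ.co-mono-≢ p i (λ e → ℕₚ.<⇒≢ gt (sym e)))))) ∣0

  fermat : ∀ {p} → Prime p → ∀ n → + p ∣ (+ n) ^ p - + n
  fermat {suc p} pp zero = ∣0
  fermat {p} pp (suc n) = subst (+ p ∣_) (lem ((+ 1 + + n) ^ p) ((+ n) ^ p) (+ n)) (∣+ (freshman pp (+ n)) (fermat pp n))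
    where
      lem : ∀ a b n → (a - (+ 1 + b)) + (b - n) ≡ a - (+ 1 + n)
      lem = solve-∀

  fermat-unit : ∀ {p} → Prime (suc p) → ∀ n → ¬ (+ suc p ∣ + n) → + suc p ∣ (+ n) ^ p - + 1
  fermat-unit {p} pp n h with euclidℤ pp (+ n) ((+ n) ^ p - + 1) (subst (+ suc p ∣_) (lem (+ n) ((+ n) ^ p)) (fermat pp n))
    where
      lem : ∀ n x → n * x - n ≡ n * (x - + 1)
      lem = solve-∀
  ... | inj₁ d = ⊥-elim (h d)
  ... | inj₂ d = d

  ∣∣-sq : ∀ x → + ∣ x ∣ * + ∣ x ∣ ≡ x * x
  ∣∣-sq (+ n)    = refl
  ∣∣-sq -[1+ n ] = refl

  ∣abs : ∀ {p} x → + p ∣ + ∣ x ∣ → + p ∣ x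
  ∣abs x h = ∣ᵤ⇒∣ (∣⇒∣ᵤ h)

  neg-odd-power : ∀ x k → (- x) ^ suc (k ℕ.* 2) ≡ - (x ^ suc (k ℕ.* 2))
  neg-odd-power x zero    = lem x
    where
      lem : ∀ x → - x * + 1 ≡ - (x * + 1)
      lem = solve-∀
  neg-odd-power x (suc k) = trans (cong (λ t → - x * (- x * t)) (neg-odd-power x k)) (lem x (x ^ suc (k ℕ.* 2)))
    where
      lem : ∀ x t → - x * (- x * - t) ≡ - (x * (x * t))
      lem = solve-∀

  sq-^ : ∀ x h → (x * x) ^ h ≡ x ^ (h ℕ.* 2)
  sq-^ x h = trans (cong (λ t → (x * t) ^ h) (sym (ℤₚ.*-identityʳ x))) (trans (ℤₚ.^-*-assoc x 2 h) (cong (x ^_) (ℕₚ.*-comm 2 h)))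

  prime-≡3 : ∀ {p} → p % 4 ≡ 3 → ∃[ k ] p ≡ suc (suc (k ℕ.* 2) ℕ.* 2)
  prime-≡3 {p} e = p ℕ./ 4 , trans (ℕ%.m≡m%n+[m/n]*n p 4) (trans (cong (ℕ._+ p ℕ./ 4 ℕ.* 4) e) (cong (3 ℕ.+_) (sym (ℕₚ.*-assoc (p ℕ./ 4) 2 2))))

  -- Write p = 2h + 1 with h odd. If x were prime to p, raising X² ≡ -Y² to the power h would give
  -- X^(p-1) ≡ -Y^(p-1), that is 1 ≡ -1. Absolute values enter because `fermat-unit` speaks of
  -- natural numbers.
  sum-of-squares-prime : ∀ {p} → Prime p → p % 4 ≡ 3 → ∀ x y → + p ∣ x * x + y * y → + p ∣ x
  sum-of-squares-prime {p} pp e x y d with + p ∣? x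
  ... | yes h = h
  ... | no p∤x = ⊥-elim (go (prime-≡3 e))
    where
      X Y : ℤ
      X = + ∣ x ∣
      Y = + ∣ y ∣
      D : + p ∣ X * X + Y * Y
      D = subst (+ p ∣_) (sym (cong₂ _+_ (∣∣-sq x) (∣∣-sq y))) d
      p∤X : ¬ (+ p ∣ X)
      p∤X h = p∤x (∣abs x h)
      p∤Y : ¬ (+ p ∣ Y)
      p∤Y h = ∤-* pp p∤X p∤X (∣m+n∣m⇒∣n (subst (+ p ∣_) (ℤₚ.+-comm (X * X) (Y * Y)) D) (∣m⇒∣m*n Y h))
      go : ∃[ k ] p ≡ suc (suc (k ℕ.* 2) ℕ.* 2) → ⊥
      go (k , refl) = p∤2 (subst (+ p ∣_) (lem₁ (X ^ (h ℕ.* 2)) (Y ^ (h ℕ.* 2)))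
          (∣- (∣- main (fermat-unit pp ∣ x ∣ p∤X)) (fermat-unit pp ∣ y ∣ p∤Y)))
        where
          h : ℕ
          h = suc (k ℕ.* 2)
          lem₁ : ∀ a b → (a + b) - (a - + 1) - (b - + 1) ≡ + 2
          lem₁ = solve-∀
          lem₂ : ∀ a b → a + b ≡ a - - b
          lem₂ = solve-∀
          main : + p ∣ X ^ (h ℕ.* 2) + Y ^ (h ℕ.* 2)
          main = subst (+ p ∣_) (trans (cong₂ _-_ (sq-^ X h) (trans (neg-odd-power (Y * Y) k) (cong -_ (sq-^ Y h)))) (sym (lem₂ (X ^ (h ℕ.* 2)) (Y ^ (h ℕ.* 2)))))
            (^-mod (+ p) h (X * X) (- (Y * Y)) (subst (+ p ∣_) (lem₂ (X * X) (Y * Y)) D))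
          p∤2 : ¬ (+ p ∣ + 2)
          p∤2 q with ∣ℕ.∣⇒≤ (∣⇒∣ᵤ q)
          ... | s≤s (s≤s ())

  -- For n ≠ 0 and prime p: v = v_p(n) and r = r_p(n).
  Val : ℕ → ℕ → ℤ → ℤ → Set
  Val p v r n = n ≡ (+ p) ^ v * r × ¬ (+ p ∣ r)

  ∣p^suc : ∀ p v r → + p ∣ (+ p) ^ suc v * r
  ∣p^suc p v r = ∣m⇒∣m*n r (∣m⇒∣m*n ((+ p) ^ v) ∣-refl)

  valuation : ∀ {p} → Prime p → ∀ n → n ≢ + 0 → ∃[ v ] ∃[ r ] Val p v r n
  valuation {p} pp n n≢0 = go n (<-wellFounded ∣ n ∣) n≢0
    where
      go : ∀ n → Acc ℕ._<_ ∣ n ∣ → n ≢ + 0 → ∃[ v ] ∃[ r ] Val p v r n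
      go n (acc rs) n≢0 with + p ∣? n
      ... | no h = 0 , n , sym (ℤₚ.*-identityˡ n) , h
      ... | yes (divides q refl) with go q (rs (subst (∣ q ∣ ℕ.<_) (sym (ℤₚ.abs-* q (+ p))) (ℕₚ.m<m*n ∣ q ∣ p {{ℕ.≢-nonZero λ z → n≢0 (cong (_* + p) (ℤₚ.∣i∣≡0⇒i≡0 {q} z))}} (ℕ.nonTrivial⇒n>1 p {{prime⇒nonTrivial pp}}))))
                                       (λ z → n≢0 (cong (_* + p) z))
      ...   | v , r , e , h = suc v , r , trans (cong (_* + p) e) (lem ((+ p) ^ v) r (+ p)) , h
        where
          lem : ∀ x r p → x * r * p ≡ p * x * r
          lem = solve-∀

  module _ {p : ℕ} (pp : Prime p) where
    private instance
      p≢0 : ℤ.NonZero (+ p)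
      p≢0 = ℤ.≢-nonZero λ z → ℕ.≢-nonZero⁻¹ p {{prime⇒nonZero pp}} (ℤₚ.+-injective z)

    valuation-unique : ∀ v w r s → ¬ (+ p ∣ r) → ¬ (+ p ∣ s) → (+ p) ^ v * r ≡ (+ p) ^ w * s → v ≡ w × r ≡ s
    valuation-unique zero    zero    r s h k e = refl , trans (sym (ℤₚ.*-identityˡ r)) (trans e (ℤₚ.*-identityˡ s))
    valuation-unique zero    (suc w) r s h k e = ⊥-elim (h (subst (+ p ∣_) (trans (sym e) (ℤₚ.*-identityˡ r)) (∣p^suc p w s)))
    valuation-unique (suc v) zero    r s h k e = ⊥-elim (k (subst (+ p ∣_) (trans e (ℤₚ.*-identityˡ s)) (∣p^suc p v r)))
    valuation-unique (suc v) (suc w) r s h k e with valuation-unique v w r s h k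
      (ℤₚ.*-cancelˡ-≡ (+ p) _ _ (trans (sym (ℤₚ.*-assoc (+ p) ((+ p) ^ v) r)) (trans e (ℤₚ.*-assoc (+ p) ((+ p) ^ w) s))))
    ... | refl , e′ = refl , e′

    -- Infinite descent: as soon as p divides the sum it divides x and y, and cancelling p² lowers
    -- the exponent by 2.
    sum-of-squares-even : p % 4 ≡ 3 → ∀ γ x y s → ¬ (+ p ∣ s) → x * x + y * y ≡ (+ p) ^ γ * s → 2 ∣ℕ.∣ γ
    sum-of-squares-even p≡3 zero    x y s h e = ∣ℕ._∣0 2
    sum-of-squares-even p≡3 (suc γ) x y s h e with
        sum-of-squares-prime pp p≡3 x y p∣ | sum-of-squares-prime pp p≡3 y x (subst (+ p ∣_) (ℤₚ.+-comm (x * x) (y * y)) p∣)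
      where
        p∣ : + p ∣ x * x + y * y
        p∣ = subst (+ p ∣_) (sym e) (∣p^suc p γ s)
    ... | divides x′ refl | divides y′ refl = step γ (ℤₚ.*-cancelˡ-≡ (+ p) _ _ (trans (lem x′ y′ (+ p)) (trans e (ℤₚ.*-assoc (+ p) ((+ p) ^ γ) s))))
      where
        lem : ∀ x y p → p * (p * (x * x + y * y)) ≡ x * p * (x * p) + y * p * (y * p)
        lem = solve-∀
        step : ∀ γ → + p * (x′ * x′ + y′ * y′) ≡ (+ p) ^ γ * s → 2 ∣ℕ.∣ suc γ
        step zero    e′ = ⊥-elim (h (subst (+ p ∣_) (trans e′ (ℤₚ.*-identityˡ s)) (∣m⇒∣m*n (x′ * x′ + y′ * y′) ∣-refl)))
        step (suc γ) e′ = ∣ℕ.∣m∣n⇒∣m+n (∣ℕ.∣-refl {2}) (sum-of-squares-even p≡3 γ x′ y′ s h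
          (ℤₚ.*-cancelˡ-≡ (+ p) _ _ (trans e′ (ℤₚ.*-assoc (+ p) ((+ p) ^ γ) s))))

  *-^ : ∀ x y n → (x * y) ^ n ≡ x ^ n * y ^ n
  *-^ x y zero    = refl
  *-^ x y (suc n) = trans (cong (x * y *_) (*-^ x y n)) (lem x y (x ^ n) (y ^ n))
    where
      lem : ∀ x y a b → x * y * (a * b) ≡ x * a * (y * b)
      lem = solve-∀

  -- Σ αⁿ⁻¹⁻ⁱwⁱ over i < n in Horner form, the cofactor of α - w in αⁿ - wⁿ. `geo-last` is the
  -- recursion from the other end.
  geo : ℕ → ℤ → ℤ → ℤ
  geo zero    α w = + 0
  geo (suc n) α w = α ^ n + w * geo n α w

  geo-last : ∀ n α w → geo (suc n) α w ≡ α * geo n α w + w ^ n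
  geo-last zero    α w = trans (cong (λ t → + 1 + t) (ℤₚ.*-zeroʳ w)) (trans (sym (ℤₚ.+-identityˡ (+ 1))) (cong (λ t → t + + 1) (sym (ℤₚ.*-zeroʳ α))))
  geo-last (suc n) α w = trans (cong (λ t → α ^ suc n + w * t) (geo-last n α w)) (lem α w (α ^ n) (geo n α w) (w ^ n))
    where
      lem : ∀ α w x g y → α * x + w * (α * g + y) ≡ α * (x + w * g) + w * y
      lem = solve-∀

  geo-* : ∀ n α w → geo n α w * (α - w) ≡ α ^ n - w ^ n
  geo-* zero    α w = refl
  geo-* (suc n) α w = trans (lem₁ (α ^ n) w (geo n α w) α) (trans (cong (λ t → α ^ n * (α - w) + w * t) (geo-* n α w)) (lem₂ α w (α ^ n) (w ^ n)))
    where
      lem₁ : ∀ x w g α → (x + w * g) * (α - w) ≡ x * (α - w) + w * (g * (α - w))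
      lem₁ = solve-∀
      lem₂ : ∀ α w x y → x * (α - w) + w * (x - y) ≡ α * x - w * y
      lem₂ = solve-∀

  sumℤ-cong : ∀ n f g → (∀ i → i ℕ.< n → f i ≡ g i) → sumℤ n f ≡ sumℤ n g
  sumℤ-cong zero    f g h = refl
  sumℤ-cong (suc n) f g h = cong₂ _+_ (sumℤ-cong n f g λ i lt → h i (ℕₚ.m≤n⇒m≤1+n lt)) (h n ℕₚ.≤-refl)

  sumℤ-* : ∀ n c f → sumℤ n (λ i → c * f i) ≡ c * sumℤ n f
  sumℤ-* zero    c f = sym (ℤₚ.*-zeroʳ c)
  sumℤ-* (suc n) c f = trans (cong (_+ c * f n) (sumℤ-* n c f)) (sym (ℤₚ.*-distribˡ-+ c (sumℤ n f) (f n)))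

  sumℤ≡geo : ∀ n α w → sumℤ n (λ i → α ^ (n ∸ 1 ∸ i) * w ^ i) ≡ geo n α w
  sumℤ≡geo zero    α w = refl
  sumℤ≡geo (suc n) α w = begin
    sumℤ n (λ i → α ^ (n ∸ i) * w ^ i) + α ^ (n ∸ n) * w ^ n
      ≡⟨ cong₂ _+_ (sumℤ-cong n _ _ λ i lt → trans (cong (λ t → α ^ t * w ^ i) (shift n i lt)) (ℤₚ.*-assoc α (α ^ (n ∸ 1 ∸ i)) (w ^ i)))
           (trans (cong (λ t → α ^ t * w ^ n) (ℕₚ.n∸n≡0 n)) (ℤₚ.*-identityˡ (w ^ n))) ⟩
    sumℤ n (λ i → α * (α ^ (n ∸ 1 ∸ i) * w ^ i)) + w ^ n
      ≡⟨ cong (_+ w ^ n) (trans (sumℤ-* n α _) (cong (α *_) (sumℤ≡geo n α w))) ⟩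
    α * geo n α w + w ^ n       ≡⟨ geo-last n α w ⟨
    geo (suc n) α w             ∎
    where
      open ≡-Reasoning
      shift : ∀ n i → i ℕ.< n → n ∸ i ≡ suc (n ∸ 1 ∸ i)
      shift (suc n) i (s≤s le) = ℕₚ.+-∸-assoc 1 le

  -- For w ≡ α each of the n + 1 summands is ≡ αⁿ; the total is the derivative of Xⁿ⁺¹ at α.
  geo-mod : ∀ d n α w → d ∣ w - α → d ∣ geo (suc n) α w - + suc n * α ^ n
  geo-mod d zero α w h = subst (d ∣_) (lem w) ∣0
    where
      lem : ∀ w → + 0 ≡ + 1 + w * + 0 - + 1 * + 1
      lem = solve-∀
  geo-mod d (suc n) α w h = subst (d ∣_) (trans (lem α w (geo (suc n) α w) (+ suc n) (α ^ n)) (cong (λ t → α * α ^ n + w * geo (suc n) α w - t * (α * α ^ n)) (sym (ℤₚ.pos-+ 1 (suc n)))))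
      (∣+ (∣m⇒∣m*n (geo (suc n) α w) h) (∣n⇒∣m*n α (geo-mod d n α w h)))
    where
      lem : ∀ α w g n x → (w - α) * g + α * (g - n * x) ≡ α * x + w * g - (+ 1 + n) * (α * x)
      lem = solve-∀

  geo-cong-mod : ∀ {d} k {α β x y} → d ∣ α - β → d ∣ x - y → d ∣ geo k α x - geo k β y
  geo-cong-mod         zero    h h′ = ∣0
  geo-cong-mod {d} (suc k) {α} {β} {x} {y} h h′ = subst (d ∣_) (lem (α ^ k) (β ^ k) x y (geo k α x) (geo k β y))
      (∣+ (^-mod d k α β h) (∣+ (∣m⇒∣m*n (geo k α x) h′) (∣n⇒∣m*n y (geo-cong-mod k h h′))))
    where
      lem : ∀ a b x y g g′ → a - b + ((x - y) * g + y * (g - g′)) ≡ a + x * g - (b + y * g′)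
      lem = solve-∀

  geo-scale : ∀ n c α w → geo (suc n) (c * α) (c * w) ≡ c ^ n * geo (suc n) α w
  geo-scale zero    c α w = lem c w
    where
      lem : ∀ c w → + 1 + c * w * + 0 ≡ + 1 * (+ 1 + w * + 0)
      lem = solve-∀
  geo-scale (suc n) c α w = trans (cong₂ (λ s t → s + c * w * t) (*-^ c α (suc n)) (geo-scale n c α w)) (lem c (c ^ n) (α ^ suc n) w (geo (suc n) α w))
    where
      lem : ∀ c x y w g → c * x * y + c * w * (x * g) ≡ c * x * (y + w * g)
      lem = solve-∀

  geo-unitˡ : ∀ {p} → Prime p → ∀ n α w → ¬ (+ p ∣ α) → + p ∣ w → ¬ (+ p ∣ geo (suc n) α w)
  geo-unitˡ pp n α w h d e = ∤-^ pp n h (∣-cong-mod (geo (suc n) α w) (α ^ n) (subst (_ ∣_) (lem (α ^ n) w (geo n α w)) (∣m⇒∣m*n (geo n α w) d)) e)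
    where
      lem : ∀ x w g → w * g ≡ x + w * g - x
      lem = solve-∀

  geo-unitʳ : ∀ {p} → Prime p → ∀ n α w → + p ∣ α → ¬ (+ p ∣ w) → ¬ (+ p ∣ geo (suc n) α w)
  geo-unitʳ pp n α w d h e = ∤-^ pp n h (∣-cong-mod (geo (suc n) α w) (w ^ n) (subst (_ ∣_) (trans (lem (w ^ n) α (geo n α w)) (cong (_- w ^ n) (sym (geo-last n α w)))) (∣m⇒∣m*n (geo n α w) d)) e)
    where
      lem : ∀ x α g → α * g ≡ α * g + x - x
      lem = solve-∀

  0≤sqℤ : ∀ x → + 0 ℤ.≤ x * x
  0≤sqℤ x = subst (+ 0 ℤ.≤_) (trans (ℤₚ.pos-* ∣ x ∣ ∣ x ∣) (∣∣-sq x)) (ℤ.+≤+ z≤n)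

  0≤+ℤ : ∀ {x y} → + 0 ℤ.≤ x → + 0 ℤ.≤ y → + 0 ℤ.≤ x + y
  0≤+ℤ {x} {y} h k = subst (ℤ._≤ x + y) (ℤₚ.+-identityʳ (+ 0)) (ℤₚ.+-mono-≤ h k)

  even-^ : ∀ x k → x ^ (k ℕ.* 2) ≡ x ^ k * x ^ k
  even-^ x k = trans (cong (x ^_) (trans (ℕₚ.*-comm k 2) (cong (k ℕ.+_) (ℕₚ.+-identityʳ k)))) (ℤₚ.^-distribˡ-+-* x k k)

  -- When h increases by one the defect s is multiplied by α² and grows by the square (αwʰ + wʰ⁺¹)².
  geo-positive : ∀ h α w → ∃[ s ] (+ 0 ℤ.≤ s × + 2 * geo (suc (h ℕ.* 2)) α w ≡ α ^ (h ℕ.* 2) + w ^ (h ℕ.* 2) + s)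
  geo-positive zero α w = + 0 , ℤ.+≤+ z≤n , lem w
    where
      lem : ∀ w → + 2 * (+ 1 + w * + 0) ≡ + 1 + + 1 + + 0
      lem = solve-∀
  geo-positive (suc h) α w with geo-positive h α w
  ... | s , 0≤s , e = α * α * s + (α * w ^ h + y) * (α * w ^ h + y) , nonneg , (begin
      + 2 * geo (suc (suc (suc (h ℕ.* 2)))) α w
        ≡⟨ cong (+ 2 *_) (trans (geo-last (suc (suc (h ℕ.* 2))) α w) (cong (λ t → α * t + w ^ suc (suc (h ℕ.* 2))) (geo-last (suc (h ℕ.* 2)) α w))) ⟩
      + 2 * (α * (α * g + w * W) + w * (w * W))
        ≡⟨ lem₁ α w g W ⟩
      α * α * (+ 2 * g) + + 2 * (α * w * W) + + 2 * (w * w * W)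
        ≡⟨ cong (λ t → α * α * t + + 2 * (α * w * W) + + 2 * (w * w * W)) e ⟩
      α * α * (A + W + s) + + 2 * (α * w * W) + + 2 * (w * w * W)
        ≡⟨ cong (λ t → α * α * (A + t + s) + + 2 * (α * w * t) + + 2 * (w * w * t)) (even-^ w h) ⟩
      α * α * (A + w ^ h * w ^ h + s) + + 2 * (α * w * (w ^ h * w ^ h)) + + 2 * (w * w * (w ^ h * w ^ h))
        ≡⟨ lem₂ α w A (w ^ h) s ⟩
      α * (α * A) + w * (w * (w ^ h * w ^ h)) + (α * α * s + (α * w ^ h + y) * (α * w ^ h + y))
        ≡⟨ cong (λ t → α * (α * A) + w * (w * t) + (α * α * s + (α * w ^ h + y) * (α * w ^ h + y))) (even-^ w h) ⟨
      α * (α * A) + w * (w * W) + (α * α * s + (α * w ^ h + y) * (α * w ^ h + y)) ∎)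
    where
      open ≡-Reasoning
      g = geo (suc (h ℕ.* 2)) α w
      W = w ^ (h ℕ.* 2)
      A = α ^ (h ℕ.* 2)
      y = w * w ^ h
      lem₁ : ∀ α w g W → + 2 * (α * (α * g + w * W) + w * (w * W)) ≡ α * α * (+ 2 * g) + + 2 * (α * w * W) + + 2 * (w * w * W)
      lem₁ = solve-∀
      lem₂ : ∀ α w A x s → α * α * (A + x * x + s) + + 2 * (α * w * (x * x)) + + 2 * (w * w * (x * x))
        ≡ α * (α * A) + w * (w * (x * x)) + (α * α * s + (α * x + w * x) * (α * x + w * x))
      lem₂ = solve-∀
      nonneg : + 0 ℤ.≤ α * α * s + (α * w ^ h + y) * (α * w ^ h + y)
      nonneg = 0≤+ℤ 0≤ααs (0≤sqℤ (α * w ^ h + y))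
        where
          0≤ααs : + 0 ℤ.≤ α * α * s
          0≤ααs = subst (ℤ._≤ α * α * s) (ℤₚ.*-zeroʳ (α * α)) (ℤₚ.*-monoˡ-≤-nonNeg (α * α) {{ℤ.nonNegative (0≤sqℤ α)}} 0≤s)

-- Necessity of the two conditions.

module Necessary where
  open import Defs using (sumℤ; Solvable; Cond)
  open import Data.Nat as ℕ using (ℕ; zero; suc; z≤n; s≤s; _%_; _∸_)
  import Data.Nat.Properties as ℕₚ
  import Data.Nat.Divisibility as ∣ℕ
  import Data.Nat.DivMod as ℕ%
  open import Data.Nat.Induction using (<-wellFounded)
  open import Induction.WellFounded using (Acc; acc)
  open import Data.Nat.Primality using (Prime; prime[2]; prime⇒nonTrivial; prime⇒nonZero; prime⇒irreducible)
  open import Data.Integer as ℤ using (ℤ; +_; -[1+_]; _+_; _-_; _*_; -_; _^_; ∣_∣)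
  import Data.Integer.Properties as ℤₚ
  import Data.Integer.DivMod as ℤ%
  open import Data.Integer.Divisibility.Signed using (_∣_; divides; ∣ᵤ⇒∣; ∣⇒∣ᵤ; ∣n⇒∣m*n; ∣m⇒∣m*n; _∣?_; ∣-refl; ∣-trans)
  open import Data.Integer.Tactic.RingSolver using (solve-∀)
  open import Data.Product using (_,_; _×_; proj₁; proj₂; ∃-syntax)
  open import Data.Sum as Sum using (_⊎_; inj₁; inj₂)
  open import Data.Empty using (⊥; ⊥-elim)
  open import Relation.Nullary using (¬_; yes; no)
  open import Relation.Binary.Definitions using (tri<; tri≈; tri>)
  open import Relation.Binary.PropositionalEquality
  open CyclotomicShift using (p∤1)
  open PrimeValues using (∣-cong-mod; prime-divisor)
  open ArithmeticModP

  pos-^ : ∀ p v → (+ p) ^ v ≡ + (p ℕ.^ v)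
  pos-^ p zero    = refl
  pos-^ p (suc v) = trans (cong (+ p *_) (pos-^ p v)) (sym (ℤₚ.pos-* p (p ℕ.^ v)))

  valuationℕ : ∀ {p} → Prime p → ∀ N → N ≢ 0 → ∃[ v ] ∃[ s ] Val p v (+ s) (+ N)
  valuationℕ {p} pp N N≢0 with valuation pp (+ N) (λ e → N≢0 (ℤₚ.+-injective e))
  ... | v , s , e , h = v , ∣ s ∣ , trans (cong (λ t → + ∣ t ∣) e) (trans (cong +_ (ℤₚ.abs-* ((+ p) ^ v) s))
          (trans (ℤₚ.pos-* ∣ (+ p) ^ v ∣ ∣ s ∣) (cong (_* + ∣ s ∣) (trans (cong (λ t → + ∣ t ∣) (pos-^ p v)) (sym (pos-^ p v)))))) ,
          λ d → h (∣abs s d)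

  one-^ : ∀ v → (+ 1) ^ v ≡ + 1
  one-^ = ℤₚ.^-zeroˡ

  [-1]^even : ∀ v → 2 ∣ℕ.∣ v → (- + 1) ^ v ≡ + 1
  [-1]^even v (∣ℕ.divides k refl) = trans (sym (sq-^ (- + 1) k)) (one-^ k)

  mod-4 : ∀ {p} → (+ 4 ∣ + p - + 1) ⊎ p % 4 ≡ 3 ⊎ 2 ∣ℕ.∣ p
  mod-4 {p} = go (p % 4) refl (ℕ%.m%n<n p 4)
    where
      p≡ : p ≡ p % 4 ℕ.+ p ℕ./ 4 ℕ.* 4
      p≡ = ℕ%.m≡m%n+[m/n]*n p 4
      2∣q4 : 2 ∣ℕ.∣ (p ℕ./ 4 ℕ.* 4)
      2∣q4 = ∣ℕ.∣n⇒∣m*n (p ℕ./ 4) (∣ℕ.divides 2 refl)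
      go : ∀ r → p % 4 ≡ r → r ℕ.< 4 → (+ 4 ∣ + p - + 1) ⊎ p % 4 ≡ 3 ⊎ 2 ∣ℕ.∣ p
      go 0 e _ = inj₂ (inj₂ (subst (2 ∣ℕ.∣_) (sym (trans p≡ (cong (ℕ._+ p ℕ./ 4 ℕ.* 4) e))) 2∣q4))
      go 1 e _ = inj₁ (divides (+ (p ℕ./ 4)) (trans (cong (λ t → + t - + 1) (trans p≡ (cong (ℕ._+ p ℕ./ 4 ℕ.* 4) e))) (ℤₚ.pos-* (p ℕ./ 4) 4)))
      go 2 e _ = inj₂ (inj₂ (subst (2 ∣ℕ.∣_) (sym (trans p≡ (cong (ℕ._+ p ℕ./ 4 ℕ.* 4) e))) (∣ℕ.∣m∣n⇒∣m+n (∣ℕ.∣-refl {2}) 2∣q4)))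
      go 3 e _ = inj₂ (inj₁ e)
      go (suc (suc (suc (suc r)))) e (s≤s (s≤s (s≤s (s≤s ()))))

  ≡3-mod-4 : ∀ {p} → p % 4 ≡ 3 → + 4 ∣ + p - - + 1
  ≡3-mod-4 {p} e = divides (+ suc (p ℕ./ 4)) (trans (cong (λ t → + t - - + 1) (trans (ℕ%.m≡m%n+[m/n]*n p 4) (cong (ℕ._+ p ℕ./ 4 ℕ.* 4) e)))
    (trans (cong +_ (ℕₚ.+-comm (3 ℕ.+ p ℕ./ 4 ℕ.* 4) 1)) (ℤₚ.pos-* (suc (p ℕ./ 4)) 4)))

  even∧odd : ∀ {x} → + 2 ∣ x → ¬ (+ 4 ∣ x - + 3)
  even∧odd {x} h k with ∣⇒∣ᵤ (subst (+ 2 ∣_) (lem x) (∣- h (∣-trans (divides (+ 2) refl) k)))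
    where
      lem : ∀ x → x - (x - + 3) ≡ + 3
      lem = solve-∀
  ... | ∣ℕ.divides (suc (suc _)) ()

  prime-∣ : ∀ {p q} → Prime p → Prime q → + q ∣ + p → q ≡ p
  prime-∣ {p} {q} pp pq d with prime⇒irreducible pp (∣⇒∣ᵤ d)
  ... | inj₂ e = e
  ... | inj₁ refl = ⊥-elim (ℕₚ.<-irrefl refl (ℕ.nonTrivial⇒n>1 1 {{prime⇒nonTrivial pq}}))

  OddExponent : ℕ → Set
  OddExponent N = ∃[ p ] ∃[ β ] ∃[ s ] (Prime p × p % 4 ≡ 3 × Val p β s (+ N) × ¬ 2 ∣ℕ.∣ β)

  -- Split off the full power pᵛ of a prime divisor. Either p ≡ 3 (mod 4) and v is odd, or pᵛ ≡ 1
  -- (mod 4) and the smaller cofactor is again ≡ 3.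
  odd-exponent-prime : ∀ N → + 4 ∣ + N - + 3 → OddExponent N
  odd-exponent-prime N h = go N (<-wellFounded N) h
    where
      P : ℕ → Set
      P = OddExponent
      go : ∀ N → Acc ℕ._<_ N → + 4 ∣ + N - + 3 → P N
      go N (acc rs) h = step (prime-divisor N N≢1)
        where
          N≢1 : N ≢ 1
          N≢1 refl with ∣⇒∣ᵤ h
          ... | ∣ℕ.divides zero ()
          ... | ∣ℕ.divides (suc _) ()
          N≢0 : N ≢ 0
          N≢0 refl with ∣⇒∣ᵤ h
          ... | ∣ℕ.divides zero ()
          ... | ∣ℕ.divides (suc _) ()
          step : ∃[ p ] (Prime p × p ∣ℕ.∣ N) → P N
          step (p , pp , p∣N) = use (valuationℕ pp N N≢0) mod-4
            where
              2∤p : ¬ 2 ∣ℕ.∣ p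
              2∤p d = even∧odd {+ N} (∣ᵤ⇒∣ (∣ℕ.∣-trans d p∣N)) h
              use : ∃[ v ] ∃[ s ] Val p v (+ s) (+ N) → (+ 4 ∣ + p - + 1) ⊎ p % 4 ≡ 3 ⊎ 2 ∣ℕ.∣ p → P N
              use _ (inj₂ (inj₂ d)) = ⊥-elim (2∤p d)
              use (zero , s , e , k) _ = ⊥-elim (k (subst (+ p ∣_) (trans e (ℤₚ.*-identityˡ (+ s))) (∣ᵤ⇒∣ p∣N)))
              use (suc v , s , e , k) m = decide m (2 ∣ℕ.∣? suc v)
                where
                  recurse : + 4 ∣ (+ p) ^ suc v - + 1 → P N
                  recurse d = combine (go s (rs s<N) (subst (+ 4 ∣_) eq (∣- h (∣m⇒∣m*n (+ s) d))))
                    where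
                      lem : ∀ x s → (x * s - + 3) - (x - + 1) * s ≡ s - + 3
                      lem = solve-∀
                      eq : + N - + 3 - ((+ p) ^ suc v - + 1) * + s ≡ + s - + 3
                      eq = trans (cong (λ t → t - + 3 - ((+ p) ^ suc v - + 1) * + s) e) (lem ((+ p) ^ suc v) (+ s))
                      N≡ : N ≡ p ℕ.^ suc v ℕ.* s
                      N≡ = ℤₚ.+-injective (trans e (trans (cong (_* + s) (pos-^ p (suc v))) (sym (ℤₚ.pos-* (p ℕ.^ suc v) s))))
                      s≢0 : s ≢ 0
                      s≢0 refl = N≢0 (trans N≡ (ℕₚ.*-zeroʳ (p ℕ.^ suc v)))
                      1<p^ : 1 ℕ.< p ℕ.^ suc v
                      1<p^ = ℕₚ.<-≤-trans (ℕ.nonTrivial⇒n>1 p {{prime⇒nonTrivial pp}}) (ℕₚ.m≤m*n p (p ℕ.^ v) {{ℕₚ.m^n≢0 p v {{prime⇒nonZero pp}}}})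
                      s<N : s ℕ.< N
                      s<N = subst (s ℕ.<_) (trans (ℕₚ.*-comm s (p ℕ.^ suc v)) (sym N≡)) (ℕₚ.m<m*n s (p ℕ.^ suc v) {{ℕ.≢-nonZero s≢0}} 1<p^)
                      combine : P s → P N
                      combine (q , zero , _ , _ , _ , _ , odd) = ⊥-elim (odd (2 ∣ℕ.∣0))
                      combine (q , suc β , s′ , pq , q3 , (e′ , k′) , odd) = q , suc β , (+ p) ^ suc v * s′ , pq , q3 ,
                          (trans e (trans (cong ((+ p) ^ suc v *_) e′) (lem′ ((+ p) ^ suc v) ((+ q) ^ suc β) s′)) , ∤-* pq (∤-^ pq (suc v) q∤p) k′) , odd
                        where
                          lem′ : ∀ x y s → x * (y * s) ≡ y * (x * s)
                          lem′ = solve-∀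
                          q∤p : ¬ (+ q ∣ + p)
                          q∤p d = k (subst (λ t → + t ∣ + s) (prime-∣ pp pq d) (subst (+ q ∣_) (sym e′) (∣p^suc q β s′)))
                  decide : (+ 4 ∣ + p - + 1) ⊎ p % 4 ≡ 3 ⊎ 2 ∣ℕ.∣ p → _ → P N
                  decide (inj₁ d) _ = recurse (subst (λ t → + 4 ∣ (+ p) ^ suc v - t) (one-^ (suc v)) (^-mod (+ 4) (suc v) (+ p) (+ 1) d))
                  decide (inj₂ (inj₁ p3)) (no odd) = p , suc v , + s , pp , p3 , (e , k) , odd
                  decide (inj₂ (inj₁ p3)) (yes even) = recurse (subst (λ t → + 4 ∣ (+ p) ^ suc v - t) ([-1]^even (suc v) even) (^-mod (+ 4) (suc v) (+ p) (- + 1) (≡3-mod-4 p3)))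
                  decide (inj₂ (inj₂ d)) _ = ⊥-elim (2∤p d)

  -- For n ≡ 2 (mod 4) and w odd only the last two terms of Σ nᵃ⁻¹⁻ⁱwⁱ survive modulo 4.
  geo-≡3 : ∀ h n w → + 4 ∣ n - + 2 → + 2 ∣ w - + 1 → + 4 ∣ geo (suc (suc h ℕ.* 2)) n w - + 3
  geo-≡3 h n w (divides s es) (divides t et) = subst (+ 4 ∣_) (sym eq) (∣+ (∣+ (∣m⇒∣m*n ((+ 1 + s * + 2) * (+ 1 + s * + 2) * g) ∣-refl) ∣W) (∣m⇒∣m*n ((s + t + + 2 * s * t + t + t * t) * W) ∣-refl))
    where
      g = geo (suc (h ℕ.* 2)) n w
      W = w ^ (h ℕ.* 2)
      w≡ : w ≡ + 1 + t * + 2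
      w≡ = trans (lem w) (cong (λ u → + 1 + u) et)
        where
          lem : ∀ w → w ≡ + 1 + (w - + 1)
          lem = solve-∀
      n≡ : n ≡ + 2 + s * + 4
      n≡ = trans (lem n) (cong (λ u → + 2 + u) es)
        where
          lem : ∀ n → n ≡ + 2 + (n - + 2)
          lem = solve-∀
      4∣w²-1 : + 4 ∣ w * w - + 1
      4∣w²-1 = divides (t + t * t) (trans (cong (λ u → u * u - + 1) w≡) (lem t))
        where
          lem : ∀ t → (+ 1 + t * + 2) * (+ 1 + t * + 2) - + 1 ≡ (t + t * t) * + 4
          lem = solve-∀
      ∣W : + 4 ∣ + 3 * (W - + 1)
      ∣W = ∣n⇒∣m*n (+ 3) (subst₂ (λ a b → + 4 ∣ a - b) (sq-^ w h) (one-^ h) (^-mod (+ 4) h (w * w) (+ 1) 4∣w²-1))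
      lem : ∀ s t g W → (+ 2 + s * + 4) * ((+ 2 + s * + 4) * g + (+ 1 + t * + 2) * W) + (+ 1 + t * + 2) * ((+ 1 + t * + 2) * W) - + 3
        ≡ + 4 * ((+ 1 + s * + 2) * (+ 1 + s * + 2) * g) + + 3 * (W - + 1) + + 4 * ((s + t + + 2 * s * t + t + t * t) * W)
      lem = solve-∀
      eq : geo (suc (suc h ℕ.* 2)) n w - + 3 ≡ + 4 * ((+ 1 + s * + 2) * (+ 1 + s * + 2) * g) + + 3 * (W - + 1) + + 4 * ((s + t + + 2 * s * t + t + t * t) * W)
      eq = trans (cong (_- + 3) (trans (geo-last (suc (suc (h ℕ.* 2))) n w) (cong (λ u → n * u + w ^ suc (suc (h ℕ.* 2))) (geo-last (suc (h ℕ.* 2)) n w))))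
        (trans (cong₂ (λ n w → n * (n * g + w * W) + w * (w * W) - + 3) n≡ w≡) (lem s t g W))

  geo-pos : ∀ h n w → n ≢ + 0 → + 0 ℤ.< geo (suc (h ℕ.* 2)) n w
  geo-pos h n w n≢0 with geo-positive h n w
  ... | s , 0≤s , e = ℤₚ.*-cancelˡ-<-nonNeg (+ 2) (subst (ℤ._< + 2 * geo (suc (h ℕ.* 2)) n w) refl
        (subst (+ 0 ℤ.<_) (sym e) (ℤₚ.<-≤-trans 0<nn (ℤₚ.≤-trans (ℤₚ.≤-reflexive (sym (ℤₚ.+-identityʳ _)))
          (ℤₚ.≤-trans (ℤₚ.+-monoʳ-≤ (n ^ (h ℕ.* 2)) (0≤+ℤ (subst (+ 0 ℤ.≤_) (sym (even-^ w h)) (0≤sqℤ (w ^ h))) 0≤s))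
            (ℤₚ.≤-reflexive (sym (ℤₚ.+-assoc (n ^ (h ℕ.* 2)) (w ^ (h ℕ.* 2)) s))))))))
    where
      0<nn : + 0 ℤ.< n ^ (h ℕ.* 2)
      0<nn = ℤₚ.≤∧≢⇒< (subst (+ 0 ℤ.≤_) (sym (even-^ n h)) (0≤sqℤ (n ^ h))) λ z → n≢0 (ℤₚ.i^n≡0⇒i≡0 n (h ℕ.* 2) (sym z))

  module Local (h b : ℕ) (pa : Prime (suc (h ℕ.* 2))) (a≡1 : suc (h ℕ.* 2) % 4 ≡ 1) (n z : ℤ) (n≢0 : n ≢ + 0)
               {p : ℕ} (pp : Prime p) (p≡3 : p % 4 ≡ 3) where
    a a′ : ℕ
    a = suc (h ℕ.* 2)
    a′ = h ℕ.* 2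

    2∣v*a′ : ∀ v → 2 ∣ℕ.∣ v ℕ.* a′
    2∣v*a′ v = ∣ℕ.∣n⇒∣m*n v (∣ℕ.∣n⇒∣m*n h ∣ℕ.∣-refl)

    p∤a : ¬ (+ p ∣ + a)
    p∤a d with prime-∣ pa pp d
    ... | refl with trans (sym a≡1) p≡3
    ...   | ()

    module _ (w : ℤ) (w≡ : w ≡ z ^ b)
             (β α : ℕ) (s t : ℤ) (vF : Val p β s (geo a n w)) (vn-w : Val p α t (n - w))
             (β-odd : ¬ 2 ∣ℕ.∣ β) (α-odd : ¬ 2 ∣ℕ.∣ α)
             (hyp : ∀ v r → + p ∣ n → Val p v r n → ¬ b ∣ℕ.∣ v ⊎ 2 ∣ℕ.∣ v ⊎ ¬ (∃[ z′ ] (z′ ℕ.< p × + p ∣ geo a r ((+ z′) ^ b)))) where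
      private
        odd⇒p∣ : ∀ {β s x} → Val p β s x → ¬ 2 ∣ℕ.∣ β → + p ∣ x
        odd⇒p∣ {zero}          (e , _) odd = ⊥-elim (odd (2 ∣ℕ.∣0))
        odd⇒p∣ {suc β} {s} {x} (e , _) odd = subst (+ p ∣_) (sym e) (∣p^suc p β s)

        p∣F : + p ∣ geo a n w
        p∣F = odd⇒p∣ vF β-odd
        p∣n-w : + p ∣ n - w
        p∣n-w = odd⇒p∣ vn-w α-odd

        neg-diff : ∀ x y → + p ∣ x - y → + p ∣ y - x
        neg-diff x y d = subst (+ p ∣_) (lem x y) (∣- ∣0 d)
          where
            lem : ∀ x y → + 0 - (x - y) ≡ y - x
            lem = solve-∀

        -- modulo p, w ≡ α makes Σ αᵃ⁻¹⁻ⁱwⁱ ≡ a αᵃ⁻¹.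
        p∣⇒p∣α : ∀ α w → + p ∣ α - w → + p ∣ geo a α w → + p ∣ α
        p∣⇒p∣α α w d e with + p ∣? α
        ... | yes q = q
        ... | no q = ⊥-elim (∤-* pp p∤a (∤-^ pp a′ q) (∣-cong-mod (geo a α w) (+ a * α ^ a′) (geo-mod (+ p) a′ α w (neg-diff α w d)) e))

        p∣n : + p ∣ n
        p∣n = p∣⇒p∣α n w p∣n-w p∣F

        -- As a - 1 is even, p would have the even exponent v(a - 1) in the sum, against `β-odd`.
        -- The three comparisons of n with w below all end here or in the hypothesis at p.
        not-even-multiple : ∀ v u → ¬ (+ p ∣ u) → geo a n w ≢ ((+ p) ^ v) ^ a′ * u
        not-even-multiple v u k e = β-odd (subst (2 ∣ℕ.∣_) (sym (proj₁ (valuation-unique pp β (v ℕ.* a′) s u (proj₂ vF) k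
          (trans (sym (proj₁ vF)) (trans e (cong (_* u) (ℤₚ.^-*-assoc (+ p) v a′))))))) (2∣v*a′ v))

        module _ (v : ℕ) (r : ℤ) (vn : Val p v r n) where
          -- If w has the larger exponent, taking out pᵛ leaves a sum ≡ r^(a-1), a unit modulo p.
          -- `w-low` is the mirror image, with the last summand as the unit.
          w-high : ∀ w′ → w ≢ (+ p) ^ v * (+ p * w′)
          w-high w′ e = not-even-multiple v (geo a r (+ p * w′)) (geo-unitˡ pp a′ r (+ p * w′) (proj₂ vn) (∣m⇒∣m*n w′ ∣-refl))
            (trans (cong₂ (geo a) (proj₁ vn) e) (geo-scale a′ ((+ p) ^ v) r (+ p * w′)))

          w-low : ∀ x r′ w₀ → ¬ (+ p ∣ w₀) → n ≡ (+ p) ^ x * (+ p * r′) → w ≢ (+ p) ^ x * w₀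
          w-low x r′ w₀ k e e′ = not-even-multiple x (geo a (+ p * r′) w₀) (geo-unitʳ pp a′ (+ p * r′) w₀ (∣m⇒∣m*n r′ ∣-refl) k)
            (trans (cong₂ (geo a) e e′) (geo-scale a′ ((+ p) ^ x) (+ p * r′) w₀))

          -- With equal exponents the remaining sum must vanish modulo p, so z₀ reduces to the root
          -- that the hypothesis speaks of. Then p does not divide r - z₀^b, so v is the exponent of
          -- p in n - w and hence odd; and b ∣ v. All three alternatives of the hypothesis fail.
          w-equal : ∀ u z₀ → v ≡ u ℕ.* b → w ≢ (+ p) ^ v * z₀ ^ b
          w-equal u z₀ v≡ub e = use (hyp v r p∣n vn)
            where
              w₀ = z₀ ^ b
              F≡ : geo a n w ≡ ((+ p) ^ v) ^ a′ * geo a r w₀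
              F≡ = trans (cong₂ (geo a) (proj₁ vn) e) (geo-scale a′ ((+ p) ^ v) r w₀)
              p∣geo : + p ∣ geo a r w₀
              p∣geo with + p ∣? geo a r w₀
              ... | yes d = d
              ... | no k = ⊥-elim (not-even-multiple v (geo a r w₀) k F≡)
              p∤r-w₀ : ¬ (+ p ∣ r - w₀)
              p∤r-w₀ d = proj₂ vn (p∣⇒p∣α r w₀ d p∣geo)
              v≡α : α ≡ v
              v≡α = proj₁ (valuation-unique pp α v t (r - w₀) (proj₂ vn-w) p∤r-w₀ (trans (sym (proj₁ vn-w)) (trans (cong₂ _-_ (proj₁ vn) e) (lem ((+ p) ^ v) r w₀))))
                where
                  lem : ∀ x r w → x * r - x * w ≡ x * (r - w)
                  lem = solve-∀
              instance _ = prime⇒nonZero pp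
              z′ : ℕ
              z′ = z₀ ℤ%.%ℕ p
              z′-mod : + p ∣ z₀ - + z′
              z′-mod = divides (z₀ ℤ%./ℕ p) (trans (cong (_- + z′) (ℤ%.a≡a%ℕn+[a/ℕn]*n z₀ p)) (lem (+ z′) _))
                where
                  lem : ∀ x y → x + y - x ≡ y
                  lem = solve-∀
              use : ¬ b ∣ℕ.∣ v ⊎ 2 ∣ℕ.∣ v ⊎ ¬ (∃[ z′ ] (z′ ℕ.< p × + p ∣ geo a r ((+ z′) ^ b))) → ⊥
              use (inj₁ b∤v) = b∤v (∣ℕ.divides u v≡ub)
              use (inj₂ (inj₁ 2∣v)) = α-odd (subst (2 ∣ℕ.∣_) (sym v≡α) 2∣v)
              use (inj₂ (inj₂ none)) = none (z′ , ℤ%.n%ℕd<d z₀ p ,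
                ∣-cong-mod (geo a r w₀) (geo a r ((+ z′) ^ b)) (geo-cong-mod a {r} {r} {w₀} {(+ z′) ^ b} (subst (+ p ∣_) (sym (ℤₚ.+-inverseʳ r)) ∣0) (^-mod (+ p) b z₀ (+ z′) z′-mod)) p∣geo)

          finish : ⊥
          finish with z ℤ.≟ + 0
          ... | yes refl = w-zero b w≡
            where
              w-zero : ∀ b → w ≡ (+ 0) ^ b → ⊥
              -- For b = 0 one has w = 1, and p divides both n and n - w.
              w-zero zero    e = p∤1 pp (subst (+ p ∣_) (trans e refl) (∣-cong-mod n w p∣n-w p∣n))
              w-zero (suc b) e = w-high (+ 0) (trans e (lem ((+ p) ^ v) (+ p)))
                where
                  lem : ∀ x p → + 0 ≡ x * (p * + 0)
                  lem = solve-∀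
          ... | no z≢0 = compare (valuation pp z z≢0)
            where
              ^-split : ∀ x d → (+ p) ^ (suc x ℕ.+ d) ≡ (+ p) ^ x * (+ p * (+ p) ^ d)
              ^-split x d = trans (ℤₚ.^-distribˡ-+-* (+ p) (suc x) d) (lem (+ p) ((+ p) ^ x) ((+ p) ^ d))
                where
                  lem : ∀ p x y → p * x * y ≡ x * (p * y)
                  lem = solve-∀
              compare : ∃[ u ] ∃[ z₀ ] Val p u z₀ z → ⊥
              compare (u , z₀ , e , k) = cases (ℕₚ.<-cmp v (u ℕ.* b))
                where
                  w≡′ : w ≡ (+ p) ^ (u ℕ.* b) * z₀ ^ b
                  w≡′ = trans w≡ (trans (cong (_^ b) e) (trans (*-^ ((+ p) ^ u) z₀ b) (cong (_* z₀ ^ b) (ℤₚ.^-*-assoc (+ p) u b))))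
                  cases : _ → ⊥
                  cases (tri< lt _ _) = w-high ((+ p) ^ (u ℕ.* b ∸ suc v) * z₀ ^ b)
                    (trans w≡′ (trans (cong (λ x → (+ p) ^ x * z₀ ^ b) (sym (ℕₚ.m+[n∸m]≡n lt))) (trans (cong (_* z₀ ^ b) (^-split v (u ℕ.* b ∸ suc v)))
                      (lem ((+ p) ^ v) (+ p) ((+ p) ^ (u ℕ.* b ∸ suc v)) (z₀ ^ b)))))
                    where
                      lem : ∀ x p y z → x * (p * y) * z ≡ x * (p * (y * z))
                      lem = solve-∀
                  cases (tri≈ _ eq _) = w-equal u z₀ eq (trans w≡′ (cong (λ x → (+ p) ^ x * z₀ ^ b) (sym eq)))
                  cases (tri> _ _ gt) = w-low (u ℕ.* b) ((+ p) ^ (v ∸ suc (u ℕ.* b)) * r) (z₀ ^ b) (∤-^ pp b k)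
                    (trans (proj₁ vn) (trans (cong (λ x → (+ p) ^ x * r) (sym (ℕₚ.m+[n∸m]≡n gt))) (trans (cong (_* r) (^-split (u ℕ.* b) (v ∸ suc (u ℕ.* b))))
                      (lem ((+ p) ^ (u ℕ.* b)) (+ p) ((+ p) ^ (v ∸ suc (u ℕ.* b))) r)))) w≡′
                    where
                      lem : ∀ x p y z → x * (p * y) * z ≡ x * (p * (y * z))
                      lem = solve-∀

      contradiction : ⊥
      contradiction with valuation pp n n≢0
      ... | v , r , vn = finish v r vn

  ≡1-form : ∀ {a} → Prime a → a % 4 ≡ 1 → ∃[ h ] a ≡ suc (suc h ℕ.* 2)
  ≡1-form {a} pa e = go (a ℕ./ 4) refl
    where
      a≡ : a ≡ 1 ℕ.+ a ℕ./ 4 ℕ.* 4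
      a≡ = trans (ℕ%.m≡m%n+[m/n]*n a 4) (cong (ℕ._+ a ℕ./ 4 ℕ.* 4) e)
      go : ∀ q → a ℕ./ 4 ≡ q → ∃[ h ] a ≡ suc (suc h ℕ.* 2)
      go zero    eq = ⊥-elim (ℕₚ.<-irrefl (sym (trans a≡ (cong (λ t → 1 ℕ.+ t ℕ.* 4) eq))) (ℕ.nonTrivial⇒n>1 a {{prime⇒nonTrivial pa}}))
      go (suc q) eq = suc (q ℕ.* 2) , trans a≡ (trans (cong (λ t → 1 ℕ.+ t ℕ.* 4) eq) (cong suc (sym (ℕₚ.*-assoc (suc q) 2 2))))

  parity : ∀ z → (+ 2 ∣ z) ⊎ (+ 2 ∣ z - + 1)
  parity z = go (z ℤ%.%ℕ 2) refl (ℤ%.n%ℕd<d z 2)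
    where
      z≡ : z ≡ + (z ℤ%.%ℕ 2) + (z ℤ%./ℕ 2) * + 2
      z≡ = ℤ%.a≡a%ℕn+[a/ℕn]*n z 2
      lem : ∀ q → + 1 + q * + 2 - + 1 ≡ q * + 2
      lem = solve-∀
      go : ∀ r → z ℤ%.%ℕ 2 ≡ r → r ℕ.< 2 → (+ 2 ∣ z) ⊎ (+ 2 ∣ z - + 1)
      go 0 e _ = inj₁ (divides (z ℤ%./ℕ 2) (trans z≡ (trans (cong (λ r → + r + (z ℤ%./ℕ 2) * + 2) e) (ℤₚ.+-identityˡ _))))
      go 1 e _ = inj₂ (divides (z ℤ%./ℕ 2) (trans (cong (_- + 1) (trans z≡ (cong (λ r → + r + (z ℤ%./ℕ 2) * + 2) e))) (lem (z ℤ%./ℕ 2))))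
      go (suc (suc r)) e (s≤s (s≤s ()))

  p∤2 : ∀ {p} → Prime p → p % 4 ≡ 3 → ¬ (+ p ∣ + 2)
  p∤2 pp p3 d with prime-∣ prime[2] pp d
  ... | refl with p3
  ...   | ()

  2∤1 : ¬ (+ 2 ∣ + 1)
  2∤1 = p∤1 prime[2]

  positive-form : ∀ {x} → + 0 ℤ.< x → ∃[ N ] x ≡ + suc N
  positive-form {+ suc N} _ = N , refl
  positive-form {+ zero} (ℤ.+<+ ())
  positive-form { -[1+ _ ]} ()

  cofactor-nonneg : ∀ {x y} → + 0 ℤ.< x → + 0 ℤ.≤ x * y → + 0 ℤ.≤ y
  cofactor-nonneg {x} {+ n}       _ _ = ℤ.+≤+ z≤n
  cofactor-nonneg {+ suc m} { -[1+ n ]} _ ()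
  cofactor-nonneg {+ zero} (ℤ.+<+ ())
  cofactor-nonneg { -[1+ _ ]} ()

  geo-sum : ∀ a b r z → sumℤ a (λ i → r ^ (a ∸ 1 ∸ i) * z ^ (i ℕ.* b)) ≡ geo a r (z ^ b)
  geo-sum a b r z = trans (sumℤ-cong a _ _ λ i _ → cong (r ^ (a ∸ 1 ∸ i) *_) (trans (cong (z ^_) (ℕₚ.*-comm i b)) (sym (ℤₚ.^-*-assoc z b i))))
    (sumℤ≡geo a r (z ^ b))

  local-contradiction : ∀ {a h b n z p} → a ≡ suc (suc h ℕ.* 2) → Prime a → a % 4 ≡ 1 → n ≢ + 0 → Prime p → p % 4 ≡ 3 →
    ∀ {β α s t} → Val p β s (geo a n (z ^ b)) → Val p α t (n - z ^ b) → ¬ 2 ∣ℕ.∣ β → ¬ 2 ∣ℕ.∣ α →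
    (∀ v r → + p ∣ n → Val p v r n → ¬ b ∣ℕ.∣ v ⊎ 2 ∣ℕ.∣ v ⊎ ¬ (∃[ z′ ] (z′ ℕ.< p × + p ∣ geo a r ((+ z′) ^ b)))) → ⊥
  local-contradiction {_} {h} {b} {n} {z} refl pa a1 n≢0 pp p3 {β} {α} {s} {t} vF vW ob oa hyp =
    Local.contradiction (suc h) b pa a1 n z n≢0 pp p3 (z ^ b) refl β α s t vF vW ob oa hyp

  geo-pos′ : ∀ {a} h → a ≡ suc (suc h ℕ.* 2) → ∀ n w → n ≢ + 0 → + 0 ℤ.< geo a n w
  geo-pos′ h refl = geo-pos (suc h)

  geo-≡3′ : ∀ {a} h → a ≡ suc (suc h ℕ.* 2) → ∀ n w → + 4 ∣ n - + 2 → + 2 ∣ w - + 1 → + 4 ∣ geo a n w - + 3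
  geo-≡3′ h refl = geo-≡3 h

  8∣even-power : ∀ {b} k {z} → b ≡ suc (suc k ℕ.* 2) → + 2 ∣ z → + 8 ∣ z ^ b
  8∣even-power k {z} refl (divides z₁ z≡) = divides (z₁ * z₁ * z₁ * z ^ (k ℕ.* 2)) (trans (cong (λ t → t * (t * (t * z ^ (k ℕ.* 2)))) z≡) (lem z₁ (z ^ (k ℕ.* 2))))
    where
      lem : ∀ z t → z * + 2 * (z * + 2 * (z * + 2 * t)) ≡ z * z * z * t * + 8
      lem = solve-∀

  necessity : ∀ {a b} → Prime a → Prime b → a % 4 ≡ 1 → b % 4 ≡ 1 → ∀ {m} → Solvable (a ℕ.* b) m → Cond a b m
  necessity {a} {b} pa pb a1 b1 {m} (x , y , z , sol) (n , n6 , m≡ , cond) = split (parity z)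
    where
      h k : ℕ
      h = proj₁ (≡1-form pa a1)
      k = proj₁ (≡1-form pb b1)
      a≡ : a ≡ suc (suc h ℕ.* 2)
      a≡ = proj₂ (≡1-form pa a1)
      w F : ℤ
      w = z ^ b
      F = geo a n w
      n2 : + 4 ∣ n - + 2
      n2 = subst (+ 4 ∣_) (lem n) (∣+ {x = n - + 6} (∣-trans (divides (+ 2) refl) (∣ᵤ⇒∣ n6)) (∣-refl {+ 4}))
        where
          lem : ∀ n → n - + 6 + + 4 ≡ n - + 2
          lem = solve-∀
      2∣n : + 2 ∣ n
      2∣n = subst (+ 2 ∣_) (lem n) (∣+ (∣-trans (divides (+ 2) refl) n2) (∣-refl {+ 2}))
        where
          lem : ∀ n → n - + 2 + + 2 ≡ n
          lem = solve-∀
      n≢0 : n ≢ + 0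
      n≢0 refl with ∣⇒∣ᵤ n2
      ... | ∣ℕ.divides zero ()
      ... | ∣ℕ.divides (suc _) ()
      sum-sq : F * (n - w) ≡ x * x + y * y
      sum-sq = begin
        F * (n - w)                          ≡⟨ geo-* a n w ⟩
        n ^ a - w ^ a                        ≡⟨ cong₂ _-_ (sym m≡) (trans (ℤₚ.^-*-assoc z b a) (cong (z ^_) (ℕₚ.*-comm b a))) ⟩
        m - z ^ (a ℕ.* b)                    ≡⟨ cong (_- z ^ (a ℕ.* b)) sol ⟨
        x ^ 2 + y ^ 2 + z ^ (a ℕ.* b) - z ^ (a ℕ.* b) ≡⟨ lem x y (z ^ (a ℕ.* b)) ⟩
        x * x + y * y                        ∎
        where
          open ≡-Reasoning
          lem : ∀ x y t → x * (x * + 1) + y * (y * + 1) + t - t ≡ x * x + y * y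
          lem = solve-∀
      F>0 : + 0 ℤ.< F
      F>0 = geo-pos′ h a≡ n w n≢0
      -- The exponent of p in x² + y² = F (n - w) is even, so it is odd in both factors once it is
      -- odd in one.
      finish : ∀ {p} β α {s t} → Prime p → p % 4 ≡ 3 → Val p β s F → Val p α t (n - w) → (¬ 2 ∣ℕ.∣ β) ⊎ (¬ 2 ∣ℕ.∣ α) → ⊥
      finish {p} β α {s} {t} pp p3 vF@(eF , kF) vW@(eW , kW) odd = local-contradiction {a} {h} {b} {n} {z} a≡ pa a1 n≢0 pp p3 {β} {α} {s} {t} vF vW
          (λ e → Sum.[ (λ o → o e) , (λ o → o (∣ℕ.∣m+n∣m⇒∣n even e)) ] odd)
          (λ e → Sum.[ (λ o → o (∣ℕ.∣m+n∣m⇒∣n (subst (2 ∣ℕ.∣_) (ℕₚ.+-comm β α) even) e)) , (λ o → o e) ] odd)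
          (λ v r p∣n vn → Sum.map₂ (Sum.map₂ (λ none (z′ , lt , d) → none (z′ , lt , ∣⇒∣ᵤ (subst (+ p ∣_) (sym (geo-sum a b r (+ z′))) d))))
            (cond p v r pp p3 (∣⇒∣ᵤ p∣n) (proj₁ vn) (λ d → proj₂ vn (∣ᵤ⇒∣ d))))
        where
          even : 2 ∣ℕ.∣ β ℕ.+ α
          even = sum-of-squares-even pp p3 (β ℕ.+ α) x y (s * t) (∤-* pp kF kW)
            (trans (sym sum-sq) (trans (cong₂ _*_ eF eW) (trans (lem ((+ p) ^ β) s ((+ p) ^ α) t) (cong (_* (s * t)) (sym (ℤₚ.^-distribˡ-+-* (+ p) β α))))))
            where
              lem : ∀ a s b t → a * s * (b * t) ≡ a * b * (s * t)
              lem = solve-∀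
      split : (+ 2 ∣ z) ⊎ (+ 2 ∣ z - + 1) → ⊥
      -- For odd z the prime is found in F, which is positive and ≡ 3 (mod 4).
      split (inj₂ z-odd) = odd-case (positive-form F>0)
        where
          w-odd : + 2 ∣ w - + 1
          w-odd = subst (λ t → + 2 ∣ w - t) (one-^ b) (^-mod (+ 2) b z (+ 1) z-odd)
          n-w≢0 : n - w ≢ + 0
          n-w≢0 e = 2∤1 (subst (+ 2 ∣_) (lem n w) (∣- (∣- 2∣n w-odd) (subst (+ 2 ∣_) (sym e) ∣0)))
            where
              lem : ∀ n w → n - (w - + 1) - (n - w) ≡ + 1
              lem = solve-∀
          odd-case : ∃[ N ] F ≡ + suc N → ⊥
          odd-case (N , F≡) = use (odd-exponent-prime (suc N) (subst (λ t → + 4 ∣ t - + 3) F≡ (geo-≡3′ h a≡ n w n2 w-odd)))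
            where
              use : OddExponent (suc N) → ⊥
              use (p , β , s , pp , p3 , (e , k) , odd) = go (valuation pp (n - w) n-w≢0)
                where
                  go : ∃[ α ] ∃[ t ] Val p α t (n - w) → ⊥
                  go (α , t , v) = finish β α pp p3 (trans F≡ e , k) v (inj₁ odd)
      -- For even z, b ≥ 3 gives 8 ∣ w, and the prime is found in (n - w)/2 ≡ 3 (mod 4).
      split (inj₁ z-even) = even-case (∣ᵤ⇒∣ n6) (8∣even-power k (proj₂ (≡1-form pb b1)) z-even)
        where
          even-case : + 8 ∣ n - + 6 → + 8 ∣ w → ⊥
          even-case (divides i ei) (divides j ej) = go (N-form)
            where
              lem : ∀ n w → n - w ≡ + 6 + (n - + 6) - w
              lem = solve-∀
              lem′ : ∀ i j → + 6 + i * + 8 - j * + 8 ≡ + 2 * (+ 3 + + 4 * (i - j))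
              lem′ = solve-∀
              n-w≡ : n - w ≡ + 2 * (+ 3 + + 4 * (i - j))
              n-w≡ = trans (lem n w) (trans (cong₂ (λ a b → + 6 + a - b) ei ej) (lem′ i j))
              -- The sign matters: the absolute value of a negative number ≡ 3 (mod 4) is ≡ 1 and
              -- may have no suitable prime. It comes from F > 0 and F (n - w) ≥ 0.
              n-w≥0 : + 0 ℤ.≤ + 2 * (+ 3 + + 4 * (i - j))
              n-w≥0 = subst (+ 0 ℤ.≤_) n-w≡ (cofactor-nonneg F>0 (subst (+ 0 ℤ.≤_) (sym sum-sq) (0≤+ℤ (0≤sqℤ x) (0≤sqℤ y))))
              N-form : ∃[ N ] + 3 + + 4 * (i - j) ≡ + N
              N-form = ∣ + 3 + + 4 * (i - j) ∣ , sym (ℤₚ.0≤i⇒+∣i∣≡i (cofactor-nonneg {+ 2} {+ 3 + + 4 * (i - j)} (ℤ.+<+ (s≤s z≤n)) n-w≥0))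
              F≢0 : F ≢ + 0
              F≢0 e = ℤₚ.<-irrefl (sym e) F>0
              lem″ : ∀ t → + 3 + + 4 * t - + 3 ≡ t * + 4
              lem″ = solve-∀
              go : ∃[ N ] + 3 + + 4 * (i - j) ≡ + N → ⊥
              go (N , N≡) = use (odd-exponent-prime N (subst (λ t → + 4 ∣ t - + 3) N≡ (divides (i - j) (lem″ (i - j)))))
                where
                  lem‴ : ∀ x t → + 2 * (x * t) ≡ x * (+ 2 * t)
                  lem‴ = solve-∀
                  use : OddExponent N → ⊥
                  use (p , α , t , pp , p3 , (e , k) , odd) = go′ (valuation pp F F≢0)
                    where
                      go′ : ∃[ β ] ∃[ s ] Val p β s F → ⊥
                      go′ (β , s , v) = finish β α pp p3 v (trans n-w≡ (trans (cong (+ 2 *_) (trans N≡ e)) (lem‴ ((+ p) ^ α) t)) , ∤-* pp (p∤2 pp p3) k) (inj₂ odd)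

-- From prime values of the factors of m + y^k to solutions.

module PrimeSpecialisations where
  open import Defs using (Solvable; HypothesisH; evalZ)
  open import Data.Nat as ℕ using (ℕ; zero; suc; z≤n; s≤s; _%_)
  import Data.Nat.Properties as ℕₚ
  open import Data.Nat.Primality using (Prime; prime[2])
  open import Data.Integer as ℤ using (ℤ; +_; -[1+_]; _+_; _-_; _*_; -_; _^_; ∣_∣)
  import Data.Integer.Properties as ℤₚ
  open import Data.Integer.Divisibility.Signed using (_∣_; divides; ∣m⇒∣m*n; ∣-refl; ∣-trans)
  open import Data.Integer.Tactic.RingSolver using (solve-∀)
  open import Data.List using (List; []; _∷_)
  open import Data.List.Relation.Unary.All using (All; []; _∷_)
  open import Data.Product using (_,_; _×_; proj₁; proj₂; ∃-syntax)
  open import Data.Empty using (⊥)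
  import Data.Sum as Sum
  open import Relation.Nullary using (¬_)
  open import Relation.Binary.PropositionalEquality
  open PolynomialRings
  open WeightedReciprocals
  open GeometricPolynomials
  open IntegersInRationals
  open PureBinomials using (module PQ; NotPower; RootFree; pure-irreducible; prime-rootFree; /1≢0; squareRoot)
  open CyclotomicShift using (module PZ; module GZ; module GQ; euclidℤ; p∤1)
  open SparsePolynomials using (sparse-irreducible)
  open PrimeValues
  open Fermat using (prime-two-squares)
  open ArithmeticModP
  open Necessary using (one-^; pos-^; prime-∣; 2∤1)
  open BoundedSequences using (module DQ)
  open Maps.Hom ζ using (mapP; map-comp)

  SumSq : ℤ → Set
  SumSq n = ∃[ x ] ∃[ y ] n ≡ x * x + y * y

  sumSq-* : ∀ {m n} → SumSq m → SumSq n → SumSq (m * n)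
  sumSq-* (x , y , refl) (u , v , refl) = x * u - y * v , x * v + y * u , lem x y u v
    where
      lem : ∀ x y u v → (x * x + y * y) * (u * u + v * v) ≡ (x * u - y * v) * (x * u - y * v) + (x * v + y * u) * (x * v + y * u)
      lem = solve-∀

  sumSq-prime : ∀ {p} → Prime p → p % 4 ≡ 1 → SumSq (+ p)
  sumSq-prime pp e with prime-two-squares pp e
  ... | x , y , refl = + x , + y , trans (ℤₚ.pos-+ (x ℕ.* x) (y ℕ.* y)) (cong₂ _+_ (ℤₚ.pos-* x x) (ℤₚ.pos-* y y))

  neg-odd-^ : ∀ {k} h → k ≡ suc (h ℕ.* 2) → ∀ x → (- x) ^ k ≡ - (x ^ k)
  neg-odd-^ h refl x = neg-odd-power x h

  solution : ∀ {k h} m y → k ≡ suc (h ℕ.* 2) → SumSq (m + y ^ k) → Solvable k m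
  solution {k} {h} m y k≡ (u , v , e) = u , v , - y , (begin
      u ^ 2 + v ^ 2 + (- y) ^ k          ≡⟨ cong (λ t → u ^ 2 + v ^ 2 + t) (neg-odd-^ h k≡ y) ⟩
      u ^ 2 + v ^ 2 - y ^ k              ≡⟨ lem u v (y ^ k) ⟩
      (u * u + v * v) - y ^ k            ≡⟨ cong (_- y ^ k) e ⟨
      m + y ^ k - y ^ k                  ≡⟨ lem′ m (y ^ k) ⟩
      m                                  ∎)
    where
      open ≡-Reasoning
      lem : ∀ u v t → u * (u * + 1) + v * (v * + 1) - t ≡ (u * u + v * v) - t
      lem = solve-∀
      lem′ : ∀ m t → m + t - t ≡ m
      lem′ = solve-∀

  pow≡^ : ∀ x n → DZ.pow x n ≡ x ^ n
  pow≡^ x zero    = refl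
  pow≡^ x (suc n) = cong (x *_) (pow≡^ x n)

  map-monoζ : ∀ n → mapP (DZ.mono n) ≡ DQ.mono n
  map-monoζ zero    = refl
  map-monoζ (suc n) = cong ((+ 0) /1 ∷_) (map-monoζ n)

  map-phiζ : ∀ α j → mapP (GZ.phi α j) PQ.≋ GQ.phi (α /1) j
  map-phiζ α zero    = PQ.≋-refl
  map-phiζ α (suc j) = PQ.∷-cong (trans (cong _/1 (pow≡^ α j)) (sym (/1-pow α j))) (map-phiζ α j)

  evalZ-phi : ∀ α j w → evalZ (GZ.phi α j) w ≡ geo j α w
  evalZ-phi α zero    w = refl
  evalZ-phi α (suc j) w = cong₂ (λ s t → s + w * t) (pow≡^ α j) (evalZ-phi α j w)

  pure : ℤ → ℕ → PZ.Poly
  pure m k = m ∷ DZ.mono k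

  evalZ-pure : ∀ m k y → evalZ (pure m k) y ≡ m + y ^ suc k
  evalZ-pure m k y = cong (λ t → m + y * t) (evalZ-mono k y)

  -- Σ (-n)^(a-1-i) X^(bi), for odd a the cofactor of X^b + n in X^(ab) + n^a.
  spread : ℤ → ℕ → ℕ → PZ.Poly
  spread n a b = PZ.comp (DZ.mono b) (GZ.phi (- n) a)

  evalZ-spread : ∀ n a b y → evalZ (spread n a b) y ≡ geo a (- n) (y ^ b)
  evalZ-spread n a b y = trans (evalZ-comp y (DZ.mono b) (GZ.phi (- n) a)) (trans (evalZ-phi (- n) a _) (cong (geo a (- n)) (evalZ-mono b y)))

  n≤n^suc : ∀ n k → suc n ℕ.≤ suc n ℕ.^ suc k
  n≤n^suc n k = ℕₚ.m≤m*n (suc n) (suc n ℕ.^ k) {{ℕₚ.m^n≢0 (suc n) k}}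

  ≤-power : ∀ y k → + 1 ℤ.≤ y → y ℤ.≤ y ^ suc k
  ≤-power (+ suc y) k _ = ℤₚ.≤-trans (ℤ.+≤+ (n≤n^suc y k)) (ℤₚ.≤-reflexive (sym (pos-^ (suc y) (suc k))))
  ≤-power (+ zero) k (ℤ.+≤+ ())
  ≤-power -[1+ _ ] k ()

  grows-pure : ∀ m k → Grows (pure m k)
  grows-pure m k B = + suc (∣ B ∣ ℕ.+ ∣ m ∣) , λ y le → subst (B ℤ.≤_) (sym (evalZ-pure m k y)) (begin
      B                              ≤⟨ i≤∣i∣ B ⟩
      + ∣ B ∣                        ≡⟨ ℤₚ.+-identityˡ _ ⟨
      + 0 + + ∣ B ∣                  ≤⟨ ℤₚ.+-monoˡ-≤ (+ ∣ B ∣) (0≤i+∣i∣ m) ⟩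
      m + + ∣ m ∣ + + ∣ B ∣          ≡⟨ ℤₚ.+-assoc m (+ ∣ m ∣) (+ ∣ B ∣) ⟩
      m + + (∣ m ∣ ℕ.+ ∣ B ∣)        ≤⟨ ℤₚ.+-monoʳ-≤ m (ℤ.+≤+ (ℕₚ.≤-trans (ℕₚ.≤-reflexive (ℕₚ.+-comm ∣ m ∣ ∣ B ∣)) (ℕₚ.n≤1+n _))) ⟩
      m + + suc (∣ B ∣ ℕ.+ ∣ m ∣)    ≤⟨ ℤₚ.+-monoʳ-≤ m (ℤₚ.≤-trans le (≤-power y k (ℤₚ.≤-trans (ℤ.+≤+ (s≤s z≤n)) le))) ⟩
      m + y ^ suc k                  ∎)
    where open ℤₚ.≤-Reasoning

  -- By `geo-positive` twice the value is at least w^(a-1) with w = y^b, and for y ≥ 1 this is at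
  -- least y.
  grows-spread : ∀ n h b′ → Grows (spread n (suc (suc h ℕ.* 2)) (suc b′))
  grows-spread n h b′ B = + suc (∣ + 2 * B ∣) , λ y le → subst (B ℤ.≤_) (sym (evalZ-spread n a (suc b′) y)) (ℤₚ.*-cancelˡ-≤-pos B (geo a (- n) (y ^ suc b′)) (+ 2) (large y le))
    where
      open ℤₚ.≤-Reasoning
      a : ℕ
      a = suc (suc h ℕ.* 2)
      large : ∀ y → + suc (∣ + 2 * B ∣) ℤ.≤ y → + 2 * B ℤ.≤ + 2 * geo a (- n) (y ^ suc b′)
      large y le = begin
          + 2 * B                       ≤⟨ i≤∣i∣ (+ 2 * B) ⟩
          + ∣ + 2 * B ∣                 ≤⟨ ℤ.+≤+ (ℕₚ.n≤1+n _) ⟩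
          + suc (∣ + 2 * B ∣)           ≤⟨ le ⟩
          y                             ≤⟨ ≤-power y b′ 1≤y ⟩
          w                             ≤⟨ ≤-power w (suc (h ℕ.* 2)) (ℤₚ.≤-trans 1≤y (≤-power y b′ 1≤y)) ⟩
          w ^ (suc h ℕ.* 2)             ≡⟨ ℤₚ.+-identityˡ _ ⟨
          + 0 + w ^ (suc h ℕ.* 2)       ≤⟨ ℤₚ.+-monoˡ-≤ _ (subst (+ 0 ℤ.≤_) (sym (even-^ (- n) (suc h))) (0≤sqℤ ((- n) ^ suc h))) ⟩
          (- n) ^ (suc h ℕ.* 2) + w ^ (suc h ℕ.* 2)   ≡⟨ ℤₚ.+-identityʳ _ ⟨
          (- n) ^ (suc h ℕ.* 2) + w ^ (suc h ℕ.* 2) + + 0   ≤⟨ ℤₚ.+-monoʳ-≤ ((- n) ^ (suc h ℕ.* 2) + w ^ (suc h ℕ.* 2)) (proj₁ (proj₂ gp)) ⟩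
          (- n) ^ (suc h ℕ.* 2) + w ^ (suc h ℕ.* 2) + proj₁ gp   ≡⟨ proj₂ (proj₂ gp) ⟨
          + 2 * geo a (- n) w           ∎
        where
          w = y ^ suc b′
          1≤y = ℤₚ.≤-trans (ℤ.+≤+ (s≤s z≤n)) le
          gp = geo-positive (suc h) (- n) w

  0^suc : ∀ k → (+ 0) ^ suc k ≡ + 0
  0^suc k = ℤₚ.*-zeroˡ ((+ 0) ^ k)

  odd-unit : ∀ {w} → + 4 ∣ w - + 1 → ¬ (+ 2 ∣ w)
  odd-unit {w} h d = 2∤1 (subst (+ 2 ∣_) (lem w) (∣- d (∣-trans (divides (+ 2) refl) h)))
    where
      lem : ∀ w → w - (w - + 1) ≡ + 1
      lem = solve-∀

  unit-4G : ∀ {w} G → + 4 ∣ w - + 1 → (∀ {ℓ} → Prime ℓ → + ℓ ∣ G → ¬ (+ ℓ ∣ w)) → ∀ {ℓ} → Prime ℓ → + ℓ ∣ + 4 * G → ¬ (+ ℓ ∣ w)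
  unit-4G {w} G h u {ℓ} pℓ d e = Sum.[ four , (λ g → u pℓ g e) ] (euclidℤ pℓ (+ 4) G d)
    where
      two : + ℓ ∣ + 2 → ⊥
      two g = odd-unit h (subst (λ t → + t ∣ w) (prime-∣ prime[2] pℓ g) e)
      four : + ℓ ∣ + 4 → ⊥
      four g = Sum.[ two , two ] (euclidℤ pℓ (+ 2) (+ 2) g)

  nonzero-values-coprime : ∀ {ℓ} k → Prime ℓ → ∀ m → + ℓ ∣ m + (+ 0) ^ suc k → + ℓ ∣ m + (+ 1) ^ suc k → ⊥
  nonzero-values-coprime {ℓ} k pℓ m h₀ h₁ = p∤1 pℓ (subst (+ ℓ ∣_) (lem m) (∣- (subst (λ t → + ℓ ∣ m + t) (one-^ (suc k)) h₁) (subst (λ t → + ℓ ∣ m + t) (0^suc k) h₀)))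
    where
      lem : ∀ m → m + + 1 - (m + + 0) ≡ + 1
      lem = solve-∀

  odd-product : ∀ {a b i j} → a ≡ suc (i ℕ.* 2) → b ≡ suc (j ℕ.* 2) → a ℕ.* b ≡ suc ((j ℕ.+ i ℕ.* b) ℕ.* 2)
  odd-product {_} {b} {i} {j} refl b≡ = trans (cong (ℕ._+ (i ℕ.* 2) ℕ.* b) b≡) (cong suc (trans
    (cong (j ℕ.* 2 ℕ.+_) (trans (ℕₚ.*-assoc i 2 b) (trans (cong (i ℕ.*_) (ℕₚ.*-comm 2 b)) (sym (ℕₚ.*-assoc i b 2)))))
    (sym (ℕₚ.*-distribʳ-+ 2 j (i ℕ.* b)))))

  case-irreducible : ∀ k h → suc k ≡ suc (h ℕ.* 2) → ∀ m → m ≢ + 0 → RootFree (suc k) ∣ m ∣ →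
    ∀ c G′ w → + suc G′ * w ≡ m + c ^ suc k → + 4 ∣ w - + 1 → (∀ {ℓ} → Prime ℓ → + ℓ ∣ + suc G′ → ¬ (+ ℓ ∣ w)) → SumSq (+ suc G′) →
    HypothesisH → Solvable (suc k) m
  case-irreducible k h k≡ m m≢0 free c G′ w fc w1 u ss H = finish (prime-values (piece ∷ []) coprime H)
    where
      -- The modulus is the successor of this number, that is 4G: dividing by the fixed divisor G
      -- leaves w + 4t(...), still ≡ 1 (mod 4).
      open Progression c (3 ℕ.+ 4 ℕ.* G′)
      d≡ : d ≡ + 4 * + suc G′
      d≡ = trans (cong +_ (sym (ℕₚ.*-suc 4 G′))) (ℤₚ.pos-* 4 (suc G′))
      piece : Piece
      piece = record
        { f = pure m k ; G′ = G′ ; w = w ; D = + 4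
        ; f-c = trans fc (sym (evalZ-pure m k c)) ; GD = trans (ℤₚ.*-comm (+ suc G′) (+ 4)) (sym d≡)
        ; 4∣D = ∣-refl ; 4∣w-1 = w1
        ; unit = λ {ℓ} pℓ ℓ∣d → unit-4G (+ suc G′) w1 u pℓ (subst (+ ℓ ∣_) d≡ ℓ∣d)
        ; irr = λ p q e → pure-irreducible k m m≢0 free p q (PQ.≋-trans e (subst (λ t → (m /1 ∷ t) PQ.≋ (m /1 ∷ DQ.mono k)) (sym (map-monoζ k)) PQ.≋-refl))
        ; grows = grows-pure m k }
      coprime : ∀ {ℓ} → Prime ℓ → + ℓ ∣ values (piece ∷ []) (+ 0) → + ℓ ∣ values (piece ∷ []) (+ 1) → ⊥
      coprime {ℓ} pℓ h₀ h₁ = nonzero-values-coprime k pℓ m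
        (subst (+ ℓ ∣_) (trans (ℤₚ.*-identityʳ _) (evalZ-pure m k (+ 0))) h₀) (subst (+ ℓ ∣_) (trans (ℤₚ.*-identityʳ _) (evalZ-pure m k (+ 1))) h₁)
      finish : ∃[ y ] All (PrimeValue (piece ∷ []) coprime y) (piece ∷ []) → Solvable (suc k) m
      finish (y , (p , pp , p1 , e) ∷ []) = solution {suc k} {h} m y k≡
        (subst SumSq (trans (sym e) (evalZ-pure m k y)) (sumSq-* ss (sumSq-prime pp p1)))

  -- Only the product of the two fixed divisors has to be a sum of two squares; this leaves room for
  -- a prime ≡ 3 (mod 4) with an odd exponent in each of them.
  case-reducible : ∀ a′ b′ h → suc a′ ≡ suc (suc h ℕ.* 2) → ∀ j → suc b′ ≡ suc (j ℕ.* 2) →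
    Prime (suc a′) → Prime (suc b′) → suc b′ ≢ 2 → ∀ n → n ≢ + 0 → NotPower (suc b′) ∣ n ∣ →
    ∀ c G₁ G₂ w₁ w₂ → + suc G₁ * w₁ ≡ n + c ^ suc b′ → + suc G₂ * w₂ ≡ geo (suc a′) (- n) (c ^ suc b′) →
    + 4 ∣ w₁ - + 1 → + 4 ∣ w₂ - + 1 →
    (∀ {ℓ} → Prime ℓ → + ℓ ∣ + suc G₁ * + suc G₂ → ¬ (+ ℓ ∣ w₁) × ¬ (+ ℓ ∣ w₂)) → SumSq (+ suc G₁ * + suc G₂) →
    HypothesisH → Solvable (suc a′ ℕ.* suc b′) (n ^ suc a′)
  case-reducible a′ b′ h a≡ j b≡ pa pb b≢2 n n≢0 np c G₁ G₂ w₁ w₂ f₁c f₂c w₁1 w₂1 u ss H = finish (prime-values ps coprime H)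
    where
      a b k : ℕ
      a = suc a′
      b = suc b′
      k = b′ ℕ.+ a′ ℕ.* b
      G : ℕ
      -- So that `suc G` computes to `suc G₁ ℕ.* suc G₂`. With modulus 4G₁G₂ the increments after
      -- division by G₁ and G₂ are multiples of 4G₂ and 4G₁.
      G = G₂ ℕ.+ G₁ ℕ.* suc G₂
      open Progression c (3 ℕ.+ 4 ℕ.* G)
      d≡ : d ≡ + 4 * (+ suc G₁ * + suc G₂)
      d≡ = trans (cong +_ (sym (ℕₚ.*-suc 4 G))) (trans (ℤₚ.pos-* 4 (suc G)) (cong (+ 4 *_) (ℤₚ.pos-* (suc G₁) (suc G₂))))
      instance
        n-nonzero : ℕ.NonZero ∣ n ∣
        n-nonzero = ℕ.≢-nonZero λ z → n≢0 (ℤₚ.∣i∣≡0⇒i≡0 z)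
      -n≢0 : - n ≢ + 0
      -n≢0 e = n≢0 (ℤₚ.neg-injective e)
      lem₁ : ∀ x y → x * (+ 4 * y) ≡ + 4 * (x * y)
      lem₁ = solve-∀
      lem₂ : ∀ x y → y * (+ 4 * x) ≡ + 4 * (x * y)
      lem₂ = solve-∀
      grows₂ : ∀ {a′} → suc a′ ≡ suc (suc h ℕ.* 2) → Grows (spread n (suc a′) b)
      grows₂ refl = grows-spread n h b′
      piece₁ piece₂ : Piece
      piece₁ = record
        { f = pure n b′ ; G′ = G₁ ; w = w₁ ; D = + 4 * + suc G₂
        ; f-c = trans f₁c (sym (evalZ-pure n b′ c)) ; GD = trans (lem₁ (+ suc G₁) (+ suc G₂)) (sym d≡)
        ; 4∣D = ∣m⇒∣m*n (+ suc G₂) ∣-refl ; 4∣w-1 = w₁1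
        ; unit = λ {ℓ} pℓ ℓ∣d → unit-4G (+ suc G₁ * + suc G₂) w₁1 (λ q e → proj₁ (u q e)) pℓ (subst (+ ℓ ∣_) d≡ ℓ∣d)
        ; irr = λ p q e → pure-irreducible b′ n n≢0 (prime-rootFree pb b≢2 np) p q (PQ.≋-trans e (subst (λ t → (n /1 ∷ t) PQ.≋ (n /1 ∷ DQ.mono b′)) (sym (map-monoζ b′)) PQ.≋-refl))
        ; grows = grows-pure n b′ }
      piece₂ = record
        { f = spread n a b ; G′ = G₂ ; w = w₂ ; D = + 4 * + suc G₁
        ; f-c = trans f₂c (sym (evalZ-spread n a b c)) ; GD = trans (lem₂ (+ suc G₁) (+ suc G₂)) (sym d≡)
        ; 4∣D = ∣m⇒∣m*n (+ suc G₁) ∣-refl ; 4∣w-1 = w₂1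
        ; unit = λ {ℓ} pℓ ℓ∣d → unit-4G (+ suc G₁ * + suc G₂) w₂1 (λ q e → proj₂ (u q e)) pℓ (subst (+ ℓ ∣_) d≡ ℓ∣d)
        ; irr = λ p q e → sparse-irreducible a′ b′ pa pb b≢2 (- n) -n≢0 (subst (NotPower b) (sym (ℤₚ.∣-i∣≡∣i∣ n)) np) (squareRoot b′ ((- n) /1) (/1≢0 -n≢0)) p q
            (PQ.≋-trans e (PQ.≋-trans (map-comp (DZ.mono b) (GZ.phi (- n) a)) (PQ.≋-trans
              (PQ.comp-cong (mapP (DZ.mono b)) (map-phiζ (- n) a))
              (subst (λ t → PQ.comp t (GQ.phi ((- n) /1) a) PQ.≋ PQ.comp (DQ.mono b) (GQ.phi ((- n) /1) a)) (sym (map-monoζ b)) PQ.≋-refl))))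
        ; grows = grows₂ a≡ }
      ps : List Piece
      ps = piece₁ ∷ piece₂ ∷ []
      factor : ∀ y → evalZ (pure n b′) y * evalZ (spread n a b) y ≡ n ^ a + y ^ (a ℕ.* b)
      factor y = begin
        evalZ (pure n b′) y * evalZ (spread n a b) y   ≡⟨ cong₂ _*_ (evalZ-pure n b′ y) (evalZ-spread n a b y) ⟩
        (n + w) * geo a (- n) w                        ≡⟨ lem n w (geo a (- n) w) ⟩
        - (geo a (- n) w * (- n - w))                  ≡⟨ cong -_ (geo-* a (- n) w) ⟩
        - ((- n) ^ a - w ^ a)                          ≡⟨ cong (λ t → - (t - w ^ a)) (neg-odd-^ (suc h) a≡ n) ⟩
        - (- (n ^ a) - w ^ a)                          ≡⟨ lem′ (n ^ a) (w ^ a) ⟩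
        n ^ a + w ^ a                                  ≡⟨ cong (λ t → n ^ a + t) (trans (ℤₚ.^-*-assoc y b a) (cong (y ^_) (ℕₚ.*-comm b a))) ⟩
        n ^ a + y ^ (a ℕ.* b)                          ∎
        where
          open ≡-Reasoning
          w = y ^ b
          lem : ∀ n w g → (n + w) * g ≡ - (g * (- n - w))
          lem = solve-∀
          lem′ : ∀ x y → - (- x - y) ≡ x + y
          lem′ = solve-∀
      values≡ : ∀ y → values ps y ≡ n ^ a + y ^ suc k
      values≡ y = trans (cong (evalZ (pure n b′) y *_) (ℤₚ.*-identityʳ (evalZ (spread n a b) y))) (factor y)
      coprime : ∀ {ℓ} → Prime ℓ → + ℓ ∣ values ps (+ 0) → + ℓ ∣ values ps (+ 1) → ⊥
      coprime {ℓ} pℓ h₀ h₁ = nonzero-values-coprime k pℓ (n ^ a)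
        (subst (+ ℓ ∣_) (values≡ (+ 0)) h₀) (subst (+ ℓ ∣_) (values≡ (+ 1)) h₁)
      finish : ∃[ y ] All (PrimeValue ps coprime y) ps → Solvable (a ℕ.* b) (n ^ a)
      finish (y , (p , pp , p1 , e) ∷ (q , pq , q1 , e′) ∷ []) = solution {a ℕ.* b} {j ℕ.+ suc h ℕ.* b} (n ^ a) y (odd-product {a} {b} {suc h} {j} a≡ b≡)
        (subst SumSq (trans (lem (+ suc G₁) (+ suc G₂) (+ p) (+ q)) (trans (sym (cong₂ _*_ e e′)) (factor y)))
          (sumSq-* ss (sumSq-* (sumSq-prime pp p1) (sumSq-prime pq q1))))
        where
          lem : ∀ a b p q → a * b * (p * q) ≡ a * p * (b * q)
          lem = solve-∀

-- Choice of the progression in each residue class, and sufficiency.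

module Sufficient where
  open import Defs using (Solvable; Cond; HypothesisH; sumℤ)
  open import Data.Nat as ℕ using (ℕ; zero; suc; z≤n; s≤s; _%_; _∸_)
  import Data.Nat.Properties as ℕₚ
  import Data.Nat.Divisibility as ∣ℕ
  open import Data.Nat.Primality using (Prime; prime[2]; prime?; prime⇒nonZero)
  open import Data.Integer as ℤ using (ℤ; +_; -[1+_]; _+_; _-_; _*_; -_; _^_; ∣_∣)
  import Data.Integer.Properties as ℤₚ
  import Data.Integer.DivMod as ℤ%
  import Data.Integer.Divisibility as ∣ᵤ
  open import Data.Integer.Divisibility.Signed using (_∣_; divides; ∣ᵤ⇒∣; ∣⇒∣ᵤ; ∣m⇒∣-m; ∣n⇒∣m*n; ∣m⇒∣m*n; _∣?_; ∣-refl; ∣-trans)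
  open import Data.Integer.Tactic.RingSolver using (solve-∀)
  open import Data.Product using (_,_; _×_; proj₁; proj₂; ∃; ∃-syntax)
  open import Data.Sum as Sum using (_⊎_; inj₁; inj₂)
  open import Data.Empty using (⊥; ⊥-elim)
  open import Relation.Nullary using (¬_; Dec; yes; no)
  open import Relation.Nullary.Decidable using (map′)
  open import Relation.Binary.PropositionalEquality
  open IntegersInRationals using (∣^∣)
  open PureBinomials using (NotPower; product-rootFree)
  open CyclotomicShift using (p∤1)
  open PrimeValues using (∣-cong-mod)
  open ArithmeticModP
  open Necessary
  open PrimeSpecialisations

  geo-1,-1 : ∀ h → geo (suc (h ℕ.* 2)) (+ 1) (- + 1) ≡ + 1
  geo-1,-1 zero    = refl
  geo-1,-1 (suc h) = trans (cong₂ (λ s t → s + - + 1 * t) (one-^ (suc h ℕ.* 2)) (cong₂ (λ s t → s + - + 1 * t) (one-^ (suc (h ℕ.* 2))) (geo-1,-1 h))) refl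

  geo-0 : ∀ k α → geo (suc k) α (+ 0) ≡ α ^ k
  geo-0 k α = ℤₚ.+-identityʳ (α ^ k)

  geo-0,1 : ∀ k → geo (suc k) (+ 0) (+ 1) ≡ + 1
  geo-0,1 k = trans (geo-last k (+ 0) (+ 1)) (trans (cong (_+ (+ 1) ^ k) (ℤₚ.*-zeroˡ (geo k (+ 0) (+ 1)))) (trans (ℤₚ.+-identityˡ _) (one-^ k)))

  geo-neg : ∀ h α w → geo (suc (h ℕ.* 2)) (- α) (- w) ≡ geo (suc (h ℕ.* 2)) α w
  geo-neg h α w = trans (cong₂ (geo (suc (h ℕ.* 2))) (sym (ℤₚ.-1*i≡-i α)) (sym (ℤₚ.-1*i≡-i w))) (trans (geo-scale (h ℕ.* 2) (- + 1) α w)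
    (trans (cong (_* geo (suc (h ℕ.* 2)) α w) ([-1]^even (h ℕ.* 2) (∣ℕ.divides h refl))) (ℤₚ.*-identityˡ _)))

  even-^-mod : ∀ d h x → d ∣ x * x - + 1 → d ∣ x ^ (h ℕ.* 2) - + 1
  even-^-mod d h x k = subst₂ (λ s t → d ∣ s - t) (sq-^ x h) (one-^ h) (^-mod d h (x * x) (+ 1) k)

  odd-^-mod : ∀ d h x → d ∣ x * x - + 1 → d ∣ x ^ suc (h ℕ.* 2) - x
  odd-^-mod d h x k = subst (d ∣_) (lem x (x ^ (h ℕ.* 2))) (∣n⇒∣m*n x (even-^-mod d h x k))
    where
      lem : ∀ x t → x * (t - + 1) ≡ x * t - x
      lem = solve-∀

  odd-form : ∀ v → ¬ 2 ∣ℕ.∣ v → ∃[ i ] v ≡ suc (i ℕ.* 2)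
  odd-form zero          h = ⊥-elim (h (2 ∣ℕ.∣0))
  odd-form (suc zero)    h = 0 , refl
  odd-form (suc (suc v)) h with odd-form v (λ d → h (∣ℕ.∣m∣n⇒∣m+n (∣ℕ.∣-refl {2}) d))
  ... | i , refl = suc i , refl

  [-1]^odd : ∀ i → (- + 1) ^ suc (i ℕ.* 2) ≡ - + 1
  [-1]^odd i = cong (- + 1 *_) ([-1]^even (i ℕ.* 2) (∣ℕ.divides i refl))

  -- The first-order Taylor expansion of X^(k+1) at z, modulo p².
  taylor : ∀ p k z → p * p ∣ (z + p) ^ suc k - z ^ suc k - + suc k * (z ^ k * p)
  taylor p zero z = subst (p * p ∣_) (lem p z) ∣0
    where
      lem : ∀ p z → + 0 ≡ (z + p) * + 1 - z * + 1 - + 1 * (+ 1 * p)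
      lem = solve-∀
  taylor p (suc k) z = subst (p * p ∣_) (trans (lem p z ((z + p) ^ suc k) (z ^ k) (+ suc k))
      (cong (λ t → (z + p) * (z + p) ^ suc k - z * (z * z ^ k) - t * (z * z ^ k * p)) (sym (ℤₚ.pos-+ 1 (suc k)))))
      (∣+ (∣n⇒∣m*n (z + p) (taylor p k z)) (∣m⇒∣m*n (+ suc k * z ^ k) ∣-refl))
    where
      lem : ∀ p z y x n → (z + p) * (y - z * x - n * (x * p)) + p * p * (n * x) ≡ (z + p) * y - z * (z * x) - (+ 1 + n) * (z * x * p)
      lem = solve-∀

  -- For n ≡ 2 (mod 4) the class of n/2 modulo 4 decides, hence the two classes modulo 8.
  data Residue (n : ℤ) : Set where
    r0 : + 4 ∣ n → Residue n
    r1 : + 4 ∣ n - + 1 → Residue n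
    r3 : + 4 ∣ n - + 3 → Residue n
    r2 : + 8 ∣ n - + 2 → Residue n
    r6 : + 8 ∣ n - + 6 → Residue n

  residue : ∀ n → Residue n
  residue n = go (n ℤ%.%ℕ 8) refl (ℤ%.n%ℕd<d n 8)
    where
      q : ℤ
      q = n ℤ%./ℕ 8
      n≡ : ∀ {r} → n ℤ%.%ℕ 8 ≡ r → n ≡ + r + q * + 8
      n≡ e = trans (ℤ%.a≡a%ℕn+[a/ℕn]*n n 8) (cong (λ r → + r + q * + 8) e)
      l0 : ∀ q → + 0 + q * + 8 ≡ + 2 * q * + 4
      l0 = solve-∀
      l1 : ∀ q → + 1 + q * + 8 - + 1 ≡ + 2 * q * + 4
      l1 = solve-∀
      l2 : ∀ q → + 2 + q * + 8 - + 2 ≡ q * + 8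
      l2 = solve-∀
      l3 : ∀ q → + 3 + q * + 8 - + 3 ≡ + 2 * q * + 4
      l3 = solve-∀
      l4 : ∀ q → + 4 + q * + 8 ≡ (+ 1 + + 2 * q) * + 4
      l4 = solve-∀
      l5 : ∀ q → + 5 + q * + 8 - + 1 ≡ (+ 1 + + 2 * q) * + 4
      l5 = solve-∀
      l6 : ∀ q → + 6 + q * + 8 - + 6 ≡ q * + 8
      l6 = solve-∀
      l7 : ∀ q → + 7 + q * + 8 - + 3 ≡ (+ 1 + + 2 * q) * + 4
      l7 = solve-∀
      go : ∀ r → n ℤ%.%ℕ 8 ≡ r → r ℕ.< 8 → Residue n
      go 0 e _ = r0 (divides (+ 2 * q) (trans (n≡ e) (l0 q)))
      go 1 e _ = r1 (divides (+ 2 * q) (trans (cong (_- + 1) (n≡ e)) (l1 q)))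
      go 2 e _ = r2 (divides q (trans (cong (_- + 2) (n≡ e)) (l2 q)))
      go 3 e _ = r3 (divides (+ 2 * q) (trans (cong (_- + 3) (n≡ e)) (l3 q)))
      go 4 e _ = r0 (divides (+ 1 + + 2 * q) (trans (n≡ e) (l4 q)))
      go 5 e _ = r1 (divides (+ 1 + + 2 * q) (trans (cong (_- + 1) (n≡ e)) (l5 q)))
      go 6 e _ = r6 (divides q (trans (cong (_- + 6) (n≡ e)) (l6 q)))
      go 7 e _ = r3 (divides (+ 1 + + 2 * q) (trans (cong (_- + 3) (n≡ e)) (l7 q)))
      go (suc (suc (suc (suc (suc (suc (suc (suc r)))))))) e (s≤s (s≤s (s≤s (s≤s (s≤s (s≤s (s≤s (s≤s ()))))))))

  sumSq-1 : SumSq (+ 1)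
  sumSq-1 = + 1 , + 0 , refl

  ≡1⇒≢2 : ∀ {b} → b % 4 ≡ 1 → b ≢ 2
  ≡1⇒≢2 e refl with e
  ... | ()

  square-mod-8 : ∀ n → + 4 ∣ n - + 3 → + 8 ∣ (+ 2 - n) * (+ 2 - n) - + 1
  square-mod-8 n (divides i e) = divides (i + + 2 * (i * i)) (trans (cong (λ t → (+ 2 - t) * (+ 2 - t) - + 1) n≡) (lem i))
    where
      lem′ : ∀ n → n ≡ + 3 + (n - + 3)
      lem′ = solve-∀
      n≡ : n ≡ + 3 + i * + 4
      n≡ = trans (lem′ n) (cong (λ t → + 3 + t) e)
      lem : ∀ i → (+ 2 - (+ 3 + i * + 4)) * (+ 2 - (+ 3 + i * + 4)) - + 1 ≡ (i + + 2 * (i * i)) * + 8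
      lem = solve-∀

  module Power (h k : ℕ) (a b : ℕ) (a≡ : a ≡ suc (suc h ℕ.* 2)) (b≡ : b ≡ suc (suc k ℕ.* 2))
               (pa : Prime a) (pb : Prime b) (a1 : a % 4 ≡ 1) (b1 : b % 4 ≡ 1)
               (n : ℤ) (n≢0 : n ≢ + 0) (np : NotPower b ∣ n ∣) (H : HypothesisH) where
    a′ : ℕ
    a′ = suc h ℕ.* 2

    Goal : Set
    Goal = Solvable (a ℕ.* b) (n ^ a)

    solve : ∀ c g₁ g₂ w₁ w₂ → + 0 ℤ.< g₁ → + 0 ℤ.< g₂ → g₁ * w₁ ≡ n + c ^ b → g₂ * w₂ ≡ geo a (- n) (c ^ b) →
      + 4 ∣ w₁ - + 1 → + 4 ∣ w₂ - + 1 →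
      (∀ {ℓ} → Prime ℓ → + ℓ ∣ g₁ * g₂ → ¬ (+ ℓ ∣ w₁) × ¬ (+ ℓ ∣ w₂)) → SumSq (g₁ * g₂) → Goal
    solve c g₁ g₂ w₁ w₂ 0<g₁ 0<g₂ e₁ e₂ m₁ m₂ u ss = go (positive-form 0<g₁) (positive-form 0<g₂) a≡ b≡
      where
        go : ∃[ G₁ ] g₁ ≡ + suc G₁ → ∃[ G₂ ] g₂ ≡ + suc G₂ → a ≡ suc (suc h ℕ.* 2) → b ≡ suc (suc k ℕ.* 2) → Goal
        go (G₁ , refl) (G₂ , refl) refl refl = case-reducible (suc h ℕ.* 2) (suc k ℕ.* 2) h refl (suc k) refl pa pb (≡1⇒≢2 b1) n n≢0 np
          c G₁ G₂ w₁ w₂ e₁ e₂ m₁ m₂ u ss H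

    solve-1 : ∀ c → + 4 ∣ n + c ^ b - + 1 → + 4 ∣ geo a (- n) (c ^ b) - + 1 → Goal
    solve-1 c m₁ m₂ = solve c (+ 1) (+ 1) _ _ (ℤ.+<+ (s≤s z≤n)) (ℤ.+<+ (s≤s z≤n)) (ℤₚ.*-identityˡ (n + c ^ b)) (ℤₚ.*-identityˡ (geo a (- n) (c ^ b))) m₁ m₂
      (λ pℓ d → ⊥-elim (p∤1 pℓ d)) sumSq-1

    0^b : (+ 0) ^ b ≡ + 0
    0^b = trans (cong ((+ 0) ^_) b≡) (0^suc (suc k ℕ.* 2))

    -- At c = 0 the factors are n and (-n)^(a-1) with a - 1 even, both ≡ 1 (mod 4).
    case-r1 : + 4 ∣ n - + 1 → Goal
    case-r1 d = solve-1 (+ 0) (subst (λ t → + 4 ∣ n + t - + 1) (sym 0^b) (subst (λ t → + 4 ∣ t - + 1) (sym (ℤₚ.+-identityʳ n)) d))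
        (subst₂ (λ t s → + 4 ∣ geo t (- n) s - + 1) (sym a≡) (sym 0^b) (subst (λ t → + 4 ∣ t - + 1) (sym (geo-0 a′ (- n)))
          (even-^-mod (+ 4) (suc h) (- n) (subst (+ 4 ∣_) (lem n) (∣n⇒∣m*n (n + + 1) d)))))
      where
        lem : ∀ n → (n + + 1) * (n - + 1) ≡ - n * - n - + 1
        lem = solve-∀

    -- At c = 1 the factors are n + 1 and a sum of which modulo 4 only the last term, 1, remains.
    case-r0 : + 4 ∣ n → Goal
    case-r0 d = solve-1 (+ 1) (subst (λ t → + 4 ∣ n + t - + 1) (sym (one-^ b)) (subst (+ 4 ∣_) (lem n) d))
        (subst₂ (λ t s → + 4 ∣ geo t (- n) s - + 1) (sym a≡) (sym (one-^ b)) (subst (λ t → + 4 ∣ geo (suc a′) (- n) (+ 1) - t) (geo-0,1 a′)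
          (geo-cong-mod (suc a′) { - n} {+ 0} {+ 1} {+ 1} (subst (+ 4 ∣_) (lem′ n) (∣- ∣0 d)) ∣0)))
      where
        lem : ∀ n → n ≡ n + + 1 - + 1
        lem = solve-∀
        lem′ : ∀ n → + 0 - n ≡ - n - + 0
        lem′ = solve-∀

    prime-∣2 : ∀ {ℓ} → Prime ℓ → + ℓ ∣ + 2 → ∀ {w} → + 4 ∣ w - + 1 → ¬ (+ ℓ ∣ w)
    prime-∣2 pℓ d {w} m e = odd-unit m (subst (λ t → + t ∣ w) (prime-∣ prime[2] pℓ d) e)

    -- For c = 2 - n, odd, c^b ≡ c (mod 8) since b is odd. So n + c^b ≡ 2 (mod 8), which gives the
    -- fixed divisor 2 = 1² + 1². Modulo 4 the second factor is the alternating sum at -n ≡ 1 and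
    -- c^b ≡ -1, whose value is 1.
    case-r3 : + 4 ∣ n - + 3 → Goal
    case-r3 d = go (subst (λ t → + 8 ∣ (+ 2 - n) ^ t - (+ 2 - n)) (sym b≡) (odd-^-mod (+ 8) (suc k) (+ 2 - n) (square-mod-8 n d)))
      where
        c : ℤ
        c = + 2 - n
        go : + 8 ∣ c ^ b - c → Goal
        go (divides i e) = solve c (+ 2) (+ 1) (+ 1 + i * + 4) (geo a (- n) (c ^ b)) (ℤ.+<+ (s≤s z≤n)) (ℤ.+<+ (s≤s z≤n))
            (trans (lem i) (trans (cong (λ t → + 2 + t) (sym e)) (lem′ n (c ^ b)))) (ℤₚ.*-identityˡ _)
            m₁ m₂
            (λ pℓ g → prime-∣2 pℓ g m₁ , prime-∣2 pℓ g m₂) (+ 1 , + 1 , refl)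
          where
            lem : ∀ i → + 2 * (+ 1 + i * + 4) ≡ + 2 + i * + 8
            lem = solve-∀
            lem′ : ∀ n x → + 2 + (x - (+ 2 - n)) ≡ n + x
            lem′ = solve-∀
            lem₁ : ∀ i → + 1 + i * + 4 - + 1 ≡ i * + 4
            lem₁ = solve-∀
            m₁ : + 4 ∣ + 1 + i * + 4 - + 1
            m₁ = divides i (lem₁ i)
            lem₂ : ∀ n → - (n - + 3) - + 4 ≡ - n - + 1
            lem₂ = solve-∀
            lem₃ : ∀ n x → x - (+ 2 - n) - (n - + 3) ≡ x - - + 1
            lem₃ = solve-∀
            m₂ : + 4 ∣ geo a (- n) (c ^ b) - + 1
            m₂ = subst (λ t → + 4 ∣ geo t (- n) (c ^ b) - + 1) (sym a≡) (subst (λ t → + 4 ∣ geo (suc a′) (- n) (c ^ b) - t) (geo-1,-1 (suc h))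
              (geo-cong-mod (suc a′) { - n} {+ 1} {c ^ b} { - + 1} (subst (+ 4 ∣_) (lem₂ n) (∣- (∣m⇒∣-m d) (∣-refl {+ 4})))
                (subst (+ 4 ∣_) (lem₃ n (c ^ b)) (∣- (∣-trans (divides (+ 2) refl) (divides i e)) d))))

    -- At c = 0 with n = 2n₁, n₁ ≡ 1 (mod 4), the factors are 2n₁ and 2^(a-1)(-n₁)^(a-1). The fixed
    -- divisors multiply to 2^a = x² + x² with x = 2^((a-1)/2).
    case-r2 : + 8 ∣ n - + 2 → Goal
    case-r2 (divides i e) = solve (+ 0) (+ 2) ((+ 2) ^ a′) n₁ ((- n₁) ^ a′) (ℤ.+<+ (s≤s z≤n))
        (subst (+ 0 ℤ.<_) (sym (pos-^ 2 a′)) (ℤ.+<+ (ℕₚ.m^n>0 2 a′)))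
        (trans (sym n≡) (trans (sym (ℤₚ.+-identityʳ n)) (cong (λ t → n + t) (sym 0^b))))
        (trans (sym (*-^ (+ 2) (- n₁) a′)) (trans (cong (_^ a′) (trans (lem₁ n₁) (cong -_ (sym n≡)))) (trans (sym (geo-0 a′ (- n))) (cong₂ (λ t s → geo t (- n) s) (sym a≡) (sym 0^b)))))
        m₁ m₂
        (λ {ℓ} pℓ g → prime-∣2 pℓ (∣2 pℓ g) m₁ , prime-∣2 pℓ (∣2 pℓ g) m₂)
        ((+ 2) ^ suc h , (+ 2) ^ suc h , trans (cong (+ 2 *_) (even-^ (+ 2) (suc h))) (lem₂ ((+ 2) ^ suc h)))
      where
        n₁ : ℤ
        n₁ = + 1 + i * + 4
        lem₀ : ∀ n → n ≡ + 2 + (n - + 2)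
        lem₀ = solve-∀
        lem₀′ : ∀ i → + 2 + i * + 8 ≡ + 2 * (+ 1 + i * + 4)
        lem₀′ = solve-∀
        n≡ : n ≡ + 2 * n₁
        n≡ = trans (lem₀ n) (trans (cong (λ t → + 2 + t) e) (lem₀′ i))
        lem₁ : ∀ x → + 2 * - x ≡ - (+ 2 * x)
        lem₁ = solve-∀
        lem₂ : ∀ x → + 2 * (x * x) ≡ x * x + x * x
        lem₂ = solve-∀
        lem₃ : ∀ i → + 1 + i * + 4 - + 1 ≡ i * + 4
        lem₃ = solve-∀
        m₁ : + 4 ∣ n₁ - + 1
        m₁ = divides i (lem₃ i)
        lem₄ : ∀ x → (x + + 1) * (x - + 1) ≡ - x * - x - + 1
        lem₄ = solve-∀
        m₂ : + 4 ∣ (- n₁) ^ a′ - + 1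
        m₂ = even-^-mod (+ 4) (suc h) (- n₁) (subst (+ 4 ∣_) (lem₄ n₁) (∣n⇒∣m*n (n₁ + + 1) m₁))
        ∣2 : ∀ {ℓ} → Prime ℓ → + ℓ ∣ + 2 * (+ 2) ^ a′ → + ℓ ∣ + 2
        ∣2 {ℓ} pℓ g with + ℓ ∣? + 2
        ... | yes y = y
        ... | no x  = ⊥-elim (∤-* pℓ x (∤-^ pℓ a′ x) g)

    ∤-≡1 : ∀ {p q} → Prime p → p % 4 ≡ 3 → Prime q → q % 4 ≡ 1 → ¬ (+ p ∣ + q)
    ∤-≡1 pp p3 pq q1 d with prime-∣ pq pp d
    ... | refl with trans (sym q1) p3
    ...   | ()

    -- A prime at which all three alternatives of the condition fail: b ∣ v, v is odd, and z is a
    -- root modulo p.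
    module Bad (n6 : + 8 ∣ n - + 6) {p : ℕ} (pp : Prime p) (p3 : p % 4 ≡ 3) (v : ℕ) (r : ℤ) (vn : Val p v r n)
               (u : ℕ) (v≡ : v ≡ u ℕ.* b) (v-odd : ¬ 2 ∣ℕ.∣ v) (z : ℤ) (p∣Q : + p ∣ geo a r (z ^ b)) where
      P : ℤ
      P = + p

      Q : ℤ → ℤ
      Q z = geo a r (z ^ b)

      p∤r : ¬ (P ∣ r)
      p∤r = proj₂ vn

      p∤z : ¬ (P ∣ z)
      p∤z d = geo-unitˡ pp a′ r (z ^ b) p∤r (subst (λ t → P ∣ z ^ t) (sym b≡) (∣m⇒∣m*n (z ^ (suc k ℕ.* 2)) d)) (subst (λ t → P ∣ geo t r (z ^ b)) a≡ p∣Q)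

      p∤b*a : ¬ (P ∣ + (b ℕ.* a))
      p∤b*a d = ∤-* pp (∤-≡1 pp p3 pb b1) (∤-≡1 pp p3 pa a1) (subst (P ∣_) (ℤₚ.pos-* b a) d)

      Lift : Set
      Lift = ∃[ z₀ ] ∃[ t ] (Q z₀ ≡ P * t × ¬ (P ∣ t))

      -- z and z + p cannot both be roots modulo p², because the derivative of Xᵃᵇ does not vanish at z.
      not-both : P * P ∣ Q z → P * P ∣ Q (z + P) → ⊥
      not-both d d′ = go (b ℕ.* a) refl
        where
          diff : P * P ∣ (z + P) ^ (b ℕ.* a) - z ^ (b ℕ.* a)
          diff = subst (P * P ∣_) (trans (cong₂ _-_ (geo-* a r (z ^ b)) (geo-* a r ((z + P) ^ b)))
              (trans (lem (r ^ a) ((z ^ b) ^ a) (((z + P) ^ b) ^ a)) (cong₂ _-_ (ℤₚ.^-*-assoc (z + P) b a) (ℤₚ.^-*-assoc z b a))))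
            (∣- (∣m⇒∣m*n (r - z ^ b) d) (∣m⇒∣m*n (r - (z + P) ^ b) d′))
            where
              lem : ∀ x y w → x - y - (x - w) ≡ w - y
              lem = solve-∀
          go : ∀ m → b ℕ.* a ≡ m → ⊥
          go zero    e = p∤b*a (subst (λ t → P ∣ + t) (sym e) ∣0)
          go (suc m) e = ∤-* pp (subst (λ t → ¬ (P ∣ + t)) e p∤b*a) (∤-^ pp m p∤z) (cancel (subst (P * P ∣_) (lem ((z + P) ^ suc m) (z ^ suc m) (+ suc m * (z ^ m * P)))
              (∣- (subst (λ t → P * P ∣ (z + P) ^ t - z ^ t) e diff) (taylor P m z))))
            where
              lem : ∀ x y w → x - y - (x - y - w) ≡ w
              lem = solve-∀
              cancel : P * P ∣ + suc m * (z ^ m * P) → P ∣ + suc m * z ^ m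
              cancel (divides q e′) = divides q (ℤₚ.*-cancelʳ-≡ _ _ P {{ℤ.≢-nonZero λ x → ℕ.≢-nonZero⁻¹ p {{prime⇒nonZero pp}} (ℤₚ.+-injective x)}} (trans (lem₁ (+ suc m) (z ^ m) P) (trans e′ (lem₂ q P))))
                where
                  lem₁ : ∀ x y w → x * y * w ≡ x * (y * w)
                  lem₁ = solve-∀
                  lem₂ : ∀ x w → x * (w * w) ≡ x * w * w
                  lem₂ = solve-∀

      -- By `not-both`, z or z + p is a root modulo p that is no root modulo p²; the second factor
      -- will then contain exactly one further p.
      lift : Lift
      lift = go p∣Q p∣Q′
        where
          p∣Q′ : P ∣ Q (z + P)
          p∣Q′ = ∣-cong-mod (Q z) (Q (z + P)) (geo-cong-mod a {r} {r} (subst (P ∣_) (lem₀ r) ∣0) (^-mod P b z (z + P) (divides (- + 1) (lem z P)))) p∣Q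
            where
              lem₀ : ∀ r → + 0 ≡ r - r
              lem₀ = solve-∀
              lem : ∀ z p → z - (z + p) ≡ - + 1 * p
              lem = solve-∀
          square : ∀ {x t} → x ≡ t * P → P ∣ t → P * P ∣ x
          square {x} e (divides s e′) = divides s (trans e (trans (cong (_* P) e′) (ℤₚ.*-assoc s P P)))
          go : P ∣ Q z → P ∣ Q (z + P) → Lift
          go (divides t e) (divides t′ e′) = choose (P ∣? t) (P ∣? t′)
            where
              choose : Dec (P ∣ t) → Dec (P ∣ t′) → Lift
              choose (no x)  _       = z , t , trans e (ℤₚ.*-comm t P) , x
              choose (yes _) (no x)  = z + P , t′ , trans e′ (ℤₚ.*-comm t′ P) , x
              choose (yes x) (yes y) = ⊥-elim (not-both (square e x) (square e′ y))

      module Lifted (z₀ t : ℤ) (Qz₀ : Q z₀ ≡ P * t) (p∤t : ¬ (P ∣ t)) where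
        w₀ c₀ c : ℤ
        w₀ = z₀ ^ b
        -- c₀ ≡ − z₀ (mod p²) and c₀ ≡ 3 (mod 4).
        c₀ = - z₀ + P * P * (+ 3 + z₀)
        c = P ^ u * c₀

        -- For r ≡ w₀ the sum would be ≡ a r^(a-1), a unit modulo p, yet it is p t.
        p∤r-w₀ : ¬ (P ∣ r - w₀)
        p∤r-w₀ d = ∤-* pp (∤-≡1 pp p3 pa a1) (∤-^ pp a′ p∤r) (subst (λ s → P ∣ + s * r ^ a′) (sym a≡)
            (∣-cong-mod (geo (suc a′) r w₀) (+ suc a′ * r ^ a′) (geo-mod P a′ r w₀ (subst (P ∣_) (lem r w₀) (∣- ∣0 d)))
              (subst (λ s → P ∣ geo s r w₀) a≡ (subst (P ∣_) (sym Qz₀) (∣m⇒∣m*n t ∣-refl)))))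
          where
            lem : ∀ r w → + 0 - (r - w) ≡ w - r
            lem = solve-∀

        c^b : c ^ b ≡ P ^ v * c₀ ^ b
        c^b = trans (*-^ (P ^ u) c₀ b) (cong (_* c₀ ^ b) (trans (ℤₚ.^-*-assoc P u b) (cong (P ^_) (sym v≡))))

        c₀^b : P * P ∣ c₀ ^ b - - w₀
        c₀^b = subst (λ s → P * P ∣ c₀ ^ b - s) (neg-odd-^ (suc k) b≡ z₀) (^-mod (P * P) b c₀ (- z₀) (divides (+ 3 + z₀) (lem z₀ P)))
          where
            lem : ∀ z p → - z + p * p * (+ 3 + z) - - z ≡ (+ 3 + z) * (p * p)
            lem = solve-∀

        -- The exact powers of p in the two factors at c: the exponents v and v(a - 1) + 1 are both
        -- odd, so `g₁` and `g₂` are ≡ -1 (mod 4) and their product is a square.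
        g₁ g₂ w₁ : ℤ
        g₁ = P ^ v
        g₂ = (P ^ v) ^ a′ * P
        w₁ = r + c₀ ^ b

        e₁ : g₁ * w₁ ≡ n + c ^ b
        e₁ = trans (ℤₚ.*-distribˡ-+ (P ^ v) r (c₀ ^ b)) (cong₂ _+_ (sym (proj₁ vn)) (sym c^b))

        -- The sum is homogeneous of even degree, so changing the sign of both arguments does not
        -- affect it; and c₀^b ≡ -w₀ (mod p²) brings it to the value p t found at z₀.
        geo-near : P * P ∣ geo a (- r) (c₀ ^ b) - P * t
        geo-near = subst (λ s → P * P ∣ geo a (- r) (c₀ ^ b) - s) (trans (subst (λ s → geo s (- r) (- w₀) ≡ geo s r w₀) (sym a≡) (geo-neg (suc h) r w₀)) Qz₀)
            (geo-cong-mod a { - r} { - r} (subst (P * P ∣_) (lem r) ∣0) c₀^b)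
          where
            lem : ∀ r → + 0 ≡ - r - - r
            lem = solve-∀

        P≡-1 : + 4 ∣ P - - + 1
        P≡-1 = ≡3-mod-4 p3

        odd-power : ∀ j → ¬ 2 ∣ℕ.∣ j → + 4 ∣ P ^ j - - + 1
        odd-power j o = go (odd-form j o)
          where
            go : ∃[ i ] j ≡ suc (i ℕ.* 2) → + 4 ∣ P ^ j - - + 1
            go (i , refl) = subst (λ s → + 4 ∣ P ^ j - s) ([-1]^odd i) (^-mod (+ 4) j P (- + 1) P≡-1)

        -- As v = u b is odd, so is u, and p^u ≡ -1; also c₀ ≡ 3 ≡ -1. Hence c ≡ 1, which makes both
        -- factors ≡ 3 (mod 4).
        c≡1 : + 4 ∣ c - + 1
        c≡1 = subst (+ 4 ∣_) (lem (P ^ u) z₀ P) (∣- (∣m⇒∣m*n c₀ (odd-power u λ d → v-odd (subst (2 ∣ℕ.∣_) (sym v≡) (∣ℕ.∣m⇒∣m*n b d))))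
            (∣+ (∣m⇒∣m*n ((P - + 1) * (+ 3 + z₀)) P≡-1) (∣-refl {+ 4})))
          where
            lem : ∀ x z p → (x - - + 1) * (- z + p * p * (+ 3 + z)) - ((p - - + 1) * ((p - + 1) * (+ 3 + z)) + + 4) ≡ x * (- z + p * p * (+ 3 + z)) - + 1
            lem = solve-∀

        c^b≡1 : + 4 ∣ c ^ b - + 1
        c^b≡1 = subst (λ s → + 4 ∣ c ^ b - s) (one-^ b) (^-mod (+ 4) b c (+ 1) c≡1)

        n≡2 : + 4 ∣ n - + 2
        n≡2 = subst (+ 4 ∣_) (lem n) (∣+ (∣-trans (divides (+ 2) refl) n6) (∣-refl {+ 4}))
          where
            lem : ∀ n → n - + 6 + + 4 ≡ n - + 2
            lem = solve-∀

        -- Used for both factors: a value ≡ 3 divided by a fixed divisor ≡ -1 leaves 1 modulo 4.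
        quotient-≡1 : ∀ g w → + 4 ∣ g - - + 1 → + 4 ∣ g * w - + 3 → + 4 ∣ w - + 1
        quotient-≡1 g w d d′ = subst (+ 4 ∣_) (lem g w) (∣- (∣- (∣n⇒∣m*n w d) d′) (∣-refl {+ 4}))
          where
            lem : ∀ g w → w * (g - - + 1) - (g * w - + 3) - + 4 ≡ w - + 1
            lem = solve-∀

        m₁ : + 4 ∣ w₁ - + 1
        m₁ = quotient-≡1 g₁ w₁ (odd-power v v-odd) (subst (λ s → + 4 ∣ s - + 3) (sym e₁) (subst (+ 4 ∣_) (lem n (c ^ b)) (∣+ n≡2 c^b≡1)))
          where
            lem : ∀ n x → n - + 2 + (x - + 1) ≡ n + x - + 3
            lem = solve-∀

        g₂≡-1 : + 4 ∣ g₂ - - + 1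
        g₂≡-1 = subst (+ 4 ∣_) (lem ((P ^ v) ^ a′) P) (∣+ (∣m⇒∣m*n P (even-^-mod (+ 4) (suc h) (P ^ v) (subst (+ 4 ∣_) (lem′ (P ^ v)) (∣n⇒∣m*n (P ^ v - + 1) (odd-power v v-odd))))) P≡-1)
          where
            lem : ∀ x p → (x - + 1) * p + (p - - + 1) ≡ x * p - - + 1
            lem = solve-∀
            lem′ : ∀ x → (x - + 1) * (x - - + 1) ≡ x * x - + 1
            lem′ = solve-∀

        p∤w₁ : ¬ (P ∣ w₁)
        p∤w₁ d = p∤r-w₀ (subst (P ∣_) (lem r (c₀ ^ b) w₀) (∣- d (∣-trans (∣m⇒∣m*n P ∣-refl) c₀^b)))
          where
            lem : ∀ r x w → r + x - (x - - w) ≡ r - w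
            lem = solve-∀

        ∣P : ∀ {ℓ} → Prime ℓ → + ℓ ∣ g₁ * g₂ → ℓ ≡ p
        ∣P {ℓ} pℓ g with + ℓ ∣? P
        ... | yes y = prime-∣ pp pℓ y
        ... | no x  = ⊥-elim (∤-* pℓ (∤-^ pℓ v x) (∤-* pℓ (∤-^ pℓ a′ (∤-^ pℓ v x)) x) g)

        0<P^ : ∀ j → + 0 ℤ.< P ^ j
        0<P^ j = subst (+ 0 ℤ.<_) (sym (pos-^ p j)) (ℤ.+<+ (ℕₚ.m^n>0 p {{prime⇒nonZero pp}} j))

        0<g₂ : + 0 ℤ.< g₂
        0<g₂ = subst (+ 0 ℤ.<_) (trans (ℤₚ.*-comm P (P ^ (v ℕ.* a′))) (cong (_* P) (sym (ℤₚ.^-*-assoc P v a′)))) (0<P^ (suc (v ℕ.* a′)))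

        sumSq : SumSq (g₁ * g₂)
        sumSq = go (odd-form v v-odd)
          where
            go : ∃[ i ] v ≡ suc (i ℕ.* 2) → SumSq (g₁ * g₂)
            -- The total exponent v + v(a - 1) + 1 is even; the witness is the square root of g₁g₂,
            -- with 0 as the second square.
            go (i , v≡′) = P * P ^ i * (P ^ v) ^ suc h , + 0 , trans (cong₂ (λ x y → x * (y * P)) (trans (cong (P ^_) v≡′) (cong (P *_) (even-^ P i))) (even-^ (P ^ v) (suc h)))
                (lem P (P ^ i) ((P ^ v) ^ suc h))
              where
                lem : ∀ p x y → p * (x * x) * (y * y * p) ≡ p * x * y * (p * x * y) + + 0 * + 0
                lem = solve-∀

        conclude : Goal
        conclude = go geo-near
          where
            go : P * P ∣ geo a (- r) (c₀ ^ b) - P * t → Goal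
            go (divides e near) = solve c g₁ g₂ w₁ w₂ (0<P^ v) 0<g₂ e₁ e₂ m₁ m₂
                (λ pℓ d → (λ x → p∤w₁ (subst (λ s → + s ∣ w₁) (∣P pℓ d) x)) , (λ x → p∤w₂ (subst (λ s → + s ∣ w₂) (∣P pℓ d) x))) sumSq
              where
                w₂ : ℤ
                w₂ = t + e * P
                lem : ∀ x y w → w + (x - w) ≡ x
                lem = solve-∀
                lem₁ : ∀ p t e → p * t + e * (p * p) ≡ p * (t + e * p)
                lem₁ = solve-∀
                geo≡ : geo a (- r) (c₀ ^ b) ≡ P * w₂
                geo≡ = trans (sym (lem (geo a (- r) (c₀ ^ b)) P (P * t))) (trans (cong (λ s → P * t + s) near) (lem₁ P t e))
                lem₂ : ∀ x y → - (x * y) ≡ x * - y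
                lem₂ = solve-∀
                e₂ : g₂ * w₂ ≡ geo a (- n) (c ^ b)
                e₂ = trans (ℤₚ.*-assoc ((P ^ v) ^ a′) P w₂) (trans (cong ((P ^ v) ^ a′ *_) (sym geo≡))
                  (trans (subst (λ s → (P ^ v) ^ a′ * geo s (- r) (c₀ ^ b) ≡ geo s (P ^ v * - r) (P ^ v * c₀ ^ b)) (sym a≡) (sym (geo-scale a′ (P ^ v) (- r) (c₀ ^ b))))
                    (cong₂ (geo a) (trans (sym (lem₂ (P ^ v) r)) (cong -_ (sym (proj₁ vn)))) (sym c^b))))
                lem₃ : ∀ n → - (n - + 2) - + 4 ≡ - n - + 2
                lem₃ = solve-∀
                m₂ : + 4 ∣ w₂ - + 1
                m₂ = quotient-≡1 g₂ w₂ g₂≡-1 (subst (λ s → + 4 ∣ s - + 3) (sym e₂) (geo-≡3′ h a≡ (- n) (c ^ b)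
                  (subst (+ 4 ∣_) (lem₃ n) (∣- (∣m⇒∣-m n≡2) (∣-refl {+ 4}))) (∣-trans (divides (+ 2) refl) c^b≡1)))
                p∤w₂ : ¬ (P ∣ w₂)
                p∤w₂ d = p∤t (subst (P ∣_) (lem₄ t e P) (∣- d (∣n⇒∣m*n e ∣-refl)))
                  where
                    lem₄ : ∀ t e p → t + e * p - e * p ≡ t
                    lem₄ = solve-∀

      goal : Goal
      goal = go lift
        where
          go : Lift → Goal
          go (z₀ , t , e , h) = Lifted.conclude z₀ t e h

    -- What `Cond` asks of a given n at one p, with the same divisibility of absolute values.
    Clause : ℕ → Set
    Clause p = ∀ (v : ℕ) (r : ℤ) → Prime p → p % 4 ≡ 3 → (+ p) ∣ᵤ.∣ n → n ≡ (+ p) ^ v * r → ¬ ((+ p) ∣ᵤ.∣ r) →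
      (¬ (+ b ∣ᵤ.∣ + v)) ⊎ (+ 2 ∣ᵤ.∣ + v) ⊎ ¬ (∃[ z′ ] (z′ ℕ.< p × (+ p) ∣ᵤ.∣ sumℤ a (λ i → r ^ (a ∸ 1 ∸ i) * (+ z′) ^ (i ℕ.* b))))

    -- Each p is tested: it satisfies the clause or it yields a solution through `Bad`. Valuations
    -- being unique, one pair v, r decides, and z′ is found by a search below p. No bad prime has to
    -- be extracted from a negated statement.
    clause? : + 8 ∣ n - + 6 → ∀ p → Goal ⊎ Clause p
    clause? n6 p = go (prime? p) (p % 4 ℕ.≟ 3)
      where
        go : Dec (Prime p) → Dec (p % 4 ≡ 3) → Goal ⊎ Clause p
        go (no ¬pp) _        = inj₂ λ v r pp → ⊥-elim (¬pp pp)
        go (yes _)  (no ¬p3) = inj₂ λ v r _ p3 → ⊥-elim (¬p3 p3)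
        go (yes pp) (yes p3) = at-valuation (valuation pp n n≢0)
          where
            at-valuation : ∃[ v ] ∃[ r ] Val p v r n → Goal ⊎ Clause p
            at-valuation (v , r , vn) = decide (b ∣ℕ.∣? v) (2 ∣ℕ.∣? v) (ℕₚ.anyUpTo? (λ z → + p ∣? geo a r ((+ z) ^ b)) p)
              where
                unique : ∀ v′ r′ → n ≡ (+ p) ^ v′ * r′ → ¬ ((+ p) ∣ᵤ.∣ r′) → v ≡ v′ × r ≡ r′
                unique v′ r′ e h = valuation-unique pp v v′ r r′ (proj₂ vn) (λ d → h (∣⇒∣ᵤ d)) (trans (sym (proj₁ vn)) e)
                decide : Dec (b ∣ℕ.∣ v) → Dec (2 ∣ℕ.∣ v) → Dec (∃ λ z → z ℕ.< p × + p ∣ geo a r ((+ z) ^ b)) → Goal ⊎ Clause p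
                decide (no b∤v) _ _ = inj₂ λ v′ r′ _ _ _ e h → inj₁ λ d → b∤v (subst (b ∣ℕ.∣_) (sym (proj₁ (unique v′ r′ e h))) d)
                decide (yes _) (yes 2∣v) _ = inj₂ λ v′ r′ _ _ _ e h → inj₂ (inj₁ (subst (2 ∣ℕ.∣_) (proj₁ (unique v′ r′ e h)) 2∣v))
                decide (yes _) (no _) (no none) = inj₂ λ v′ r′ _ _ _ e h → inj₂ (inj₂ λ (z , lt , d) →
                  none (z , lt , subst (+ p ∣_) (trans (geo-sum a b r′ (+ z)) (cong (λ s → geo a s ((+ z) ^ b)) (sym (proj₂ (unique v′ r′ e h))))) (∣ᵤ⇒∣ d)))
                decide (yes (∣ℕ.divides u v≡)) (no v-odd) (yes (z , _ , d)) = inj₁ (Bad.goal n6 pp p3 v r vn u v≡ v-odd (+ z) d)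

    search : + 8 ∣ n - + 6 → ∀ N → Goal ⊎ (∀ p → p ℕ.< N → Clause p)
    search n6 zero    = inj₂ λ p ()
    search n6 (suc N) = combine (clause? n6 N) (search n6 N)
      where
        combine : Goal ⊎ Clause N → Goal ⊎ (∀ p → p ℕ.< N → Clause p) → Goal ⊎ (∀ p → p ℕ.< suc N → Clause p)
        combine (inj₁ g) _        = inj₁ g
        combine (inj₂ c) (inj₁ g) = inj₁ g
        combine (inj₂ c) (inj₂ f) = inj₂ λ p lt → Sum.[ f p , (λ { refl → c }) ] (ℕₚ.m<1+n⇒m<n∨m≡n lt)

    -- A prime dividing n ≠ 0 is at most |n|, so a search below |n| + 1 covers all that the
    -- condition quantifies over; if it finds nothing, n contradicts `Cond`.
    case-r6 : + 8 ∣ n - + 6 → Cond a b (n ^ a) → Goal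
    case-r6 n6 cond = Sum.[ (λ g → g) , (λ f → ⊥-elim (cond (n , ∣⇒∣ᵤ n6 , refl , λ p v r pp p3 p∣n →
        f p (s≤s (∣ℕ.∣⇒≤ {{ℕ.≢-nonZero λ z → n≢0 (ℤₚ.∣i∣≡0⇒i≡0 z)}} p∣n)) v r pp p3 p∣n))) ] (search n6 (suc ∣ n ∣))

    sufficient : Cond a b (n ^ a) → Goal
    sufficient cond = go (residue n)
      where
        go : Residue n → Goal
        go (r0 d) = case-r0 d
        go (r1 d) = case-r1 d
        go (r2 d) = case-r2 d
        go (r3 d) = case-r3 d
        go (r6 d) = case-r6 d cond

  power-sufficient : ∀ {a b} → Prime a → Prime b → a % 4 ≡ 1 → b % 4 ≡ 1 → ∀ n → n ≢ + 0 → NotPower b ∣ n ∣ →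
    HypothesisH → Cond a b (n ^ a) → Solvable (a ℕ.* b) (n ^ a)
  power-sufficient {a} {b} pa pb a1 b1 n n≢0 np H = Power.sufficient (proj₁ (≡1-form pa a1)) (proj₁ (≡1-form pb b1)) a b
    (proj₂ (≡1-form pa a1)) (proj₂ (≡1-form pb b1)) pa pb a1 b1 n n≢0 np H

  power? : ∀ a → Prime a → ∀ N → Dec (∃[ n ] n ℕ.^ a ≡ N)
  power? a pa N = map′ (λ (n , _ , e) → n , e) (λ (n , e) → n , s≤s (subst (n ℕ.≤_) e (n≤n^a a (prime⇒nonZero pa) n)) , e)
      (ℕₚ.anyUpTo? (λ n → n ℕ.^ a ℕ.≟ N) (suc N))
    where
      n≤n^a : ∀ a → ℕ.NonZero a → ∀ n → n ℕ.≤ n ℕ.^ a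
      n≤n^a (suc a) _ zero    = z≤n
      n≤n^a (suc a) _ (suc n) = n≤n^suc n a

  signed-root : ∀ {a h} → a ≡ suc (h ℕ.* 2) → ∀ m n → n ℕ.^ a ≡ ∣ m ∣ → ∃[ l ] (∣ l ∣ ≡ n × l ^ a ≡ m)
  signed-root {a} {h} a≡ (+ m)    n e = + n , refl , trans (pos-^ n a) (cong +_ e)
  signed-root {a} {h} a≡ -[1+ m ] n e = - + n , ℤₚ.∣-i∣≡∣i∣ (+ n) , trans (neg-odd-^ h a≡ (+ n)) (cong -_ (trans (pos-^ n a) (cong +_ e)))

  -- With a single factor every class can be served: c = 1, 0, -1 give m + c^k ≡ 1 (mod 4) for m ≡
  -- 0, 1, 2, and for m ≡ 3 the choice c = 2 - m gives the fixed divisor 2.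
  pure-sufficient : ∀ {k h m} → k ≡ suc (h ℕ.* 2) → m ≢ + 0 → PureBinomials.RootFree k ∣ m ∣ → HypothesisH → Solvable k m
  pure-sufficient {k} {h} {m} refl m≢0 free H = go (residue m)
    where
      k′ : ℕ
      k′ = h ℕ.* 2
      with-1 : ∀ c → + 4 ∣ m + c ^ k - + 1 → Solvable k m
      with-1 c d = case-irreducible k′ h refl m m≢0 free c 0 (m + c ^ k) (ℤₚ.*-identityˡ _) d (λ pℓ e → ⊥-elim (p∤1 pℓ e)) sumSq-1 H
      l0 : ∀ m → m ≡ m + + 1 - + 1
      l0 = solve-∀
      l2 : ∀ m → m - + 2 ≡ m + - + 1 - + 1
      l2 = solve-∀
      case-2 : + 4 ∣ m - + 2 → Solvable k m
      case-2 d = with-1 (- + 1) (subst (λ t → + 4 ∣ m + t - + 1) (sym ([-1]^odd h)) (subst (+ 4 ∣_) (l2 m) d))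
      case-3 : + 4 ∣ m - + 3 → Solvable k m
      case-3 d = use (odd-^-mod (+ 8) h (+ 2 - m) (square-mod-8 m d))
        where
          use : + 8 ∣ (+ 2 - m) ^ k - (+ 2 - m) → Solvable k m
          use (divides i e) = case-irreducible k′ h refl m m≢0 free (+ 2 - m) 1 (+ 1 + i * + 4)
              (trans (lem i) (trans (cong (λ t → + 2 + t) (sym e)) (lem′ m ((+ 2 - m) ^ k)))) (divides i (lem₁ i))
              (λ {ℓ} pℓ g x → odd-unit (divides i (lem₁ i)) (subst (λ t → + t ∣ + 1 + i * + 4) (prime-∣ prime[2] pℓ g) x)) (+ 1 , + 1 , refl) H
            where
              lem : ∀ i → + 2 * (+ 1 + i * + 4) ≡ + 2 + i * + 8
              lem = solve-∀
              lem′ : ∀ n x → + 2 + (x - (+ 2 - n)) ≡ n + x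
              lem′ = solve-∀
              lem₁ : ∀ i → + 1 + i * + 4 - + 1 ≡ i * + 4
              lem₁ = solve-∀
      l6 : ∀ m → m - + 6 + + 4 ≡ m - + 2
      l6 = solve-∀
      go : Residue m → Solvable k m
      go (r0 d) = with-1 (+ 1) (subst (λ t → + 4 ∣ m + t - + 1) (sym (one-^ k)) (subst (+ 4 ∣_) (l0 m) d))
      go (r1 d) = with-1 (+ 0) (subst (λ t → + 4 ∣ m + t - + 1) (sym (0^suc k′)) (subst (λ t → + 4 ∣ t - + 1) (sym (ℤₚ.+-identityʳ m)) d))
      go (r2 d) = case-2 (∣-trans (divides (+ 2) refl) d)
      go (r3 d) = case-3 d
      go (r6 d) = case-2 (subst (+ 4 ∣_) (l6 m) (∣+ (∣-trans (divides (+ 2) refl) d) (∣-refl {+ 4})))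

  -- If m is neither an a-th nor a b-th power, `pure-sufficient` applies. If m = l^a, either l is a
  -- b-th power, so that m is an ab-th power and x = y = 0 will do, or `power-sufficient` applies.
  -- Exponents are odd, so powers may be sought up to sign.
  sufficiency : ∀ {a b} → Prime a → Prime b → a % 4 ≡ 1 → b % 4 ≡ 1 → ∀ {m} → m ≢ + 0 → HypothesisH →
    Cond a b m → Cond b a m → Solvable (a ℕ.* b) m
  sufficiency {a} {b} pa pb a1 b1 {m} m≢0 H condₐ condᵦ = go (power? a pa ∣ m ∣) (power? b pb ∣ m ∣)
    where
      i j : ℕ
      i = proj₁ (≡1-form pa a1)
      j = proj₁ (≡1-form pb b1)
      a≡ : a ≡ suc (suc i ℕ.* 2)
      a≡ = proj₂ (≡1-form pa a1)
      b≡ : b ≡ suc (suc j ℕ.* 2)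
      b≡ = proj₂ (≡1-form pb b1)
      root≢0 : ∀ {c h} → c ≡ suc (h ℕ.* 2) → ∀ l → l ^ c ≡ m → l ≢ + 0
      root≢0 {_} {h} refl l e refl = m≢0 (trans (sym e) (0^suc (h ℕ.* 2)))
      perfect : ∀ z → z ^ (a ℕ.* b) ≡ m → Solvable (a ℕ.* b) m
      perfect z e = + 0 , + 0 , z , trans (ℤₚ.+-identityˡ _) e
      a-power : ∃[ l ] l ^ a ≡ m → Solvable (a ℕ.* b) m
      a-power (l , e) = decide (power? b pb ∣ l ∣)
        where
          decide : Dec (∃[ n ] n ℕ.^ b ≡ ∣ l ∣) → Solvable (a ℕ.* b) m
          decide (yes (n , e′)) = root (signed-root {b} {suc j} b≡ l n e′)
            where
              root : ∃[ z ] (∣ z ∣ ≡ n × z ^ b ≡ l) → Solvable (a ℕ.* b) m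
              root (z , _ , e″) = perfect z (trans (cong (z ^_) (ℕₚ.*-comm a b)) (trans (sym (ℤₚ.^-*-assoc z b a)) (trans (cong (_^ a) e″) e)))
          decide (no np) = subst (Solvable (a ℕ.* b)) e (power-sufficient pa pb a1 b1 l (root≢0 {a} {suc i} a≡ l e) (λ n e′ → np (n , e′)) H (subst (Cond a b) (sym e) condₐ))
      -- If |l| were an a-th power, |m| = |l|^b would be one too, and that case belongs to
      -- `a-power`.
      b-power : (∀ n → n ℕ.^ a ≢ ∣ m ∣) → ∃[ l ] (l ^ b ≡ m) → Solvable (a ℕ.* b) m
      b-power npₐ (l , e) = subst₂ Solvable (ℕₚ.*-comm b a) e (power-sufficient pb pa b1 a1 l (root≢0 {b} {suc j} b≡ l e)
          (λ n e′ → npₐ (n ℕ.^ b) (trans (ℕₚ.^-*-assoc n b a) (trans (cong (n ℕ.^_) (ℕₚ.*-comm b a)) (trans (sym (ℕₚ.^-*-assoc n a b)) (trans (cong (ℕ._^ b) e′) (trans (sym (∣^∣ l b)) (cong ∣_∣ e)))))))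
          H (subst (Cond b a) (sym e) condᵦ))
      drop : ∀ {c} {n : ℕ} → ∃[ l ] (∣ l ∣ ≡ n × l ^ c ≡ m) → ∃[ l ] l ^ c ≡ m
      drop (l , _ , e) = l , e
      go : Dec (∃[ n ] n ℕ.^ a ≡ ∣ m ∣) → Dec (∃[ n ] n ℕ.^ b ≡ ∣ m ∣) → Solvable (a ℕ.* b) m
      go (yes (n , e)) _ = a-power (drop {a} (signed-root {a} {suc i} a≡ m n e))
      go (no npₐ) (yes (n , e)) = b-power (λ n e → npₐ (n , e)) (drop {b} (signed-root {b} {suc j} b≡ m n e))
      go (no npₐ) (no npᵦ) = pure-sufficient {a ℕ.* b} {suc j ℕ.+ suc i ℕ.* b} (odd-product {a} {b} {suc i} {suc j} a≡ b≡) m≢0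
        (product-rootFree {{ℕ.≢-nonZero λ z → m≢0 (ℤₚ.∣i∣≡0⇒i≡0 z)}} pa pb (≡1⇒≢2 a1) (≡1⇒≢2 b1) (λ n e → npₐ (n , e)) (λ n e → npᵦ (n , e))) H

open import Defs
open import Data.Nat using (ℕ; _*_; _%_)
open import Data.Nat.Primality using (Prime)
open import Data.Integer using (ℤ; +_)
open import Data.Product using (_×_; _,_)
open import Relation.Binary.PropositionalEquality using (_≡_; _≢_)

theorem5p11 : (a b : ℕ) → Prime a → Prime b → a % 4 ≡ 1 → b % 4 ≡ 1 →
    (m : ℤ) → m ≢ + 0 →
    (Solvable (a * b) m → Cond a b m × Cond b a m) ×
    (HypothesisH → Cond a b m × Cond b a m → Solvable (a * b) m)
theorem5p11 a b pa pb a≡1 b≡1 m m≢0 =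
  (λ s → necessity pa pb a≡1 b≡1 s , necessity pb pa b≡1 a≡1 (subst (λ k → Solvable k m) (*-comm a b) s)) ,
  (λ H (condₐ , condᵦ) → sufficiency pa pb a≡1 b≡1 m≢0 H condₐ condᵦ)
  where
    open Necessary using (necessity)
    open Sufficient using (sufficiency)
    open import Data.Nat.Properties using (*-comm)
    open import Relation.Binary.PropositionalEquality using (subst)
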